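{- For a positive integer $k$ let $\sigma(k)=\sum_{d\mid k} d$ denote the sum of the positive divisors of $k$, and for a positive integer $n$ define \[ F(n)=\sum_{k=1}^{n} k\,\sigma(k)\,(k^2-3n+2)(2k^2-n)\binom{2n}{n-k}. \] Then for every integer $n\geq 10000$, \[ \left|\frac{F(n)}{\binom{2n}{n}}-\left(-\frac{n^2}{8}+\frac{n}{24}\right)\right|\leq \frac{38755553}{5000}\, n^{3/4}. \]
   Context: In the paper this is written as $F(n)=\binom{2n}{n}\big(-\frac{n^2}{8}+\frac{n}{24}+B_{n\geq N}(\frac{38755553}{5000}n^{3/4})\big)$ with $N=10000$, where a $B$-term $B_{n\geq N}(f(n))$ denotes an unspecified quantity whose absolute value is at most $f(n)$ for all $n\geq N$. -}

module Defs where

open import Data.Nat using (ℕ; zero; suc; _^_; _∸_)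
import Data.Nat as ℕ
open import Data.Nat.Divisibility using (_∣?_)
open import Data.Nat.Combinatorics using (_C_)
open import Data.Nat.ListAction using (sum)
open import Data.List using (List; map; filter; upTo; foldr)
import Data.List as List
open import Data.Integer using (ℤ; +_; _+_; _-_; _*_; ∣_∣)

range1 : ℕ → List ℕ
range1 n = map suc (upTo n)

σ : ℕ → ℕ
σ k = sum (filter (_∣? k) (range1 k))

sumℤ : List ℤ → ℤ
sumℤ = foldr _+_ (+ 0)

F : ℕ → ℤ
F n = sumℤ (map term (range1 n))
  where
  term : ℕ → ℤ
  term k = (+ k) * (+ σ k) * ((+ (k ^ 2)) - (+ (3 ℕ.* n)) + (+ 2))
           * ((+ (2 ℕ.* k ^ 2)) - (+ n)) * (+ ((2 ℕ.* n) C (n ∸ k)))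

centralBinom : ℕ → ℕ
centralBinom n = (2 ℕ.* n) C n

-- A(n) = | 24 F(n) + binom(2n,n) (3n² - n) |, so that
-- | F(n)/binom(2n,n) - (-n²/8 + n/24) | = A(n) / (24 binom(2n,n)).
A : ℕ → ℕ
A n = ∣ (+ 24) * F n + (+ centralBinom n) * ((+ (3 ℕ.* n ^ 2)) - (+ n)) ∣

{-# OPTIONS --safe #-}

-- Write p = 2n − 6 and let coef r s t be the coefficient of y^t in (y − y⁻¹)^r (y + y⁻¹)^s.
-- The weight k (k² − 3n + 2)(2k² − n) binom(2n, n − k) is, up to a factor κ₀/16, the combination
-- 3 coef 3 (p + 3) + (p + 3) coef 5 (p + 1) at t = 2k: it has no component of order one.  Expanding σ,
-- 16 F(n) = κ₀ Σ_{d,m} d u(dm).  For m up to Q ≈ n^(2/5) the sum over d is a folded sum over a cycle of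
-- length 2m and exponentially small, by a maximum principle.  For larger m a twelve-point quadrature rule
-- replaces the sum with step d by d sums with step one; the error is controlled by twelfth differences of u,
-- which Cauchy–Schwarz with Krawtchouk polynomials bounds.  The sums with step one telescope to an even
-- function of d, whose sum over all integers d is again exponentially small, so minus half of its value at
-- d = 0 remains, and this value is the main term.
module Submission where

-- What makes the sums over d small is the absence of order one. Multiplication by t turns order r
-- into orders r - 1 and r + 1, and a component of order zero does not decay when folded over a
-- cycle: it tends to its positive mean. Orders 3 and 5 lead only to 2, 4 and 6, whose folds are
-- differences of odd functions that vanish at both ends of [0, m]. The quadrature rule enters
-- without any integral: the same sum over m is written once for each node, cut at twelve
-- consecutive places, and averaged with the weights of the rule. Two demands fix the cutoff. The
-- small terms carry n^8 against a decay of about exp(-8n/Q²), which has to win from n = 10000 on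
-- and keeps Q well below √n; the panels carry n^(7/2)/Q^13, which has to stay below n^(3/4). The
-- choice 10 Q⁵ ≈ 7 n² meets both. All arithmetic is integral: interpolating polynomials carry an
-- integer scale, exactness of the rule is decided by finitely many values, and the exponent 3/4
-- appears only through fourth powers.

module Sums where

  open import Data.Nat as ℕ using (ℕ; zero; suc; z≤n)
  import Data.Nat.Properties as ℕₚ
  open import Data.Integer using (ℤ; +_; -[1+_]; _+_; _*_; _-_; -_; ∣_∣; 0ℤ; 1ℤ; -1ℤ)
  import Data.Integer.Properties as ℤₚ
  open import Data.Integer.Tactic.RingSolver using (solve-∀)
  import Data.Nat.Tactic.RingSolver as ℕS
  open import Data.Sum using (inj₁; inj₂)
  open import Relation.Nullary using (yes; no; contradiction)
  open import Relation.Binary.PropositionalEquality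

  -- Finite sums, sums over symmetric windows of ℤ, and Cauchy-Schwarz

  ∑ : ℕ → (ℕ → ℤ) → ℤ
  ∑ zero    f = 0ℤ
  ∑ (suc n) f = ∑ n f + f n

  ∑ᴺ : ℕ → (ℕ → ℕ) → ℕ
  ∑ᴺ zero    f = 0
  ∑ᴺ (suc n) f = ∑ᴺ n f ℕ.+ f n

  ∑-cong< : ∀ n {f g : ℕ → ℤ} → (∀ i → i ℕ.< n → f i ≡ g i) → ∑ n f ≡ ∑ n g
  ∑-cong< zero    e = refl
  ∑-cong< (suc n) e = cong₂ _+_ (∑-cong< n (λ i i<n → e i (ℕₚ.m<n⇒m<1+n i<n))) (e n (ℕₚ.n<1+n n))

  ∑-cong : ∀ n {f g : ℕ → ℤ} → (∀ i → f i ≡ g i) → ∑ n f ≡ ∑ n g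
  ∑-cong n e = ∑-cong< n (λ i _ → e i)

  ∑-0 : ∀ n {f : ℕ → ℤ} → (∀ i → f i ≡ 0ℤ) → ∑ n f ≡ 0ℤ
  ∑-0 zero    e = refl
  ∑-0 (suc n) e = cong₂ _+_ (∑-0 n e) (e n)

  ∑-+ : ∀ n (f g : ℕ → ℤ) → ∑ n (λ i → f i + g i) ≡ ∑ n f + ∑ n g
  ∑-+ zero    f g = refl
  ∑-+ (suc n) f g = trans (cong (_+ (f n + g n)) (∑-+ n f g)) (ring (∑ n f) (∑ n g) (f n) (g n))
    where
    ring : ∀ a b c d → (a + b) + (c + d) ≡ (a + c) + (b + d)
    ring = solve-∀

  ∑-* : ∀ n c (f : ℕ → ℤ) → ∑ n (λ i → c * f i) ≡ c * ∑ n f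
  ∑-* zero    c f = sym (ℤₚ.*-zeroʳ c)
  ∑-* (suc n) c f = trans (cong (_+ c * f n) (∑-* n c f)) (sym (ℤₚ.*-distribˡ-+ c (∑ n f) (f n)))

  ∑-swap : ∀ m n (f : ℕ → ℕ → ℤ) → ∑ m (λ i → ∑ n (f i)) ≡ ∑ n (λ j → ∑ m (λ i → f i j))
  ∑-swap zero    n f = sym (∑-0 n (λ _ → refl))
  ∑-swap (suc m) n f = trans (cong (_+ ∑ n (f m)) (∑-swap m n f)) (sym (∑-+ n (λ j → ∑ m (λ i → f i j)) (f m)))

  ∑-split : ∀ m n (f : ℕ → ℤ) → ∑ (m ℕ.+ n) f ≡ ∑ m f + ∑ n (λ i → f (m ℕ.+ i))
  ∑-split m zero    f rewrite ℕₚ.+-identityʳ m = sym (ℤₚ.+-identityʳ (∑ m f))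
  ∑-split m (suc n) f rewrite ℕₚ.+-suc m n =
    trans (cong (_+ f (m ℕ.+ n)) (∑-split m n f)) (ℤₚ.+-assoc (∑ m f) _ _)

  ∑-head : ∀ n (f : ℕ → ℤ) → ∑ (suc n) f ≡ f 0 + ∑ n (λ i → f (suc i))
  ∑-head n f = trans (∑-split 1 n f) (cong (_+ ∑ n (λ i → f (suc i))) (ℤₚ.+-identityˡ (f 0)))

  ∑-telescope : ∀ n (f : ℕ → ℤ) → ∑ n (λ i → f i - f (suc i)) ≡ f 0 - f n
  ∑-telescope zero    f = sym (ℤₚ.+-inverseʳ (f 0))
  ∑-telescope (suc n) f = trans (cong (_+ (f n - f (suc n))) (∑-telescope n f)) (ℤₚ.+-minus-telescope (f 0) (f n) (f (suc n)))

  ∑-abs : ∀ n (f : ℕ → ℤ) → ∣ ∑ n f ∣ ℕ.≤ ∑ᴺ n (λ i → ∣ f i ∣)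
  ∑-abs zero    f = z≤n
  ∑-abs (suc n) f = ℕₚ.≤-trans (ℤₚ.∣i+j∣≤∣i∣+∣j∣ (∑ n f) (f n)) (ℕₚ.+-monoˡ-≤ _ (∑-abs n f))

  +∑ᴺ : ∀ n (f : ℕ → ℕ) → + ∑ᴺ n f ≡ ∑ n (λ i → + f i)
  +∑ᴺ zero    f = refl
  +∑ᴺ (suc n) f = cong (_+ + f n) (+∑ᴺ n f)

  ∑ᴺ-mono< : ∀ n {f g : ℕ → ℕ} → (∀ i → i ℕ.< n → f i ℕ.≤ g i) → ∑ᴺ n f ℕ.≤ ∑ᴺ n g
  ∑ᴺ-mono< zero    e = z≤n
  ∑ᴺ-mono< (suc n) e = ℕₚ.+-mono-≤ (∑ᴺ-mono< n (λ i i<n → e i (ℕₚ.m<n⇒m<1+n i<n))) (e n (ℕₚ.n<1+n n))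

  ∑ᴺ-mono : ∀ n {f g : ℕ → ℕ} → (∀ i → f i ℕ.≤ g i) → ∑ᴺ n f ℕ.≤ ∑ᴺ n g
  ∑ᴺ-mono n e = ∑ᴺ-mono< n (λ i _ → e i)

  ∑ᴺ-cong : ∀ n {f g : ℕ → ℕ} → (∀ i → f i ≡ g i) → ∑ᴺ n f ≡ ∑ᴺ n g
  ∑ᴺ-cong zero    e = refl
  ∑ᴺ-cong (suc n) e = cong₂ ℕ._+_ (∑ᴺ-cong n e) (e n)

  ∑ᴺ-0 : ∀ n → ∑ᴺ n (λ _ → 0) ≡ 0
  ∑ᴺ-0 zero    = refl
  ∑ᴺ-0 (suc n) = cong (ℕ._+ 0) (∑ᴺ-0 n)

  ∑ᴺ-const : ∀ n c → ∑ᴺ n (λ _ → c) ≡ n ℕ.* c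
  ∑ᴺ-const zero    c = refl
  ∑ᴺ-const (suc n) c = trans (ℕₚ.+-comm (∑ᴺ n (λ _ → c)) c) (cong (c ℕ.+_) (∑ᴺ-const n c))

  ∑ᴺ-+ : ∀ n (f g : ℕ → ℕ) → ∑ᴺ n (λ i → f i ℕ.+ g i) ≡ ∑ᴺ n f ℕ.+ ∑ᴺ n g
  ∑ᴺ-+ zero    f g = refl
  ∑ᴺ-+ (suc n) f g = trans (cong (ℕ._+ (f n ℕ.+ g n)) (∑ᴺ-+ n f g)) (ring (∑ᴺ n f) (∑ᴺ n g) (f n) (g n))
    where
    ring : ∀ a b c d → (a ℕ.+ b) ℕ.+ (c ℕ.+ d) ≡ (a ℕ.+ c) ℕ.+ (b ℕ.+ d)
    ring = ℕS.solve-∀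

  ∑ᴺ-* : ∀ n c (f : ℕ → ℕ) → ∑ᴺ n (λ i → c ℕ.* f i) ≡ c ℕ.* ∑ᴺ n f
  ∑ᴺ-* zero    c f = sym (ℕₚ.*-zeroʳ c)
  ∑ᴺ-* (suc n) c f = trans (cong (ℕ._+ c ℕ.* f n) (∑ᴺ-* n c f)) (sym (ℕₚ.*-distribˡ-+ c (∑ᴺ n f) (f n)))

  ∑ᴺ-swap : ∀ m n (f : ℕ → ℕ → ℕ) → ∑ᴺ m (λ i → ∑ᴺ n (f i)) ≡ ∑ᴺ n (λ j → ∑ᴺ m (λ i → f i j))
  ∑ᴺ-swap zero    n f = sym (∑ᴺ-0 n)
  ∑ᴺ-swap (suc m) n f = trans (cong (ℕ._+ ∑ᴺ n (f m)) (∑ᴺ-swap m n f)) (sym (∑ᴺ-+ n (λ j → ∑ᴺ m (λ i → f i j)) (f m)))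

  ∑ᴺ-split : ∀ m n (f : ℕ → ℕ) → ∑ᴺ (m ℕ.+ n) f ≡ ∑ᴺ m f ℕ.+ ∑ᴺ n (λ i → f (m ℕ.+ i))
  ∑ᴺ-split m zero    f rewrite ℕₚ.+-identityʳ m = sym (ℕₚ.+-identityʳ (∑ᴺ m f))
  ∑ᴺ-split m (suc n) f rewrite ℕₚ.+-suc m n =
    trans (cong (ℕ._+ f (m ℕ.+ n)) (∑ᴺ-split m n f)) (ℕₚ.+-assoc (∑ᴺ m f) _ _)

  ∑ᴺ-head : ∀ n (f : ℕ → ℕ) → ∑ᴺ (suc n) f ≡ f 0 ℕ.+ ∑ᴺ n (λ i → f (suc i))
  ∑ᴺ-head n f = ∑ᴺ-split 1 n f

  ∑ᴺ-extend : ∀ {m n} (f : ℕ → ℕ) → m ℕ.≤ n → ∑ᴺ m f ℕ.≤ ∑ᴺ n f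
  ∑ᴺ-extend {m} {n} f m≤n = begin
    ∑ᴺ m f                                          ≤⟨ ℕₚ.m≤m+n _ _ ⟩
    ∑ᴺ m f ℕ.+ ∑ᴺ (n ℕ.∸ m) (λ i → f (m ℕ.+ i)) ≡⟨ ∑ᴺ-split m (n ℕ.∸ m) f ⟨
    ∑ᴺ (m ℕ.+ (n ℕ.∸ m)) f                        ≡⟨ cong (λ k → ∑ᴺ k f) (ℕₚ.m+[n∸m]≡n m≤n) ⟩
    ∑ᴺ n f                                          ∎
    where open ℕₚ.≤-Reasoning

  ∑ᴺ-shift : ∀ m n (f : ℕ → ℕ) → ∑ᴺ n (λ i → f (m ℕ.+ i)) ℕ.≤ ∑ᴺ (m ℕ.+ n) f
  ∑ᴺ-shift m n f = ℕₚ.≤-trans (ℕₚ.m≤n+m _ (∑ᴺ m f)) (ℕₚ.≤-reflexive (sym (∑ᴺ-split m n f)))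

  ∑ᴺ-reverse : ∀ n (f : ℕ → ℕ) → ∑ᴺ n (λ i → f (n ℕ.∸ suc i)) ≡ ∑ᴺ n f
  ∑ᴺ-reverse zero    f = refl
  ∑ᴺ-reverse (suc n) f = trans (∑ᴺ-head n (λ i → f (n ℕ.∸ i)))
    (trans (cong₂ ℕ._+_ refl (∑ᴺ-reverse n f)) (ℕₚ.+-comm (f n) (∑ᴺ n f)))

  -- The terms at t and -t are kept together, so that reflection and parity act inside each summand.
  ∑± : ℕ → (ℤ → ℤ) → ℤ
  ∑± T f = f 0ℤ + ∑ T (λ i → f (+ suc i) + f -[1+ i ])

  ∑±ᴺ : ℕ → (ℤ → ℕ) → ℕ
  ∑±ᴺ T f = f 0ℤ ℕ.+ ∑ᴺ T (λ i → f (+ suc i) ℕ.+ f -[1+ i ])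

  ∑±-cong : ∀ T {f g : ℤ → ℤ} → (∀ t → f t ≡ g t) → ∑± T f ≡ ∑± T g
  ∑±-cong T e = cong₂ _+_ (e 0ℤ) (∑-cong T (λ i → cong₂ _+_ (e _) (e _)))

  ∑±-+ : ∀ T (f g : ℤ → ℤ) → ∑± T (λ t → f t + g t) ≡ ∑± T f + ∑± T g
  ∑±-+ T f g = trans
    (cong (λ z → f 0ℤ + g 0ℤ + z)
      (trans (∑-cong T (λ i → ring (f (+ suc i)) (g (+ suc i)) (f -[1+ i ]) (g -[1+ i ])))
             (∑-+ T (λ i → f (+ suc i) + f -[1+ i ]) (λ i → g (+ suc i) + g -[1+ i ]))))
    (ring (f 0ℤ) (g 0ℤ) (∑ T (λ i → f (+ suc i) + f -[1+ i ])) (∑ T (λ i → g (+ suc i) + g -[1+ i ])))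
    where
    ring : ∀ a b c d → (a + b) + (c + d) ≡ (a + c) + (b + d)
    ring = solve-∀

  ∑±-* : ∀ T c (f : ℤ → ℤ) → ∑± T (λ t → c * f t) ≡ c * ∑± T f
  ∑±-* T c f = trans
    (cong (λ z → c * f 0ℤ + z)
      (trans (∑-cong T (λ i → sym (ℤₚ.*-distribˡ-+ c (f (+ suc i)) (f -[1+ i ]))))
             (∑-* T c (λ i → f (+ suc i) + f -[1+ i ]))))
    (sym (ℤₚ.*-distribˡ-+ c (f 0ℤ) (∑ T (λ i → f (+ suc i) + f -[1+ i ]))))

  ∑±-neg : ∀ T (f : ℤ → ℤ) → ∑± T (λ t → - f t) ≡ - ∑± T f
  ∑±-neg T f = trans (∑±-cong T (λ t → sym (ℤₚ.-1*i≡-i (f t)))) (trans (∑±-* T -1ℤ f) (ℤₚ.-1*i≡-i _))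

  ∑±-reflect : ∀ T (f : ℤ → ℤ) → ∑± T (λ t → f (- t)) ≡ ∑± T f
  ∑±-reflect T f = cong (λ z → f 0ℤ + z) (∑-cong T (λ i → ℤₚ.+-comm (f -[1+ i ]) (f (+ suc i))))

  -- The pairing d ↔ -1-d.
  ∑±-unfold : ∀ T (f : ℤ → ℤ) → ∑± T f ≡ ∑ T (λ i → f (+ i) + f -[1+ i ]) + f (+ T)
  ∑±-unfold zero    f = trans (ℤₚ.+-identityʳ (f 0ℤ)) (sym (ℤₚ.+-identityˡ (f 0ℤ)))
  ∑±-unfold (suc T) f =
    trans (sym (ℤₚ.+-assoc (f 0ℤ) _ _))
    (trans (cong (_+ (f (+ suc T) + f -[1+ T ])) (∑±-unfold T f))
           (ring (∑ T (λ i → f (+ i) + f -[1+ i ])) (f (+ T)) (f (+ suc T)) (f -[1+ T ])))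
    where
    ring : ∀ a b c d → (a + b) + (c + d) ≡ (a + (b + d)) + c
    ring = solve-∀

  -- A shift of the window only exchanges its two end terms. For functions that vanish near the ends
  -- this becomes summation by parts.
  ∑±-suc : ∀ T (f : ℤ → ℤ) → ∑± T (λ t → f (t + 1ℤ)) ≡ ∑± T f + f (+ suc T) - f (- + T)
  ∑±-suc zero    f = ring (f 1ℤ) (f 0ℤ)
    where
    ring : ∀ a b → a + 0ℤ ≡ (b + 0ℤ) + a - b
    ring = solve-∀
  ∑±-suc (suc T) f =
    trans (sym (ℤₚ.+-assoc (f 1ℤ) _ _))
    (trans (cong₂ _+_ (∑±-suc T f) (cong₂ _+_ (cong (λ k → f (+ suc k)) (ℕₚ.+-comm T 1)) (cong f (lem T))))
           (ring (f 0ℤ) _ _ _ _ _))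
    where
    lem : ∀ T → -[1+ T ] + 1ℤ ≡ - + T
    lem zero    = refl
    lem (suc T) = refl
    ring : ∀ z a c d e g → ((z + a) + c - d) + (e + d) ≡ (z + (a + (c + g))) + e - g
    ring = solve-∀

  +∑±ᴺ : ∀ T (f : ℤ → ℕ) → + ∑±ᴺ T f ≡ ∑± T (λ t → + f t)
  +∑±ᴺ T f = cong (λ z → + f 0ℤ + z) (+∑ᴺ T _)

  ∑±ᴺ-cong : ∀ T {f g : ℤ → ℕ} → (∀ t → f t ≡ g t) → ∑±ᴺ T f ≡ ∑±ᴺ T g
  ∑±ᴺ-cong T e = cong₂ ℕ._+_ (e 0ℤ) (∑ᴺ-cong T (λ i → cong₂ ℕ._+_ (e _) (e _)))

  ∑±ᴺ-mono : ∀ T {f g : ℤ → ℕ} → (∀ t → f t ℕ.≤ g t) → ∑±ᴺ T f ℕ.≤ ∑±ᴺ T g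
  ∑±ᴺ-mono T e = ℕₚ.+-mono-≤ (e 0ℤ) (∑ᴺ-mono T (λ i → ℕₚ.+-mono-≤ (e _) (e _)))

  ∑±ᴺ-+ : ∀ T (f g : ℤ → ℕ) → ∑±ᴺ T (λ t → f t ℕ.+ g t) ≡ ∑±ᴺ T f ℕ.+ ∑±ᴺ T g
  ∑±ᴺ-+ T f g = trans (cong₂ ℕ._+_ refl (trans (∑ᴺ-cong T (λ i → ring (f (+ suc i)) (g (+ suc i)) (f -[1+ i ]) (g -[1+ i ]))) (∑ᴺ-+ T _ _)))
    (ring (f 0ℤ) (g 0ℤ) _ _)
    where
    ring : ∀ a b c d → (a ℕ.+ b) ℕ.+ (c ℕ.+ d) ≡ (a ℕ.+ c) ℕ.+ (b ℕ.+ d)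
    ring = ℕS.solve-∀

  ∑±ᴺ-* : ∀ T c (f : ℤ → ℕ) → ∑±ᴺ T (λ t → c ℕ.* f t) ≡ c ℕ.* ∑±ᴺ T f
  ∑±ᴺ-* T c f = trans (cong (c ℕ.* f 0ℤ ℕ.+_) (trans (∑ᴺ-cong T (λ i → sym (ℕₚ.*-distribˡ-+ c _ _))) (∑ᴺ-* T c _)))
    (sym (ℕₚ.*-distribˡ-+ c _ _))

  square-cancel-≤ : ∀ {x y} → x ℕ.* x ℕ.≤ y ℕ.* y → x ℕ.≤ y
  square-cancel-≤ {x} {y} le with x ℕ.≤? y
  ... | yes p = p
  ... | no ¬p = contradiction le (ℕₚ.<⇒≱ (ℕₚ.*-mono-< (ℕₚ.≰⇒> ¬p) (ℕₚ.≰⇒> ¬p)))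

  4ab≤[a+b]² : ∀ a b → 4 ℕ.* (a ℕ.* b) ℕ.≤ (a ℕ.+ b) ℕ.* (a ℕ.+ b)
  4ab≤[a+b]² a b with ℕₚ.≤-total a b
  ... | inj₁ a≤b = subst (λ c → 4 ℕ.* (a ℕ.* c) ℕ.≤ (a ℕ.+ c) ℕ.* (a ℕ.+ c)) (ℕₚ.m+[n∸m]≡n a≤b) (lem a (b ℕ.∸ a))
    where
    ring : ∀ a k → (a ℕ.+ (a ℕ.+ k)) ℕ.* (a ℕ.+ (a ℕ.+ k)) ≡ 4 ℕ.* (a ℕ.* (a ℕ.+ k)) ℕ.+ k ℕ.* k
    ring = ℕS.solve-∀
    lem : ∀ a k → 4 ℕ.* (a ℕ.* (a ℕ.+ k)) ℕ.≤ (a ℕ.+ (a ℕ.+ k)) ℕ.* (a ℕ.+ (a ℕ.+ k))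
    lem a k = ℕₚ.≤-trans (ℕₚ.m≤m+n _ (k ℕ.* k)) (ℕₚ.≤-reflexive (sym (ring a k)))
  ... | inj₂ b≤a = subst (λ c → 4 ℕ.* (c ℕ.* b) ℕ.≤ (c ℕ.+ b) ℕ.* (c ℕ.+ b)) (ℕₚ.m+[n∸m]≡n b≤a) (lem b (a ℕ.∸ b))
    where
    ring : ∀ b k → ((b ℕ.+ k) ℕ.+ b) ℕ.* ((b ℕ.+ k) ℕ.+ b) ≡ 4 ℕ.* ((b ℕ.+ k) ℕ.* b) ℕ.+ k ℕ.* k
    ring = ℕS.solve-∀
    lem : ∀ b k → 4 ℕ.* ((b ℕ.+ k) ℕ.* b) ℕ.≤ ((b ℕ.+ k) ℕ.+ b) ℕ.* ((b ℕ.+ k) ℕ.+ b)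
    lem b k = ℕₚ.≤-trans (ℕₚ.m≤m+n _ (k ℕ.* k)) (ℕₚ.≤-reflexive (sym (ring b k)))

  -- Square roots are avoided by bounding the square of the cross term: (2 S S′)² ≤ 4 (P R′)(P′ R) ≤
  -- (P R′ + P′ R)².
  cauchySchwarz-step : ∀ S P R S′ P′ R′ → S ℕ.* S ℕ.≤ P ℕ.* R → S′ ℕ.* S′ ℕ.≤ P′ ℕ.* R′ →
                       (S ℕ.+ S′) ℕ.* (S ℕ.+ S′) ℕ.≤ (P ℕ.+ P′) ℕ.* (R ℕ.+ R′)
  cauchySchwarz-step S P R S′ P′ R′ h h′ = begin
    (S ℕ.+ S′) ℕ.* (S ℕ.+ S′)                                        ≡⟨ ring₁ S S′ ⟩
    S ℕ.* S ℕ.+ S′ ℕ.* S′ ℕ.+ 2 ℕ.* (S ℕ.* S′)                     ≤⟨ ℕₚ.+-mono-≤ (ℕₚ.+-mono-≤ h h′) cross ⟩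
    P ℕ.* R ℕ.+ P′ ℕ.* R′ ℕ.+ (P ℕ.* R′ ℕ.+ P′ ℕ.* R)              ≡⟨ ring₂ P R P′ R′ ⟩
    (P ℕ.+ P′) ℕ.* (R ℕ.+ R′)                                        ∎
    where
    open ℕₚ.≤-Reasoning
    ring₁ : ∀ S S′ → (S ℕ.+ S′) ℕ.* (S ℕ.+ S′) ≡ S ℕ.* S ℕ.+ S′ ℕ.* S′ ℕ.+ 2 ℕ.* (S ℕ.* S′)
    ring₁ = ℕS.solve-∀
    ring₂ : ∀ P R P′ R′ → P ℕ.* R ℕ.+ P′ ℕ.* R′ ℕ.+ (P ℕ.* R′ ℕ.+ P′ ℕ.* R) ≡ (P ℕ.+ P′) ℕ.* (R ℕ.+ R′)
    ring₂ = ℕS.solve-∀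
    ring₃ : ∀ S S′ → (2 ℕ.* (S ℕ.* S′)) ℕ.* (2 ℕ.* (S ℕ.* S′)) ≡ 4 ℕ.* ((S ℕ.* S) ℕ.* (S′ ℕ.* S′))
    ring₃ = ℕS.solve-∀
    ring₄ : ∀ P R P′ R′ → 4 ℕ.* ((P ℕ.* R) ℕ.* (P′ ℕ.* R′)) ≡ 4 ℕ.* ((P ℕ.* R′) ℕ.* (P′ ℕ.* R))
    ring₄ = ℕS.solve-∀
    cross : 2 ℕ.* (S ℕ.* S′) ℕ.≤ P ℕ.* R′ ℕ.+ P′ ℕ.* R
    cross = square-cancel-≤ (begin
      (2 ℕ.* (S ℕ.* S′)) ℕ.* (2 ℕ.* (S ℕ.* S′))          ≡⟨ ring₃ S S′ ⟩
      4 ℕ.* ((S ℕ.* S) ℕ.* (S′ ℕ.* S′))                   ≤⟨ ℕₚ.*-monoʳ-≤ 4 (ℕₚ.*-mono-≤ h h′) ⟩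
      4 ℕ.* ((P ℕ.* R) ℕ.* (P′ ℕ.* R′))                   ≡⟨ ring₄ P R P′ R′ ⟩
      4 ℕ.* ((P ℕ.* R′) ℕ.* (P′ ℕ.* R))                   ≤⟨ 4ab≤[a+b]² (P ℕ.* R′) (P′ ℕ.* R) ⟩
      (P ℕ.* R′ ℕ.+ P′ ℕ.* R) ℕ.* (P ℕ.* R′ ℕ.+ P′ ℕ.* R) ∎)

  cauchySchwarz : ∀ T (s p r : ℤ → ℕ) → (∀ t → s t ℕ.* s t ℕ.≤ p t ℕ.* r t) →
                  ∑±ᴺ T s ℕ.* ∑±ᴺ T s ℕ.≤ ∑±ᴺ T p ℕ.* ∑±ᴺ T r
  cauchySchwarz T s p r h = cauchySchwarz-step (s 0ℤ) (p 0ℤ) (r 0ℤ) (half s T) (half p T) (half r T) (h 0ℤ) (go T)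
    where
    half : (ℤ → ℕ) → ℕ → ℕ
    half f T = ∑ᴺ T (λ i → f (+ suc i) ℕ.+ f -[1+ i ])
    go : ∀ T → half s T ℕ.* half s T ℕ.≤ half p T ℕ.* half r T
    go zero    = z≤n
    go (suc T) = cauchySchwarz-step (half s T) (half p T) (half r T) _ _ _ (go T)
      (cauchySchwarz-step (s (+ suc T)) (p (+ suc T)) (r (+ suc T)) _ _ _ (h (+ suc T)) (h -[1+ T ]))

-- Coefficients of (y - y⁻¹)^r (y + y⁻¹)^s

module Coefficients where

  open Sums
  open import Data.Nat as ℕ using (ℕ; zero; suc)
  import Data.Nat.Properties as ℕₚ
  open import Data.Integer using (ℤ; +_; -[1+_]; _+_; _*_; _-_; -_; ∣_∣; 0ℤ; 1ℤ)
  import Data.Integer.Properties as ℤₚ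
  open import Data.Integer.Tactic.RingSolver using (solve-∀)
  open import Relation.Binary.PropositionalEquality

  t-1+1≡t : ∀ t → t - 1ℤ + 1ℤ ≡ t
  t-1+1≡t = solve-∀

  t+1-1≡t : ∀ t → t + 1ℤ - 1ℤ ≡ t
  t+1-1≡t = solve-∀

  sgn : ℕ → ℤ
  sgn zero    = 1ℤ
  sgn (suc r) = - sgn r

  ∣t∣≤1+∣t+1∣ : ∀ t → ∣ t ∣ ℕ.≤ suc ∣ t + 1ℤ ∣
  ∣t∣≤1+∣t+1∣ t = begin
    ∣ t ∣             ≡⟨ cong ∣_∣ (sym (t+1-1≡t t)) ⟩
    ∣ t + 1ℤ - 1ℤ ∣   ≤⟨ ℤₚ.∣i-j∣≤∣i∣+∣j∣ (t + 1ℤ) 1ℤ ⟩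
    ∣ t + 1ℤ ∣ ℕ.+ 1  ≡⟨ ℕₚ.+-comm ∣ t + 1ℤ ∣ 1 ⟩
    suc ∣ t + 1ℤ ∣    ∎
    where open ℕₚ.≤-Reasoning

  ∣t∣≤1+∣t-1∣ : ∀ t → ∣ t ∣ ℕ.≤ suc ∣ t - 1ℤ ∣
  ∣t∣≤1+∣t-1∣ t = begin
    ∣ t ∣             ≡⟨ cong ∣_∣ (sym (t-1+1≡t t)) ⟩
    ∣ t - 1ℤ + 1ℤ ∣   ≤⟨ ℤₚ.∣i+j∣≤∣i∣+∣j∣ (t - 1ℤ) 1ℤ ⟩
    ∣ t - 1ℤ ∣ ℕ.+ 1  ≡⟨ ℕₚ.+-comm ∣ t - 1ℤ ∣ 1 ⟩
    suc ∣ t - 1ℤ ∣    ∎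
    where open ℕₚ.≤-Reasoning

  δ₀ : ℤ → ℤ
  δ₀ (+ zero)  = 1ℤ
  δ₀ (+ suc _) = 0ℤ
  δ₀ -[1+ _ ]  = 0ℤ

  -- coef r s t is the coefficient of y^t in (y − y⁻¹)^r (y + y⁻¹)^s.
  abstract
    coef : ℕ → ℕ → ℤ → ℤ
    coef zero    zero    t = δ₀ t
    coef zero    (suc s) t = coef zero s (t - 1ℤ) + coef zero s (t + 1ℤ)
    coef (suc r) s       t = coef r s (t - 1ℤ) - coef r s (t + 1ℤ)

    coef-δ : ∀ t → coef 0 0 t ≡ δ₀ t
    coef-δ t = refl

    coef-B : ∀ r s t → coef (suc r) s t ≡ coef r s (t - 1ℤ) - coef r s (t + 1ℤ)
    coef-B r s t = refl

    -- The definition peels off the factors y - y⁻¹ first. Multiplication by y + y⁻¹ commutes with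
    -- them, so that factor can be peeled off for every r.
    coef-A : ∀ r s t → coef r (suc s) t ≡ coef r s (t - 1ℤ) + coef r s (t + 1ℤ)
    coef-A zero    s t = refl
    coef-A (suc r) s t =
      trans (cong₂ _-_ (coef-A r s (t - 1ℤ)) (coef-A r s (t + 1ℤ)))
            (trans (cong₂ (λ x y → a + coef r s x - (coef r s y + b)) (t-1+1≡t t) (t+1-1≡t t))
            (trans (ring a b (coef r s t))
                   (sym (cong₂ (λ x y → a - coef r s x + (coef r s y - b)) (t-1+1≡t t) (t+1-1≡t t)))))
      where
      a b : ℤ
      a = coef r s (t - 1ℤ - 1ℤ)
      b = coef r s (t + 1ℤ + 1ℤ)
      ring : ∀ a b c → a + c - (c + b) ≡ a - c + (c - b)
      ring = solve-∀

  neg-pred : ∀ t → - t - 1ℤ ≡ - (t + 1ℤ)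
  neg-pred = solve-∀

  neg-succ : ∀ t → - t + 1ℤ ≡ - (t - 1ℤ)
  neg-succ = solve-∀

  coef-parity : ∀ r s t → coef r s (- t) ≡ sgn r * coef r s t
  coef-parity zero zero (+ zero) = sym (ℤₚ.*-identityˡ (coef 0 0 0ℤ))
  coef-parity zero zero (+ suc n) = trans (coef-δ _) (sym (trans (ℤₚ.*-identityˡ _) (coef-δ _)))
  coef-parity zero zero -[1+ n ] = trans (coef-δ _) (sym (trans (ℤₚ.*-identityˡ _) (coef-δ _)))
  coef-parity zero (suc s) t = begin
    coef 0 (suc s) (- t)                                    ≡⟨ coef-A 0 s (- t) ⟩
    coef 0 s (- t - 1ℤ) + coef 0 s (- t + 1ℤ)               ≡⟨ cong₂ (λ x y → coef 0 s x + coef 0 s y) (neg-pred t) (neg-succ t) ⟩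
    coef 0 s (- (t + 1ℤ)) + coef 0 s (- (t - 1ℤ))           ≡⟨ cong₂ _+_ (coef-parity 0 s (t + 1ℤ)) (coef-parity 0 s (t - 1ℤ)) ⟩
    1ℤ * coef 0 s (t + 1ℤ) + 1ℤ * coef 0 s (t - 1ℤ)         ≡⟨ ring (coef 0 s (t + 1ℤ)) (coef 0 s (t - 1ℤ)) ⟩
    1ℤ * (coef 0 s (t - 1ℤ) + coef 0 s (t + 1ℤ))            ≡⟨ cong (1ℤ *_) (coef-A 0 s t) ⟨
    1ℤ * coef 0 (suc s) t                                   ∎
    where
    open ≡-Reasoning
    ring : ∀ a b → 1ℤ * a + 1ℤ * b ≡ 1ℤ * (b + a)
    ring = solve-∀
  coef-parity (suc r) s t = begin
    coef (suc r) s (- t)                                    ≡⟨ coef-B r s (- t) ⟩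
    coef r s (- t - 1ℤ) - coef r s (- t + 1ℤ)               ≡⟨ cong₂ (λ x y → coef r s x - coef r s y) (neg-pred t) (neg-succ t) ⟩
    coef r s (- (t + 1ℤ)) - coef r s (- (t - 1ℤ))           ≡⟨ cong₂ _-_ (coef-parity r s (t + 1ℤ)) (coef-parity r s (t - 1ℤ)) ⟩
    sgn r * coef r s (t + 1ℤ) - sgn r * coef r s (t - 1ℤ)   ≡⟨ ring (sgn r) (coef r s (t + 1ℤ)) (coef r s (t - 1ℤ)) ⟩
    - sgn r * (coef r s (t - 1ℤ) - coef r s (t + 1ℤ))       ≡⟨ cong (- sgn r *_) (coef-B r s t) ⟨
    - sgn r * coef (suc r) s t                              ∎
    where
    open ≡-Reasoning
    ring : ∀ g a b → g * a - g * b ≡ - g * (b - a)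
    ring = solve-∀

  coef-support : ∀ r s t → r ℕ.+ s ℕ.< ∣ t ∣ → coef r s t ≡ 0ℤ
  coef-support zero zero (+ suc n) lt = coef-δ _
  coef-support zero zero -[1+ n ]  lt = coef-δ _
  coef-support zero (suc s) t lt = trans (coef-A 0 s t)
    (cong₂ _+_ (coef-support 0 s (t - 1ℤ) (ℕₚ.≤-pred (ℕₚ.≤-trans lt (∣t∣≤1+∣t-1∣ t))))
               (coef-support 0 s (t + 1ℤ) (ℕₚ.≤-pred (ℕₚ.≤-trans lt (∣t∣≤1+∣t+1∣ t)))))
  coef-support (suc r) s t lt = trans (coef-B r s t)
    (cong₂ _-_ (coef-support r s (t - 1ℤ) (ℕₚ.≤-pred (ℕₚ.≤-trans lt (∣t∣≤1+∣t-1∣ t))))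
               (coef-support r s (t + 1ℤ) (ℕₚ.≤-pred (ℕₚ.≤-trans lt (∣t∣≤1+∣t+1∣ t)))))

  -- The two terms of the product rule: one factor of the first kind turned into the second, or
  -- conversely. A missing factor has derivative 0, which also avoids subtraction of naturals.
  lower raise : ℕ → ℕ → ℤ → ℤ
  lower zero    s t = 0ℤ
  lower (suc r) s t = coef r (suc s) t
  raise r zero    t = 0ℤ
  raise r (suc s) t = coef (suc r) s t

  -- Multiplication by t is a derivation exchanging y − y⁻¹ and y + y⁻¹.
  coef-*t : ∀ r s t → t * coef r s t ≡ + r * lower r s t + + s * raise r s t
  coef-*t zero zero (+ zero)  = refl
  coef-*t zero zero (+ suc n) = trans (cong (+ suc n *_) (coef-δ _)) (ℤₚ.*-zeroʳ (+ suc n))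
  coef-*t zero zero -[1+ n ]  = trans (cong (-[1+ n ] *_) (coef-δ _)) (ℤₚ.*-zeroʳ -[1+ n ])
  coef-*t zero (suc s) t = begin
    t * coef 0 (suc s) t                                               ≡⟨ cong (t *_) (coef-A 0 s t) ⟩
    t * (a + b)                                                        ≡⟨ ring₁ t a b ⟩
    (t - 1ℤ) * a + (t + 1ℤ) * b + (a - b)                              ≡⟨ cong₂ (λ x y → x + y + (a - b)) (coef-*t 0 s (t - 1ℤ)) (coef-*t 0 s (t + 1ℤ)) ⟩
    (0ℤ * 0ℤ + + s * raise 0 s (t - 1ℤ)) + (0ℤ * 0ℤ + + s * raise 0 s (t + 1ℤ)) + (a - b)
                                                                       ≡⟨ ring₂ (+ s) (raise 0 s (t - 1ℤ)) (raise 0 s (t + 1ℤ)) (a - b) ⟩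
    + s * (raise 0 s (t - 1ℤ) + raise 0 s (t + 1ℤ)) + (a - b)          ≡⟨ cong₂ _+_ (lem s) (sym (coef-B 0 s t)) ⟩
    + s * coef 1 s t + coef 1 s t                                      ≡⟨ ring₃ (+ s) (coef 1 s t) ⟩
    0ℤ * 0ℤ + + suc s * coef 1 s t                                     ∎
    where
    open ≡-Reasoning
    a b : ℤ
    a = coef 0 s (t - 1ℤ)
    b = coef 0 s (t + 1ℤ)
    lem : ∀ s → + s * (raise 0 s (t - 1ℤ) + raise 0 s (t + 1ℤ)) ≡ + s * coef 1 s t
    lem zero    = refl
    lem (suc s) = cong (+ suc s *_) (sym (coef-A 1 s t))
    ring₁ : ∀ t a b → t * (a + b) ≡ (t - 1ℤ) * a + (t + 1ℤ) * b + (a - b)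
    ring₁ = solve-∀
    ring₂ : ∀ s x y z → (0ℤ * 0ℤ + s * x) + (0ℤ * 0ℤ + s * y) + z ≡ s * (x + y) + z
    ring₂ = solve-∀
    ring₃ : ∀ s x → s * x + x ≡ 0ℤ * 0ℤ + (1ℤ + s) * x
    ring₃ = solve-∀
  coef-*t (suc r) s t = begin
    t * coef (suc r) s t                                               ≡⟨ cong (t *_) (coef-B r s t) ⟩
    t * (a - b)                                                        ≡⟨ ring₁ t a b ⟩
    (t - 1ℤ) * a - (t + 1ℤ) * b + (a + b)                              ≡⟨ cong₂ (λ x y → x - y + (a + b)) (coef-*t r s (t - 1ℤ)) (coef-*t r s (t + 1ℤ)) ⟩
    (+ r * lower r s (t - 1ℤ) + + s * raise r s (t - 1ℤ)) - (+ r * lower r s (t + 1ℤ) + + s * raise r s (t + 1ℤ)) + (a + b)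
                                                                       ≡⟨ ring₂ (+ r) (+ s) (lower r s (t - 1ℤ)) (lower r s (t + 1ℤ)) (raise r s (t - 1ℤ)) (raise r s (t + 1ℤ)) (a + b) ⟩
    + r * (lower r s (t - 1ℤ) - lower r s (t + 1ℤ)) + + s * (raise r s (t - 1ℤ) - raise r s (t + 1ℤ)) + (a + b)
                                                                       ≡⟨ cong₂ _+_ (cong₂ _+_ (lemₗ r) (lemᵣ s)) (sym (coef-A r s t)) ⟩
    + r * coef r (suc s) t + + s * raise (suc r) s t + coef r (suc s) t ≡⟨ ring₃ (+ r) (coef r (suc s) t) (+ s * raise (suc r) s t) ⟩
    + suc r * coef r (suc s) t + + s * raise (suc r) s t               ∎
    where
    open ≡-Reasoning
    a b : ℤ
    a = coef r s (t - 1ℤ)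
    b = coef r s (t + 1ℤ)
    lemₗ : ∀ r → + r * (lower r s (t - 1ℤ) - lower r s (t + 1ℤ)) ≡ + r * coef r (suc s) t
    lemₗ zero    = refl
    lemₗ (suc r) = cong (+ suc r *_) (sym (coef-B r (suc s) t))
    lemᵣ : ∀ s → + s * (raise r s (t - 1ℤ) - raise r s (t + 1ℤ)) ≡ + s * raise (suc r) s t
    lemᵣ zero    = refl
    lemᵣ (suc s) = cong (+ suc s *_) (sym (coef-B (suc r) s t))
    ring₁ : ∀ t a b → t * (a - b) ≡ (t - 1ℤ) * a - (t + 1ℤ) * b + (a + b)
    ring₁ = solve-∀
    ring₂ : ∀ r s l l′ x y z → (r * l + s * x) - (r * l′ + s * y) + z ≡ r * (l - l′) + s * (x - y) + z
    ring₂ = solve-∀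
    ring₃ : ∀ r x y → r * x + y + x ≡ (1ℤ + r) * x + y
    ring₃ = solve-∀

  -- Summation by parts over a window containing the support of f.

  private
    -T-1 : ∀ T → - + T - 1ℤ ≡ -[1+ T ]
    -T-1 zero    = refl
    -T-1 (suc T) = cong (λ k → -[1+ suc k ]) (ℕₚ.+-identityʳ T)

  module _ (T : ℕ) (f q : ℤ → ℤ) (f≡0 : ∀ t → T ℕ.≤ ∣ t ∣ → f t ≡ 0ℤ) where

    ∑±-shift₋ : ∑± T (λ t → f (t - 1ℤ) * q t) ≡ ∑± T (λ t → f t * q (t + 1ℤ))
    ∑±-shift₋ = sym (begin
      ∑± T (λ t → f t * q (t + 1ℤ))                  ≡⟨ ∑±-cong T (λ t → cong (λ z → f z * q (t + 1ℤ)) (sym (t+1-1≡t t))) ⟩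
      ∑± T (λ t → f (t + 1ℤ - 1ℤ) * q (t + 1ℤ))      ≡⟨ ∑±-suc T (λ t → f (t - 1ℤ) * q t) ⟩
      S + f (+ suc T - 1ℤ) * q (+ suc T) - f (- + T - 1ℤ) * q (- + T)
        ≡⟨ cong₂ (λ x y → S + x * q (+ suc T) - y * q (- + T)) (f≡0 (+ T) ℕₚ.≤-refl)
                 (trans (cong f (-T-1 T)) (f≡0 -[1+ T ] (ℕₚ.n≤1+n T))) ⟩
      S + 0ℤ * q (+ suc T) - 0ℤ * q (- + T)          ≡⟨ ring S (q (+ suc T)) (q (- + T)) ⟩
      S                                              ∎)
      where
      open ≡-Reasoning
      S = ∑± T (λ t → f (t - 1ℤ) * q t)
      ring : ∀ s x y → s + 0ℤ * x - 0ℤ * y ≡ s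
      ring = solve-∀

    ∑±-shift₊ : ∑± T (λ t → f (t + 1ℤ) * q t) ≡ ∑± T (λ t → f t * q (t - 1ℤ))
    ∑±-shift₊ = begin
      ∑± T (λ t → f (t + 1ℤ) * q t)                  ≡⟨ ∑±-cong T (λ t → cong (λ z → f (t + 1ℤ) * q z) (sym (t+1-1≡t t))) ⟩
      ∑± T (λ t → f (t + 1ℤ) * q (t + 1ℤ - 1ℤ))      ≡⟨ ∑±-suc T (λ t → f t * q (t - 1ℤ)) ⟩
      S + f (+ suc T) * q (+ suc T - 1ℤ) - f (- + T) * q (- + T - 1ℤ)
        ≡⟨ cong₂ (λ x y → S + x * q (+ suc T - 1ℤ) - y * q (- + T - 1ℤ)) (f≡0 (+ suc T) (ℕₚ.n≤1+n T))
                 (f≡0 (- + T) (ℕₚ.≤-reflexive (sym (ℤₚ.∣-i∣≡∣i∣ (+ T))))) ⟩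
      S + 0ℤ * q (+ suc T - 1ℤ) - 0ℤ * q (- + T - 1ℤ) ≡⟨ ring S (q (+ suc T - 1ℤ)) (q (- + T - 1ℤ)) ⟩
      S                                              ∎
      where
      open ≡-Reasoning
      S = ∑± T (λ t → f t * q (t - 1ℤ))
      ring : ∀ s x y → s + 0ℤ * x - 0ℤ * y ≡ s
      ring = solve-∀

  -- In this pairing multiplication by y + y⁻¹ is self-adjoint, and multiplication by y - y⁻¹ is
  -- anti-self-adjoint (`∑±-B`). The condition r + s < T makes the coefficients vanish from the ends
  -- of the window on, so no boundary terms arise.
  ∑±-A : ∀ T r s (q : ℤ → ℤ) → r ℕ.+ s ℕ.< T →
         ∑± T (λ t → coef r (suc s) t * q t) ≡ ∑± T (λ t → coef r s t * (q (t - 1ℤ) + q (t + 1ℤ)))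
  ∑±-A T r s q lt = begin
    ∑± T (λ t → coef r (suc s) t * q t)
      ≡⟨ ∑±-cong T (λ t → trans (cong (_* q t) (coef-A r s t)) (ℤₚ.*-distribʳ-+ (q t) (coef r s (t - 1ℤ)) (coef r s (t + 1ℤ)))) ⟩
    ∑± T (λ t → coef r s (t - 1ℤ) * q t + coef r s (t + 1ℤ) * q t)
      ≡⟨ ∑±-+ T (λ t → coef r s (t - 1ℤ) * q t) (λ t → coef r s (t + 1ℤ) * q t) ⟩
    ∑± T (λ t → coef r s (t - 1ℤ) * q t) + ∑± T (λ t → coef r s (t + 1ℤ) * q t)
      ≡⟨ cong₂ _+_ (∑±-shift₋ T (coef r s) q z) (∑±-shift₊ T (coef r s) q z) ⟩
    ∑± T (λ t → coef r s t * q (t + 1ℤ)) + ∑± T (λ t → coef r s t * q (t - 1ℤ))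
      ≡⟨ ∑±-+ T (λ t → coef r s t * q (t + 1ℤ)) (λ t → coef r s t * q (t - 1ℤ)) ⟨
    ∑± T (λ t → coef r s t * q (t + 1ℤ) + coef r s t * q (t - 1ℤ))
      ≡⟨ ∑±-cong T (λ t → ring (coef r s t) (q (t - 1ℤ)) (q (t + 1ℤ))) ⟩
    ∑± T (λ t → coef r s t * (q (t - 1ℤ) + q (t + 1ℤ))) ∎
    where
    open ≡-Reasoning
    z : ∀ t → T ℕ.≤ ∣ t ∣ → coef r s t ≡ 0ℤ
    z t le = coef-support r s t (ℕₚ.≤-trans lt le)
    ring : ∀ a x y → a * y + a * x ≡ a * (x + y)
    ring = solve-∀

  ∑±-B : ∀ T r s (q : ℤ → ℤ) → r ℕ.+ s ℕ.< T →
         ∑± T (λ t → coef (suc r) s t * q t) ≡ ∑± T (λ t → coef r s t * (q (t + 1ℤ) - q (t - 1ℤ)))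
  ∑±-B T r s q lt = begin
    ∑± T (λ t → coef (suc r) s t * q t)
      ≡⟨ ∑±-cong T (λ t → trans (cong (_* q t) (coef-B r s t)) (ring₁ (coef r s (t - 1ℤ)) (coef r s (t + 1ℤ)) (q t))) ⟩
    ∑± T (λ t → coef r s (t - 1ℤ) * q t + - (coef r s (t + 1ℤ) * q t))
      ≡⟨ ∑±-+ T (λ t → coef r s (t - 1ℤ) * q t) (λ t → - (coef r s (t + 1ℤ) * q t)) ⟩
    ∑± T (λ t → coef r s (t - 1ℤ) * q t) + ∑± T (λ t → - (coef r s (t + 1ℤ) * q t))
      ≡⟨ cong₂ _+_ (∑±-shift₋ T (coef r s) q z) (trans (∑±-neg T (λ t → coef r s (t + 1ℤ) * q t))
                   (trans (cong -_ (∑±-shift₊ T (coef r s) q z)) (sym (∑±-neg T (λ t → coef r s t * q (t - 1ℤ)))))) ⟩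
    ∑± T (λ t → coef r s t * q (t + 1ℤ)) + ∑± T (λ t → - (coef r s t * q (t - 1ℤ)))
      ≡⟨ ∑±-+ T (λ t → coef r s t * q (t + 1ℤ)) (λ t → - (coef r s t * q (t - 1ℤ))) ⟨
    ∑± T (λ t → coef r s t * q (t + 1ℤ) + - (coef r s t * q (t - 1ℤ)))
      ≡⟨ ∑±-cong T (λ t → ring₂ (coef r s t) (q (t - 1ℤ)) (q (t + 1ℤ))) ⟩
    ∑± T (λ t → coef r s t * (q (t + 1ℤ) - q (t - 1ℤ))) ∎
    where
    open ≡-Reasoning
    z : ∀ t → T ℕ.≤ ∣ t ∣ → coef r s t ≡ 0ℤ
    z t le = coef-support r s t (ℕₚ.≤-trans lt le)
    ring₁ : ∀ a b q → (a - b) * q ≡ a * q + - (b * q)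
    ring₁ = solve-∀
    ring₂ : ∀ a x y → a * y + - (a * x) ≡ a * (y - x)
    ring₂ = solve-∀

-- Krawtchouk polynomials and a convexity inequality

module Krawtchouk where

  open Sums
  open Coefficients
  open import Data.Nat as ℕ using (ℕ; zero; suc; s≤s; z≤n; _!)
  import Data.Nat.Properties as ℕₚ
  open import Data.Integer using (ℤ; +_; -[1+_]; _+_; _*_; _-_; -_; ∣_∣; 0ℤ; 1ℤ; -1ℤ; _≤_; +≤+)
  import Data.Integer.Properties as ℤₚ
  open import Data.Integer.Tactic.RingSolver using (solve-∀)
  import Data.Nat.Tactic.RingSolver as ℕS
  open import Data.Product using (_×_; _,_; proj₁; proj₂)
  open import Relation.Binary.PropositionalEquality

  *-nonneg : ∀ {i j} → 0ℤ ≤ i → 0ℤ ≤ j → 0ℤ ≤ i * j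
  *-nonneg {+ m} {+ n} _ _ = subst (0ℤ ≤_) (ℤₚ.pos-* m n) (+≤+ z≤n)

  *-monoˡ : ∀ {i j k} → 0ℤ ≤ i → j ≤ k → i * j ≤ i * k
  *-monoˡ {+ m} _ le = ℤₚ.*-monoˡ-≤-nonNeg (+ m) le

  square-nonneg : ∀ i → 0ℤ ≤ i * i
  square-nonneg i = subst (0ℤ ≤_) (lem i) (+≤+ z≤n)
    where
    lem : ∀ i → + (∣ i ∣ ℕ.* ∣ i ∣) ≡ i * i
    lem (+ n)    = ℤₚ.pos-* n n
    lem -[1+ n ] = refl

  ∑±-mono : ∀ T {f g : ℤ → ℤ} → (∀ t → f t ≤ g t) → ∑± T f ≤ ∑± T g
  ∑±-mono T {f} {g} le = ℤₚ.+-mono-≤ (le 0ℤ) (go T)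
    where
    go : ∀ T → ∑ T (λ i → f (+ suc i) + f -[1+ i ]) ≤ ∑ T (λ i → g (+ suc i) + g -[1+ i ])
    go zero    = ℤₚ.≤-refl
    go (suc T) = ℤₚ.+-mono-≤ (go T) (ℤₚ.+-mono-≤ (le (+ suc T)) (le -[1+ T ]))

  coef-nonneg : ∀ s t → 0ℤ ≤ coef 0 s t
  coef-nonneg zero t = subst (0ℤ ≤_) (sym (coef-δ t)) (lem t)
    where
    lem : ∀ t → 0ℤ ≤ δ₀ t
    lem (+ zero)  = +≤+ z≤n
    lem (+ suc _) = +≤+ z≤n
    lem -[1+ _ ]  = +≤+ z≤n
  coef-nonneg (suc s) t = subst (0ℤ ≤_) (sym (coef-A 0 s t)) (ℤₚ.+-mono-≤ (coef-nonneg s (t - 1ℤ)) (coef-nonneg s (t + 1ℤ)))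

  -- Monic Krawtchouk polynomials in the centred variable t.
  kraw : ℕ → ℤ → ℤ → ℤ
  kraw zero          N t = 1ℤ
  kraw (suc zero)    N t = t
  kraw (suc (suc r)) N t = t * kraw (suc r) N t - + suc r * (N - + r) * kraw r N t

  kraw⁻ : ℕ → ℤ → ℤ → ℤ
  kraw⁻ zero    N t = 0ℤ
  kraw⁻ (suc r) N t = kraw r N t

  kraw-rec : ∀ r N t → kraw (suc r) N t ≡ t * kraw r N t - + r * (N - + r + 1ℤ) * kraw⁻ r N t
  kraw-rec zero    N t = ring t N
    where
    ring : ∀ t N → t ≡ t * 1ℤ - 0ℤ * (N - 0ℤ + 1ℤ) * 0ℤ
    ring = solve-∀
  kraw-rec (suc r) N t = ring (t * kraw (suc r) N t) (+ suc r) N (+ r) (kraw r N t)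
    where
    ring : ∀ a b N r k → a - b * (N - r) * k ≡ a - b * (N - (1ℤ + r) + 1ℤ) * k
    ring = solve-∀

  -- The dual of `coef-A` and `coef-B`: adding the values at t ± 1 lowers N, subtracting them lowers
  -- N and r. Each relation enters the induction step of the other, so the two are proved together.
  KrawAB : ℕ → ℤ → ℤ → Set
  KrawAB r N t = (kraw r (N + 1ℤ) (t - 1ℤ) + kraw r (N + 1ℤ) (t + 1ℤ) ≡ + 2 * kraw r N t)
               × (kraw r (N + 1ℤ) (t + 1ℤ) - kraw r (N + 1ℤ) (t - 1ℤ) ≡ + 2 * + r * kraw⁻ r N t)

  kraw-AB-step : ∀ r N t → KrawAB r N t → KrawAB (suc r) N t → KrawAB (suc (suc r)) N t
  kraw-AB-step r N t (jhA , jhB) (ihA , ihB) = eqA , eqB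
    where
    open ≡-Reasoning
    a₋ a₊ b₋ b₊ a b c : ℤ
    a₋ = kraw (suc r) (N + 1ℤ) (t - 1ℤ)
    a₊ = kraw (suc r) (N + 1ℤ) (t + 1ℤ)
    b₋ = kraw r (N + 1ℤ) (t - 1ℤ)
    b₊ = kraw r (N + 1ℤ) (t + 1ℤ)
    a = kraw (suc r) N t
    b = kraw r N t
    c = kraw⁻ r N t
    ring₁ : ∀ t x y p q R N r → ((t - 1ℤ) * x - R * (N + 1ℤ - r) * p) + ((t + 1ℤ) * y - R * (N + 1ℤ - r) * q)
                                ≡ t * (x + y) + (y - x) - R * (N + 1ℤ - r) * (p + q)
    ring₁ = solve-∀
    ring₂ : ∀ t a b N r → t * (+ 2 * a) + + 2 * (1ℤ + r) * b - (1ℤ + r) * (N + 1ℤ - r) * (+ 2 * b)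
                          ≡ + 2 * (t * a - (1ℤ + r) * (N - r) * b)
    ring₂ = solve-∀
    ring₃ : ∀ t x y p q R N r → ((t + 1ℤ) * y - R * (N + 1ℤ - r) * q) - ((t - 1ℤ) * x - R * (N + 1ℤ - r) * p)
                                ≡ t * (y - x) + (x + y) - R * (N + 1ℤ - r) * (q - p)
    ring₃ = solve-∀
    ring₄ : ∀ t a b c N r → t * (+ 2 * (1ℤ + r) * b) + + 2 * a - (1ℤ + r) * (N + 1ℤ - r) * (+ 2 * r * c)
                            ≡ + 2 * a + + 2 * (1ℤ + r) * (t * b - r * (N - r + 1ℤ) * c)
    ring₄ = solve-∀
    ring₅ : ∀ a r → + 2 * a + + 2 * (1ℤ + r) * a ≡ + 2 * (1ℤ + (1ℤ + r)) * a
    ring₅ = solve-∀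
    eqA : kraw (suc (suc r)) (N + 1ℤ) (t - 1ℤ) + kraw (suc (suc r)) (N + 1ℤ) (t + 1ℤ) ≡ + 2 * kraw (suc (suc r)) N t
    eqA = begin
      kraw (suc (suc r)) (N + 1ℤ) (t - 1ℤ) + kraw (suc (suc r)) (N + 1ℤ) (t + 1ℤ)
        ≡⟨ ring₁ t a₋ a₊ b₋ b₊ (+ suc r) N (+ r) ⟩
      t * (a₋ + a₊) + (a₊ - a₋) - + suc r * (N + 1ℤ - + r) * (b₋ + b₊)
        ≡⟨ cong₂ (λ x y → x - + suc r * (N + 1ℤ - + r) * y) (cong₂ (λ x y → t * x + y) ihA ihB) jhA ⟩
      t * (+ 2 * a) + + 2 * + suc r * b - + suc r * (N + 1ℤ - + r) * (+ 2 * b)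
        ≡⟨ ring₂ t a b N (+ r) ⟩
      + 2 * kraw (suc (suc r)) N t ∎
    eqB : kraw (suc (suc r)) (N + 1ℤ) (t + 1ℤ) - kraw (suc (suc r)) (N + 1ℤ) (t - 1ℤ) ≡ + 2 * + suc (suc r) * a
    eqB = begin
      kraw (suc (suc r)) (N + 1ℤ) (t + 1ℤ) - kraw (suc (suc r)) (N + 1ℤ) (t - 1ℤ)
        ≡⟨ ring₃ t a₋ a₊ b₋ b₊ (+ suc r) N (+ r) ⟩
      t * (a₊ - a₋) + (a₋ + a₊) - + suc r * (N + 1ℤ - + r) * (b₊ - b₋)
        ≡⟨ cong₂ (λ x y → x - + suc r * (N + 1ℤ - + r) * y) (cong₂ (λ x y → t * x + y) ihB ihA) jhB ⟩
      t * (+ 2 * + suc r * b) + + 2 * a - + suc r * (N + 1ℤ - + r) * (+ 2 * + r * c)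
        ≡⟨ ring₄ t a b c N (+ r) ⟩
      + 2 * a + + 2 * + suc r * (t * b - + r * (N - + r + 1ℤ) * c)
        ≡⟨ cong (λ z → + 2 * a + + 2 * + suc r * z) (kraw-rec r N t) ⟨
      + 2 * a + + 2 * + suc r * a
        ≡⟨ ring₅ a (+ r) ⟩
      + 2 * + suc (suc r) * a ∎

  kraw-AB : ∀ r N t → KrawAB r N t
  kraw-AB zero          N t = refl , refl
  kraw-AB (suc zero)    N t = ring₁ t , ring₂ t
    where
    ring₁ : ∀ t → t - 1ℤ + (t + 1ℤ) ≡ + 2 * t
    ring₁ = solve-∀
    ring₂ : ∀ t → t + 1ℤ - (t - 1ℤ) ≡ + 2
    ring₂ = solve-∀
  kraw-AB (suc (suc r)) N t = kraw-AB-step r N t (kraw-AB r N t) (kraw-AB (suc r) N t)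

  ∑±-coef : ∀ T s → s ℕ.≤ T → ∑± T (λ t → coef 0 s t * 1ℤ) ≡ + (2 ℕ.^ s)
  ∑±-coef T zero    le = trans (∑±-cong T (λ t → trans (ℤₚ.*-identityʳ _) (coef-δ t))) (cong (λ z → 1ℤ + z) (∑-0 T (λ _ → refl)))
  ∑±-coef T (suc s) le = begin
    ∑± T (λ t → coef 0 (suc s) t * 1ℤ)          ≡⟨ ∑±-A T 0 s (λ _ → 1ℤ) le ⟩
    ∑± T (λ t → coef 0 s t * + 2)               ≡⟨ ∑±-cong T (λ t → ring (coef 0 s t)) ⟩
    ∑± T (λ t → + 2 * (coef 0 s t * 1ℤ))        ≡⟨ ∑±-* T (+ 2) (λ t → coef 0 s t * 1ℤ) ⟩
    + 2 * ∑± T (λ t → coef 0 s t * 1ℤ)          ≡⟨ cong (+ 2 *_) (∑±-coef T s (ℕₚ.<⇒≤ le)) ⟩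
    + 2 * + (2 ℕ.^ s)                           ≡⟨ ℤₚ.pos-* 2 (2 ℕ.^ s) ⟨
    + (2 ℕ.* 2 ℕ.^ s)                           ∎
    where
    open ≡-Reasoning
    ring : ∀ x → x * + 2 ≡ + 2 * (x * 1ℤ)
    ring = solve-∀

  -- Summation by parts moves the r factors y - y⁻¹ one at a time onto the polynomial, each move
  -- giving 2r times the polynomial of degree r - 1. What remains is the total mass 2^s of the
  -- binomial weight. The norm of the polynomial follows without orthogonality.
  ∑±-coef-kraw : ∀ T r s → r ℕ.+ s ℕ.≤ T → ∑± T (λ t → coef r s t * kraw r (+ (r ℕ.+ s)) t) ≡ + (2 ℕ.^ (r ℕ.+ s) ℕ.* r !)
  ∑±-coef-kraw T zero    s le = trans (∑±-coef T s le) (cong +_ (sym (ℕₚ.*-identityʳ (2 ℕ.^ s))))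
  ∑±-coef-kraw T (suc r) s le = begin
    ∑± T (λ t → coef (suc r) s t * kraw (suc r) (+ suc (r ℕ.+ s)) t)
      ≡⟨ ∑±-B T r s (kraw (suc r) (+ suc (r ℕ.+ s))) le ⟩
    ∑± T (λ t → coef r s t * (kraw (suc r) (+ suc (r ℕ.+ s)) (t + 1ℤ) - kraw (suc r) (+ suc (r ℕ.+ s)) (t - 1ℤ)))
      ≡⟨ ∑±-cong T (λ t → trans (cong (coef r s t *_) (eq t)) (ring (coef r s t) (+ suc r) (kraw r (+ (r ℕ.+ s)) t))) ⟩
    ∑± T (λ t → + 2 * + suc r * (coef r s t * kraw r (+ (r ℕ.+ s)) t))
      ≡⟨ ∑±-* T (+ 2 * + suc r) (λ t → coef r s t * kraw r (+ (r ℕ.+ s)) t) ⟩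
    + 2 * + suc r * ∑± T (λ t → coef r s t * kraw r (+ (r ℕ.+ s)) t)
      ≡⟨ cong (+ 2 * + suc r *_) (∑±-coef-kraw T r s (ℕₚ.<⇒≤ le)) ⟩
    + 2 * + suc r * + (2 ℕ.^ (r ℕ.+ s) ℕ.* r !)
      ≡⟨ trans (ℤₚ.pos-* (2 ℕ.* suc r) (2 ℕ.^ (r ℕ.+ s) ℕ.* r !)) (cong (_* + (2 ℕ.^ (r ℕ.+ s) ℕ.* r !)) (ℤₚ.pos-* 2 (suc r))) ⟨
    + (2 ℕ.* suc r ℕ.* (2 ℕ.^ (r ℕ.+ s) ℕ.* r !))
      ≡⟨ cong +_ (ringᴺ (suc r) (2 ℕ.^ (r ℕ.+ s)) (r !)) ⟩
    + (2 ℕ.^ (suc r ℕ.+ s) ℕ.* suc r !) ∎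
    where
    open ≡-Reasoning
    eq : ∀ t → kraw (suc r) (+ suc (r ℕ.+ s)) (t + 1ℤ) - kraw (suc r) (+ suc (r ℕ.+ s)) (t - 1ℤ) ≡ + 2 * + suc r * kraw r (+ (r ℕ.+ s)) t
    eq t = trans (cong (λ N → kraw (suc r) N (t + 1ℤ) - kraw (suc r) N (t - 1ℤ)) (cong +_ (ℕₚ.+-comm 1 (r ℕ.+ s))))
                 (proj₂ (kraw-AB (suc r) (+ (r ℕ.+ s)) t))
    ring : ∀ f R k → f * (+ 2 * R * k) ≡ + 2 * R * (f * k)
    ring = solve-∀
    ringᴺ : ∀ R p q → 2 ℕ.* R ℕ.* (p ℕ.* q) ≡ 2 ℕ.* p ℕ.* (R ℕ.* q)
    ringᴺ = ℕS.solve-∀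

  -- The product (s + 1)(s + 2) ⋯ (s + r).
  rise : ℕ → ℕ → ℕ
  rise zero    s = 1
  rise (suc r) s = suc s ℕ.* rise r (suc s)

  -- A discrete Rodrigues formula: coefficients of order r are the binomial weight times a
  -- polynomial. `coef-*t` is the three-term recurrence of `kraw` in another normalisation, so an
  -- induction reaching back two orders proves it.
  coef-kraw : ∀ r s N t → r ℕ.+ s ≡ N → + rise r s * coef r s t ≡ coef 0 N t * kraw r (+ N) t
  coef-kraw zero s _ t refl = ℤₚ.*-comm 1ℤ (coef 0 s t)
  coef-kraw (suc zero) s _ t refl = begin
    + (suc s ℕ.* 1) * coef 1 s t           ≡⟨ cong (λ k → + k * coef 1 s t) (ℕₚ.*-identityʳ (suc s)) ⟩
    + suc s * coef 1 s t                   ≡⟨ ring (+ suc s * coef 1 s t) ⟩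
    0ℤ * 0ℤ + + suc s * coef 1 s t         ≡⟨ coef-*t 0 (suc s) t ⟨
    t * coef 0 (suc s) t                   ≡⟨ ℤₚ.*-comm t _ ⟩
    coef 0 (suc s) t * t                   ∎
    where
    open ≡-Reasoning
    ring : ∀ x → x ≡ 0ℤ * 0ℤ + x
    ring = solve-∀
  coef-kraw (suc (suc r)) s N t eq = begin
    + (suc s ℕ.* P) * coef (suc (suc r)) s t
      ≡⟨ cong (_* coef (suc (suc r)) s t) (ℤₚ.pos-* (suc s) P) ⟩
    + suc s * + P * coef (suc (suc r)) s t
      ≡⟨ ring₁ (+ suc s) (+ P) (coef (suc (suc r)) s t) (+ suc r) (coef r (suc (suc s)) t) ⟩
    + P * (+ suc r * coef r (suc (suc s)) t + + suc s * coef (suc (suc r)) s t) - + suc r * (+ P * coef r (suc (suc s)) t)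
      ≡⟨ cong₂ (λ x y → + P * x - + suc r * y) (sym (coef-*t (suc r) (suc s) t))
               (trans (cong (_* coef r (suc (suc s)) t) (ℤₚ.pos-* (suc (suc s)) (rise r (suc (suc s)))))
                      (ℤₚ.*-assoc (+ suc (suc s)) (+ rise r (suc (suc s))) (coef r (suc (suc s)) t))) ⟩
    + P * (t * coef (suc r) (suc s) t) - + suc r * (+ suc (suc s) * (+ rise r (suc (suc s)) * coef r (suc (suc s)) t))
      ≡⟨ cong₂ (λ x y → x - + suc r * (+ suc (suc s) * y))
               (trans (ring₂ (+ P) t (coef (suc r) (suc s) t)) (cong (t *_) (coef-kraw (suc r) (suc s) N t eq₁)))
               (coef-kraw r (suc (suc s)) N t eq₂) ⟩
    t * (coef 0 N t * kraw (suc r) (+ N) t) - + suc r * (+ suc (suc s) * (coef 0 N t * kraw r (+ N) t))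
      ≡⟨ ring₃ t (coef 0 N t) (kraw (suc r) (+ N) t) (kraw r (+ N) t) (+ suc r) (+ suc (suc s)) ⟩
    coef 0 N t * (t * kraw (suc r) (+ N) t - + suc r * + suc (suc s) * kraw r (+ N) t)
      ≡⟨ cong (λ z → coef 0 N t * (t * kraw (suc r) (+ N) t - + suc r * z * kraw r (+ N) t)) eq₃ ⟩
    coef 0 N t * kraw (suc (suc r)) (+ N) t ∎
    where
    open ≡-Reasoning
    P = rise (suc r) (suc s)
    eq₁ : suc r ℕ.+ suc s ≡ N
    eq₁ = trans (cong suc (ℕₚ.+-suc r s)) eq
    eq₂ : r ℕ.+ suc (suc s) ≡ N
    eq₂ = trans (trans (ℕₚ.+-suc r (suc s)) (cong suc (ℕₚ.+-suc r s))) eq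
    ring₀ : ∀ a b → a ≡ b + a - b
    ring₀ = solve-∀
    eq₃ : + suc (suc s) ≡ + N - + r
    eq₃ = trans (ring₀ (+ suc (suc s)) (+ r)) (cong (λ z → + z - + r) eq₂)
    ring₁ : ∀ S P f R g → S * P * f ≡ P * (R * g + S * f) - R * (P * g)
    ring₁ = solve-∀
    ring₂ : ∀ P t f → P * (t * f) ≡ t * (P * f)
    ring₂ = solve-∀
    ring₃ : ∀ t w k k′ R S → t * (w * k) - R * (S * (w * k′)) ≡ w * (t * k - R * S * k′)
    ring₃ = solve-∀

  even^ : ℕ → ℤ → ℤ
  even^ zero    t = 1ℤ
  even^ (suc j) t = t * t * even^ j t

  even^-nonneg : ∀ j t → 0ℤ ≤ even^ j t
  even^-nonneg zero    t = +≤+ z≤n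
  even^-nonneg (suc j) t = *-nonneg (square-nonneg t) (even^-nonneg j t)

  even^-abs : ∀ j t → + (∣ t ∣ ℕ.^ j ℕ.* ∣ t ∣ ℕ.^ j) ≡ even^ j t
  even^-abs zero    t = refl
  even^-abs (suc j) t = begin
    + (∣ t ∣ ℕ.* ∣ t ∣ ℕ.^ j ℕ.* (∣ t ∣ ℕ.* ∣ t ∣ ℕ.^ j))    ≡⟨ cong +_ (ring ∣ t ∣ (∣ t ∣ ℕ.^ j)) ⟩
    + (∣ t ∣ ℕ.* ∣ t ∣ ℕ.* (∣ t ∣ ℕ.^ j ℕ.* ∣ t ∣ ℕ.^ j))    ≡⟨ ℤₚ.pos-* (∣ t ∣ ℕ.* ∣ t ∣) _ ⟩
    + (∣ t ∣ ℕ.* ∣ t ∣) * + (∣ t ∣ ℕ.^ j ℕ.* ∣ t ∣ ℕ.^ j)    ≡⟨ cong₂ _*_ (sq t) (even^-abs j t) ⟩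
    t * t * even^ j t                                          ∎
    where
    open ≡-Reasoning
    ring : ∀ a p → a ℕ.* p ℕ.* (a ℕ.* p) ≡ a ℕ.* a ℕ.* (p ℕ.* p)
    ring = ℕS.solve-∀
    sq : ∀ t → + (∣ t ∣ ℕ.* ∣ t ∣) ≡ t * t
    sq (+ n)    = ℤₚ.pos-* n n
    sq -[1+ n ] = refl

  -- The trapezoidal rule overestimates the integral of the convex function (2j+1) x^{2j} over [t-1, t+1].
  trapezoid : ∀ j t → (t + 1ℤ) * even^ j (t + 1ℤ) - (t - 1ℤ) * even^ j (t - 1ℤ)
                    ≤ + (2 ℕ.* j ℕ.+ 1) * (even^ j (t - 1ℤ) + even^ j (t + 1ℤ))
  trapezoid j t = proj₂ (go j)
    where
    X Y : ℕ → ℤ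
    X j = (t + 1ℤ) * even^ j (t + 1ℤ) - (t - 1ℤ) * even^ j (t - 1ℤ)
    Y j = even^ j (t - 1ℤ) + even^ j (t + 1ℤ)
    Y≥0 : ∀ j → 0ℤ ≤ Y j
    Y≥0 j = ℤₚ.+-mono-≤ (even^-nonneg j (t - 1ℤ)) (even^-nonneg j (t + 1ℤ))
    ringX : ∀ t x y → (t + 1ℤ) * ((t + 1ℤ) * (t + 1ℤ) * y) - (t - 1ℤ) * ((t - 1ℤ) * (t - 1ℤ) * x)
                      ≡ + 2 * ((t - 1ℤ) * (t - 1ℤ) * x + (t + 1ℤ) * (t + 1ℤ) * y) + (t * t - 1ℤ) * ((t + 1ℤ) * y - (t - 1ℤ) * x)
    ringX = solve-∀
    ringY : ∀ t x y → (t - 1ℤ) * (t - 1ℤ) * x + (t + 1ℤ) * (t + 1ℤ) * y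
                      ≡ (t * t - 1ℤ) * (x + y) + + 2 * ((t + 1ℤ) * y - (t - 1ℤ) * x)
    ringY = solve-∀
    go : ∀ j → 0ℤ ≤ X j × X j ≤ + (2 ℕ.* j ℕ.+ 1) * Y j
    go zero    = subst (0ℤ ≤_) (sym (r t)) (+≤+ z≤n) , ℤₚ.≤-reflexive (r t)
      where
      r : ∀ t → (t + 1ℤ) * 1ℤ - (t - 1ℤ) * 1ℤ ≡ + 2
      r = solve-∀
    go (suc j) = step t refl
      where
      base : ∀ j → even^ j 1ℤ ≡ 1ℤ
      base zero    = refl
      base (suc j) = trans (ℤₚ.*-identityˡ _) (base j)
      base₋ : ∀ j → even^ j -1ℤ ≡ 1ℤ
      base₋ zero    = refl
      base₋ (suc j) = trans (ℤₚ.*-identityˡ _) (base₋ j)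
      c : ℤ
      c = t * t - 1ℤ
      general : 0ℤ ≤ c → 0ℤ ≤ X (suc j) × X (suc j) ≤ + (2 ℕ.* suc j ℕ.+ 1) * Y (suc j)
      general 0≤c = subst (0ℤ ≤_) (sym eqX) (ℤₚ.+-mono-≤ (*-nonneg {+ 2} (+≤+ z≤n) (Y≥0 (suc j))) (*-nonneg 0≤c (proj₁ (go j))))
                  , (begin
        X (suc j)                                                        ≡⟨ eqX ⟩
        + 2 * Y (suc j) + c * X j                                        ≤⟨ ℤₚ.+-monoʳ-≤ (+ 2 * Y (suc j)) (*-monoˡ 0≤c (proj₂ (go j))) ⟩
        + 2 * Y (suc j) + c * (+ m * Y j)                                ≡⟨ cong (λ z → + 2 * Y (suc j) + z) (ring₁ c (+ m) (Y j)) ⟩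
        + 2 * Y (suc j) + + m * (c * Y j)                                ≤⟨ ℤₚ.+-monoʳ-≤ (+ 2 * Y (suc j)) (*-monoˡ {+ m} (+≤+ z≤n) cY≤) ⟩
        + 2 * Y (suc j) + + m * Y (suc j)                                ≡⟨ ring₂ (+ m) (Y (suc j)) ⟩
        (+ 2 + + m) * Y (suc j)                                          ≡⟨ cong (λ k → + k * Y (suc j)) (ringᴺ j) ⟩
        + (2 ℕ.* suc j ℕ.+ 1) * Y (suc j)                                ∎)
        where
        open ℤₚ.≤-Reasoning
        m = 2 ℕ.* j ℕ.+ 1
        eqX = ringX t (even^ j (t - 1ℤ)) (even^ j (t + 1ℤ))
        cY≤ : c * Y j ≤ Y (suc j)
        cY≤ = subst (c * Y j ≤_) (sym (ringY t (even^ j (t - 1ℤ)) (even^ j (t + 1ℤ))))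
                (subst (_≤ c * Y j + + 2 * X j) (ℤₚ.+-identityʳ (c * Y j)) (ℤₚ.+-monoʳ-≤ (c * Y j) (*-nonneg {+ 2} (+≤+ z≤n) (proj₁ (go j)))))
        ring₁ : ∀ c m y → c * (m * y) ≡ m * (c * y)
        ring₁ = solve-∀
        ring₂ : ∀ m y → + 2 * y + m * y ≡ (+ 2 + m) * y
        ring₂ = solve-∀
        ringᴺ : ∀ j → 2 ℕ.+ (2 ℕ.* j ℕ.+ 1) ≡ 2 ℕ.* suc j ℕ.+ 1
        ringᴺ = ℕS.solve-∀
      step : ∀ u → u ≡ t → 0ℤ ≤ X (suc j) × X (suc j) ≤ + (2 ℕ.* suc j ℕ.+ 1) * Y (suc j)
      -- At t = 0 the factor t² - 1 is negative and `general` fails; the values at ±1 are known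
      -- there.
      step (+ zero)  refl rewrite base j | base₋ j = +≤+ z≤n , +≤+ (s≤s (s≤s z≤n))
      step (+ suc n) refl = general (+≤+ z≤n)
      step -[1+ n ]  refl = general (+≤+ z≤n)

-- Moments of the binomial weight and weighted norms of the coefficients

module WeightedNorms where

  open Sums
  open Coefficients
  open Krawtchouk
  open import Data.Nat as ℕ using (ℕ; zero; suc; z≤n; _!)
  import Data.Nat.Properties as ℕₚ
  open import Data.Integer using (ℤ; +_; -[1+_]; _+_; _*_; _-_; -_; ∣_∣; 0ℤ; 1ℤ; _≤_; +≤+)
  import Data.Integer.Properties as ℤₚ
  open import Data.Integer.Tactic.RingSolver using (solve-∀)
  import Data.Nat.Tactic.RingSolver as ℕS
  open import Relation.Binary.PropositionalEquality

  -- The double factorial (2j - 1)!!, the moment of order 2j of a standard Gaussian.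
  dfact : ℕ → ℕ
  dfact zero    = 1
  dfact (suc j) = (2 ℕ.* j ℕ.+ 1) ℕ.* dfact j

  -- Binomial moments stay below Gaussian ones. One factor t turns into a factor y - y⁻¹ by
  -- `coef-*t`; summation by parts moves it onto t^(2j+1); `trapezoid` bounds the resulting
  -- difference by 2j + 1 times the sum of two even powers; and `∑±-A`, read backwards, recognises
  -- the moment of order 2j.
  moment : ∀ T N j → N ℕ.≤ T → ∑± T (λ t → coef 0 N t * even^ j t) ≤ + (dfact j ℕ.* N ℕ.^ j ℕ.* 2 ℕ.^ N)
  moment T N zero le = ℤₚ.≤-reflexive (trans (∑±-coef T N le) (cong +_ (sym (ℕₚ.+-identityʳ (2 ℕ.^ N)))))
  moment T zero (suc j) le = subst (_≤ + (dfact (suc j) ℕ.* 0 ℕ.* 1)) (sym zero-sum) (+≤+ z≤n)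
    where
    ring : ∀ f t e → f * (t * t * e) ≡ (t * f) * (t * e)
    ring = solve-∀
    zero-sum : ∑± T (λ t → coef 0 0 t * even^ (suc j) t) ≡ 0ℤ
    zero-sum = trans (∑±-cong T {g = λ _ → 0ℤ} (λ t → trans (ring (coef 0 0 t) t (even^ j t)) (cong (_* (t * even^ j t)) (coef-*t 0 0 t))))
                     (cong (λ z → 0ℤ + z) (∑-0 T (λ _ → refl)))
  moment T (suc N) (suc j) le = begin
    ∑± T (λ t → coef 0 (suc N) t * even^ (suc j) t)
      ≡⟨ ∑±-cong T (λ t → trans (ring₁ (coef 0 (suc N) t) t (even^ j t))
                            (trans (cong (_* (t * even^ j t)) (coef-*t 0 (suc N) t))
                                   (ring₂ (+ suc N) (coef 1 N t) (t * even^ j t)))) ⟩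
    ∑± T (λ t → + suc N * (coef 1 N t * (t * even^ j t)))
      ≡⟨ ∑±-* T (+ suc N) (λ t → coef 1 N t * (t * even^ j t)) ⟩
    + suc N * ∑± T (λ t → coef 1 N t * (t * even^ j t))
      ≡⟨ cong (+ suc N *_) (∑±-B T 0 N (λ t → t * even^ j t) le) ⟩
    + suc N * ∑± T (λ t → coef 0 N t * ((t + 1ℤ) * even^ j (t + 1ℤ) - (t - 1ℤ) * even^ j (t - 1ℤ)))
      ≤⟨ *-monoˡ {+ suc N} (+≤+ z≤n) (∑±-mono T (λ t → *-monoˡ (coef-nonneg N t) (trapezoid j t))) ⟩
    + suc N * ∑± T (λ t → coef 0 N t * (+ m * (even^ j (t - 1ℤ) + even^ j (t + 1ℤ))))
      ≡⟨ cong (+ suc N *_) (trans (∑±-cong T (λ t → ring₃ (coef 0 N t) (+ m) (even^ j (t - 1ℤ) + even^ j (t + 1ℤ))))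
                                  (∑±-* T (+ m) (λ t → coef 0 N t * (even^ j (t - 1ℤ) + even^ j (t + 1ℤ))))) ⟩
    + suc N * (+ m * ∑± T (λ t → coef 0 N t * (even^ j (t - 1ℤ) + even^ j (t + 1ℤ))))
      ≡⟨ cong (λ z → + suc N * (+ m * z)) (∑±-A T 0 N (even^ j) le) ⟨
    + suc N * (+ m * ∑± T (λ t → coef 0 (suc N) t * even^ j t))
      ≤⟨ *-monoˡ {+ suc N} (+≤+ z≤n) (*-monoˡ {+ m} (+≤+ z≤n) (moment T (suc N) j le)) ⟩
    + suc N * (+ m * + (dfact j ℕ.* suc N ℕ.^ j ℕ.* 2 ℕ.^ suc N))
      ≡⟨ trans (ℤₚ.pos-* (suc N) (m ℕ.* B)) (cong (+ suc N *_) (ℤₚ.pos-* m B)) ⟨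
    + (suc N ℕ.* (m ℕ.* B))
      ≡⟨ cong +_ (ring₄ (suc N) m (dfact j) (suc N ℕ.^ j) (2 ℕ.^ suc N)) ⟩
    + (dfact (suc j) ℕ.* suc N ℕ.^ suc j ℕ.* 2 ℕ.^ suc N) ∎
    where
    open ℤₚ.≤-Reasoning
    m = 2 ℕ.* j ℕ.+ 1
    B = dfact j ℕ.* suc N ℕ.^ j ℕ.* 2 ℕ.^ suc N
    ring₁ : ∀ f t e → f * (t * t * e) ≡ (t * f) * (t * e)
    ring₁ = solve-∀
    ring₂ : ∀ n f e → (0ℤ * 0ℤ + n * f) * e ≡ n * (f * e)
    ring₂ = solve-∀
    ring₃ : ∀ f m e → f * (m * e) ≡ m * (f * e)
    ring₃ = solve-∀
    ring₄ : ∀ n m d p q → n ℕ.* (m ℕ.* (d ℕ.* p ℕ.* q)) ≡ m ℕ.* d ℕ.* (n ℕ.* p) ℕ.* q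
    ring₄ = ℕS.solve-∀

  rise-nonZero : ∀ r s → ℕ.NonZero (rise r s)
  rise-nonZero zero    s = _
  rise-nonZero (suc r) s = ℕₚ.m*n≢0 (suc s) (rise r (suc s)) {{_}} {{rise-nonZero r (suc s)}}

  -- By `coef-kraw` the summand, times P, is |t|^j √w times √w |kraw| for the binomial weight w, and
  -- Cauchy-Schwarz separates the two. The first square sum is a moment; in the second, w kraw² is P
  -- coef kraw, which `∑±-coef-kraw` evaluates.
  weighted-ℓ¹ : ∀ T r s j → r ℕ.+ s ℕ.≤ T →
    let N = r ℕ.+ s ; Z = ∑±ᴺ T (λ t → ∣ t ∣ ℕ.^ j ℕ.* ∣ coef r s t ∣) in
    rise r s ℕ.* (Z ℕ.* Z) ℕ.≤ dfact j ℕ.* N ℕ.^ j ℕ.* 2 ℕ.^ N ℕ.* (2 ℕ.^ N ℕ.* r !)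
  weighted-ℓ¹ T r s j le = ℕₚ.*-cancelˡ-≤ P {{rise-nonZero r s}} (begin
    P ℕ.* (P ℕ.* (Z ℕ.* Z))                                ≡⟨ ring₁ P Z ⟩
    (P ℕ.* Z) ℕ.* (P ℕ.* Z)                                ≡⟨ cong (λ z → z ℕ.* z) (∑±ᴺ-* T P (λ t → ∣ t ∣ ℕ.^ j ℕ.* ∣ coef r s t ∣)) ⟨
    ∑±ᴺ T S ℕ.* ∑±ᴺ T S                                    ≤⟨ cauchySchwarz T S U V pointwise ⟩
    ∑±ᴺ T U ℕ.* ∑±ᴺ T V                                    ≤⟨ ℕₚ.*-mono-≤ U≤ (ℕₚ.≤-reflexive V≡) ⟩
    M ℕ.* (P ℕ.* (2 ℕ.^ N ℕ.* r !))                        ≡⟨ ring₂ M P (2 ℕ.^ N ℕ.* r !) ⟩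
    P ℕ.* (M ℕ.* (2 ℕ.^ N ℕ.* r !))                        ∎)
    where
    open ℕₚ.≤-Reasoning
    N = r ℕ.+ s
    P = rise r s
    Z = ∑±ᴺ T (λ t → ∣ t ∣ ℕ.^ j ℕ.* ∣ coef r s t ∣)
    M = dfact j ℕ.* N ℕ.^ j ℕ.* 2 ℕ.^ N
    w k : ℤ → ℕ
    w t = ∣ coef 0 N t ∣
    k t = ∣ kraw r (+ N) t ∣
    S U V : ℤ → ℕ
    S t = P ℕ.* (∣ t ∣ ℕ.^ j ℕ.* ∣ coef r s t ∣)
    U t = w t ℕ.* (∣ t ∣ ℕ.^ j ℕ.* ∣ t ∣ ℕ.^ j)
    V t = w t ℕ.* (k t ℕ.* k t)
    ring₁ : ∀ P Z → P ℕ.* (P ℕ.* (Z ℕ.* Z)) ≡ (P ℕ.* Z) ℕ.* (P ℕ.* Z)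
    ring₁ = ℕS.solve-∀
    ring₂ : ∀ M P q → M ℕ.* (P ℕ.* q) ≡ P ℕ.* (M ℕ.* q)
    ring₂ = ℕS.solve-∀
    ring₃ : ∀ P a c → P ℕ.* (a ℕ.* c) ≡ a ℕ.* (P ℕ.* c)
    ring₃ = ℕS.solve-∀
    ring₄ : ∀ a w k → (a ℕ.* (w ℕ.* k)) ℕ.* (a ℕ.* (w ℕ.* k)) ≡ (w ℕ.* (a ℕ.* a)) ℕ.* (w ℕ.* (k ℕ.* k))
    ring₄ = ℕS.solve-∀
    Pc≡wk : ∀ t → P ℕ.* ∣ coef r s t ∣ ≡ w t ℕ.* k t
    Pc≡wk t = trans (sym (ℤₚ.∣i*j∣≡∣i∣*∣j∣ (+ P) (coef r s t)))
             (trans (cong ∣_∣ (coef-kraw r s N t refl)) (ℤₚ.∣i*j∣≡∣i∣*∣j∣ (coef 0 N t) (kraw r (+ N) t)))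
    pointwise : ∀ t → S t ℕ.* S t ℕ.≤ U t ℕ.* V t
    pointwise t = ℕₚ.≤-reflexive (trans (cong (λ z → z ℕ.* z) (trans (ring₃ P a ∣ coef r s t ∣) (cong (a ℕ.*_) (Pc≡wk t)))) (ring₄ a (w t) (k t)))
      where a = ∣ t ∣ ℕ.^ j
    +w : ∀ t → + w t ≡ coef 0 N t
    +w t = ℤₚ.0≤i⇒+∣i∣≡i (coef-nonneg N t)
    U≤ : ∑±ᴺ T U ℕ.≤ M
    U≤ = ℤₚ.drop‿+≤+ (subst (_≤ + M) (sym (trans (+∑±ᴺ T U) (∑±-cong T (λ t →
           trans (ℤₚ.pos-* (w t) _) (cong₂ _*_ (+w t) (even^-abs j t)))))) (moment T N j le))
    sq : ∀ i → + (∣ i ∣ ℕ.* ∣ i ∣) ≡ i * i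
    sq (+ n)    = ℤₚ.pos-* n n
    sq -[1+ n ] = refl
    ring₅ : ∀ w k → w * (k * k) ≡ (w * k) * k
    ring₅ = solve-∀
    ring₆ : ∀ P c k → P * c * k ≡ P * (c * k)
    ring₆ = solve-∀
    V≡ : ∑±ᴺ T V ≡ P ℕ.* (2 ℕ.^ N ℕ.* r !)
    V≡ = ℤₚ.+-injective (trans (+∑±ᴺ T V) (trans (∑±-cong T (λ t → trans (ℤₚ.pos-* (w t) (k t ℕ.* k t))
           (trans (cong₂ _*_ (+w t) (sq (kraw r (+ N) t)))
           (trans (ring₅ (coef 0 N t) (kraw r (+ N) t))
           (trans (cong (_* kraw r (+ N) t) (sym (coef-kraw r s N t refl)))
                  (ring₆ (+ P) (coef r s t) (kraw r (+ N) t)))))))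
         (trans (∑±-* T (+ P) (λ t → coef r s t * kraw r (+ N) t))
         (trans (cong (+ P *_) (∑±-coef-kraw T r s le)) (sym (ℤₚ.pos-* P (2 ℕ.^ N ℕ.* r !)))))))

-- Folding over a cycle: a discrete heat equation with decaying solutions

module Folding where

  open Sums
  open Coefficients
  open import Data.Nat as ℕ using (ℕ; zero; suc; s≤s; z≤n)
  import Data.Nat.Properties as ℕₚ
  open import Data.Integer as ℤ using (ℤ; +_; -[1+_]; _+_; _*_; _-_; -_; ∣_∣; 0ℤ; 1ℤ; -1ℤ)
  import Data.Integer.Properties as ℤₚ
  open import Data.Integer.Tactic.RingSolver using (solve-∀)
  import Data.Nat.Tactic.RingSolver as ℕS
  open import Relation.Nullary using (yes; no; contradiction)
  open import Relation.Binary.PropositionalEquality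

  x≡-x⇒x≡0 : ∀ x → x ≡ - x → x ≡ 0ℤ
  x≡-x⇒x≡0 (+ zero) eq = refl

  module _ (m D : ℕ) where

    private
      c : ℤ
      c = + (2 ℕ.* m)

    -- The function induced on the cycle of length 2m, truncated to |d| ≤ D. The later condition r +
    -- s < m (2D + 1) puts all omitted terms outside the support when |t| ≤ m.
    fold : ℕ → ℕ → ℤ → ℤ
    fold r s t = ∑± D (λ d → coef r s (t + c * d))

    private
      shift₋ : ∀ t d → t + c * d - 1ℤ ≡ t - 1ℤ + c * d
      shift₋ t d = ring t (c * d)
        where
        ring : ∀ t x → t + x - 1ℤ ≡ t - 1ℤ + x
        ring = solve-∀
      shift₊ : ∀ t d → t + c * d + 1ℤ ≡ t + 1ℤ + c * d
      shift₊ t d = ring t (c * d)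
        where
        ring : ∀ t x → t + x + 1ℤ ≡ t + 1ℤ + x
        ring = solve-∀

    fold-A : ∀ r s t → fold r (suc s) t ≡ fold r s (t - 1ℤ) + fold r s (t + 1ℤ)
    fold-A r s t = trans
      (∑±-cong D (λ d → trans (coef-A r s (t + c * d)) (cong₂ (λ x y → coef r s x + coef r s y) (shift₋ t d) (shift₊ t d))))
      (∑±-+ D (λ d → coef r s (t - 1ℤ + c * d)) (λ d → coef r s (t + 1ℤ + c * d)))

    fold-B : ∀ r s t → fold (suc r) s t ≡ fold r s (t - 1ℤ) - fold r s (t + 1ℤ)
    fold-B r s t = trans
      (∑±-cong D (λ d → trans (coef-B r s (t + c * d)) (cong₂ (λ x y → coef r s x - coef r s y) (shift₋ t d) (shift₊ t d))))
      (trans (∑±-+ D (λ d → coef r s (t - 1ℤ + c * d)) (λ d → - coef r s (t + 1ℤ + c * d)))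
             (cong (λ z → fold r s (t - 1ℤ) + z) (∑±-neg D (λ d → coef r s (t + 1ℤ + c * d)))))

    fold-parity : ∀ r s t → fold r s (- t) ≡ sgn r * fold r s t
    fold-parity r s t = begin
      ∑± D (λ d → coef r s (- t + c * d))            ≡⟨ ∑±-reflect D (λ d → coef r s (- t + c * d)) ⟨
      ∑± D (λ d → coef r s (- t + c * (- d)))        ≡⟨ ∑±-cong D (λ d → trans (cong (coef r s) (ring t c d)) (coef-parity r s (t + c * d))) ⟩
      ∑± D (λ d → sgn r * coef r s (t + c * d))      ≡⟨ ∑±-* D (sgn r) (λ d → coef r s (t + c * d)) ⟩
      sgn r * fold r s t                             ∎
      where
      open ≡-Reasoning
      ring : ∀ t c d → - t + c * (- d) ≡ - (t + c * d)
      ring = solve-∀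

    private
      ∣δ₀∣≤1 : ∀ t → ∣ δ₀ t ∣ ℕ.≤ 1
      ∣δ₀∣≤1 (+ zero)  = ℕₚ.≤-refl
      ∣δ₀∣≤1 (+ suc _) = z≤n
      ∣δ₀∣≤1 -[1+ _ ]  = z≤n

    module _ (m≥1 : 1 ℕ.≤ m) where

      private
        -- The terms of an arithmetic progression are pairwise distinct, so at most one of them vanishes.
        progression : ∀ K (y : ℕ → ℤ) → (∀ i j → i ℕ.< j → δ₀ (y i) ≡ 1ℤ → δ₀ (y j) ≡ 0ℤ) → ∣ ∑ K (λ i → δ₀ (y i)) ∣ ℕ.≤ 1
        progression zero    y distinct = z≤n
        progression (suc K) y distinct = subst (λ z → ∣ z ∣ ℕ.≤ 1) (sym (∑-head K (λ i → δ₀ (y i)))) (go (y 0) refl)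
          where
          rest = ∑ K (λ i → δ₀ (y (suc i)))
          later : ∣ 0ℤ + rest ∣ ℕ.≤ 1
          later = subst (λ z → ∣ z ∣ ℕ.≤ 1) (sym (ℤₚ.+-identityˡ rest)) (progression K (λ i → y (suc i)) (λ i j i<j → distinct (suc i) (suc j) (s≤s i<j)))
          go : ∀ y₀ → y 0 ≡ y₀ → ∣ δ₀ (y 0) + rest ∣ ℕ.≤ 1
          go (+ zero)  eq rewrite eq = subst (λ z → ∣ 1ℤ + z ∣ ℕ.≤ 1) (sym (∑-0 K (λ i → distinct 0 (suc i) (s≤s z≤n) (cong δ₀ eq)))) ℕₚ.≤-refl
          go (+ suc n) eq rewrite eq = later
          go -[1+ n ]  eq rewrite eq = later

        δ₀≡1 : ∀ x → δ₀ x ≡ 1ℤ → x ≡ 0ℤ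
        δ₀≡1 (+ zero) eq = refl

        δ₀≡0 : ∀ x → x ≢ 0ℤ → δ₀ x ≡ 0ℤ
        δ₀≡0 (+ zero)  ne = contradiction refl ne
        δ₀≡0 (+ suc n) ne = refl
        δ₀≡0 -[1+ n ]  ne = refl

        c-nonZero : ℤ.NonZero c
        c-nonZero = ℤ.≢-nonZero (λ eq → ℕₚ.<⇒≢ (ℕₚ.*-mono-≤ {1} {2} (s≤s z≤n) m≥1) (sym (ℤₚ.+-injective eq)))

        distinct : ∀ t x y → x ≢ y → δ₀ (t + c * x) ≡ 1ℤ → δ₀ (t + c * y) ≡ 0ℤ
        distinct t x y x≢y e = δ₀≡0 (t + c * y) (λ e′ → x≢y (ℤₚ.*-cancelˡ-≡ c x y {{c-nonZero}}
          (trans (ring t (c * x)) (trans (cong (_- t) (trans (δ₀≡1 (t + c * x) e) (sym e′))) (sym (ring t (c * y)))))))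
          where
          ring : ∀ t u → u ≡ t + u - t
          ring = solve-∀

      -- The cases d = 0, d > 0 and d < 0 contain at most one nonzero term each; counting them
      -- separately gives 3 and spares a comparison across signs.
      fold-0 : ∀ t → ∣ fold 0 0 t ∣ ℕ.≤ 3
      fold-0 t = begin
        ∣ fold 0 0 t ∣                                  ≡⟨ cong ∣_∣ (∑±-cong D (λ d → coef-δ (t + c * d))) ⟩
        ∣ ∑± D (λ d → δ₀ (t + c * d)) ∣                 ≡⟨ cong (λ z → ∣ δ₀ (t + c * 0ℤ) + z ∣) (∑-+ D (λ i → δ₀ (t + c * + suc i)) (λ i → δ₀ (t + c * -[1+ i ]))) ⟩
        ∣ δ₀ (t + c * 0ℤ) + (P + M) ∣                   ≤⟨ ℤₚ.∣i+j∣≤∣i∣+∣j∣ (δ₀ (t + c * 0ℤ)) (P + M) ⟩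
        ∣ δ₀ (t + c * 0ℤ) ∣ ℕ.+ ∣ P + M ∣               ≤⟨ ℕₚ.+-mono-≤ (∣δ₀∣≤1 (t + c * 0ℤ)) (ℕₚ.≤-trans (ℤₚ.∣i+j∣≤∣i∣+∣j∣ P M) (ℕₚ.+-mono-≤
                                                            (progression D (λ i → t + c * + suc i) (λ i j i<j → distinct t (+ suc i) (+ suc j) (λ e → ℕₚ.<⇒≢ i<j (ℕₚ.suc-injective (ℤₚ.+-injective e)))))
                                                            (progression D (λ i → t + c * -[1+ i ]) (λ i j i<j → distinct t -[1+ i ] -[1+ j ] (λ e → ℕₚ.<⇒≢ i<j (ℤₚ.-[1+-injective e)))))) ⟩
        3 ∎
        where
        open ℕₚ.≤-Reasoning
        P = ∑ D (λ i → δ₀ (t + c * + suc i))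
        M = ∑ D (λ i → δ₀ (t + c * -[1+ i ]))

      fold-init : ∀ r t → ∣ fold r 0 t ∣ ℕ.≤ 3 ℕ.* 2 ℕ.^ r
      fold-init zero    t = fold-0 t
      fold-init (suc r) t = begin
        ∣ fold (suc r) 0 t ∣                             ≡⟨ cong ∣_∣ (fold-B r 0 t) ⟩
        ∣ fold r 0 (t - 1ℤ) - fold r 0 (t + 1ℤ) ∣        ≤⟨ ℤₚ.∣i-j∣≤∣i∣+∣j∣ (fold r 0 (t - 1ℤ)) (fold r 0 (t + 1ℤ)) ⟩
        ∣ fold r 0 (t - 1ℤ) ∣ ℕ.+ ∣ fold r 0 (t + 1ℤ) ∣  ≤⟨ ℕₚ.+-mono-≤ (fold-init r (t - 1ℤ)) (fold-init r (t + 1ℤ)) ⟩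
        3 ℕ.* 2 ℕ.^ r ℕ.+ 3 ℕ.* 2 ℕ.^ r                  ≡⟨ ring (2 ℕ.^ r) ⟩
        3 ℕ.* 2 ℕ.^ suc r                                ∎
        where
        open ℕₚ.≤-Reasoning
        ring : ∀ x → 3 ℕ.* x ℕ.+ 3 ℕ.* x ≡ 3 ℕ.* (2 ℕ.* x)
        ring = ℕS.solve-∀

      module _ (r : ℕ) (odd : sgn r ≡ -1ℤ) where

        fold-at-0 : ∀ s → fold r s 0ℤ ≡ 0ℤ
        fold-at-0 s = x≡-x⇒x≡0 _ (trans (fold-parity r s 0ℤ) (trans (cong (_* fold r s 0ℤ) odd) (ℤₚ.-1*i≡-i _)))

        -- The pairing of d with -1 - d sends m + 2md to its negative, so odd order makes the terms
        -- cancel. The unpaired term d = D lies outside the support.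
        fold-at-m : ∀ s → r ℕ.+ s ℕ.< m ℕ.* (2 ℕ.* D ℕ.+ 1) → fold r s (+ m) ≡ 0ℤ
        fold-at-m s lt = begin
          ∑± D y                                       ≡⟨ ∑±-unfold D y ⟩
          ∑ D (λ i → y (+ i) + y -[1+ i ]) + y (+ D)   ≡⟨ cong₂ _+_ (∑-0 D cancel) last ⟩
          0ℤ                                           ∎
          where
          open ≡-Reasoning
          y : ℤ → ℤ
          y d = coef r s (+ m + c * d)
          c≡ : c ≡ + 2 * + m
          c≡ = ℤₚ.pos-* 2 m
          ring₁ : ∀ m i → m + + 2 * m * (- (1ℤ + i)) ≡ - (m + + 2 * m * i)
          ring₁ = solve-∀
          ring₂ : ∀ a → a + -1ℤ * a ≡ 0ℤ
          ring₂ = solve-∀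
          ring₃ : ∀ m d → m + + 2 * m * d ≡ m * (+ 2 * d + 1ℤ)
          ring₃ = solve-∀
          cancel : ∀ i → y (+ i) + y -[1+ i ] ≡ 0ℤ
          cancel i = trans (cong (λ z → y (+ i) + z) (trans (cong (coef r s) arg) (trans (coef-parity r s (+ m + c * + i)) (cong (_* y (+ i)) odd)))) (ring₂ (y (+ i)))
            where
            arg : + m + c * -[1+ i ] ≡ - (+ m + c * + i)
            arg = trans (cong (λ z → + m + z * -[1+ i ]) c≡) (trans (ring₁ (+ m) (+ i)) (cong (λ z → - (+ m + z * + i)) (sym c≡)))
          last : y (+ D) ≡ 0ℤ
          last = coef-support r s (+ m + c * + D) (subst (λ z → r ℕ.+ s ℕ.< ∣ z ∣) (sym arg) lt)
            where
            arg : + m + c * + D ≡ + (m ℕ.* (2 ℕ.* D ℕ.+ 1))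
            arg = trans (cong (λ z → + m + z * + D) c≡) (trans (ring₃ (+ m) (+ D))
                  (trans (cong (λ z → + m * (z + 1ℤ)) (sym (ℤₚ.pos-* 2 D))) (sym (ℤₚ.pos-* m (2 ℕ.* D ℕ.+ 1)))))

        module _ (q : ℕ) (m²≤ : m ℕ.* m ℕ.≤ 4 ℕ.+ q) where

          private
            K = 3 ℕ.* 2 ℕ.^ r

          -- Maximum principle: the parabola a (m − a) is a supersolution on [0, m].
          supersolution : ∀ s a b → a ℕ.+ b ≡ m → r ℕ.+ s ℕ.< m ℕ.* (2 ℕ.* D ℕ.+ 1) →
            (m ℕ.∸ 1) ℕ.* ∣ fold r s (+ a) ∣ ℕ.* (4 ℕ.+ q) ℕ.^ s ℕ.≤ K ℕ.* (2 ℕ.* q) ℕ.^ s ℕ.* (a ℕ.* b)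
          supersolution s zero b eq lt = ℕₚ.≤-trans (ℕₚ.≤-reflexive
            (trans (cong (λ z → (m ℕ.∸ 1) ℕ.* ∣ z ∣ ℕ.* (4 ℕ.+ q) ℕ.^ s) (fold-at-0 s)) (cong (ℕ._* (4 ℕ.+ q) ℕ.^ s) (ℕₚ.*-zeroʳ (m ℕ.∸ 1))))) z≤n
          supersolution s (suc a) zero eq lt = ℕₚ.≤-trans (ℕₚ.≤-reflexive
            (trans (cong (λ z → (m ℕ.∸ 1) ℕ.* ∣ z ∣ ℕ.* (4 ℕ.+ q) ℕ.^ s) (trans (cong (λ k → fold r s (+ k)) (trans (sym (ℕₚ.+-identityʳ (suc a))) eq)) (fold-at-m s lt)))
                   (cong (ℕ._* (4 ℕ.+ q) ℕ.^ s) (ℕₚ.*-zeroʳ (m ℕ.∸ 1))))) z≤n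
          supersolution zero (suc a) (suc b) eq lt = begin
            (m ℕ.∸ 1) ℕ.* ∣ fold r 0 (+ suc a) ∣ ℕ.* 1      ≡⟨ ℕₚ.*-identityʳ _ ⟩
            (m ℕ.∸ 1) ℕ.* ∣ fold r 0 (+ suc a) ∣            ≤⟨ ℕₚ.*-mono-≤ m-1≤ (fold-init r (+ suc a)) ⟩
            (suc a ℕ.* suc b) ℕ.* K                         ≡⟨ ring₁ (suc a ℕ.* suc b) K ⟩
            K ℕ.* 1 ℕ.* (suc a ℕ.* suc b)                   ∎
            where
            open ℕₚ.≤-Reasoning
            ring₁ : ∀ x K → x ℕ.* K ≡ K ℕ.* 1 ℕ.* x
            ring₁ = ℕS.solve-∀
            ring₂ : ∀ a b → suc a ℕ.* suc b ≡ a ℕ.+ suc b ℕ.+ a ℕ.* b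
            ring₂ = ℕS.solve-∀
            -- The smallest interior value of the parabola is m - 1, which explains the factor m - 1
            -- on the left of the claim.
            m-1≤ : m ℕ.∸ 1 ℕ.≤ suc a ℕ.* suc b
            m-1≤ = subst (λ z → z ℕ.∸ 1 ℕ.≤ suc a ℕ.* suc b) eq (ℕₚ.≤-trans (ℕₚ.m≤m+n (a ℕ.+ suc b) (a ℕ.* b)) (ℕₚ.≤-reflexive (sym (ring₂ a b))))
          supersolution (suc s) (suc a) (suc b) eq lt = begin
            M ℕ.* ∣ fold r (suc s) (+ suc a) ∣ ℕ.* (R ℕ.* R^)
              ≤⟨ ℕₚ.*-monoˡ-≤ (R ℕ.* R^) (ℕₚ.*-monoʳ-≤ M (ℕₚ.≤-trans (ℕₚ.≤-reflexive (cong ∣_∣ split)) (ℤₚ.∣i+j∣≤∣i∣+∣j∣ (fold r s (+ a)) (fold r s (+ suc (suc a)))))) ⟩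
            M ℕ.* (∣ fold r s (+ a) ∣ ℕ.+ ∣ fold r s (+ suc (suc a)) ∣) ℕ.* (R ℕ.* R^)
              ≡⟨ ring₁ M ∣ fold r s (+ a) ∣ ∣ fold r s (+ suc (suc a)) ∣ R R^ ⟩
            R ℕ.* (M ℕ.* ∣ fold r s (+ a) ∣ ℕ.* R^ ℕ.+ M ℕ.* ∣ fold r s (+ suc (suc a)) ∣ ℕ.* R^)
              ≤⟨ ℕₚ.*-monoʳ-≤ R (ℕₚ.+-mono-≤ (supersolution s a (suc (suc b)) (trans (ℕₚ.+-suc a (suc b)) eq) lt′)
                                              (supersolution s (suc (suc a)) b (trans (cong suc (sym (ℕₚ.+-suc a b))) eq) lt′)) ⟩
            R ℕ.* (C ℕ.* (a ℕ.* suc (suc b)) ℕ.+ C ℕ.* (suc (suc a) ℕ.* b))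
              ≡⟨ ring₂ R C a b ⟩
            C ℕ.* (R ℕ.* (a ℕ.* suc (suc b) ℕ.+ suc (suc a) ℕ.* b))
              ≤⟨ ℕₚ.*-monoʳ-≤ C concave ⟩
            C ℕ.* (2 ℕ.* q ℕ.* (suc a ℕ.* suc b))
              ≡⟨ ring₃ K ((2 ℕ.* q) ℕ.^ s) (2 ℕ.* q) (suc a ℕ.* suc b) ⟩
            K ℕ.* (2 ℕ.* q ℕ.* (2 ℕ.* q) ℕ.^ s) ℕ.* (suc a ℕ.* suc b) ∎
            where
            open ℕₚ.≤-Reasoning
            M = m ℕ.∸ 1
            R = 4 ℕ.+ q
            R^ = R ℕ.^ s
            C = K ℕ.* (2 ℕ.* q) ℕ.^ s
            lt′ : r ℕ.+ s ℕ.< m ℕ.* (2 ℕ.* D ℕ.+ 1)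
            lt′ = ℕₚ.<-trans (ℕₚ.+-monoʳ-< r (ℕₚ.n<1+n s)) lt
            split : fold r (suc s) (+ suc a) ≡ fold r s (+ a) + fold r s (+ suc (suc a))
            split = trans (fold-A r s (+ suc a)) (cong (λ z → fold r s (+ a) + fold r s (+ z)) (ℕₚ.+-comm (suc a) 1))
            ring₁ : ∀ M x y R P → M ℕ.* (x ℕ.+ y) ℕ.* (R ℕ.* P) ≡ R ℕ.* (M ℕ.* x ℕ.* P ℕ.+ M ℕ.* y ℕ.* P)
            ring₁ = ℕS.solve-∀
            ring₂ : ∀ R C a b → R ℕ.* (C ℕ.* (a ℕ.* (2 ℕ.+ b)) ℕ.+ C ℕ.* ((2 ℕ.+ a) ℕ.* b)) ≡ C ℕ.* (R ℕ.* (a ℕ.* (2 ℕ.+ b) ℕ.+ (2 ℕ.+ a) ℕ.* b))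
            ring₂ = ℕS.solve-∀
            ring₃ : ∀ K P Q x → K ℕ.* P ℕ.* (Q ℕ.* x) ≡ K ℕ.* (Q ℕ.* P) ℕ.* x
            ring₃ = ℕS.solve-∀
            ring₄ : ∀ q a b → (4 ℕ.+ q) ℕ.* (a ℕ.* (2 ℕ.+ b) ℕ.+ (2 ℕ.+ a) ℕ.* b) ℕ.+ 2 ℕ.* (4 ℕ.+ q)
                              ≡ 2 ℕ.* q ℕ.* ((1 ℕ.+ a) ℕ.* (1 ℕ.+ b)) ℕ.+ 2 ℕ.* (4 ℕ.* ((1 ℕ.+ a) ℕ.* (1 ℕ.+ b)))
            ring₄ = ℕS.solve-∀
            -- The neighbours of the product ab add up to 2ab - 2, and since 4ab ≤ m² ≤ 4 + q, the
            -- loss 2 is at least the fraction 4/(4 + q) of 2ab. This is the decay per step.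
            concave : R ℕ.* (a ℕ.* suc (suc b) ℕ.+ suc (suc a) ℕ.* b) ℕ.≤ 2 ℕ.* q ℕ.* (suc a ℕ.* suc b)
            concave = ℕₚ.+-cancelʳ-≤ (2 ℕ.* R) _ _ (ℕₚ.≤-trans (ℕₚ.≤-reflexive (ring₄ q a b)) (ℕₚ.+-monoʳ-≤ _ (ℕₚ.*-monoʳ-≤ 2
                        (ℕₚ.≤-trans (4ab≤[a+b]² (suc a) (suc b)) (ℕₚ.≤-trans (ℕₚ.≤-reflexive (cong (λ z → z ℕ.* z) eq)) m²≤)))))

          fold-odd-bound : ∀ s a → a ℕ.≤ m → r ℕ.+ s ℕ.< m ℕ.* (2 ℕ.* D ℕ.+ 1) →
            ∣ fold r s (+ a) ∣ ℕ.* (4 ℕ.+ q) ℕ.^ s ℕ.≤ K ℕ.* (2 ℕ.* q) ℕ.^ s ℕ.* a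
          fold-odd-bound s zero    a≤m lt = ℕₚ.≤-trans (ℕₚ.≤-reflexive (cong (λ z → ∣ z ∣ ℕ.* (4 ℕ.+ q) ℕ.^ s) (fold-at-0 s))) z≤n
          fold-odd-bound s (suc a) a≤m lt with m ℕ.≟ 1
          -- For m = 1 the factor m - 1 cannot be cancelled, but then a = 1 is the end point m,
          -- where the fold vanishes.
          ... | yes refl = ℕₚ.≤-trans (ℕₚ.≤-reflexive (cong (λ z → ∣ z ∣ ℕ.* (4 ℕ.+ q) ℕ.^ s)
                  (trans (cong (λ k → fold r s (+ suc k)) (ℕₚ.n≤0⇒n≡0 (ℕₚ.≤-pred a≤m))) (fold-at-m s lt)))) z≤n
          ... | no m≢1 = ℕₚ.*-cancelˡ-≤ M {{ℕ.>-nonZero M>0}} (begin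
            M ℕ.* (x ℕ.* P)                                     ≡⟨ ℕₚ.*-assoc M x P ⟨
            M ℕ.* x ℕ.* P                                       ≤⟨ supersolution s (suc a) (m ℕ.∸ suc a) (ℕₚ.m+[n∸m]≡n a≤m) lt ⟩
            C ℕ.* (suc a ℕ.* (m ℕ.∸ suc a))                     ≤⟨ ℕₚ.*-monoʳ-≤ C (ℕₚ.*-monoʳ-≤ (suc a) (ℕₚ.∸-monoʳ-≤ m (s≤s z≤n))) ⟩
            C ℕ.* (suc a ℕ.* M)                                 ≡⟨ ring C (suc a) M ⟩
            M ℕ.* (C ℕ.* suc a)                                 ∎)
            where
            open ℕₚ.≤-Reasoning
            M = m ℕ.∸ 1
            x = ∣ fold r s (+ suc a) ∣
            P = (4 ℕ.+ q) ℕ.^ s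
            C = K ℕ.* (2 ℕ.* q) ℕ.^ s
            M>0 : 0 ℕ.< M
            M>0 = ℕₚ.m<n⇒0<n∸m (ℕₚ.≤∧≢⇒< m≥1 (λ e → m≢1 (sym e)))
            ring : ∀ C a M → C ℕ.* (a ℕ.* M) ≡ M ℕ.* (C ℕ.* a)
            ring = ℕS.solve-∀

          -- An even order is one difference of the odd order below it, so the odd bound at t - 1
          -- and t + 1 suffices; suc ∣ t ∣ ≤ m keeps both points in range.
          fold-even-bound : ∀ s t → suc ∣ t ∣ ℕ.≤ m → r ℕ.+ s ℕ.< m ℕ.* (2 ℕ.* D ℕ.+ 1) →
            ∣ fold (suc r) s t ∣ ℕ.* (4 ℕ.+ q) ℕ.^ s ℕ.≤ 3 ℕ.* 2 ℕ.^ suc r ℕ.* (2 ℕ.* q) ℕ.^ s ℕ.* suc ∣ t ∣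
          fold-even-bound s t t<m lt = begin
            ∣ fold (suc r) s t ∣ ℕ.* P                                      ≤⟨ ℕₚ.*-monoˡ-≤ P (ℕₚ.≤-trans (ℕₚ.≤-reflexive (cong ∣_∣ (fold-B r s t))) (ℤₚ.∣i-j∣≤∣i∣+∣j∣ (fold r s (t - 1ℤ)) (fold r s (t + 1ℤ)))) ⟩
            (∣ fold r s (t - 1ℤ) ∣ ℕ.+ ∣ fold r s (t + 1ℤ) ∣) ℕ.* P         ≡⟨ ℕₚ.*-distribʳ-+ P ∣ fold r s (t - 1ℤ) ∣ _ ⟩
            ∣ fold r s (t - 1ℤ) ∣ ℕ.* P ℕ.+ ∣ fold r s (t + 1ℤ) ∣ ℕ.* P     ≤⟨ ℕₚ.+-mono-≤ (bound (t - 1ℤ) (ℤₚ.∣i-j∣≤∣i∣+∣j∣ t 1ℤ)) (bound (t + 1ℤ) (ℤₚ.∣i+j∣≤∣i∣+∣j∣ t 1ℤ)) ⟩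
            C ℕ.* suc ∣ t ∣ ℕ.+ C ℕ.* suc ∣ t ∣                              ≡⟨ ring (2 ℕ.^ r) ((2 ℕ.* q) ℕ.^ s) (suc ∣ t ∣) ⟩
            3 ℕ.* 2 ℕ.^ suc r ℕ.* (2 ℕ.* q) ℕ.^ s ℕ.* suc ∣ t ∣              ∎
            where
            open ℕₚ.≤-Reasoning
            P = (4 ℕ.+ q) ℕ.^ s
            C = K ℕ.* (2 ℕ.* q) ℕ.^ s
            ring : ∀ x y z → 3 ℕ.* x ℕ.* y ℕ.* z ℕ.+ 3 ℕ.* x ℕ.* y ℕ.* z ≡ 3 ℕ.* (2 ℕ.* x) ℕ.* y ℕ.* z
            ring = ℕS.solve-∀
            abs-fold : ∀ u → ∣ fold r s u ∣ ≡ ∣ fold r s (+ ∣ u ∣) ∣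
            abs-fold (+ n)    = refl
            abs-fold -[1+ n ] = trans (cong ∣_∣ (trans (fold-parity r s (+ suc n)) (trans (cong (_* fold r s (+ suc n)) odd) (ℤₚ.-1*i≡-i (fold r s (+ suc n)))))) (ℤₚ.∣-i∣≡∣i∣ (fold r s (+ suc n)))
            bound : ∀ u → ∣ u ∣ ℕ.≤ ∣ t ∣ ℕ.+ 1 → ∣ fold r s u ∣ ℕ.* P ℕ.≤ C ℕ.* suc ∣ t ∣
            bound u le = ℕₚ.≤-trans (ℕₚ.≤-reflexive (cong (ℕ._* P) (abs-fold u)))
                        (ℕₚ.≤-trans (fold-odd-bound s ∣ u ∣ (ℕₚ.≤-trans le′ t<m) lt) (ℕₚ.*-monoʳ-≤ C le′))
              where
              le′ : ∣ u ∣ ℕ.≤ suc ∣ t ∣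
              le′ = ℕₚ.≤-trans le (ℕₚ.≤-reflexive (ℕₚ.+-comm ∣ t ∣ 1))

-- Finite differences, integral interpolation and the twelve-point rule

module Quadrature where

  open Sums
  open Coefficients
  open Krawtchouk using (rise)
  open import Data.Nat as ℕ using (ℕ; zero; suc; s≤s; z≤n; _!)
  import Data.Nat.Properties as ℕₚ
  open import Data.Integer as ℤ using (ℤ; +_; -[1+_]; _+_; _*_; _-_; -_; ∣_∣; 0ℤ; 1ℤ; -1ℤ; _^_)
  import Data.Integer.Properties as ℤₚ
  open import Data.Integer.Tactic.RingSolver using (solve-∀)
  import Data.Nat.Tactic.RingSolver as ℕS
  open import Data.List using (List; []; _∷_)
  open import Data.List.Relation.Unary.All using (All; []; _∷_; all?)
  open import Data.Product using (_×_; _,_; proj₁)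
  open import Data.Sum using (inj₁; inj₂)
  open import Data.Unit using (tt)
  open import Relation.Nullary using (Dec; yes; no)
  open import Relation.Nullary.Decidable using (toWitness)
  open import Relation.Binary.PropositionalEquality

  Δ : (ℕ → ℤ) → ℕ → ℤ
  Δ e j = e (suc j) - e j

  Δ^ : ℕ → (ℕ → ℤ) → ℕ → ℤ
  Δ^ zero    e = e
  Δ^ (suc k) e = Δ^ k (Δ e)

  Δ^-cong : ∀ k {e e′ : ℕ → ℤ} → (∀ j → e j ≡ e′ j) → ∀ j → Δ^ k e j ≡ Δ^ k e′ j
  Δ^-cong zero    eq = eq
  Δ^-cong (suc k) eq = Δ^-cong k (λ j → cong₂ _-_ (eq (suc j)) (eq j))

  Δ^-+ : ∀ k (e e′ : ℕ → ℤ) j → Δ^ k (λ i → e i + e′ i) j ≡ Δ^ k e j + Δ^ k e′ j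
  Δ^-+ zero    e e′ j = refl
  Δ^-+ (suc k) e e′ j = trans (Δ^-cong k (λ i → ring (e (suc i)) (e′ (suc i)) (e i) (e′ i)) j) (Δ^-+ k (Δ e) (Δ e′) j)
    where
    ring : ∀ a b c d → (a + b) - (c + d) ≡ (a - c) + (b - d)
    ring = solve-∀

  Δ^-* : ∀ k a (e : ℕ → ℤ) j → Δ^ k (λ i → a * e i) j ≡ a * Δ^ k e j
  Δ^-* zero    a e j = refl
  Δ^-* (suc k) a e j = trans (Δ^-cong k (λ i → ring a (e (suc i)) (e i)) j) (Δ^-* k a (Δ e) j)
    where
    ring : ∀ a x y → a * x - a * y ≡ a * (x - y)
    ring = solve-∀

  Δ^-suc : ∀ k (e : ℕ → ℤ) j → Δ^ (suc k) e j ≡ Δ^ k e (suc j) - Δ^ k e j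
  Δ^-suc zero    e j = refl
  Δ^-suc (suc k) e j = Δ^-suc k (Δ e) j

  Δ^-shift : ∀ k (e : ℕ → ℤ) j → Δ^ k (λ i → e (suc i)) j ≡ Δ^ k e (suc j)
  Δ^-shift zero    e j = refl
  Δ^-shift (suc k) e j = Δ^-shift k (Δ e) j

  rise-last : ∀ r s → rise (suc r) s ≡ rise r s ℕ.* (s ℕ.+ suc r)
  rise-last zero    s = ring s
    where
    ring : ∀ s → suc s ℕ.* 1 ≡ 1 ℕ.* (s ℕ.+ 1)
    ring = ℕS.solve-∀
  rise-last (suc r) s = trans (cong (suc s ℕ.*_) (rise-last r (suc s))) (ring s r (rise r (suc s)))
    where
    ring : ∀ s r p → suc s ℕ.* (p ℕ.* (suc s ℕ.+ suc r)) ≡ suc s ℕ.* p ℕ.* (s ℕ.+ suc (suc r))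
    ring = ℕS.solve-∀

  -- The hockey-stick identity, multiplied by factorials.
  ∑ᴺ-rise : ∀ K t → suc K ℕ.* ∑ᴺ (suc t) (rise K) ≡ rise (suc K) t
  ∑ᴺ-rise K zero = trans (ring K (rise K 0)) (sym (rise-last K 0))
    where
    ring : ∀ K x → suc K ℕ.* x ≡ x ℕ.* (0 ℕ.+ suc K)
    ring = ℕS.solve-∀
  ∑ᴺ-rise K (suc t) = begin
    suc K ℕ.* (∑ᴺ (suc t) (rise K) ℕ.+ rise K (suc t))            ≡⟨ ℕₚ.*-distribˡ-+ (suc K) (∑ᴺ (suc t) (rise K)) (rise K (suc t)) ⟩
    suc K ℕ.* ∑ᴺ (suc t) (rise K) ℕ.+ suc K ℕ.* rise K (suc t)    ≡⟨ cong (ℕ._+ suc K ℕ.* rise K (suc t)) (∑ᴺ-rise K t) ⟩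
    suc t ℕ.* rise K (suc t) ℕ.+ suc K ℕ.* rise K (suc t)         ≡⟨ ring t K (rise K (suc t)) ⟩
    rise K (suc t) ℕ.* (suc t ℕ.+ suc K)                          ≡⟨ rise-last K (suc t) ⟨
    rise (suc K) (suc t)                                          ∎
    where
    open ≡-Reasoning
    ring : ∀ t K p → suc t ℕ.* p ℕ.+ suc K ℕ.* p ≡ p ℕ.* (suc t ℕ.+ suc K)
    ring = ℕS.solve-∀

  ∑-Δ : ∀ t (e : ℕ → ℤ) → e t ≡ e 0 + ∑ t (Δ e)
  ∑-Δ zero    e = sym (ℤₚ.+-identityʳ (e 0))
  ∑-Δ (suc t) e = trans (ring (e (suc t)) (e t)) (trans (cong (_+ Δ e t) (∑-Δ t e)) (ℤₚ.+-assoc (e 0) (∑ t (Δ e)) (Δ e t)))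
    where
    ring : ∀ x y → x ≡ y + (x - y)
    ring = solve-∀

  -- A discrete Taylor remainder. Beyond its zeros e is a sum of values of `Δ e`, which has one zero
  -- less; the induction hypothesis bounds these, and the kernels `rise K v` add up by the
  -- hockey-stick identity.
  vanishing-bound : ∀ K (e : ℕ → ℤ) → (∀ j → j ℕ.≤ K → e j ≡ 0ℤ) → ∀ t →
    K ! ℕ.* ∣ e (K ℕ.+ suc t) ∣ ℕ.≤ rise K t ℕ.* ∑ᴺ (suc t) (λ v → ∣ Δ^ (suc K) e v ∣)
  vanishing-bound zero e e≡0 t = ℕₚ.≤-trans (ℕₚ.≤-reflexive (ℕₚ.+-identityʳ _)) (ℕₚ.≤-trans (begin
    ∣ e (suc t) ∣                    ≡⟨ cong ∣_∣ (trans (∑-Δ (suc t) e) (cong (_+ ∑ (suc t) (Δ e)) (e≡0 0 z≤n))) ⟩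
    ∣ 0ℤ + ∑ (suc t) (Δ e) ∣         ≡⟨ cong ∣_∣ (ℤₚ.+-identityˡ (∑ (suc t) (Δ e))) ⟩
    ∣ ∑ (suc t) (Δ e) ∣              ≤⟨ ∑-abs (suc t) (Δ e) ⟩
    ∑ᴺ (suc t) (λ v → ∣ Δ e v ∣)     ∎) (ℕₚ.≤-reflexive (sym (ℕₚ.+-identityʳ _))))
    where open ℕₚ.≤-Reasoning
  vanishing-bound (suc K) e e≡0 t = begin
    suc K ! ℕ.* ∣ e (suc K ℕ.+ suc t) ∣
      ≡⟨ cong (λ z → suc K ! ℕ.* ∣ z ∣) expand ⟩
    suc K ! ℕ.* ∣ ∑ (suc t) (λ v → Δ e (K ℕ.+ suc v)) ∣
      ≤⟨ ℕₚ.*-monoʳ-≤ (suc K !) (∑-abs (suc t) (λ v → Δ e (K ℕ.+ suc v))) ⟩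
    suc K ! ℕ.* ∑ᴺ (suc t) (λ v → ∣ Δ e (K ℕ.+ suc v) ∣)
      ≡⟨ trans (ℕₚ.*-assoc (suc K) (K !) _) (cong (suc K ℕ.*_) (sym (∑ᴺ-* (suc t) (K !) (λ v → ∣ Δ e (K ℕ.+ suc v) ∣)))) ⟩
    suc K ℕ.* ∑ᴺ (suc t) (λ v → K ! ℕ.* ∣ Δ e (K ℕ.+ suc v) ∣)
      ≤⟨ ℕₚ.*-monoʳ-≤ (suc K) (∑ᴺ-mono< (suc t) (λ v v<t → ℕₚ.≤-trans (vanishing-bound K (Δ e) Δe≡0 v)
           (ℕₚ.≤-trans (ℕₚ.*-monoʳ-≤ (rise K v) (∑ᴺ-extend (λ v → ∣ Δ^ (suc (suc K)) e v ∣) v<t)) (ℕₚ.≤-reflexive (ℕₚ.*-comm (rise K v) S))))) ⟩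
    suc K ℕ.* ∑ᴺ (suc t) (λ v → S ℕ.* rise K v)
      ≡⟨ cong (suc K ℕ.*_) (∑ᴺ-* (suc t) S (rise K)) ⟩
    suc K ℕ.* (S ℕ.* ∑ᴺ (suc t) (rise K))
      ≡⟨ ring (suc K) S (∑ᴺ (suc t) (rise K)) ⟩
    suc K ℕ.* ∑ᴺ (suc t) (rise K) ℕ.* S
      ≡⟨ cong (ℕ._* S) (∑ᴺ-rise K t) ⟩
    rise (suc K) t ℕ.* S ∎
    where
    open ℕₚ.≤-Reasoning
    S = ∑ᴺ (suc t) (λ v → ∣ Δ^ (suc (suc K)) e v ∣)
    ring : ∀ K S R → K ℕ.* (S ℕ.* R) ≡ K ℕ.* R ℕ.* S
    ring = ℕS.solve-∀
    Δe≡0 : ∀ j → j ℕ.≤ K → Δ e j ≡ 0ℤ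
    Δe≡0 j j≤K = cong₂ _-_ (e≡0 (suc j) (s≤s j≤K)) (e≡0 j (ℕₚ.m≤n⇒m≤1+n j≤K))
    expand : e (suc K ℕ.+ suc t) ≡ ∑ (suc t) (λ v → Δ e (K ℕ.+ suc v))
    expand = trans (∑-Δ (suc t) (λ v → e (suc K ℕ.+ v)))
      (trans (cong₂ _+_ (trans (cong e (ℕₚ.+-identityʳ (suc K))) (e≡0 (suc K) ℕₚ.≤-refl))
                        (∑-cong (suc t) (λ v → cong₂ (λ x y → e x - e y) refl (sym (ℕₚ.+-suc K v)))))
             (ℤₚ.+-identityˡ _))

  -- The sequence is a polynomial of degree below k. It is a record because k and e cannot be
  -- recovered from the computed term `Δ^ k e j`.
  record Kill (k : ℕ) (e : ℕ → ℤ) : Set where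
    constructor killed
    field
      vanishes : ∀ j → Δ^ k e j ≡ 0ℤ

  open Kill

  kill-cong : ∀ {k} {e e′ : ℕ → ℤ} → (∀ j → e j ≡ e′ j) → Kill k e′ → Kill k e
  kill-cong {k} eq K .vanishes j = trans (Δ^-cong k eq j) (K .vanishes j)

  kill-suc : ∀ {k e} → Kill k e → Kill (suc k) e
  kill-suc {k} {e} K .vanishes j = trans (Δ^-suc k e j) (cong₂ _-_ (K .vanishes (suc j)) (K .vanishes j))

  kill-≤ : ∀ {k l e} → k ℕ.≤ l → Kill k e → Kill l e
  kill-≤ {k} {l} {e} k≤l K = subst (λ n → Kill n e) (ℕₚ.m∸n+n≡m k≤l) (go (l ℕ.∸ k))
    where
    go : ∀ i → Kill (i ℕ.+ k) e
    go zero    = K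
    go (suc i) = kill-suc (go i)

  kill-+ : ∀ {k} {e e′ : ℕ → ℤ} → Kill k e → Kill k e′ → Kill k (λ i → e i + e′ i)
  kill-+ {k} {e} {e′} K K′ .vanishes j = trans (Δ^-+ k e e′ j) (cong₂ _+_ (K .vanishes j) (K′ .vanishes j))

  kill-* : ∀ {k} a {e : ℕ → ℤ} → Kill k e → Kill k (λ i → a * e i)
  kill-* {k} a {e} K .vanishes j = trans (Δ^-* k a e j) (trans (cong (a *_) (K .vanishes j)) (ℤₚ.*-zeroʳ a))

  kill-0 : ∀ k → Kill k (λ _ → 0ℤ)
  kill-0 zero    .vanishes j = refl
  kill-0 (suc k) .vanishes j = kill-0 k .vanishes j

  kill-const : ∀ a → Kill 1 (λ _ → a)
  kill-const a .vanishes j = ℤₚ.+-inverseʳ a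

  kill-Δ : ∀ {k e} → Kill k (Δ e) → Kill (suc k) e
  kill-Δ K .vanishes = K .vanishes

  -- The product rule: the difference of (a + bi) e(i) is (a + bi) Δe(i) + b e(i + 1), and both
  -- terms fall under a smaller order.
  kill-affine : ∀ k a b {e : ℕ → ℤ} → Kill k e → Kill (suc k) (λ i → (a + b * + i) * e i)
  kill-affine zero    a b {e} K .vanishes j =
    cong₂ _-_ (trans (cong ((a + b * + suc j) *_) (K .vanishes (suc j))) (ℤₚ.*-zeroʳ (a + b * + suc j)))
              (trans (cong ((a + b * + j) *_) (K .vanishes j)) (ℤₚ.*-zeroʳ (a + b * + j)))
  kill-affine (suc k) a b {e} K = kill-Δ (kill-cong (λ i → ring a b (+ i) (e i) (e (suc i)))
    (kill-+ (kill-affine k a b {Δ e} (killed (K .vanishes)))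
            (kill-* b (killed (λ j → trans (Δ^-shift (suc k) e j) (K .vanishes (suc j)))))))
    where
    ring : ∀ a b i x y → (a + b * (1ℤ + i)) * y - (a + b * i) * x ≡ (a + b * i) * (y - x) + b * y
    ring = solve-∀

  kill-power : ∀ k a b → Kill (suc k) (λ i → (a + b * + i) ^ k)
  kill-power zero    a b = kill-const 1ℤ
  kill-power (suc k) a b = kill-affine (suc k) a b {λ i → (a + b * + i) ^ k} (kill-power k a b)

  kill-∑ : ∀ {k} {e : ℕ → ℤ} → Kill k e → Kill (suc k) (λ d → ∑ d e)
  kill-∑ {k} {e} K = kill-Δ (kill-cong (λ d → ring (∑ d e) (e d)) K)
    where
    ring : ∀ s x → s + x - s ≡ x
    ring = solve-∀

  m*n≤0⇒n≡0 : ∀ m n .{{_ : ℕ.NonZero m}} → m ℕ.* n ℕ.≤ 0 → n ≡ 0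
  m*n≤0⇒n≡0 m n le = ℕₚ.n≤0⇒n≡0 (ℕₚ.*-cancelˡ-≤ m (ℕₚ.≤-trans le (ℕₚ.≤-reflexive (sym (ℕₚ.*-zeroʳ m)))))

  -- A polynomial with more zeros than its degree; here the Taylor remainder of `vanishing-bound` is
  -- zero.
  kill-unique : ∀ K {e} → Kill (suc K) e → (∀ j → j ℕ.≤ K → e j ≡ 0ℤ) → ∀ j → e j ≡ 0ℤ
  kill-unique K {e} killed-e e≡0 j with j ℕ.≤? K
  ... | yes j≤K = e≡0 j j≤K
  ... | no  j≰K = subst (λ z → e z ≡ 0ℤ) j≡ (ℤₚ.∣i∣≡0⇒i≡0 (m*n≤0⇒n≡0 (K !) _ {{K ℕₚ.!≢0}} bound))
    where
    t = j ℕ.∸ suc K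
    j≡ : K ℕ.+ suc t ≡ j
    j≡ = trans (ℕₚ.+-suc K t) (ℕₚ.m+[n∸m]≡n (ℕₚ.≰⇒> j≰K))
    bound : K ! ℕ.* ∣ e (K ℕ.+ suc t) ∣ ℕ.≤ 0
    bound = ℕₚ.≤-trans (vanishing-bound K e e≡0 t) (ℕₚ.≤-reflexive (trans (cong (rise K t ℕ.*_)
      (trans (∑ᴺ-cong (suc t) {g = λ _ → 0} (λ v → cong ∣_∣ (killed-e .vanishes v))) (∑ᴺ-0 (suc t)))) (ℕₚ.*-zeroʳ (rise K t))))

  -- Polynomial functions of degree below k as a leading term plus a remainder. In contrast to
  -- `Kill` this speaks of all of ℤ, so that nodes to the left and the reflected index 11 - j are
  -- covered; `poly-kill` restricts it to any arithmetic progression.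
  data Poly : ℕ → (ℤ → ℤ) → Set where
    zeroP : ∀ {p} → (∀ x → p x ≡ 0ℤ) → Poly 0 p
    sucP  : ∀ {k p g} c → Poly k g → (∀ x → p x ≡ c * x ^ k + g x) → Poly (suc k) p

  poly-kill : ∀ {k p} → Poly k p → ∀ a b → Kill k (λ i → p (a + b * + i))
  poly-kill (zeroP eq) a b .vanishes j = eq _
  poly-kill (sucP {k} {p} {g} c P eq) a b = kill-cong (λ i → eq (a + b * + i))
    (kill-+ (kill-* c (kill-power k a b)) (kill-suc (poly-kill P a b)))

  poly-lift : ∀ {k p} → Poly k p → Poly (suc k) p
  poly-lift {k} {p} P = sucP 0ℤ P (λ x → ring (x ^ k) (p x))
    where
    ring : ∀ y z → z ≡ 0ℤ * y + z
    ring = solve-∀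

  poly-x* : ∀ {k p} → Poly k p → Poly (suc k) (λ x → x * p x)
  poly-x* (zeroP eq) = poly-lift (zeroP (λ x → trans (cong (x *_) (eq x)) (ℤₚ.*-zeroʳ x)))
  poly-x* (sucP {k} {p} {g} c P eq) = sucP c (poly-x* P) (λ x → trans (cong (x *_) (eq x)) (ring x c (x ^ k) (g x)))
    where
    ring : ∀ x c y z → x * (c * y + z) ≡ c * (x * y) + x * z
    ring = solve-∀

  poly-* : ∀ {k p} a → Poly k p → Poly k (λ x → a * p x)
  poly-* a (zeroP eq) = zeroP (λ x → trans (cong (a *_) (eq x)) (ℤₚ.*-zeroʳ a))
  poly-* a (sucP {k} {p} {g} c P eq) = sucP (a * c) (poly-* a P) (λ x → trans (cong (a *_) (eq x)) (ring a c (x ^ k) (g x)))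
    where
    ring : ∀ a c y z → a * (c * y + z) ≡ a * c * y + a * z
    ring = solve-∀

  poly-+ : ∀ {k p p′} → Poly k p → Poly k p′ → Poly k (λ x → p x + p′ x)
  poly-+ (zeroP eq) (zeroP eq′) = zeroP (λ x → cong₂ _+_ (eq x) (eq′ x))
  poly-+ (sucP {k} {p} {g} c P eq) (sucP {g = g′} c′ P′ eq′) =
    sucP (c + c′) (poly-+ P P′) (λ x → trans (cong₂ _+_ (eq x) (eq′ x)) (ring c c′ (x ^ k) (g x) (g′ x)))
    where
    ring : ∀ c c′ y z z′ → c * y + z + (c′ * y + z′) ≡ (c + c′) * y + (z + z′)
    ring = solve-∀

  nodes : ℕ → ℤ → ℤ
  nodes zero    x = 1ℤ
  nodes (suc k) x = (x - + k) * nodes k x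

  poly-cong : ∀ {k p p′} → (∀ x → p′ x ≡ p x) → Poly k p → Poly k p′
  poly-cong e (zeroP eq)    = zeroP (λ x → trans (e x) (eq x))
  poly-cong e (sucP c P eq) = sucP c P (λ x → trans (e x) (eq x))

  nodes-poly : ∀ k → Poly (suc k) (nodes k)
  nodes-poly zero    = sucP 1ℤ (zeroP {λ _ → 0ℤ} (λ _ → refl)) (λ _ → refl)
  nodes-poly (suc k) = poly-cong (λ x → ring x (+ k) (nodes k x)) (poly-+ (poly-x* (nodes-poly k)) (poly-lift (poly-* (- + k) (nodes-poly k))))
    where
    ring : ∀ x k y → (x - k) * y ≡ x * y + - k * y
    ring = solve-∀

  nodes-zero : ∀ k j → j ℕ.< k → nodes k (+ j) ≡ 0ℤ
  nodes-zero (suc k) j j<1+k with ℕₚ.m≤n⇒m<n∨m≡n (ℕₚ.≤-pred j<1+k)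
  ... | inj₁ j<k  = trans (cong ((+ j - + k) *_) (nodes-zero k j j<k)) (ℤₚ.*-zeroʳ (+ j - + k))
  ... | inj₂ refl = trans (cong (_* nodes j (+ j)) (ℤₚ.+-inverseʳ (+ j))) (ℤₚ.*-zeroˡ (nodes j (+ j)))

  nodes-nonZero : ∀ k j → k ℕ.≤ j → ℤ.NonZero (nodes k (+ j))
  nodes-nonZero zero    j k≤j = _
  nodes-nonZero (suc k) j k<j = ℤₚ.i*j≢0 (+ j - + k) (nodes k (+ j))
    {{ℤ.≢-nonZero (λ e → ℕₚ.<⇒≢ k<j (sym (ℤₚ.+-injective (ℤₚ.i-j≡0⇒i≡j (+ j) (+ k) e))))}}
    {{nodes-nonZero k j (ℕₚ.<⇒≤ k<j)}}

  -- Interpolation at 0, ..., k - 1 without fractions: f is multiplied by a nonzero integer instead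
  -- of dividing coefficients. The factor is cancelled once the panel has been bounded.
  record Interpolant (k : ℕ) (f : ℕ → ℤ) : Set where
    field
      scale    : ℤ
      nonZero  : ℤ.NonZero scale
      q        : ℤ → ℤ
      poly     : Poly k q
      agrees   : ∀ j → j ℕ.< k → scale * f j ≡ q (+ j)

  abstract
    interpolate : ∀ k f → Interpolant k f
    interpolate zero    f = record { scale = 1ℤ ; nonZero = _ ; q = λ _ → 0ℤ ; poly = zeroP (λ _ → refl) ; agrees = λ j () }
    interpolate (suc k) f = record
      { scale   = ν * scale
      ; nonZero = ℤₚ.i*j≢0 ν scale {{nodes-nonZero k k ℕₚ.≤-refl}} {{nonZero}}
      ; q       = λ x → ν * q x + (scale * f k - q (+ k)) * nodes k x
      ; poly    = poly-+ (poly-lift (poly-* ν poly)) (poly-* (scale * f k - q (+ k)) (nodes-poly k))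
      ; agrees  = agrees′
      }
      where
      open Interpolant (interpolate k f)
      ν : ℤ
      ν = nodes k (+ k)
      ring₁ : ∀ ν s x y → ν * s * x ≡ ν * (s * x) + y * 0ℤ
      ring₁ = solve-∀
      ring₂ : ∀ ν s x y → ν * s * x ≡ ν * y + (s * x - y) * ν
      ring₂ = solve-∀
      agrees′ : ∀ j → j ℕ.< suc k → ν * scale * f j ≡ ν * q (+ j) + (scale * f k - q (+ k)) * nodes k (+ j)
      agrees′ j j<1+k with ℕₚ.m≤n⇒m<n∨m≡n (ℕₚ.≤-pred j<1+k)
      ... | inj₁ j<k  = trans (ring₁ ν scale (f j) (scale * f k - q (+ k)))
                              (cong₂ (λ x y → ν * x + (scale * f k - q (+ k)) * y) (agrees j j<k) (sym (nodes-zero k j j<k)))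
      ... | inj₂ refl = ring₂ ν scale (f j) (q (+ j))

  -- Linear functionals given by a finite list of (node , weight) pairs.

  lin : List (ℤ × ℤ) → (ℤ → ℤ) → ℤ
  lin []            X = 0ℤ
  lin ((s , w) ∷ l) X = w * X s + lin l X

  lin-cong : ∀ l {X Y : ℤ → ℤ} → (∀ s → X s ≡ Y s) → lin l X ≡ lin l Y
  lin-cong []            e = refl
  lin-cong ((s , w) ∷ l) e = cong₂ _+_ (cong (w *_) (e s)) (lin-cong l e)

  lin-+ : ∀ l (X Y : ℤ → ℤ) → lin l (λ s → X s + Y s) ≡ lin l X + lin l Y
  lin-+ []            X Y = refl
  lin-+ ((s , w) ∷ l) X Y = trans (cong (λ z → w * (X s + Y s) + z) (lin-+ l X Y)) (ring w (X s) (Y s) (lin l X) (lin l Y))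
    where
    ring : ∀ w x y a b → w * (x + y) + (a + b) ≡ w * x + a + (w * y + b)
    ring = solve-∀

  lin-* : ∀ l c (X : ℤ → ℤ) → lin l (λ s → c * X s) ≡ c * lin l X
  lin-* []            c X = sym (ℤₚ.*-zeroʳ c)
  lin-* ((s , w) ∷ l) c X = trans (cong (λ z → w * (c * X s) + z) (lin-* l c X)) (ring w c (X s) (lin l X))
    where
    ring : ∀ w c x a → w * (c * x) + c * a ≡ c * (w * x + a)
    ring = solve-∀

  lin-∑ : ∀ l n (X : ℕ → ℤ → ℤ) → lin l (λ s → ∑ n (λ i → X i s)) ≡ ∑ n (λ i → lin l (X i))
  lin-∑ l zero    X = trans (lin-cong l (λ _ → refl)) (lin-0 l)
    where
    lin-0 : ∀ l → lin l (λ _ → 0ℤ) ≡ 0ℤ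
    lin-0 []            = refl
    lin-0 ((s , w) ∷ l) = trans (cong₂ _+_ (ℤₚ.*-zeroʳ w) (lin-0 l)) refl
  lin-∑ l (suc n) X = trans (lin-+ l (λ s → ∑ n (λ i → X i s)) (X n)) (cong (_+ lin l (X n)) (lin-∑ l n X))

  linᴺ : List (ℤ × ℤ) → (ℤ → ℕ) → ℕ
  linᴺ []            b = 0
  linᴺ ((s , w) ∷ l) b = ∣ w ∣ ℕ.* b s ℕ.+ linᴺ l b

  lin-abs : ∀ l (Ok : ℤ → Set) → All (λ sw → Ok (proj₁ sw)) l → ∀ a (X : ℤ → ℤ) (b : ℤ → ℕ) →
            (∀ s → Ok s → a ℕ.* ∣ X s ∣ ℕ.≤ b s) → a ℕ.* ∣ lin l X ∣ ℕ.≤ linᴺ l b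
  lin-abs []            Ok []       a X b h = ℕₚ.≤-reflexive (ℕₚ.*-zeroʳ a)
  lin-abs ((s , w) ∷ l) Ok (o ∷ os) a X b h = begin
    a ℕ.* ∣ w * X s + lin l X ∣                                   ≤⟨ ℕₚ.*-monoʳ-≤ a (ℤₚ.∣i+j∣≤∣i∣+∣j∣ (w * X s) (lin l X)) ⟩
    a ℕ.* (∣ w * X s ∣ ℕ.+ ∣ lin l X ∣)                           ≡⟨ cong (λ z → a ℕ.* (z ℕ.+ ∣ lin l X ∣)) (ℤₚ.∣i*j∣≡∣i∣*∣j∣ w (X s)) ⟩
    a ℕ.* (∣ w ∣ ℕ.* ∣ X s ∣ ℕ.+ ∣ lin l X ∣)                     ≡⟨ ring a (∣ w ∣) (∣ X s ∣) (∣ lin l X ∣) ⟩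
    ∣ w ∣ ℕ.* (a ℕ.* ∣ X s ∣) ℕ.+ a ℕ.* ∣ lin l X ∣               ≤⟨ ℕₚ.+-mono-≤ (ℕₚ.*-monoʳ-≤ ∣ w ∣ (h s o)) (lin-abs l Ok os a X b h) ⟩
    ∣ w ∣ ℕ.* b s ℕ.+ linᴺ l b                                    ∎
    where
    open ℕₚ.≤-Reasoning
    ring : ∀ a w x y → a ℕ.* (w ℕ.* x ℕ.+ y) ≡ w ℕ.* (a ℕ.* x) ℕ.+ a ℕ.* y
    ring = ℕS.solve-∀

  kill-lin : ∀ l k (X : ℕ → ℤ → ℤ) → (∀ s → Kill k (λ i → X i s)) → Kill k (λ i → lin l (X i))
  kill-lin []            k X K = kill-0 k
  kill-lin ((s , w) ∷ l) k X K = kill-+ (kill-* w (K s)) (kill-lin l k X K)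

  ^-distrib-* : ∀ k a b → (a ℕ.* b) ℕ.^ k ≡ a ℕ.^ k ℕ.* b ℕ.^ k
  ^-distrib-* zero    a b = refl
  ^-distrib-* (suc k) a b = trans (cong (a ℕ.* b ℕ.*_) (^-distrib-* k a b)) (ring a b (a ℕ.^ k) (b ℕ.^ k))
    where
    ring : ∀ a b x y → a ℕ.* b ℕ.* (x ℕ.* y) ≡ a ℕ.* x ℕ.* (b ℕ.* y)
    ring = ℕS.solve-∀

  -- Sealed, lest the type checker unfold them.
  abstract
    pow : ℕ → ℕ → ℕ
    pow k x = x ℕ.^ k

    pow≡^ : ∀ k x → pow k x ≡ x ℕ.^ k
    pow≡^ k x = refl

    fact : ℕ → ℕ
    fact k = k !

    fact≡! : ∀ k → fact k ≡ k !
    fact≡! k = refl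

    pow-mono : ∀ k {a b} → a ℕ.≤ b → pow k a ℕ.≤ pow k b
    pow-mono k le = ℕₚ.^-monoˡ-≤ k le

    pow-suc : ∀ k x → pow (suc k) x ≡ x ℕ.* pow k x
    pow-suc k x = refl

    pow-* : ∀ k a b → pow k (a ℕ.* b) ≡ pow k a ℕ.* pow k b
    pow-* = ^-distrib-*

  Ok : ℤ → Set
  Ok (+ a)    = a ℕ.≤ 6
  Ok -[1+ a ] = a ℕ.≤ 4

  -- Nodes beyond the panel, on the right and on the left, and nodes of the unit steps.
  cʳ cˡ cᵘ : ℤ → ℕ
  cʳ (+ a)    = pow 11 a
  cʳ -[1+ a ] = 0
  cˡ (+ a)    = 0
  cˡ -[1+ a ] = pow 11 (suc a)
  cᵘ (+ a)    = pow 11 (a ℕ.⊔ 2)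
  cᵘ -[1+ a ] = pow 11 2

  ok? : ∀ s → Dec (Ok s)
  ok? (+ a)    = a ℕ.≤? 6
  ok? -[1+ a ] = a ℕ.≤? 4

  mirror : List (ℕ × ℤ) → List (ℤ × ℤ)
  mirror []            = []
  mirror ((a , w) ∷ l) = (- + a , w) ∷ (+ suc a , w) ∷ mirror l

  lin-mirror : ∀ l (X : ℤ → ℤ) → lin (mirror l) (λ s → X (1ℤ - s)) ≡ lin (mirror l) X
  lin-mirror []            X = refl
  lin-mirror ((a , w) ∷ l) X = trans
    (cong₂ (λ x y → w * X x + (w * X y + lin (mirror l) (λ s → X (1ℤ - s)))) (ring₁ (+ a)) (ring₂ (+ a)))
    (trans (cong (λ z → w * X (+ suc a) + (w * X (- + a) + z)) (lin-mirror l X)) (ring₃ (w * X (+ suc a)) (w * X (- + a)) (lin (mirror l) X)))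
    where
    ring₁ : ∀ a → 1ℤ - - a ≡ 1ℤ + a
    ring₁ = solve-∀
    ring₂ : ∀ a → 1ℤ - (1ℤ + a) ≡ - a
    ring₂ = solve-∀
    ring₃ : ∀ x y z → x + (y + z) ≡ y + (x + z)
    ring₃ = solve-∀

  -- The twelve-point rule for ∫₀¹, exact in degree below 12, with common denominator 958003200.
  abstract
    μ c₁ c₂ c₃ : ℕ
    μ = 2280960
    c₁ = 8448 ℕ.* μ
    c₂ = 384
    c₃ = 40500

    μ-value : μ ≡ 2280960
    μ-value = refl

    c₁-value : c₁ ≡ 19269550080
    c₁-value = refl

    c₂-value : c₂ ≡ 384
    c₂-value = refl

    c₃-value : c₃ ≡ 40500
    c₃-value = refl

    c₁≡ : + c₁ ≡ + 8448 * + μ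
    c₁≡ = refl

    c₂≡ : + c₂ ≡ + 24 * + 16
    c₂≡ = refl

    c₃≡ : 30 ℕ.* 3 ℕ.* 450 ≡ c₃
    c₃≡ = refl

    half : List (ℕ × ℤ)
    half = (0 , + 548839986) ∷ (1 , - + 91373082) ∷ (2 , + 27022635) ∷ (3 , - + 6409423) ∷ (4 , + 995469) ∷ (5 , - + 73985) ∷ []

    ωs : List (ℤ × ℤ)
    ωs = mirror half

    ωs-ok : All (λ sw → Ok (proj₁ sw)) ωs
    ωs-ok = toWitness {a? = all? (λ sw → ok? (proj₁ sw)) ωs} tt

    ωs-sym : ∀ (X : ℤ → ℤ) → lin ωs (λ s → X (1ℤ - s)) ≡ lin ωs X
    ωs-sym = lin-mirror half

    ωs-norm : linᴺ ωs (λ _ → 1) ≡ 1349429160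
    ωs-norm = refl

    ωs-right : linᴺ ωs (λ s → pow 11 2 ℕ.* cʳ s ℕ.+ cᵘ s) ≡ 219872813022816738
    ωs-right = refl

    ωs-left : linᴺ ωs (λ s → pow 11 2 ℕ.* cˡ s) ≡ 18388361671565312
    ωs-left = refl

    -- The integrals over [0, 1] of the powers 0 to 3 of s(s - 1) are 1, -1/6, 1/30 and -1/140.
    -- Their common denominator is 420, and 420 μ = 958003200 is the total weight.
    ωs-moment₀ : lin ωs (λ _ → 1ℤ) ≡ + 420 * + μ
    ωs-moment₀ = refl

    ωs-moment₁ : lin ωs (λ s → s * (s - 1ℤ)) ≡ - + 70 * + μ
    ωs-moment₁ = refl

    ωs-moment₂ : lin ωs (λ s → s * (s - 1ℤ) * (s * (s - 1ℤ))) ≡ + 14 * + μ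
    ωs-moment₂ = refl

    ωs-moment₃ : lin ωs (λ s → s * (s - 1ℤ) * (s * (s - 1ℤ)) * (s * (s - 1ℤ))) ≡ - + 3 * + μ
    ωs-moment₃ = refl

  -- The rule with step d on one panel against the sum of the rules with step 1 on its d parts.
  panel : (ℤ → ℤ) → ℕ → ℤ
  panel p d = + d * lin ωs (λ s → p (+ 5 + s * + d)) - ∑ d (λ v → lin ωs (λ s → p (+ 5 + s + + v)))

  panel-cong : ∀ {p p′ : ℤ → ℤ} → (∀ x → p x ≡ p′ x) → ∀ d → panel p d ≡ panel p′ d
  panel-cong e d = cong₂ (λ x y → + d * x - y) (lin-cong ωs (λ s → e _)) (∑-cong d (λ v → lin-cong ωs (λ s → e _)))

  panel-+ : ∀ p p′ d → panel (λ x → p x + p′ x) d ≡ panel p d + panel p′ d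
  panel-+ p p′ d = trans (cong₂ (λ x y → + d * x - y)
      (lin-+ ωs (λ s → p (+ 5 + s * + d)) (λ s → p′ (+ 5 + s * + d)))
      (trans (∑-cong d (λ v → lin-+ ωs (λ s → p (+ 5 + s + + v)) (λ s → p′ (+ 5 + s + + v))))
             (∑-+ d (λ v → lin ωs (λ s → p (+ 5 + s + + v))) (λ v → lin ωs (λ s → p′ (+ 5 + s + + v))))))
    (ring (+ d) (lin ωs (λ s → p (+ 5 + s * + d))) (lin ωs (λ s → p′ (+ 5 + s * + d))) _ _)
    where
    ring : ∀ d a b x y → d * (a + b) - (x + y) ≡ d * a - x + (d * b - y)
    ring = solve-∀

  panel-* : ∀ c p d → panel (λ x → c * p x) d ≡ c * panel p d
  panel-* c p d = trans (cong₂ (λ x y → + d * x - y)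
      (lin-* ωs c (λ s → p (+ 5 + s * + d)))
      (trans (∑-cong d (λ v → lin-* ωs c (λ s → p (+ 5 + s + + v)))) (∑-* d c (λ v → lin ωs (λ s → p (+ 5 + s + + v))))))
    (ring (+ d) c (lin ωs (λ s → p (+ 5 + s * + d))) _)
    where
    ring : ∀ d c a x → d * (c * a) - c * x ≡ c * (d * a - x)
    ring = solve-∀

  -- For x^i the wide rule is d times a polynomial of degree i in d, and summing the unit rules over
  -- v < d also raises the degree by one. Hence the panel is a polynomial of degree at most i + 1 in
  -- the step d.
  panel-kill : ∀ i → Kill (suc (suc i)) (panel (_^ i))
  panel-kill i = kill-+ K₁ (kill-cong (λ d → sym (ℤₚ.-1*i≡-i _)) (kill-* -1ℤ K₂))
    where
    ring : ∀ d → d ≡ 0ℤ + 1ℤ * d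
    ring = solve-∀
    K₁ : Kill (suc (suc i)) (λ d → + d * lin ωs (λ s → (+ 5 + s * + d) ^ i))
    K₁ = kill-cong (λ d → cong (_* lin ωs (λ s → (+ 5 + s * + d) ^ i)) (ring (+ d)))
           (kill-affine (suc i) 0ℤ 1ℤ (kill-lin ωs (suc i) (λ d s → (+ 5 + s * + d) ^ i) (λ s → kill-power i (+ 5) s)))
    K₂ : Kill (suc (suc i)) (λ d → ∑ d (λ v → lin ωs (λ s → (+ 5 + s + + v) ^ i)))
    K₂ = kill-∑ (kill-lin ωs (suc i) (λ v s → (+ 5 + s + + v) ^ i)
           (λ s → kill-cong (λ v → cong (λ z → (+ 5 + s + z) ^ i) (sym (ℤₚ.*-identityˡ (+ v)))) (kill-power i (+ 5 + s) 1ℤ)))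

  abstract
    panel-monomial-check : ∀ {i} → i ℕ.< 12 → ∀ {d} → d ℕ.< 13 → panel (_^ i) d ≡ 0ℤ
    panel-monomial-check = toWitness {a? = ℕₚ.allUpTo? (λ i → ℕₚ.allUpTo? (λ d → panel (_^ i) d ℤₚ.≟ 0ℤ) 13) 12} tt

  -- Both sides are polynomials of degree at most 12 in d, so finitely many values decide.
  panel-monomial : ∀ i → i ℕ.< 12 → ∀ d → panel (_^ i) d ≡ 0ℤ
  panel-monomial i i<12 = kill-unique 12 (kill-≤ (s≤s i<12) (panel-kill i)) (λ j j≤12 → panel-monomial-check i<12 (s≤s j≤12))

  panel-poly : ∀ {k p} → Poly k p → k ℕ.≤ 12 → ∀ d → panel p d ≡ 0ℤ
  panel-poly {p = p} (zeroP eq) k≤12 d = trans (panel-cong (λ x → trans (eq x) (sym (ℤₚ.*-zeroˡ (p x)))) d)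
    (trans (panel-* 0ℤ p d) (ℤₚ.*-zeroˡ (panel p d)))
  panel-poly (sucP {k} {p} {g} c P eq) k<12 d = trans (panel-cong eq d) (trans (panel-+ (λ x → c * x ^ k) g d)
    (cong₂ _+_ (trans (panel-* c (_^ k) d) (trans (cong (c *_) (panel-monomial k k<12 d)) (ℤₚ.*-zeroʳ c))) (panel-poly P (ℕₚ.<⇒≤ k<12) d)))

-- The error of one panel in terms of twelfth differences

module PanelBound where

  open Sums
  open Coefficients
  open Krawtchouk using (rise)
  open Quadrature
  open import Data.Nat as ℕ using (ℕ; zero; suc; s≤s; z≤n; _!)
  import Data.Nat.Properties as ℕₚ
  open import Data.Integer using (ℤ; +_; -[1+_]; _+_; _*_; _-_; -_; ∣_∣; 0ℤ; 1ℤ; -1ℤ; _^_)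
  import Data.Integer.Properties as ℤₚ
  open import Data.Integer.Tactic.RingSolver using (solve-∀)
  import Data.Nat.Tactic.RingSolver as ℕS
  open import Data.List using ([]; _∷_)
  open import Data.List.Relation.Unary.All using ([]; _∷_)
  open import Data.Product using (_,_)
  open import Data.Sum using (inj₁; inj₂)
  open import Relation.Nullary using (yes; no)
  open import Relation.Binary.PropositionalEquality

  -- Two factors at equal distance from the middle factor multiply to at most its square.
  rise-central : ∀ k t → rise (suc (k ℕ.+ k)) t ℕ.≤ (suc k ℕ.+ t) ℕ.^ suc (k ℕ.+ k)
  rise-central zero    t = ℕₚ.≤-refl
  rise-central (suc k) t = begin
    rise (suc (suc k ℕ.+ suc k)) t                          ≡⟨ cong (λ z → rise (suc (suc z)) t) (ℕₚ.+-suc k k) ⟩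
    suc t ℕ.* rise (suc (suc (k ℕ.+ k))) (suc t)            ≡⟨ cong (suc t ℕ.*_) (rise-last (suc (k ℕ.+ k)) (suc t)) ⟩
    suc t ℕ.* (rise (suc (k ℕ.+ k)) (suc t) ℕ.* (suc t ℕ.+ suc (suc (k ℕ.+ k))))
                                                            ≤⟨ ℕₚ.*-monoʳ-≤ (suc t) (ℕₚ.*-monoˡ-≤ (suc t ℕ.+ suc (suc (k ℕ.+ k))) (rise-central k (suc t))) ⟩
    suc t ℕ.* ((suc k ℕ.+ suc t) ℕ.^ suc (k ℕ.+ k) ℕ.* (suc t ℕ.+ suc (suc (k ℕ.+ k))))
                                                            ≡⟨ cong (λ z → suc t ℕ.* (z ℕ.^ suc (k ℕ.+ k) ℕ.* (suc t ℕ.+ suc (suc (k ℕ.+ k))))) (ℕₚ.+-suc (suc k) t) ⟩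
    suc t ℕ.* (X ℕ.^ suc (k ℕ.+ k) ℕ.* (suc t ℕ.+ suc (suc (k ℕ.+ k))))
                                                            ≡⟨ ring₁ t k (X ℕ.^ suc (k ℕ.+ k)) ⟩
    suc t ℕ.* (suc t ℕ.+ suc (suc (k ℕ.+ k))) ℕ.* X ℕ.^ suc (k ℕ.+ k)
                                                            ≤⟨ ℕₚ.*-monoˡ-≤ (X ℕ.^ suc (k ℕ.+ k)) (ℕₚ.≤-trans (ℕₚ.m≤m+n _ (suc k ℕ.* suc k)) (ℕₚ.≤-reflexive (ring₂ t k))) ⟩
    X ℕ.* X ℕ.* X ℕ.^ suc (k ℕ.+ k)                         ≡⟨ ℕₚ.*-assoc X X (X ℕ.^ suc (k ℕ.+ k)) ⟩
    X ℕ.^ suc (suc (suc (k ℕ.+ k)))                         ≡⟨ cong (λ z → X ℕ.^ suc (suc z)) (ℕₚ.+-suc k k) ⟨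
    X ℕ.^ suc (suc k ℕ.+ suc k)                             ∎
    where
    open ℕₚ.≤-Reasoning
    X = suc (suc k) ℕ.+ t
    ring₁ : ∀ t k p → suc t ℕ.* (p ℕ.* (suc t ℕ.+ suc (suc (k ℕ.+ k)))) ≡ suc t ℕ.* (suc t ℕ.+ suc (suc (k ℕ.+ k))) ℕ.* p
    ring₁ = ℕS.solve-∀
    ring₂ : ∀ t k → suc t ℕ.* (suc t ℕ.+ suc (suc (k ℕ.+ k))) ℕ.+ suc k ℕ.* suc k ≡ (suc (suc k) ℕ.+ t) ℕ.* (suc (suc k) ℕ.+ t)
    ring₂ = ℕS.solve-∀

  -- Measuring the distance i from the middle of the block of zeros turns the kernel into the pure
  -- power i^(2k+1). Being homogeneous, it lets a node at distance a d contribute a^11 d^11.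
  vanishing-edge : ∀ k (e : ℕ → ℤ) → (∀ j → j ℕ.≤ suc (k ℕ.+ k) → e j ≡ 0ℤ) → ∀ i →
    suc (k ℕ.+ k) ! ℕ.* ∣ e (suc k ℕ.+ i) ∣ ℕ.≤ i ℕ.^ suc (k ℕ.+ k) ℕ.* ∑ᴺ i (λ v → ∣ Δ^ (suc (suc (k ℕ.+ k))) e v ∣)
  vanishing-edge k e e≡0 i with i ℕ.≤? k
  ... | yes i≤k = ℕₚ.≤-trans (ℕₚ.≤-reflexive (trans (cong (λ z → suc (k ℕ.+ k) ! ℕ.* ∣ z ∣) (e≡0 (suc k ℕ.+ i) (s≤s (ℕₚ.+-monoʳ-≤ k i≤k))))
                                                    (ℕₚ.*-zeroʳ (suc (k ℕ.+ k) !)))) z≤n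
  ... | no  i≰k = subst (λ z → suc (k ℕ.+ k) ! ℕ.* ∣ e (suc k ℕ.+ z) ∣ ℕ.≤ z ℕ.^ suc (k ℕ.+ k) ℕ.* ∑ᴺ z D) i≡
    (ℕₚ.≤-trans (ℕₚ.≤-reflexive (cong (λ z → suc (k ℕ.+ k) ! ℕ.* ∣ e z ∣) index))
    (ℕₚ.≤-trans (vanishing-bound (suc (k ℕ.+ k)) e e≡0 t) (ℕₚ.*-mono-≤ (rise-central k t) (∑ᴺ-extend D (s≤s (ℕₚ.m≤n+m t k))))))
    where
    D : ℕ → ℕ
    D v = ∣ Δ^ (suc (suc (k ℕ.+ k))) e v ∣
    t = i ℕ.∸ suc k
    i≡ : suc k ℕ.+ t ≡ i
    i≡ = ℕₚ.m+[n∸m]≡n (ℕₚ.≰⇒> i≰k)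
    ring : ∀ k t → suc k ℕ.+ (suc k ℕ.+ t) ≡ suc (k ℕ.+ k) ℕ.+ suc t
    ring = ℕS.solve-∀
    index : suc k ℕ.+ (suc k ℕ.+ t) ≡ suc (k ℕ.+ k) ℕ.+ suc t
    index = ring k t

  abstract
    -- A sealed copy of `Δ^`, lest a twelfth difference unfold into 4096 terms.
    δ : ℕ → (ℕ → ℤ) → ℕ → ℤ
    δ = Δ^

    δ≡Δ^ : ∀ k e j → δ k e j ≡ Δ^ k e j
    δ≡Δ^ k e j = refl

  -- Differences of order k do not see an interpolating polynomial of degree below k; only its
  -- integer scale remains.
  δ-scale : ∀ k D (e q : ℕ → ℤ) → Kill k q → ∀ v → ∣ δ k (λ j → D * e j - q j) v ∣ ≡ ∣ D ∣ ℕ.* ∣ δ k e v ∣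
  δ-scale k D e q K v = trans (cong ∣_∣ (begin
    δ k (λ j → D * e j - q j) v                        ≡⟨ δ≡Δ^ k (λ j → D * e j - q j) v ⟩
    Δ^ k (λ j → D * e j - q j) v                       ≡⟨ Δ^-+ k (λ j → D * e j) (λ j → - q j) v ⟩
    Δ^ k (λ j → D * e j) v + Δ^ k (λ j → - q j) v      ≡⟨ cong₂ _+_ (Δ^-* k D e v) (trans (Δ^-cong k (λ j → sym (ℤₚ.-1*i≡-i (q j))) v) (Kill.vanishes (kill-* -1ℤ K) v)) ⟩
    D * Δ^ k e v + 0ℤ                                  ≡⟨ ℤₚ.+-identityʳ _ ⟩
    D * Δ^ k e v                                       ≡⟨ cong (D *_) (δ≡Δ^ k e v) ⟨
    D * δ k e v                                        ∎)) (ℤₚ.∣i*j∣≡∣i∣*∣j∣ D (δ k e v))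
    where open ≡-Reasoning

  δ-edge : ∀ k (e : ℕ → ℤ) → (∀ j → j ℕ.≤ suc (k ℕ.+ k) → e j ≡ 0ℤ) → ∀ i →
    fact (suc (k ℕ.+ k)) ℕ.* ∣ e (suc k ℕ.+ i) ∣ ℕ.≤ pow (suc (k ℕ.+ k)) i ℕ.* ∑ᴺ i (λ v → ∣ δ (suc (suc (k ℕ.+ k))) e v ∣)
  δ-edge k e e≡0 i = ℕₚ.≤-trans (ℕₚ.≤-reflexive (cong (ℕ._* ∣ e (suc k ℕ.+ i) ∣) (fact≡! (suc (k ℕ.+ k)))))
    (ℕₚ.≤-trans (vanishing-edge k e e≡0 i)
    (ℕₚ.≤-reflexive (cong₂ ℕ._*_ (sym (pow≡^ (suc (k ℕ.+ k)) i)) (∑ᴺ-cong i (λ v → cong ∣_∣ (sym (δ≡Δ^ (suc (suc (k ℕ.+ k))) e v)))))))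

  lin-0 : ∀ l → linᴺ l (λ _ → 0) ≡ 0
  lin-0 []            = refl
  lin-0 ((s , w) ∷ l) = cong₂ ℕ._+_ (ℕₚ.*-zeroʳ ∣ w ∣) (lin-0 l)

  linᴺ-+ : ∀ l (a b : ℤ → ℕ) → linᴺ l (λ s → a s ℕ.+ b s) ≡ linᴺ l a ℕ.+ linᴺ l b
  linᴺ-+ []            a b = refl
  linᴺ-+ ((s , w) ∷ l) a b = trans (cong (∣ w ∣ ℕ.* (a s ℕ.+ b s) ℕ.+_) (linᴺ-+ l a b)) (ring (∣ w ∣) (a s) (b s) (linᴺ l a) (linᴺ l b))
    where
    ring : ∀ w x y p q → w ℕ.* (x ℕ.+ y) ℕ.+ (p ℕ.+ q) ≡ w ℕ.* x ℕ.+ p ℕ.+ (w ℕ.* y ℕ.+ q)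
    ring = ℕS.solve-∀

  linᴺ-* : ∀ l c (a : ℤ → ℕ) → linᴺ l (λ s → c ℕ.* a s) ≡ c ℕ.* linᴺ l a
  linᴺ-* []            c a = sym (ℕₚ.*-zeroʳ c)
  linᴺ-* ((s , w) ∷ l) c a = trans (cong (∣ w ∣ ℕ.* (c ℕ.* a s) ℕ.+_) (linᴺ-* l c a)) (ring (∣ w ∣) c (a s) (linᴺ l a))
    where
    ring : ∀ w c x p → w ℕ.* (c ℕ.* x) ℕ.+ c ℕ.* p ≡ c ℕ.* (w ℕ.* x ℕ.+ p)
    ring = ℕS.solve-∀

  ∣a-b∣≤ : ∀ c a b → c ℕ.* ∣ a - b ∣ ℕ.≤ c ℕ.* ∣ a ∣ ℕ.+ c ℕ.* ∣ b ∣
  ∣a-b∣≤ c a b = ℕₚ.≤-trans (ℕₚ.*-monoʳ-≤ c (ℤₚ.∣i-j∣≤∣i∣+∣j∣ a b)) (ℕₚ.≤-reflexive (ℕₚ.*-distribˡ-+ c (∣ a ∣) (∣ b ∣)))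

  -- Sums of |weight| times the eleventh power of the node distance in units of d, over a common
  -- factor 2^11. They are separate because nodes to the right and to the left draw on different
  -- windows of twelfth differences.
  Kʳ Kˡ : ℕ
  Kʳ = linᴺ ωs (λ s → pow 11 2 ℕ.* cʳ s ℕ.+ cᵘ s)
  Kˡ = linᴺ ωs (λ s → pow 11 2 ℕ.* cˡ s)

  module _ (u : ℤ → ℤ) (b : ℤ) (d : ℕ) (d≥2 : 2 ℕ.≤ d) where

    private
      -- `uˡ` reads the same values backwards from 11, so that nodes to the left of the panel too
      -- lie beyond the block of twelve zeros.
      uʳ uˡ : ℕ → ℤ
      uʳ j = u (b + + j)
      uˡ j = u (b + (+ 11 - + j))

      Sʳ Sˡ : ℕ
      Sʳ = ∑ᴺ (6 ℕ.* d) (λ v → ∣ δ 12 uʳ v ∣)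
      Sˡ = ∑ᴺ (5 ℕ.* d) (λ v → ∣ δ 12 uˡ v ∣)

      -- The interpolation points 0 to 11 are the nodes 5 + s of the first unit rule; the wide rule
      -- spreads out from them to both sides.
      open Interpolant (interpolate 12 uʳ)

      D : ℕ
      D = ∣ scale ∣

      E : ℤ → ℤ
      E x = scale * u (b + x) - q x

      eʳ eˡ : ℕ → ℤ
      eʳ j = E (+ j)
      eˡ j = E (+ 11 - + j)

      eʳ≡0 : ∀ j → j ℕ.≤ 11 → eʳ j ≡ 0ℤ
      eʳ≡0 j j≤11 = ℤₚ.i≡j⇒i-j≡0 (agrees j (s≤s j≤11))

      eˡ≡0 : ∀ j → j ℕ.≤ 11 → eˡ j ≡ 0ℤ
      eˡ≡0 j j≤11 = trans (cong E (trans (ℤₚ.m-n≡m⊖n 11 j) (ℤₚ.⊖-≥ j≤11))) (eʳ≡0 (11 ℕ.∸ j) (ℕₚ.m∸n≤m 11 j))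

      δʳ : ∀ v → ∣ δ 12 eʳ v ∣ ≡ D ℕ.* ∣ δ 12 uʳ v ∣
      δʳ = δ-scale 12 scale uʳ (λ j → q (+ j)) (kill-cong (λ j → cong q (ring (+ j))) (poly-kill poly 0ℤ 1ℤ))
        where
        ring : ∀ x → x ≡ 0ℤ + 1ℤ * x
        ring = solve-∀

      δˡ : ∀ v → ∣ δ 12 eˡ v ∣ ≡ D ℕ.* ∣ δ 12 uˡ v ∣
      δˡ = δ-scale 12 scale uˡ (λ j → q (+ 11 - + j)) (kill-cong (λ j → cong q (ring (+ j))) (poly-kill poly (+ 11) -1ℤ))
        where
        ring : ∀ x → + 11 - x ≡ + 11 + -1ℤ * x
        ring = solve-∀

      edge : ∀ (e w : ℕ → ℤ) → (∀ j → j ℕ.≤ 11 → e j ≡ 0ℤ) → (∀ v → ∣ δ 12 e v ∣ ≡ D ℕ.* ∣ δ 12 w v ∣) →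
             ∀ n i → i ℕ.≤ n → ∀ x → i ℕ.≤ x → fact 11 ℕ.* ∣ e (6 ℕ.+ i) ∣ ℕ.≤ pow 11 x ℕ.* (D ℕ.* ∑ᴺ n (λ v → ∣ δ 12 w v ∣))
      edge e w e≡0 eq n i i≤n x i≤x = ℕₚ.≤-trans (δ-edge 5 e e≡0 i) (ℕₚ.*-mono-≤ (pow-mono 11 i≤x)
        (ℕₚ.≤-trans (∑ᴺ-extend (λ v → ∣ δ 12 e v ∣) i≤n) (ℕₚ.≤-reflexive (trans (∑ᴺ-cong n eq) (∑ᴺ-* n D (λ v → ∣ δ 12 w v ∣))))))

      trivial : ∀ {x y} → x ≡ 0ℤ → fact 11 ℕ.* ∣ x ∣ ℕ.≤ y
      trivial eq = ℕₚ.≤-trans (ℕₚ.≤-reflexive (trans (cong (λ z → fact 11 ℕ.* ∣ z ∣) eq) (ℕₚ.*-zeroʳ (fact 11)))) z≤n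

      right : ∀ j x → j ℕ.≤ 6 ℕ.+ x → x ℕ.≤ 6 ℕ.* d → fact 11 ℕ.* ∣ eʳ j ∣ ℕ.≤ pow 11 x ℕ.* (D ℕ.* Sʳ)
      right j x j≤ x≤ with j ℕ.≤? 6
      ... | yes j≤6 = trivial {eʳ j} (eʳ≡0 j (ℕₚ.≤-trans j≤6 (ℕₚ.m≤m+n 6 5)))
      ... | no  j≰6 = subst (λ z → fact 11 ℕ.* ∣ eʳ z ∣ ℕ.≤ pow 11 x ℕ.* (D ℕ.* Sʳ)) (ℕₚ.m+[n∸m]≡n 6≤j)
                            (edge eʳ uʳ eʳ≡0 δʳ (6 ℕ.* d) (j ℕ.∸ 6) (ℕₚ.≤-trans i≤x x≤) x i≤x)
        where
        6≤j : 6 ℕ.≤ j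
        6≤j = ℕₚ.<⇒≤ (ℕₚ.≰⇒> j≰6)
        i≤x : j ℕ.∸ 6 ℕ.≤ x
        i≤x = ℕₚ.m≤n+o⇒m∸n≤o j 6 j≤

      [ab]^11 : ∀ a b → pow 11 (a ℕ.* b) ≡ pow 11 a ℕ.* pow 11 b
      [ab]^11 a b = pow-* 11 a b

      node : ∀ s → Ok s → fact 11 ℕ.* ∣ E (+ 5 + s * + d) ∣ ℕ.≤ pow 11 d ℕ.* D ℕ.* (cʳ s ℕ.* Sʳ ℕ.+ cˡ s ℕ.* Sˡ)
      node (+ a) a≤6 = begin
        fact 11 ℕ.* ∣ E (+ 5 + + a * + d) ∣                    ≡⟨ cong (λ z → fact 11 ℕ.* ∣ E (+ 5 + z) ∣) (sym (ℤₚ.pos-* a d)) ⟩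
        fact 11 ℕ.* ∣ eʳ (5 ℕ.+ a ℕ.* d) ∣                     ≤⟨ right (5 ℕ.+ a ℕ.* d) (a ℕ.* d) (ℕₚ.n≤1+n _) (ℕₚ.*-monoˡ-≤ d a≤6) ⟩
        pow 11 (a ℕ.* d) ℕ.* (D ℕ.* Sʳ)                     ≡⟨ cong (ℕ._* (D ℕ.* Sʳ)) ([ab]^11 a d) ⟩
        pow 11 a ℕ.* pow 11 d ℕ.* (D ℕ.* Sʳ)                ≡⟨ ring (pow 11 a) (pow 11 d) D Sʳ ⟩
        pow 11 d ℕ.* D ℕ.* (pow 11 a ℕ.* Sʳ ℕ.+ 0)          ∎
        where
        open ℕₚ.≤-Reasoning
        ring : ∀ a d D S → a ℕ.* d ℕ.* (D ℕ.* S) ≡ d ℕ.* D ℕ.* (a ℕ.* S ℕ.+ 0)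
        ring = ℕS.solve-∀
      node -[1+ a ] a≤4 = begin
        fact 11 ℕ.* ∣ E (+ 5 + -[1+ a ] * + d) ∣               ≡⟨ cong (λ z → fact 11 ℕ.* ∣ E z ∣) index ⟩
        fact 11 ℕ.* ∣ eˡ (6 ℕ.+ suc a ℕ.* d) ∣                 ≤⟨ edge eˡ uˡ eˡ≡0 δˡ (5 ℕ.* d) (suc a ℕ.* d) (ℕₚ.*-monoˡ-≤ d (s≤s a≤4)) (suc a ℕ.* d) ℕₚ.≤-refl ⟩
        pow 11 (suc a ℕ.* d) ℕ.* (D ℕ.* Sˡ)                 ≡⟨ cong (ℕ._* (D ℕ.* Sˡ)) ([ab]^11 (suc a) d) ⟩
        pow 11 (suc a) ℕ.* pow 11 d ℕ.* (D ℕ.* Sˡ)            ≡⟨ ring (pow 11 (suc a)) (pow 11 d) D Sˡ ⟩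
        pow 11 d ℕ.* D ℕ.* (0 ℕ.+ pow 11 (suc a) ℕ.* Sˡ)      ∎
        where
        open ℕₚ.≤-Reasoning
        ring : ∀ a d D S → a ℕ.* d ℕ.* (D ℕ.* S) ≡ d ℕ.* D ℕ.* (0 ℕ.+ a ℕ.* S)
        ring = ℕS.solve-∀
        ringℤ : ∀ a d → + 5 + (- a) * d ≡ + 11 - (+ 6 + a * d)
        ringℤ = solve-∀
        index : + 5 + -[1+ a ] * + d ≡ + 11 - + (6 ℕ.+ suc a ℕ.* d)
        index = trans (ringℤ (+ suc a) (+ d)) (cong (λ z → + 11 - (+ 6 + z)) (sym (ℤₚ.pos-* (suc a) d)))

      -- Nodes of the unit rules reach only about half as far as those of the wide rule. The factor
      -- 2^11 on the left allows the estimate to use 2x ≤ c d in place of x ≤ c d.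
      unit-bound : ∀ c j x → c ℕ.≤ 6 → j ℕ.≤ 6 ℕ.+ x → 2 ℕ.* x ℕ.≤ c ℕ.* d →
                   pow 11 2 ℕ.* fact 11 ℕ.* ∣ eʳ j ∣ ℕ.≤ pow 11 d ℕ.* D ℕ.* (pow 11 c ℕ.* Sʳ)
      unit-bound c j x c≤6 j≤ 2x≤ = begin
        pow 11 2 ℕ.* fact 11 ℕ.* ∣ eʳ j ∣                      ≡⟨ ℕₚ.*-assoc (pow 11 2) (fact 11) (∣ eʳ j ∣) ⟩
        pow 11 2 ℕ.* (fact 11 ℕ.* ∣ eʳ j ∣)                    ≤⟨ ℕₚ.*-monoʳ-≤ (pow 11 2) (right j x j≤ (ℕₚ.≤-trans (ℕₚ.m≤n*m x 2) (ℕₚ.≤-trans 2x≤ (ℕₚ.*-monoˡ-≤ d c≤6)))) ⟩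
        pow 11 2 ℕ.* (pow 11 x ℕ.* (D ℕ.* Sʳ))              ≡⟨ ℕₚ.*-assoc (pow 11 2) (pow 11 x) (D ℕ.* Sʳ) ⟨
        (pow 11 2 ℕ.* pow 11 x) ℕ.* (D ℕ.* Sʳ)              ≡⟨ cong (ℕ._* (D ℕ.* Sʳ)) ([ab]^11 2 x) ⟨
        pow 11 (2 ℕ.* x) ℕ.* (D ℕ.* Sʳ)                     ≤⟨ ℕₚ.*-monoˡ-≤ (D ℕ.* Sʳ) (pow-mono 11 2x≤) ⟩
        pow 11 (c ℕ.* d) ℕ.* (D ℕ.* Sʳ)                     ≡⟨ cong (ℕ._* (D ℕ.* Sʳ)) ([ab]^11 c d) ⟩
        pow 11 c ℕ.* pow 11 d ℕ.* (D ℕ.* Sʳ)                ≡⟨ ring (pow 11 c) (pow 11 d) D Sʳ ⟩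
        pow 11 d ℕ.* D ℕ.* (pow 11 c ℕ.* Sʳ)                ∎
        where
        open ℕₚ.≤-Reasoning
        ring : ∀ a d D S → a ℕ.* d ℕ.* (D ℕ.* S) ≡ d ℕ.* D ℕ.* (a ℕ.* S)
        ring = ℕS.solve-∀

      unit : ∀ s → Ok s → ∀ v → v ℕ.< d → pow 11 2 ℕ.* fact 11 ℕ.* ∣ E (+ 5 + s + + v) ∣ ℕ.≤ pow 11 d ℕ.* D ℕ.* (cᵘ s ℕ.* Sʳ)
      unit (+ a) a≤6 v v<d = unit-bound (a ℕ.⊔ 2) (5 ℕ.+ a ℕ.+ v) (a ℕ.+ v ℕ.∸ 1) (ℕₚ.⊔-lub a≤6 (s≤s (s≤s z≤n)))
        (ℕₚ.+-monoʳ-≤ 5 (lem (a ℕ.+ v))) (2x≤ (ℕₚ.≤-total a 2))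
        where
        lem : ∀ k → k ℕ.≤ suc (k ℕ.∸ 1)
        lem zero    = z≤n
        lem (suc k) = ℕₚ.≤-refl
        -- (a − 2)(d − 2) ≥ 0
        big : ∀ a d v → 2 ℕ.≤ a → 2 ℕ.≤ d → v ℕ.< d → 2 ℕ.* (a ℕ.+ v ℕ.∸ 1) ℕ.≤ a ℕ.* d
        big (suc (suc a)) (suc (suc d)) v (s≤s (s≤s _)) (s≤s (s≤s _)) v<d = ℕₚ.≤-trans
          (ℕₚ.*-monoʳ-≤ 2 (ℕₚ.+-monoʳ-≤ (suc a) (ℕₚ.≤-pred v<d)))
          (ℕₚ.≤-trans (ℕₚ.m≤m+n _ (a ℕ.* d)) (ℕₚ.≤-reflexive (ring a d)))
          where
          ring : ∀ a d → 2 ℕ.* (suc a ℕ.+ suc d) ℕ.+ a ℕ.* d ≡ suc (suc a) ℕ.* suc (suc d)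
          ring = ℕS.solve-∀
        2x≤ : _ → 2 ℕ.* (a ℕ.+ v ℕ.∸ 1) ℕ.≤ (a ℕ.⊔ 2) ℕ.* d
        2x≤ (inj₁ a≤2) = ℕₚ.*-mono-≤ (ℕₚ.m≤n⊔m a 2) (ℕₚ.≤-trans (ℕₚ.∸-monoˡ-≤ 1 (ℕₚ.+-monoˡ-≤ v a≤2)) v<d)
        2x≤ (inj₂ 2≤a) = ℕₚ.≤-trans (big a d v 2≤a d≥2 v<d) (ℕₚ.*-monoˡ-≤ d (ℕₚ.m≤m⊔n a 2))
      unit -[1+ a ] a≤4 v v<d = subst (λ z → pow 11 2 ℕ.* fact 11 ℕ.* ∣ E z ∣ ℕ.≤ pow 11 d ℕ.* D ℕ.* (pow 11 2 ℕ.* Sʳ)) index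
        (unit-bound 2 (4 ℕ.∸ a ℕ.+ v) v (s≤s (s≤s z≤n)) (ℕₚ.+-monoˡ-≤ v (ℕₚ.≤-trans (ℕₚ.m∸n≤m 4 a) (ℕₚ.m≤m+n 4 2))) (ℕₚ.*-monoʳ-≤ 2 (ℕₚ.<⇒≤ v<d)))
        where
        index : + (4 ℕ.∸ a ℕ.+ v) ≡ + 5 + -[1+ a ] + + v
        index = cong (_+ + v) (sym (trans (ℤₚ.m-n≡m⊖n 5 (suc a)) (ℤₚ.⊖-≥ (s≤s a≤4))))

      -- The interpolating polynomial drops out of the panel functional.
      panel-error : scale * panel (λ x → u (b + x)) d ≡ panel E d
      panel-error = begin
        scale * panel (λ x → u (b + x)) d                   ≡⟨ panel-* scale (λ x → u (b + x)) d ⟨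
        panel (λ x → scale * u (b + x)) d                   ≡⟨ panel-cong (λ x → ring (scale * u (b + x)) (q x)) d ⟩
        panel (λ x → E x + q x) d                           ≡⟨ panel-+ E q d ⟩
        panel E d + panel q d                               ≡⟨ cong (λ z → panel E d + z) (panel-poly poly ℕₚ.≤-refl d) ⟩
        panel E d + 0ℤ                                      ≡⟨ ℤₚ.+-identityʳ _ ⟩
        panel E d                                           ∎
        where
        open ≡-Reasoning
        ring : ∀ x y → x ≡ x - y + y
        ring = solve-∀

    -- Since the panel kills the interpolating polynomial, u may be replaced by the error E, which
    -- vanishes at 0, ..., 11 and is bounded at every node by `δ-edge`. The extra factor d is the
    -- prefactor of the wide rule and the number of unit rules.
    panel-bound : pow 11 2 ℕ.* fact 11 ℕ.* ∣ panel (λ x → u (b + x)) d ∣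
                  ℕ.≤ d ℕ.* pow 11 d ℕ.* (Kʳ ℕ.* ∑ᴺ (6 ℕ.* d) (λ v → ∣ δ 12 (λ j → u (b + + j)) v ∣) ℕ.+ Kˡ ℕ.* ∑ᴺ (5 ℕ.* d) (λ v → ∣ δ 12 (λ j → u (b + (+ 11 - + j))) v ∣))
    panel-bound = ℕₚ.*-cancelˡ-≤ D {{nonZero}} (begin
      D ℕ.* (c₀ ℕ.* ∣ p ∣)                                              ≡⟨ ring₁ D c₀ (∣ p ∣) ⟩
      c₀ ℕ.* (D ℕ.* ∣ p ∣)                                              ≡⟨ cong (c₀ ℕ.*_) (trans (sym (ℤₚ.∣i*j∣≡∣i∣*∣j∣ scale p)) (cong ∣_∣ panel-error)) ⟩
      c₀ ℕ.* ∣ + d * X - Y ∣                                            ≤⟨ ∣a-b∣≤ c₀ (+ d * X) Y ⟩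
      c₀ ℕ.* ∣ + d * X ∣ ℕ.+ c₀ ℕ.* ∣ Y ∣                               ≤⟨ ℕₚ.+-mono-≤ X-bound Y-bound ⟩
      d ℕ.* (A ℕ.* (P ℕ.* Sʳ ℕ.+ Kˡ ℕ.* Sˡ)) ℕ.+ d ℕ.* (A ℕ.* (Q ℕ.* Sʳ)) ≡⟨ ring₂ d (pow 11 d) D P Q Sʳ Kˡ Sˡ ⟩
      D ℕ.* (d ℕ.* pow 11 d ℕ.* ((P ℕ.+ Q) ℕ.* Sʳ ℕ.+ Kˡ ℕ.* Sˡ))             ≡⟨ cong (λ z → D ℕ.* (d ℕ.* pow 11 d ℕ.* (z ℕ.* Sʳ ℕ.+ Kˡ ℕ.* Sˡ))) (linᴺ-+ ωs (λ s → pow 11 2 ℕ.* cʳ s) cᵘ) ⟨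
      D ℕ.* (d ℕ.* pow 11 d ℕ.* (Kʳ ℕ.* Sʳ ℕ.+ Kˡ ℕ.* Sˡ))                    ∎)
      where
      open ℕₚ.≤-Reasoning
      c₀ = pow 11 2 ℕ.* fact 11
      A = pow 11 d ℕ.* D
      P = linᴺ ωs (λ s → pow 11 2 ℕ.* cʳ s)
      Q = linᴺ ωs cᵘ
      p X Y : ℤ
      p = panel (λ x → u (b + x)) d
      X = lin ωs (λ s → E (+ 5 + s * + d))
      Y = ∑ d (λ v → lin ωs (λ s → E (+ 5 + s + + v)))
      ring₁ : ∀ D c p → D ℕ.* (c ℕ.* p) ≡ c ℕ.* (D ℕ.* p)
      ring₁ = ℕS.solve-∀
      ring₂ : ∀ d e D P Q S K S′ → d ℕ.* (e ℕ.* D ℕ.* (P ℕ.* S ℕ.+ K ℕ.* S′)) ℕ.+ d ℕ.* (e ℕ.* D ℕ.* (Q ℕ.* S))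
                                   ≡ D ℕ.* (d ℕ.* e ℕ.* ((P ℕ.+ Q) ℕ.* S ℕ.+ K ℕ.* S′))
      ring₂ = ℕS.solve-∀
      ring₃ : ∀ c f x → c ℕ.* f ℕ.* x ≡ c ℕ.* (f ℕ.* x)
      ring₃ = ℕS.solve-∀
      ring₄ : ∀ c A r S l S′ → c ℕ.* (A ℕ.* (r ℕ.* S ℕ.+ l ℕ.* S′)) ≡ A ℕ.* S ℕ.* (c ℕ.* r) ℕ.+ A ℕ.* S′ ℕ.* (c ℕ.* l)
      ring₄ = ℕS.solve-∀
      ring₅ : ∀ A S P S′ K → A ℕ.* S ℕ.* P ℕ.+ A ℕ.* S′ ℕ.* K ≡ A ℕ.* (P ℕ.* S ℕ.+ K ℕ.* S′)
      ring₅ = ℕS.solve-∀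
      ring₆ : ∀ A c S → A ℕ.* (c ℕ.* S) ≡ A ℕ.* S ℕ.* c
      ring₆ = ℕS.solve-∀
      ring₇ : ∀ A S Q → A ℕ.* S ℕ.* Q ≡ A ℕ.* (Q ℕ.* S)
      ring₇ = ℕS.solve-∀
      node′ : ∀ s → Ok s → c₀ ℕ.* ∣ E (+ 5 + s * + d) ∣ ℕ.≤ A ℕ.* Sʳ ℕ.* (pow 11 2 ℕ.* cʳ s) ℕ.+ A ℕ.* Sˡ ℕ.* (pow 11 2 ℕ.* cˡ s)
      node′ s ok = ℕₚ.≤-trans (ℕₚ.≤-reflexive (ring₃ (pow 11 2) (fact 11) (∣ E (+ 5 + s * + d) ∣)))
        (ℕₚ.≤-trans (ℕₚ.*-monoʳ-≤ (pow 11 2) (node s ok)) (ℕₚ.≤-reflexive (ring₄ (pow 11 2) A (cʳ s) Sʳ (cˡ s) Sˡ)))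
      X-bound : c₀ ℕ.* ∣ + d * X ∣ ℕ.≤ d ℕ.* (A ℕ.* (P ℕ.* Sʳ ℕ.+ Kˡ ℕ.* Sˡ))
      X-bound = begin
        c₀ ℕ.* ∣ + d * X ∣                                  ≡⟨ cong (c₀ ℕ.*_) (ℤₚ.∣i*j∣≡∣i∣*∣j∣ (+ d) X) ⟩
        c₀ ℕ.* (d ℕ.* ∣ X ∣)                                ≡⟨ ring₁ c₀ d (∣ X ∣) ⟩
        d ℕ.* (c₀ ℕ.* ∣ X ∣)                                ≤⟨ ℕₚ.*-monoʳ-≤ d (lin-abs ωs Ok ωs-ok c₀ (λ s → E (+ 5 + s * + d)) (λ s → A ℕ.* Sʳ ℕ.* (pow 11 2 ℕ.* cʳ s) ℕ.+ A ℕ.* Sˡ ℕ.* (pow 11 2 ℕ.* cˡ s)) node′) ⟩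
        d ℕ.* linᴺ ωs (λ s → A ℕ.* Sʳ ℕ.* (pow 11 2 ℕ.* cʳ s) ℕ.+ A ℕ.* Sˡ ℕ.* (pow 11 2 ℕ.* cˡ s))
          ≡⟨ cong (d ℕ.*_) (trans (linᴺ-+ ωs (λ s → A ℕ.* Sʳ ℕ.* (pow 11 2 ℕ.* cʳ s)) (λ s → A ℕ.* Sˡ ℕ.* (pow 11 2 ℕ.* cˡ s)))
               (trans (cong₂ ℕ._+_ (linᴺ-* ωs (A ℕ.* Sʳ) (λ s → pow 11 2 ℕ.* cʳ s)) (linᴺ-* ωs (A ℕ.* Sˡ) (λ s → pow 11 2 ℕ.* cˡ s))) (ring₅ A Sʳ P Sˡ Kˡ))) ⟩
        d ℕ.* (A ℕ.* (P ℕ.* Sʳ ℕ.+ Kˡ ℕ.* Sˡ))              ∎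
      Y-bound : c₀ ℕ.* ∣ Y ∣ ℕ.≤ d ℕ.* (A ℕ.* (Q ℕ.* Sʳ))
      Y-bound = begin
        c₀ ℕ.* ∣ Y ∣                                        ≤⟨ ℕₚ.*-monoʳ-≤ c₀ (∑-abs d (λ v → lin ωs (λ s → E (+ 5 + s + + v)))) ⟩
        c₀ ℕ.* ∑ᴺ d (λ v → ∣ lin ωs (λ s → E (+ 5 + s + + v)) ∣) ≡⟨ ∑ᴺ-* d c₀ (λ v → ∣ lin ωs (λ s → E (+ 5 + s + + v)) ∣) ⟨
        ∑ᴺ d (λ v → c₀ ℕ.* ∣ lin ωs (λ s → E (+ 5 + s + + v)) ∣)
          ≤⟨ ∑ᴺ-mono< d (λ v v<d → lin-abs ωs Ok ωs-ok c₀ (λ s → E (+ 5 + s + + v)) (λ s → A ℕ.* Sʳ ℕ.* cᵘ s)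
               (λ s ok → ℕₚ.≤-trans (unit s ok v v<d) (ℕₚ.≤-reflexive (ring₆ A (cᵘ s) Sʳ)))) ⟩
        ∑ᴺ d (λ v → linᴺ ωs (λ s → A ℕ.* Sʳ ℕ.* cᵘ s))      ≡⟨ ∑ᴺ-const d _ ⟩
        d ℕ.* linᴺ ωs (λ s → A ℕ.* Sʳ ℕ.* cᵘ s)             ≡⟨ cong (d ℕ.*_) (trans (linᴺ-* ωs (A ℕ.* Sʳ) cᵘ) (ring₇ A Sʳ Q)) ⟩
        d ℕ.* (A ℕ.* (Q ℕ.* Sʳ))                            ∎

-- Sums over overlapping windows, and differences of the weight

module BlockSums where

  open Sums
  open Coefficients
  open Quadrature
  open PanelBound
  open import Data.Nat as ℕ using (ℕ; zero; suc; z≤n)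
  import Data.Nat.Properties as ℕₚ
  open import Data.Integer using (ℤ; +_; _+_; _*_; _-_; -_; ∣_∣; 1ℤ; -1ℤ)
  import Data.Integer.Properties as ℤₚ
  open import Data.Integer.Tactic.RingSolver using (solve-∀)
  import Data.Nat.Tactic.RingSolver as ℕS
  open import Relation.Nullary using (yes; no; contradiction)
  open import Relation.Binary.PropositionalEquality

  ∑ᴺ-flatten : ∀ I d (h : ℕ → ℕ) → ∑ᴺ I (λ k → ∑ᴺ d (λ v → h (k ℕ.* d ℕ.+ v))) ≡ ∑ᴺ (I ℕ.* d) h
  ∑ᴺ-flatten zero    d h = refl
  ∑ᴺ-flatten (suc I) d h = begin
    ∑ᴺ I (λ k → ∑ᴺ d (λ v → h (k ℕ.* d ℕ.+ v))) ℕ.+ ∑ᴺ d (λ v → h (I ℕ.* d ℕ.+ v)) ≡⟨ cong (ℕ._+ ∑ᴺ d (λ v → h (I ℕ.* d ℕ.+ v))) (∑ᴺ-flatten I d h) ⟩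
    ∑ᴺ (I ℕ.* d) h ℕ.+ ∑ᴺ d (λ v → h (I ℕ.* d ℕ.+ v))  ≡⟨ ∑ᴺ-split (I ℕ.* d) d h ⟨
    ∑ᴺ (I ℕ.* d ℕ.+ d) h                               ≡⟨ cong (λ z → ∑ᴺ z h) (ℕₚ.+-comm (I ℕ.* d) d) ⟩
    ∑ᴺ (d ℕ.+ I ℕ.* d) h                               ∎
    where open ≡-Reasoning

  -- Windows of length c d that start at multiples of d cover each point at most c times.
  ∑ᴺ-windows : ∀ I d c (h : ℕ → ℕ) → ∑ᴺ I (λ k → ∑ᴺ (c ℕ.* d) (λ v → h (k ℕ.* d ℕ.+ v))) ℕ.≤ c ℕ.* ∑ᴺ ((c ℕ.+ I) ℕ.* d) h
  ∑ᴺ-windows I d zero    h = ℕₚ.≤-reflexive (∑ᴺ-0 I)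
  ∑ᴺ-windows I d (suc c) h = begin
    ∑ᴺ I (λ k → ∑ᴺ (d ℕ.+ c ℕ.* d) (λ v → h (k ℕ.* d ℕ.+ v)))
      ≡⟨ ∑ᴺ-cong I (λ k → trans (∑ᴺ-split d (c ℕ.* d) (λ v → h (k ℕ.* d ℕ.+ v)))
           (cong (∑ᴺ d (λ v → h (k ℕ.* d ℕ.+ v)) ℕ.+_) (∑ᴺ-cong (c ℕ.* d) (λ v → cong h (ring₁ k d v))))) ⟩
    ∑ᴺ I (λ k → ∑ᴺ d (λ v → h (k ℕ.* d ℕ.+ v)) ℕ.+ ∑ᴺ (c ℕ.* d) (λ v → h (d ℕ.+ (k ℕ.* d ℕ.+ v))))
      ≡⟨ ∑ᴺ-+ I (λ k → ∑ᴺ d (λ v → h (k ℕ.* d ℕ.+ v))) (λ k → ∑ᴺ (c ℕ.* d) (λ v → h (d ℕ.+ (k ℕ.* d ℕ.+ v)))) ⟩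
    ∑ᴺ I (λ k → ∑ᴺ d (λ v → h (k ℕ.* d ℕ.+ v))) ℕ.+ ∑ᴺ I (λ k → ∑ᴺ (c ℕ.* d) (λ v → h (d ℕ.+ (k ℕ.* d ℕ.+ v))))
      ≤⟨ ℕₚ.+-mono-≤ (ℕₚ.≤-trans (ℕₚ.≤-reflexive (∑ᴺ-flatten I d h)) (∑ᴺ-extend h (ℕₚ.*-monoˡ-≤ d (ℕₚ.m≤n+m I (suc c)))))
                     (ℕₚ.≤-trans (∑ᴺ-windows I d c (λ w → h (d ℕ.+ w))) (ℕₚ.*-monoʳ-≤ c (∑ᴺ-shift d ((c ℕ.+ I) ℕ.* d) h))) ⟩
    ∑ᴺ ((suc c ℕ.+ I) ℕ.* d) h ℕ.+ c ℕ.* ∑ᴺ (d ℕ.+ (c ℕ.+ I) ℕ.* d) h ∎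
    where
    open ℕₚ.≤-Reasoning
    ring₁ : ∀ k d v → k ℕ.* d ℕ.+ (d ℕ.+ v) ≡ d ℕ.+ (k ℕ.* d ℕ.+ v)
    ring₁ = ℕS.solve-∀

  ind : ℕ → ℕ → ℕ
  ind c z with c ℕ.≤? z
  ... | yes _ = 1
  ... | no  _ = 0

  ind-yes : ∀ c z → c ℕ.≤ z → ind c z ≡ 1
  ind-yes c z c≤z with c ℕ.≤? z
  ... | yes _ = refl
  ... | no ¬p = contradiction c≤z ¬p

  ∑ᴺ-ind : ∀ c n Z (h : ℕ → ℕ) → c ℕ.+ n ℕ.≤ Z → ∑ᴺ n (λ w → h (c ℕ.+ w)) ℕ.≤ ∑ᴺ Z (λ z → ind c z ℕ.* h z)
  ∑ᴺ-ind c n Z h le = begin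
    ∑ᴺ n (λ w → h (c ℕ.+ w))                          ≡⟨ ∑ᴺ-cong n (λ w → sym (trans (cong (ℕ._* h (c ℕ.+ w)) (ind-yes c (c ℕ.+ w) (ℕₚ.m≤m+n c w))) (ℕₚ.+-identityʳ _))) ⟩
    ∑ᴺ n (λ w → ind c (c ℕ.+ w) ℕ.* h (c ℕ.+ w))      ≤⟨ ∑ᴺ-shift c n (λ z → ind c z ℕ.* h z) ⟩
    ∑ᴺ (c ℕ.+ n) (λ z → ind c z ℕ.* h z)              ≤⟨ ∑ᴺ-extend (λ z → ind c z ℕ.* h z) le ⟩
    ∑ᴺ Z (λ z → ind c z ℕ.* h z)                      ∎
    where open ℕₚ.≤-Reasoning

  -- The sum starts at 2, and its first term alone gives equality at n = 1. The induction step rests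
  -- on x^(e+3) ≤ (x - 1)(x + 1)^(e+2).
  ∑ᴺ-powers : ∀ e n → 2 ℕ.* ∑ᴺ n (λ k → (2 ℕ.+ k) ℕ.^ (2 ℕ.+ e)) ℕ.≤ (1 ℕ.+ n) ℕ.^ (3 ℕ.+ e)
  ∑ᴺ-powers e zero    = z≤n
  ∑ᴺ-powers e (suc zero) = ℕₚ.≤-refl
  ∑ᴺ-powers e (suc (suc n)) = begin
    2 ℕ.* (S ℕ.+ (3 ℕ.+ n) ℕ.^ (2 ℕ.+ e))                     ≡⟨ ℕₚ.*-distribˡ-+ 2 S _ ⟩
    2 ℕ.* S ℕ.+ 2 ℕ.* (3 ℕ.+ n) ℕ.^ (2 ℕ.+ e)                 ≤⟨ ℕₚ.+-monoˡ-≤ _ (∑ᴺ-powers e (suc n)) ⟩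
    (2 ℕ.+ n) ℕ.^ (3 ℕ.+ e) ℕ.+ 2 ℕ.* (3 ℕ.+ n) ℕ.^ (2 ℕ.+ e) ≤⟨ ℕₚ.+-monoˡ-≤ _ key ⟩
    (1 ℕ.+ n) ℕ.* (3 ℕ.+ n) ℕ.^ (2 ℕ.+ e) ℕ.+ 2 ℕ.* (3 ℕ.+ n) ℕ.^ (2 ℕ.+ e) ≡⟨ ring₁ n ((3 ℕ.+ n) ℕ.^ (2 ℕ.+ e)) ⟩
    (3 ℕ.+ n) ℕ.* (3 ℕ.+ n) ℕ.^ (2 ℕ.+ e)                     ∎
    where
    open ℕₚ.≤-Reasoning
    S = ∑ᴺ (suc n) (λ k → (2 ℕ.+ k) ℕ.^ (2 ℕ.+ e))
    ring₁ : ∀ n x → (1 ℕ.+ n) ℕ.* x ℕ.+ 2 ℕ.* x ≡ (3 ℕ.+ n) ℕ.* x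
    ring₁ = ℕS.solve-∀
    ring₂ : ∀ n x → (2 ℕ.+ n) ℕ.* ((2 ℕ.+ n) ℕ.* ((2 ℕ.+ n) ℕ.* x)) ℕ.+ ((1 ℕ.+ n) ℕ.* (1 ℕ.+ n) ℕ.+ n) ℕ.* x ≡ (1 ℕ.+ n) ℕ.* ((3 ℕ.+ n) ℕ.* ((3 ℕ.+ n) ℕ.* x))
    ring₂ = ℕS.solve-∀
    key : (2 ℕ.+ n) ℕ.^ (3 ℕ.+ e) ℕ.≤ (1 ℕ.+ n) ℕ.* (3 ℕ.+ n) ℕ.^ (2 ℕ.+ e)
    key = ℕₚ.≤-trans (ℕₚ.≤-trans (ℕₚ.m≤m+n _ _) (ℕₚ.≤-reflexive (ring₂ n ((2 ℕ.+ n) ℕ.^ e))))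
          (ℕₚ.*-monoʳ-≤ (1 ℕ.+ n) (ℕₚ.*-monoʳ-≤ (3 ℕ.+ n) (ℕₚ.*-monoʳ-≤ (3 ℕ.+ n) (ℕₚ.^-monoˡ-≤ e (ℕₚ.n≤1+n (2 ℕ.+ n))))))

  -- For the exchange of the sums over d and z: a position z is reached only by those d with d M ≤
  -- z, and their powers add up to at most half of ((z + 1)/M)^(e+3). This is the source of the
  -- saving M^13.
  ∑ᴺ-ind-powers : ∀ e M D z → 2 ℕ.* pow (3 ℕ.+ e) M ℕ.* ∑ᴺ D (λ k → pow (2 ℕ.+ e) (2 ℕ.+ k) ℕ.* ind ((2 ℕ.+ k) ℕ.* M) z) ℕ.≤ pow (3 ℕ.+ e) (suc z)
  ∑ᴺ-ind-powers e M zero    z = ℕₚ.≤-trans (ℕₚ.≤-reflexive (ℕₚ.*-zeroʳ (2 ℕ.* pow (3 ℕ.+ e) M))) z≤n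
  ∑ᴺ-ind-powers e M (suc D) z with (2 ℕ.+ D) ℕ.* M ℕ.≤? z
  ... | no _ = ℕₚ.≤-trans (ℕₚ.≤-reflexive (cong (2 ℕ.* pow (3 ℕ.+ e) M ℕ.*_)
          (trans (cong (∑ᴺ D (λ k → pow (2 ℕ.+ e) (2 ℕ.+ k) ℕ.* ind ((2 ℕ.+ k) ℕ.* M) z) ℕ.+_) (ℕₚ.*-zeroʳ (pow (2 ℕ.+ e) (2 ℕ.+ D)))) (ℕₚ.+-identityʳ _))))
          (∑ᴺ-ind-powers e M D z)
  ... | yes le = begin
    2 ℕ.* P ℕ.* (∑ᴺ D (λ k → pow (2 ℕ.+ e) (2 ℕ.+ k) ℕ.* ind ((2 ℕ.+ k) ℕ.* M) z) ℕ.+ pow (2 ℕ.+ e) (2 ℕ.+ D) ℕ.* 1)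
      ≤⟨ ℕₚ.*-monoʳ-≤ (2 ℕ.* P) (ℕₚ.+-mono-≤ (∑ᴺ-mono D (λ k → ℕₚ.≤-trans (ℕₚ.*-monoʳ-≤ (pow (2 ℕ.+ e) (2 ℕ.+ k)) (ind≤1 ((2 ℕ.+ k) ℕ.* M) z)) (eq k))) (eq D)) ⟩
    2 ℕ.* P ℕ.* ∑ᴺ (suc D) (λ k → (2 ℕ.+ k) ℕ.^ (2 ℕ.+ e))     ≡⟨ ring P (∑ᴺ (suc D) (λ k → (2 ℕ.+ k) ℕ.^ (2 ℕ.+ e))) ⟩
    2 ℕ.* ∑ᴺ (suc D) (λ k → (2 ℕ.+ k) ℕ.^ (2 ℕ.+ e)) ℕ.* P     ≤⟨ ℕₚ.*-monoˡ-≤ P (∑ᴺ-powers e (suc D)) ⟩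
    (2 ℕ.+ D) ℕ.^ (3 ℕ.+ e) ℕ.* P                              ≡⟨ cong (ℕ._* P) (pow≡^ (3 ℕ.+ e) (2 ℕ.+ D)) ⟨
    pow (3 ℕ.+ e) (2 ℕ.+ D) ℕ.* P                              ≡⟨ pow-* (3 ℕ.+ e) (2 ℕ.+ D) M ⟨
    pow (3 ℕ.+ e) ((2 ℕ.+ D) ℕ.* M)                            ≤⟨ pow-mono (3 ℕ.+ e) (ℕₚ.m≤n⇒m≤1+n le) ⟩
    pow (3 ℕ.+ e) (suc z)                                      ∎
    where
    open ℕₚ.≤-Reasoning
    P = pow (3 ℕ.+ e) M
    ind≤1 : ∀ c z → ind c z ℕ.≤ 1
    ind≤1 c z with c ℕ.≤? z
    ... | yes _ = ℕₚ.≤-refl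
    ... | no  _ = z≤n
    eq : ∀ k → pow (2 ℕ.+ e) (2 ℕ.+ k) ℕ.* 1 ℕ.≤ (2 ℕ.+ k) ℕ.^ (2 ℕ.+ e)
    eq k = ℕₚ.≤-reflexive (trans (ℕₚ.*-identityʳ _) (pow≡^ (2 ℕ.+ e) (2 ℕ.+ k)))
    ring : ∀ P S → 2 ℕ.* P ℕ.* S ≡ 2 ℕ.* S ℕ.* P
    ring = ℕS.solve-∀

  ∑ᴺ-odd : ∀ Z (h : ℕ → ℕ) → ∑ᴺ Z (λ z → h (suc (2 ℕ.* z))) ℕ.≤ ∑ᴺ (2 ℕ.* Z) h
  ∑ᴺ-odd zero    h = z≤n
  ∑ᴺ-odd (suc Z) h = ℕₚ.≤-trans (ℕₚ.+-mono-≤ (ℕₚ.≤-trans (∑ᴺ-odd Z h) (ℕₚ.m≤m+n _ (h (2 ℕ.* Z)))) ℕₚ.≤-refl)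
    (ℕₚ.≤-reflexive (cong (λ z → ∑ᴺ z h) (ring Z)))
    where
    ring : ∀ Z → suc (suc (2 ℕ.* Z)) ≡ 2 ℕ.* suc Z
    ring = ℕS.solve-∀

  module _ (p : ℕ) where

    -- At j = 0 the combination that represents the weight; each further j multiplies by y - y⁻¹,
    -- which is a central difference of step 2 up to sign.
    G : ℕ → ℤ → ℤ
    G j t = + 3 * coef (3 ℕ.+ j) (p ℕ.+ 3) t + + (p ℕ.+ 3) * coef (5 ℕ.+ j) (p ℕ.+ 1) t

    G-B : ∀ j t → G (suc j) t ≡ G j (t - 1ℤ) - G j (t + 1ℤ)
    G-B j t = trans (cong₂ (λ x y → + 3 * x + + (p ℕ.+ 3) * y)
        (trans (cong (λ k → coef k (p ℕ.+ 3) t) (ℕₚ.+-suc 3 j)) (coef-B (3 ℕ.+ j) (p ℕ.+ 3) t))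
        (trans (cong (λ k → coef k (p ℕ.+ 1) t) (ℕₚ.+-suc 5 j)) (coef-B (5 ℕ.+ j) (p ℕ.+ 1) t)))
      (ring (+ (p ℕ.+ 3)) (coef (3 ℕ.+ j) (p ℕ.+ 3) (t - 1ℤ)) (coef (3 ℕ.+ j) (p ℕ.+ 3) (t + 1ℤ)) (coef (5 ℕ.+ j) (p ℕ.+ 1) (t - 1ℤ)) (coef (5 ℕ.+ j) (p ℕ.+ 1) (t + 1ℤ)))
      where
      ring : ∀ c a a′ b b′ → + 3 * (a - a′) + c * (b - b′) ≡ + 3 * a + c * b - (+ 3 * a′ + c * b′)
      ring = solve-∀

    G-parity : ∀ j t → G j (- t) ≡ - sgn j * G j t
    G-parity j t = trans (cong₂ (λ x y → + 3 * x + + (p ℕ.+ 3) * y) (coef-parity (3 ℕ.+ j) (p ℕ.+ 3) t) (coef-parity (5 ℕ.+ j) (p ℕ.+ 1) t))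
      (ring (sgn j) (+ (p ℕ.+ 3)) (coef (3 ℕ.+ j) (p ℕ.+ 3) t) (coef (5 ℕ.+ j) (p ℕ.+ 1) t))
      where
      ring : ∀ g c a b → + 3 * (- - - g * a) + c * (- - - - - g * b) ≡ - g * (+ 3 * a + c * b)
      ring = solve-∀

    u : ℤ → ℤ
    u x = G 0 (+ 2 * x)

    u-odd : ∀ x → u (- x) ≡ - u x
    u-odd x = trans (cong (G 0) (sym (ℤₚ.neg-distribʳ-* (+ 2) x))) (trans (G-parity 0 (+ 2 * x)) (ℤₚ.-1*i≡-i _))

    -- A unit step of x is a step 2 of t. Each forward difference is a factor y - y⁻¹ up to sign and
    -- moves the centre by one, which accounts for the summand + j.
    Δ^-u : ∀ j b v → Δ^ j (λ i → u (b + + i)) v ≡ sgn j * G j (+ 2 * (b + + v) + + j)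
    Δ^-u zero    b v = trans (cong (G 0) (sym (ℤₚ.+-identityʳ (+ 2 * (b + + v))))) (sym (ℤₚ.*-identityˡ _))
    Δ^-u (suc j) b v = begin
      Δ^ (suc j) e v                                       ≡⟨ Δ^-suc j e v ⟩
      Δ^ j e (suc v) - Δ^ j e v                            ≡⟨ cong₂ _-_ (Δ^-u j b (suc v)) (Δ^-u j b v) ⟩
      sgn j * G j (+ 2 * (b + + suc v) + + j) - sgn j * G j (+ 2 * (b + + v) + + j)
        ≡⟨ cong₂ (λ x y → sgn j * G j x - sgn j * G j y) (ring₁ b (+ v) (+ j)) (ring₂ b (+ v) (+ j)) ⟩
      sgn j * G j (t + 1ℤ) - sgn j * G j (t - 1ℤ)          ≡⟨ ring₃ (sgn j) (G j (t + 1ℤ)) (G j (t - 1ℤ)) ⟩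
      - sgn j * (G j (t - 1ℤ) - G j (t + 1ℤ))              ≡⟨ cong (- sgn j *_) (G-B j t) ⟨
      - sgn j * G (suc j) t                                ∎
      where
      open ≡-Reasoning
      e = λ i → u (b + + i)
      t = + 2 * (b + + v) + + suc j
      ring₁ : ∀ b v j → + 2 * (b + (1ℤ + v)) + j ≡ + 2 * (b + v) + (1ℤ + j) + 1ℤ
      ring₁ = solve-∀
      ring₂ : ∀ b v j → + 2 * (b + v) + j ≡ + 2 * (b + v) + (1ℤ + j) - 1ℤ
      ring₂ = solve-∀
      ring₃ : ∀ g x y → g * x - g * y ≡ - g * (y - x)
      ring₃ = solve-∀

    ∣sgn∣ : ∀ j x → ∣ sgn j * x ∣ ≡ ∣ x ∣
    ∣sgn∣ zero    x = cong ∣_∣ (ℤₚ.*-identityˡ x)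
    ∣sgn∣ (suc j) x = trans (cong ∣_∣ (sym (ℤₚ.neg-distribˡ-* (sgn j) x))) (trans (ℤₚ.∣-i∣≡∣i∣ (sgn j * x)) (∣sgn∣ j x))

    ∣G∣-even : ∀ j t → ∣ G j (- t) ∣ ≡ ∣ G j t ∣
    ∣G∣-even j t = trans (cong ∣_∣ (G-parity j t)) (∣sgn∣ (suc j) (G j t))

    Γ : ℕ → ℕ → ℕ
    Γ k z = ∣ G (2 ℕ.* k) (+ (2 ℕ.* z)) ∣

    δ-right : ∀ k b v z → b + + v + + k ≡ + z → ∣ δ (2 ℕ.* k) (λ j → u (b + + j)) v ∣ ≡ Γ k z
    δ-right k b v z eq = trans (cong ∣_∣ (trans (δ≡Δ^ (2 ℕ.* k) (λ j → u (b + + j)) v) (Δ^-u (2 ℕ.* k) b v))) (trans (∣sgn∣ (2 ℕ.* k) (G (2 ℕ.* k) (+ 2 * (b + + v) + + (2 ℕ.* k))))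
      (cong (λ z → ∣ G (2 ℕ.* k) z ∣) (trans (cong (λ z → + 2 * (b + + v) + z) (ℤₚ.pos-* 2 k)) (trans (ring b (+ v) (+ k)) (trans (cong (+ 2 *_) eq) (sym (ℤₚ.pos-* 2 z)))))))
      where
      ring : ∀ b v k → + 2 * (b + v) + + 2 * k ≡ + 2 * (b + v + k)
      ring = solve-∀

    -- Reflection: the left-hand differences are again those of u, since u is odd.
    δ-left : ∀ k b c v z → b + c - + v - + k ≡ + z → ∣ δ (2 ℕ.* k) (λ j → u (b + (c - + j))) v ∣ ≡ Γ k z
    δ-left k b c v z eq = begin
      ∣ δ (2 ℕ.* k) (λ j → u (b + (c - + j))) v ∣           ≡⟨ cong ∣_∣ (δ≡Δ^ (2 ℕ.* k) _ v) ⟩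
      ∣ Δ^ (2 ℕ.* k) (λ j → u (b + (c - + j))) v ∣          ≡⟨ cong ∣_∣ (Δ^-cong (2 ℕ.* k) (λ j → trans (cong u (ring₁ b c (+ j))) (trans (u-odd _) (sym (ℤₚ.-1*i≡-i _)))) v) ⟩
      ∣ Δ^ (2 ℕ.* k) (λ j → -1ℤ * u (b′ + + j)) v ∣         ≡⟨ cong ∣_∣ (Δ^-* (2 ℕ.* k) -1ℤ (λ j → u (b′ + + j)) v) ⟩
      ∣ -1ℤ * Δ^ (2 ℕ.* k) (λ j → u (b′ + + j)) v ∣         ≡⟨ ∣sgn∣ 1 (Δ^ (2 ℕ.* k) (λ j → u (b′ + + j)) v) ⟩
      ∣ Δ^ (2 ℕ.* k) (λ j → u (b′ + + j)) v ∣               ≡⟨ cong ∣_∣ (Δ^-u (2 ℕ.* k) b′ v) ⟩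
      ∣ sgn (2 ℕ.* k) * G (2 ℕ.* k) (+ 2 * (b′ + + v) + + (2 ℕ.* k)) ∣ ≡⟨ ∣sgn∣ (2 ℕ.* k) _ ⟩
      ∣ G (2 ℕ.* k) (+ 2 * (b′ + + v) + + (2 ℕ.* k)) ∣      ≡⟨ cong (λ z → ∣ G (2 ℕ.* k) z ∣) (trans (cong (λ z → + 2 * (b′ + + v) + z) (ℤₚ.pos-* 2 k)) (trans (ring₂ b c (+ v) (+ k)) (cong -_ (trans (cong (+ 2 *_) eq) (sym (ℤₚ.pos-* 2 z)))))) ⟩
      ∣ G (2 ℕ.* k) (- + (2 ℕ.* z)) ∣                       ≡⟨ ∣G∣-even (2 ℕ.* k) (+ (2 ℕ.* z)) ⟩
      Γ k z                                                 ∎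
      where
      open ≡-Reasoning
      b′ = - (b + c)
      ring₁ : ∀ b c j → b + (c - j) ≡ - (- (b + c) + j)
      ring₁ = solve-∀
      ring₂ : ∀ b c v k → + 2 * (- (b + c) + v) + + 2 * k ≡ - (+ 2 * (b + c - v - k))
      ring₂ = solve-∀

-- The sum over all panels

module PanelSum where

  open Sums
  open Coefficients
  open Quadrature
  open PanelBound
  open BlockSums
  open import Data.Nat as ℕ using (ℕ; zero; suc)
  import Data.Nat.Properties as ℕₚ
  open import Data.Integer using (ℤ; +_; -[1+_]; _+_; _*_; _-_; -_; ∣_∣; 0ℤ; 1ℤ)
  import Data.Integer.Properties as ℤₚ
  open import Data.Integer.Tactic.RingSolver using (solve-∀)
  import Data.Nat.Tactic.RingSolver as ℕS
  open import Relation.Binary.PropositionalEquality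

  module _ (p : ℕ) where

    -- The panel from i d to (i + 1) d; subtracting 5 undoes the normalisation inside `panel`.
    panelAt : ℕ → ℕ → ℤ
    panelAt d i = panel (λ x → u p (+ (i ℕ.* d) - + 5 + x)) d

    -- The windows of twelfth differences have length 6d on the right and 5d on the left, so
    -- neighbouring panels count a position at most six and five times.
    c₀ K₀ : ℕ
    c₀ = pow 11 2 ℕ.* fact 11
    K₀ = 6 ℕ.* Kʳ ℕ.+ 5 ℕ.* Kˡ

    private
      γ : ℕ → ℕ
      γ = Γ p 6

    -- The 5 in the panel index makes room for the five nodes to the left: every twelfth difference
    -- that occurs is centred beyond M d.
    panelAt-bound : ∀ d M k → 2 ℕ.≤ d →
      c₀ ℕ.* ∣ panelAt d (5 ℕ.+ (M ℕ.+ k)) ∣ ℕ.≤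
      pow 12 d ℕ.* (Kʳ ℕ.* ∑ᴺ (6 ℕ.* d) (λ v → γ (suc (M ℕ.* d ℕ.+ (5 ℕ.* d ℕ.+ (k ℕ.* d ℕ.+ v)))))
                ℕ.+ Kˡ ℕ.* ∑ᴺ (5 ℕ.* d) (λ v → γ (suc (M ℕ.* d ℕ.+ (k ℕ.* d ℕ.+ v)))))
    panelAt-bound d M k d≥2 = begin
      c₀ ℕ.* ∣ panelAt d (5 ℕ.+ (M ℕ.+ k)) ∣                ≤⟨ panel-bound (u p) b d d≥2 ⟩
      d ℕ.* pow 11 d ℕ.* (Kʳ ℕ.* ∑ᴺ (6 ℕ.* d) (λ v → ∣ δ 12 (λ j → u p (b + + j)) v ∣) ℕ.+ Kˡ ℕ.* ∑ᴺ (5 ℕ.* d) (λ v → ∣ δ 12 (λ j → u p (b + (+ 11 - + j))) v ∣))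
        ≡⟨ cong₂ ℕ._*_ (sym (pow-suc 11 d)) (cong₂ (λ x y → Kʳ ℕ.* x ℕ.+ Kˡ ℕ.* y) right left) ⟩
      pow 12 d ℕ.* (Kʳ ℕ.* ∑ᴺ (6 ℕ.* d) (λ v → γ (suc (M ℕ.* d ℕ.+ (5 ℕ.* d ℕ.+ (k ℕ.* d ℕ.+ v))))) ℕ.+ Kˡ ℕ.* ∑ᴺ (5 ℕ.* d) (λ v → γ (suc (M ℕ.* d ℕ.+ (k ℕ.* d ℕ.+ v))))) ∎
      where
      open ℕₚ.≤-Reasoning
      y = (5 ℕ.+ (M ℕ.+ k)) ℕ.* d
      X = M ℕ.* d ℕ.+ k ℕ.* d
      b = + y - + 5
      ringʸ : ∀ M k d → (5 ℕ.+ (M ℕ.+ k)) ℕ.* d ≡ 5 ℕ.* d ℕ.+ (M ℕ.* d ℕ.+ k ℕ.* d)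
      ringʸ = ℕS.solve-∀
      ring₁ : ∀ y v → y - + 5 + v + + 6 ≡ 1ℤ + (y + v)
      ring₁ = solve-∀
      ring₂ : ∀ y v → y - + 5 + + 11 - v - + 6 ≡ y - v
      ring₂ = solve-∀
      ring₃ : ∀ M k d v → (5 ℕ.+ (M ℕ.+ k)) ℕ.* d ℕ.+ v ≡ M ℕ.* d ℕ.+ (5 ℕ.* d ℕ.+ (k ℕ.* d ℕ.+ v))
      ring₃ = ℕS.solve-∀
      right : ∑ᴺ (6 ℕ.* d) (λ v → ∣ δ 12 (λ j → u p (b + + j)) v ∣) ≡ ∑ᴺ (6 ℕ.* d) (λ v → γ (suc (M ℕ.* d ℕ.+ (5 ℕ.* d ℕ.+ (k ℕ.* d ℕ.+ v)))))
      right = ∑ᴺ-cong (6 ℕ.* d) (λ v → trans (δ-right p 6 b v (suc (y ℕ.+ v)) (ring₁ (+ y) (+ v))) (cong (λ z → γ (suc z)) (ring₃ M k d v)))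
      ∑ᴺ-cong< : ∀ n {f g : ℕ → ℕ} → (∀ i → i ℕ.< n → f i ≡ g i) → ∑ᴺ n f ≡ ∑ᴺ n g
      ∑ᴺ-cong< zero    e = refl
      ∑ᴺ-cong< (suc n) e = cong₂ ℕ._+_ (∑ᴺ-cong< n (λ i i<n → e i (ℕₚ.m<n⇒m<1+n i<n))) (e n (ℕₚ.n<1+n n))
      index : ∀ v → v ℕ.< 5 ℕ.* d → y ℕ.∸ (5 ℕ.* d ℕ.∸ suc v) ≡ suc (M ℕ.* d ℕ.+ (k ℕ.* d ℕ.+ v))
      index v v<5d = trans (cong (ℕ._∸ w) (trans (ringʸ M k d) (trans (cong (ℕ._+ X) (sym (ℕₚ.m+[n∸m]≡n v<5d))) (ring₄ v w X))))
                           (trans (ℕₚ.m+n∸n≡m (suc v ℕ.+ X) w) (ring₅ v (M ℕ.* d) (k ℕ.* d)))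
        where
        w = 5 ℕ.* d ℕ.∸ suc v
        ring₄ : ∀ v w X → suc v ℕ.+ w ℕ.+ X ≡ suc v ℕ.+ X ℕ.+ w
        ring₄ = ℕS.solve-∀
        ring₅ : ∀ v a b → suc v ℕ.+ (a ℕ.+ b) ≡ suc (a ℕ.+ (b ℕ.+ v))
        ring₅ = ℕS.solve-∀
      left : ∑ᴺ (5 ℕ.* d) (λ v → ∣ δ 12 (λ j → u p (b + (+ 11 - + j))) v ∣) ≡ ∑ᴺ (5 ℕ.* d) (λ v → γ (suc (M ℕ.* d ℕ.+ (k ℕ.* d ℕ.+ v))))
      left = trans (∑ᴺ-cong< (5 ℕ.* d) (λ v v<5d → δ-left p 6 b (+ 11) v (y ℕ.∸ v) (trans (ring₂ (+ y) (+ v)) (trans (ℤₚ.m-n≡m⊖n y v) (ℤₚ.⊖-≥ (ℕₚ.≤-trans (ℕₚ.<⇒≤ v<5d) (ℕₚ.≤-trans (ℕₚ.m≤m+n (5 ℕ.* d) X) (ℕₚ.≤-reflexive (sym (ringʸ M k d))))))))))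
        (trans (sym (∑ᴺ-reverse (5 ℕ.* d) (λ v → γ (y ℕ.∸ v)))) (∑ᴺ-cong< (5 ℕ.* d) (λ v v<5d → cong γ (index v v<5d))))

    module _ (M D I : ℕ) where

      Z : ℕ
      Z = (2 ℕ.+ D) ℕ.* (M ℕ.+ (11 ℕ.+ I))

      private
        tail : ℕ → ℕ
        tail d = ∑ᴺ Z (λ z → ind (d ℕ.* M) z ℕ.* γ (suc z))

        row-bound : ∀ d → 2 ℕ.≤ d → d ℕ.≤ 2 ℕ.+ D → c₀ ℕ.* ∑ᴺ I (λ k → ∣ panelAt d (5 ℕ.+ (M ℕ.+ k)) ∣) ℕ.≤ pow 12 d ℕ.* (K₀ ℕ.* tail d)
        row-bound d d≥2 d≤ = begin
          c₀ ℕ.* ∑ᴺ I (λ k → ∣ panelAt d (5 ℕ.+ (M ℕ.+ k)) ∣)      ≡⟨ ∑ᴺ-* I c₀ (λ k → ∣ panelAt d (5 ℕ.+ (M ℕ.+ k)) ∣) ⟨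
          ∑ᴺ I (λ k → c₀ ℕ.* ∣ panelAt d (5 ℕ.+ (M ℕ.+ k)) ∣)      ≤⟨ ∑ᴺ-mono I (λ k → panelAt-bound d M k d≥2) ⟩
          ∑ᴺ I (λ k → pow 12 d ℕ.* (Kʳ ℕ.* R k ℕ.+ Kˡ ℕ.* L k))    ≡⟨ ∑ᴺ-* I (pow 12 d) (λ k → Kʳ ℕ.* R k ℕ.+ Kˡ ℕ.* L k) ⟩
          pow 12 d ℕ.* ∑ᴺ I (λ k → Kʳ ℕ.* R k ℕ.+ Kˡ ℕ.* L k)      ≡⟨ cong (pow 12 d ℕ.*_) (trans (∑ᴺ-+ I (λ k → Kʳ ℕ.* R k) (λ k → Kˡ ℕ.* L k)) (cong₂ ℕ._+_ (∑ᴺ-* I Kʳ R) (∑ᴺ-* I Kˡ L))) ⟩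
          pow 12 d ℕ.* (Kʳ ℕ.* ∑ᴺ I R ℕ.+ Kˡ ℕ.* ∑ᴺ I L)           ≤⟨ ℕₚ.*-monoʳ-≤ (pow 12 d) (ℕₚ.+-mono-≤ (ℕₚ.*-monoʳ-≤ Kʳ R≤) (ℕₚ.*-monoʳ-≤ Kˡ L≤)) ⟩
          pow 12 d ℕ.* (Kʳ ℕ.* (6 ℕ.* tail d) ℕ.+ Kˡ ℕ.* (5 ℕ.* tail d)) ≡⟨ cong (pow 12 d ℕ.*_) (ring₁ Kʳ Kˡ (tail d)) ⟩
          pow 12 d ℕ.* (K₀ ℕ.* tail d)                             ∎
          where
          open ℕₚ.≤-Reasoning
          H : ℕ → ℕ
          H w = γ (suc (M ℕ.* d ℕ.+ w))
          R L : ℕ → ℕ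
          R k = ∑ᴺ (6 ℕ.* d) (λ v → H (5 ℕ.* d ℕ.+ (k ℕ.* d ℕ.+ v)))
          L k = ∑ᴺ (5 ℕ.* d) (λ v → H (k ℕ.* d ℕ.+ v))
          ring₁ : ∀ r l t → r ℕ.* (6 ℕ.* t) ℕ.+ l ℕ.* (5 ℕ.* t) ≡ (6 ℕ.* r ℕ.+ 5 ℕ.* l) ℕ.* t
          ring₁ = ℕS.solve-∀
          ring₂ : ∀ d I → 5 ℕ.* d ℕ.+ (6 ℕ.+ I) ℕ.* d ≡ (11 ℕ.+ I) ℕ.* d
          ring₂ = ℕS.solve-∀
          ring₃ : ∀ M I d → M ℕ.* d ℕ.+ (11 ℕ.+ I) ℕ.* d ≡ d ℕ.* (M ℕ.+ (11 ℕ.+ I))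
          ring₃ = ℕS.solve-∀
          H≤ : ∑ᴺ ((11 ℕ.+ I) ℕ.* d) H ℕ.≤ tail d
          H≤ = ℕₚ.≤-trans (∑ᴺ-ind (M ℕ.* d) ((11 ℕ.+ I) ℕ.* d) Z (λ z → γ (suc z)) (ℕₚ.≤-trans (ℕₚ.≤-reflexive (ring₃ M I d)) (ℕₚ.*-monoˡ-≤ _ d≤)))
               (ℕₚ.≤-reflexive (cong (λ c → ∑ᴺ Z (λ z → ind c z ℕ.* γ (suc z))) (ℕₚ.*-comm M d)))
          R≤ : ∑ᴺ I R ℕ.≤ 6 ℕ.* tail d
          R≤ = ℕₚ.≤-trans (∑ᴺ-windows I d 6 (λ w → H (5 ℕ.* d ℕ.+ w))) (ℕₚ.*-monoʳ-≤ 6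
                 (ℕₚ.≤-trans (∑ᴺ-shift (5 ℕ.* d) ((6 ℕ.+ I) ℕ.* d) H) (ℕₚ.≤-trans (ℕₚ.≤-reflexive (cong (λ z → ∑ᴺ z H) (ring₂ d I))) H≤)))
          L≤ : ∑ᴺ I L ℕ.≤ 5 ℕ.* tail d
          L≤ = ℕₚ.≤-trans (∑ᴺ-windows I d 5 H) (ℕₚ.*-monoʳ-≤ 5 (ℕₚ.≤-trans (∑ᴺ-extend H (ℕₚ.*-monoˡ-≤ d (ℕₚ.+-monoˡ-≤ I (ℕₚ.m≤m+n 5 6)))) H≤))

      panelSum : ℕ
      panelSum = ∑ᴺ D (λ k → ∑ᴺ I (λ j → ∣ panelAt (2 ℕ.+ k) (5 ℕ.+ (M ℕ.+ j)) ∣))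

      weightedNorm : ℕ → ℕ → ℕ
      weightedNorm r s = ∑±ᴺ (2 ℕ.* Z) (λ t → pow 13 ∣ t ∣ ℕ.* ∣ coef r s t ∣)

      private
        step₁ : 2 ℕ.* pow 13 M ℕ.* (c₀ ℕ.* panelSum) ℕ.≤ K₀ ℕ.* ∑ᴺ Z (λ z → pow 13 (suc z) ℕ.* γ (suc z))
        step₁ = begin
          P ℕ.* (c₀ ℕ.* panelSum)                                           ≡⟨ cong (P ℕ.*_) (∑ᴺ-* D c₀ (λ k → ∑ᴺ I (λ j → ∣ panelAt (2 ℕ.+ k) (5 ℕ.+ (M ℕ.+ j)) ∣))) ⟨
          P ℕ.* ∑ᴺ D (λ k → c₀ ℕ.* ∑ᴺ I (λ j → ∣ panelAt (2 ℕ.+ k) (5 ℕ.+ (M ℕ.+ j)) ∣))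
                                                                            ≤⟨ ℕₚ.*-monoʳ-≤ P (∑ᴺ-mono< D (λ k k<D → row-bound (2 ℕ.+ k) (ℕₚ.m≤m+n 2 k) (ℕₚ.+-monoʳ-≤ 2 (ℕₚ.<⇒≤ k<D)))) ⟩
          P ℕ.* ∑ᴺ D (λ k → pow 12 (2 ℕ.+ k) ℕ.* (K₀ ℕ.* tail (2 ℕ.+ k)))    ≡⟨ cong (P ℕ.*_) (trans (∑ᴺ-cong D (λ k → ring₁ (pow 12 (2 ℕ.+ k)) K₀ (tail (2 ℕ.+ k)))) (∑ᴺ-* D K₀ (λ k → pow 12 (2 ℕ.+ k) ℕ.* tail (2 ℕ.+ k)))) ⟩
          P ℕ.* (K₀ ℕ.* ∑ᴺ D (λ k → pow 12 (2 ℕ.+ k) ℕ.* tail (2 ℕ.+ k)))    ≡⟨ cong (λ z → P ℕ.* (K₀ ℕ.* z)) (trans (∑ᴺ-cong D (λ k → sym (∑ᴺ-* Z (pow 12 (2 ℕ.+ k)) (λ z → ind ((2 ℕ.+ k) ℕ.* M) z ℕ.* γ (suc z)))))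
                                                                                  (∑ᴺ-swap D Z (λ k z → pow 12 (2 ℕ.+ k) ℕ.* (ind ((2 ℕ.+ k) ℕ.* M) z ℕ.* γ (suc z))))) ⟩
          P ℕ.* (K₀ ℕ.* ∑ᴺ Z (λ z → ∑ᴺ D (λ k → pow 12 (2 ℕ.+ k) ℕ.* (ind ((2 ℕ.+ k) ℕ.* M) z ℕ.* γ (suc z)))))
                                                                            ≡⟨ trans (ring₂ P K₀ _) (cong (K₀ ℕ.*_) (sym (∑ᴺ-* Z P _))) ⟩
          K₀ ℕ.* ∑ᴺ Z (λ z → P ℕ.* ∑ᴺ D (λ k → pow 12 (2 ℕ.+ k) ℕ.* (ind ((2 ℕ.+ k) ℕ.* M) z ℕ.* γ (suc z))))
                                                                            ≤⟨ ℕₚ.*-monoʳ-≤ K₀ (∑ᴺ-mono Z pointwise) ⟩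
          K₀ ℕ.* ∑ᴺ Z (λ z → pow 13 (suc z) ℕ.* γ (suc z))                  ∎
          where
          open ℕₚ.≤-Reasoning
          P = 2 ℕ.* pow 13 M
          ring₁ : ∀ a b c → a ℕ.* (b ℕ.* c) ≡ b ℕ.* (a ℕ.* c)
          ring₁ = ℕS.solve-∀
          ring₂ : ∀ a b c → a ℕ.* (b ℕ.* c) ≡ b ℕ.* (a ℕ.* c)
          ring₂ = ℕS.solve-∀
          ring₃ : ∀ a b c → a ℕ.* (b ℕ.* c) ≡ c ℕ.* (a ℕ.* b)
          ring₃ = ℕS.solve-∀
          ring₄ : ∀ P g S → P ℕ.* (g ℕ.* S) ≡ P ℕ.* S ℕ.* g
          ring₄ = ℕS.solve-∀
          pointwise : ∀ z → P ℕ.* ∑ᴺ D (λ k → pow 12 (2 ℕ.+ k) ℕ.* (ind ((2 ℕ.+ k) ℕ.* M) z ℕ.* γ (suc z))) ℕ.≤ pow 13 (suc z) ℕ.* γ (suc z)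
          pointwise z = ℕₚ.≤-trans (ℕₚ.≤-reflexive (trans (cong (P ℕ.*_) (trans (∑ᴺ-cong D (λ k → ring₃ (pow 12 (2 ℕ.+ k)) (ind ((2 ℕ.+ k) ℕ.* M) z) (γ (suc z))))
                                                               (∑ᴺ-* D (γ (suc z)) (λ k → pow 12 (2 ℕ.+ k) ℕ.* ind ((2 ℕ.+ k) ℕ.* M) z))))
                                                          (ring₄ P (γ (suc z)) (∑ᴺ D (λ k → pow 12 (2 ℕ.+ k) ℕ.* ind ((2 ℕ.+ k) ℕ.* M) z)))))
                                   (ℕₚ.*-monoˡ-≤ (γ (suc z)) (∑ᴺ-ind-powers 10 M D z))

        f : ℤ → ℕ
        f t = pow 13 ∣ t ∣ ℕ.* ∣ G p 12 t ∣

        -- The differences sit at even arguments t = 2z, which replaces z^13 by t^13/2^13; counting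
        -- both t and -t gives the other factor 2.
        step₂ : 2 ℕ.* (pow 13 2 ℕ.* ∑ᴺ Z (λ z → pow 13 (suc z) ℕ.* γ (suc z))) ℕ.≤ ∑±ᴺ (2 ℕ.* Z) f
        step₂ = begin
          2 ℕ.* (pow 13 2 ℕ.* ∑ᴺ Z (λ z → pow 13 (suc z) ℕ.* γ (suc z)))    ≡⟨ cong (2 ℕ.*_) (trans (sym (∑ᴺ-* Z (pow 13 2) (λ z → pow 13 (suc z) ℕ.* γ (suc z)))) (∑ᴺ-cong Z eq)) ⟩
          2 ℕ.* ∑ᴺ Z (λ z → f (+ suc (suc (2 ℕ.* z))))                      ≤⟨ ℕₚ.*-monoʳ-≤ 2 (∑ᴺ-odd Z (λ i → f (+ suc i))) ⟩
          2 ℕ.* ∑ᴺ (2 ℕ.* Z) (λ i → f (+ suc i))                            ≡⟨ ∑ᴺ-* (2 ℕ.* Z) 2 (λ i → f (+ suc i)) ⟨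
          ∑ᴺ (2 ℕ.* Z) (λ i → 2 ℕ.* f (+ suc i))                            ≡⟨ ∑ᴺ-cong (2 ℕ.* Z) (λ i → trans (cong (f (+ suc i) ℕ.+_) (ℕₚ.+-identityʳ _)) (cong (f (+ suc i) ℕ.+_) (even i))) ⟩
          ∑ᴺ (2 ℕ.* Z) (λ i → f (+ suc i) ℕ.+ f -[1+ i ])                   ≤⟨ ℕₚ.m≤n+m _ (f 0ℤ) ⟩
          ∑±ᴺ (2 ℕ.* Z) f                                                   ∎
          where
          open ℕₚ.≤-Reasoning
          even : ∀ i → f (+ suc i) ≡ f -[1+ i ]
          even i = cong (pow 13 (suc i) ℕ.*_) (sym (∣G∣-even p 12 (+ suc i)))
          ring : ∀ z → 2 ℕ.* suc z ≡ suc (suc (2 ℕ.* z))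
          ring = ℕS.solve-∀
          eq : ∀ z → pow 13 2 ℕ.* (pow 13 (suc z) ℕ.* γ (suc z)) ≡ f (+ suc (suc (2 ℕ.* z)))
          eq z = trans (sym (ℕₚ.*-assoc (pow 13 2) (pow 13 (suc z)) (γ (suc z))))
                 (trans (cong (ℕ._* γ (suc z)) (sym (pow-* 13 2 (suc z)))) (cong (λ m → pow 13 m ℕ.* ∣ G p 12 (+ m) ∣) (ring z)))

        step₃ : ∑±ᴺ (2 ℕ.* Z) f ℕ.≤ 3 ℕ.* weightedNorm 15 (p ℕ.+ 3) ℕ.+ (p ℕ.+ 3) ℕ.* weightedNorm 17 (p ℕ.+ 1)
        step₃ = begin
          ∑±ᴺ (2 ℕ.* Z) f                                                   ≤⟨ ∑±ᴺ-mono (2 ℕ.* Z) pointwise ⟩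
          ∑±ᴺ (2 ℕ.* Z) (λ t → 3 ℕ.* g₁ t ℕ.+ (p ℕ.+ 3) ℕ.* g₂ t)           ≡⟨ ∑±ᴺ-+ (2 ℕ.* Z) (λ t → 3 ℕ.* g₁ t) (λ t → (p ℕ.+ 3) ℕ.* g₂ t) ⟩
          ∑±ᴺ (2 ℕ.* Z) (λ t → 3 ℕ.* g₁ t) ℕ.+ ∑±ᴺ (2 ℕ.* Z) (λ t → (p ℕ.+ 3) ℕ.* g₂ t) ≡⟨ cong₂ ℕ._+_ (∑±ᴺ-* (2 ℕ.* Z) 3 g₁) (∑±ᴺ-* (2 ℕ.* Z) (p ℕ.+ 3) g₂) ⟩
          3 ℕ.* weightedNorm 15 (p ℕ.+ 3) ℕ.+ (p ℕ.+ 3) ℕ.* weightedNorm 17 (p ℕ.+ 1) ∎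
          where
          open ℕₚ.≤-Reasoning
          g₁ g₂ : ℤ → ℕ
          g₁ t = pow 13 ∣ t ∣ ℕ.* ∣ coef 15 (p ℕ.+ 3) t ∣
          g₂ t = pow 13 ∣ t ∣ ℕ.* ∣ coef 17 (p ℕ.+ 1) t ∣
          ring : ∀ w a c b → w ℕ.* (3 ℕ.* a ℕ.+ c ℕ.* b) ≡ 3 ℕ.* (w ℕ.* a) ℕ.+ c ℕ.* (w ℕ.* b)
          ring = ℕS.solve-∀
          pointwise : ∀ t → f t ℕ.≤ 3 ℕ.* g₁ t ℕ.+ (p ℕ.+ 3) ℕ.* g₂ t
          pointwise t = ℕₚ.≤-trans (ℕₚ.*-monoʳ-≤ (pow 13 ∣ t ∣) (ℕₚ.≤-trans (ℤₚ.∣i+j∣≤∣i∣+∣j∣ (+ 3 * coef 15 (p ℕ.+ 3) t) (+ (p ℕ.+ 3) * coef 17 (p ℕ.+ 1) t))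
              (ℕₚ.≤-reflexive (cong₂ ℕ._+_ (ℤₚ.∣i*j∣≡∣i∣*∣j∣ (+ 3) (coef 15 (p ℕ.+ 3) t)) (ℤₚ.∣i*j∣≡∣i∣*∣j∣ (+ (p ℕ.+ 3)) (coef 17 (p ℕ.+ 1) t))))))
            (ℕₚ.≤-reflexive (ring (pow 13 ∣ t ∣) (∣ coef 15 (p ℕ.+ 3) t ∣) (p ℕ.+ 3) (∣ coef 17 (p ℕ.+ 1) t ∣)))

      panelSum-bound : 2 ℕ.* pow 13 2 ℕ.* (2 ℕ.* pow 13 M ℕ.* (c₀ ℕ.* panelSum)) ℕ.≤
                       K₀ ℕ.* (3 ℕ.* weightedNorm 15 (p ℕ.+ 3) ℕ.+ (p ℕ.+ 3) ℕ.* weightedNorm 17 (p ℕ.+ 1))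
      panelSum-bound = begin
        2 ℕ.* pow 13 2 ℕ.* (2 ℕ.* pow 13 M ℕ.* (c₀ ℕ.* panelSum))           ≤⟨ ℕₚ.*-monoʳ-≤ (2 ℕ.* pow 13 2) step₁ ⟩
        2 ℕ.* pow 13 2 ℕ.* (K₀ ℕ.* ∑ᴺ Z (λ z → pow 13 (suc z) ℕ.* γ (suc z))) ≡⟨ ring (pow 13 2) K₀ _ ⟩
        K₀ ℕ.* (2 ℕ.* (pow 13 2 ℕ.* ∑ᴺ Z (λ z → pow 13 (suc z) ℕ.* γ (suc z)))) ≤⟨ ℕₚ.*-monoʳ-≤ K₀ (ℕₚ.≤-trans step₂ step₃) ⟩
        K₀ ℕ.* (3 ℕ.* weightedNorm 15 (p ℕ.+ 3) ℕ.+ (p ℕ.+ 3) ℕ.* weightedNorm 17 (p ℕ.+ 1)) ∎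
        where
        open ℕₚ.≤-Reasoning
        ring : ∀ a b c → 2 ℕ.* a ℕ.* (b ℕ.* c) ≡ b ℕ.* (2 ℕ.* (a ℕ.* c))
        ring = ℕS.solve-∀

-- Divisor sums, binomial coefficients and the algebra of the weight

module DivisorSums where

  open Sums
  open Coefficients
  open Quadrature
  open import Defs
  open import Data.Nat as ℕ using (ℕ; zero; suc; s≤s; z≤n)
  import Data.Nat.Properties as ℕₚ
  open import Data.Nat.Divisibility as ∣ using (_∣_; _∣?_; divides)
  open import Data.Nat.Combinatorics using (_C_; nCk+nC[k+1]≡[n+1]C[k+1]; k>n⇒nCk≡0)
  open import Data.Nat.ListAction using (sum)
  open import Data.Integer using (ℤ; +_; _+_; _*_; _-_; -_; ∣_∣; 0ℤ; 1ℤ)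
  import Data.Integer.Properties as ℤₚ
  open import Data.Integer.Tactic.RingSolver using (solve-∀)
  open import Data.List using (map; filter; applyUpTo)
  open import Data.Empty using (⊥)
  open import Data.Bool using (true; false; if_then_else_)
  open import Function using (id; _∘_)
  open import Relation.Nullary using (yes; no; contradiction; does)
  open import Relation.Binary.PropositionalEquality

  sumℤ-range1 : ∀ n (f : ℕ → ℤ) → sumℤ (map f (range1 n)) ≡ ∑ n (λ i → f (suc i))
  sumℤ-range1 n f = go n id
    where
    go : ∀ n (e : ℕ → ℕ) → sumℤ (map f (map suc (applyUpTo e n))) ≡ ∑ n (λ i → f (suc (e i)))
    go zero    e = refl
    go (suc n) e = trans (cong (λ z → f (suc (e 0)) + z) (go n (e ∘ suc))) (sym (∑-head n (λ i → f (suc (e i)))))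

  ∑-extend : ∀ {m n} (f : ℕ → ℤ) → m ℕ.≤ n → (∀ i → m ℕ.≤ i → f i ≡ 0ℤ) → ∑ n f ≡ ∑ m f
  ∑-extend {m} {n} f m≤n f≡0 = begin
    ∑ n f                                          ≡⟨ cong (λ k → ∑ k f) (ℕₚ.m+[n∸m]≡n m≤n) ⟨
    ∑ (m ℕ.+ (n ℕ.∸ m)) f                          ≡⟨ ∑-split m (n ℕ.∸ m) f ⟩
    ∑ m f + ∑ (n ℕ.∸ m) (λ i → f (m ℕ.+ i))        ≡⟨ cong (λ z → ∑ m f + z) (∑-0 (n ℕ.∸ m) (λ i → f≡0 (m ℕ.+ i) (ℕₚ.m≤m+n m i))) ⟩
    ∑ m f + 0ℤ                                     ≡⟨ ℤₚ.+-identityʳ (∑ m f) ⟩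
    ∑ m f                                          ∎
    where open ≡-Reasoning

  dvd : ℕ → ℕ → ℤ
  dvd d k = if does (d ∣? k) then 1ℤ else 0ℤ

  dvd-yes : ∀ d k → d ∣ k → dvd d k ≡ 1ℤ
  dvd-yes d k d∣k with d ∣? k
  ... | yes _ = refl
  ... | no ¬p = contradiction d∣k ¬p

  dvd-no : ∀ d k → (d ∣ k → ⊥) → dvd d k ≡ 0ℤ
  dvd-no d k d∤k with d ∣? k
  ... | yes p = contradiction p d∤k
  ... | no _  = refl

  σ-∑ : ∀ k n → suc k ℕ.≤ n → + σ (suc k) ≡ ∑ n (λ i → dvd (suc i) (suc k) * + suc i)
  σ-∑ k n k<n = trans (go (suc k) id) (sym (∑-extend (λ i → dvd (suc i) (suc k) * + suc i) k<n
      (λ i k<i → trans (cong (_* + suc i) (dvd-no (suc i) (suc k) (λ d → ℕₚ.<⇒≱ (s≤s k<i) (∣.∣⇒≤ d)))) refl)))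
    where
    go : ∀ n (e : ℕ → ℕ) → + sum (filter (_∣? suc k) (map suc (applyUpTo e n))) ≡ ∑ n (λ i → dvd (suc (e i)) (suc k) * + suc (e i))
    go zero    e = refl
    go (suc n) e with does (suc (e 0) ∣? suc k) in eq
    ... | true  = trans (cong (λ z → + suc (e 0) + z) (go n (e ∘ suc)))
                  (sym (trans (∑-head n (λ i → dvd (suc (e i)) (suc k) * + suc (e i)))
                       (cong (_+ ∑ n (λ i → dvd (suc (e (suc i))) (suc k) * + suc (e (suc i)))) (trans (cong (λ b → (if b then 1ℤ else 0ℤ) * + suc (e 0)) eq) (ℤₚ.*-identityˡ (+ suc (e 0)))))))
    ... | false = trans (go n (e ∘ suc))
                  (sym (trans (∑-head n (λ i → dvd (suc (e i)) (suc k) * + suc (e i)))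
                       (trans (cong (_+ ∑ n (λ i → dvd (suc (e (suc i))) (suc k) * + suc (e (suc i)))) (cong (λ b → (if b then 1ℤ else 0ℤ) * + suc (e 0)) eq)) (ℤₚ.+-identityˡ _))))

  -- Among the numbers of each block of length e + 1 only the last is a multiple of e + 1.
  ∑-block : ∀ e X (y : ℕ → ℤ) → ∑ (X ℕ.* suc e) (λ k → dvd (suc e) (suc k) * y (suc k)) ≡ ∑ X (λ m → y (suc m ℕ.* suc e))
  ∑-block e zero    y = refl
  ∑-block e (suc X) y = begin
    ∑ (suc e ℕ.+ X ℕ.* suc e) h                                  ≡⟨ cong (λ z → ∑ z h) (ℕₚ.+-comm (suc e) (X ℕ.* suc e)) ⟩
    ∑ (X ℕ.* suc e ℕ.+ suc e) h                                  ≡⟨ ∑-split (X ℕ.* suc e) (suc e) h ⟩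
    ∑ (X ℕ.* suc e) h + (∑ e (λ v → h (X ℕ.* suc e ℕ.+ v)) + h (X ℕ.* suc e ℕ.+ e))
      ≡⟨ cong₂ (λ a b → a + (b + h (X ℕ.* suc e ℕ.+ e))) (∑-block e X y) (trans (∑-cong< e inner) (∑-0 e (λ _ → refl))) ⟩
    ∑ X (λ m → y (suc m ℕ.* suc e)) + (0ℤ + h (X ℕ.* suc e ℕ.+ e)) ≡⟨ cong (λ z → ∑ X (λ m → y (suc m ℕ.* suc e)) + z) (trans (ℤₚ.+-identityˡ _) last) ⟩
    ∑ X (λ m → y (suc m ℕ.* suc e)) + y (suc X ℕ.* suc e)        ∎
    where
    open ≡-Reasoning
    h : ℕ → ℤ
    h k = dvd (suc e) (suc k) * y (suc k)
    inner : ∀ v → v ℕ.< e → h (X ℕ.* suc e ℕ.+ v) ≡ 0ℤ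
    inner v v<e = trans (cong (_* y (suc (X ℕ.* suc e ℕ.+ v))) (dvd-no (suc e) (suc (X ℕ.* suc e ℕ.+ v)) no-dvd)) (ℤₚ.*-zeroˡ (y (suc (X ℕ.* suc e ℕ.+ v))))
      where
      no-dvd : suc e ∣ suc (X ℕ.* suc e ℕ.+ v) → ⊥
      no-dvd d = ℕₚ.<⇒≱ (s≤s v<e) (∣.∣⇒≤ (∣.∣m+n∣m⇒∣n (subst (suc e ∣_) (sym (ℕₚ.+-suc (X ℕ.* suc e) v)) d) (divides X refl)))
    last : h (X ℕ.* suc e ℕ.+ e) ≡ y (suc X ℕ.* suc e)
    last = trans (cong₂ (λ a b → a * y b) (dvd-yes (suc e) (suc (X ℕ.* suc e ℕ.+ e)) (divides (suc X) eq)) eq) (ℤₚ.*-identityˡ _)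
      where
      eq : suc (X ℕ.* suc e ℕ.+ e) ≡ suc X ℕ.* suc e
      eq = trans (sym (ℕₚ.+-suc (X ℕ.* suc e) e)) (ℕₚ.+-comm (X ℕ.* suc e) (suc e))

  ∑-multiples : ∀ e X n (y : ℕ → ℤ) → n ℕ.≤ X → (∀ k → n ℕ.< k → y k ≡ 0ℤ) →
                ∑ n (λ k → dvd (suc e) (suc k) * y (suc k)) ≡ ∑ X (λ m → y (suc m ℕ.* suc e))
  ∑-multiples e X n y n≤X y≡0 = trans (sym (∑-extend (λ k → dvd (suc e) (suc k) * y (suc k)) (ℕₚ.≤-trans n≤X (ℕₚ.m≤m*n X (suc e)))
      (λ k n≤k → trans (cong (dvd (suc e) (suc k) *_) (y≡0 (suc k) (s≤s n≤k))) (ℤₚ.*-zeroʳ (dvd (suc e) (suc k)))))) (∑-block e X y)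

  -- Each k is written as m d. As y vanishes beyond n, the range of m can be extended to a bound X
  -- that does not depend on d.
  ∑-σ : ∀ n X (y : ℕ → ℤ) → n ℕ.≤ X → (∀ k → n ℕ.< k → y k ≡ 0ℤ) →
        ∑ n (λ k → + σ (suc k) * y (suc k)) ≡ ∑ n (λ i → ∑ X (λ m → + suc i * y (suc m ℕ.* suc i)))
  ∑-σ n X y n≤X y≡0 = begin
    ∑ n (λ k → + σ (suc k) * y (suc k))
      ≡⟨ ∑-cong< n (λ k k<n → trans (cong (_* y (suc k)) (σ-∑ k n k<n)) (trans (ℤₚ.*-comm _ (y (suc k))) (sym (∑-* n (y (suc k)) (λ i → dvd (suc i) (suc k) * + suc i))))) ⟩
    ∑ n (λ k → ∑ n (λ i → y (suc k) * (dvd (suc i) (suc k) * + suc i)))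
      ≡⟨ ∑-swap n n (λ k i → y (suc k) * (dvd (suc i) (suc k) * + suc i)) ⟩
    ∑ n (λ i → ∑ n (λ k → y (suc k) * (dvd (suc i) (suc k) * + suc i)))
      ≡⟨ ∑-cong n (λ i → trans (∑-cong n (λ k → ring (y (suc k)) (dvd (suc i) (suc k)) (+ suc i))) (trans (∑-* n (+ suc i) (λ k → dvd (suc i) (suc k) * y (suc k)))
           (trans (cong (+ suc i *_) (∑-multiples i X n y n≤X y≡0)) (sym (∑-* X (+ suc i) (λ m → y (suc m ℕ.* suc i))))))) ⟩
    ∑ n (λ i → ∑ X (λ m → + suc i * y (suc m ℕ.* suc i))) ∎
    where
    open ≡-Reasoning
    ring : ∀ y d i → y * (d * i) ≡ i * (d * y)
    ring = solve-∀

  -- For r = 0 the rule `coef-A` is Pascal's rule.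
  coef-C : ∀ N j → coef 0 N (+ N - + (2 ℕ.* j)) ≡ + (N C j)
  coef-C zero    zero    = coef-δ _
  coef-C zero    (suc j) = trans (coef-support 0 0 (+ 0 - + (2 ℕ.* suc j)) (s≤s z≤n)) (cong +_ (sym (k>n⇒nCk≡0 {0} {suc j} (s≤s z≤n))))
  coef-C (suc N) zero    = trans (coef-A 0 N (+ suc N - + 0)) (trans (cong₂ _+_
      (trans (cong (coef 0 N) (ring (+ N))) (coef-C N 0))
      (coef-support 0 N (+ suc N - + 0 + 1ℤ) (subst (λ z → N ℕ.< ∣ z ∣) (ring′ (+ N)) (ℕₚ.m<n⇒m<1+n (ℕₚ.n<1+n N)))))
    refl)
    where
    ring : ∀ N → 1ℤ + N - + 0 - 1ℤ ≡ N - + 0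
    ring = solve-∀
    ring′ : ∀ N → 1ℤ + (1ℤ + N) ≡ 1ℤ + N - + 0 + 1ℤ
    ring′ = solve-∀
  coef-C (suc N) (suc j) = trans (coef-A 0 N (+ suc N - + (2 ℕ.* suc j))) (trans (cong₂ _+_
      (trans (cong (coef 0 N) eq₁) (coef-C N (suc j)))
      (trans (cong (coef 0 N) eq₂) (coef-C N j)))
    (cong +_ (trans (ℕₚ.+-comm (N C suc j) (N C j)) (nCk+nC[k+1]≡[n+1]C[k+1] N j))))
    where
    ring₁ : ∀ N j → 1ℤ + N - j - 1ℤ ≡ N - j
    ring₁ = solve-∀
    ring₂ : ∀ N j → 1ℤ + N - + 2 * (1ℤ + j) + 1ℤ ≡ N - + 2 * j
    ring₂ = solve-∀
    eq₁ : + suc N - + (2 ℕ.* suc j) - 1ℤ ≡ + N - + (2 ℕ.* suc j)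
    eq₁ = ring₁ (+ N) (+ (2 ℕ.* suc j))
    eq₂ : + suc N - + (2 ℕ.* suc j) + 1ℤ ≡ + N - + (2 ℕ.* j)
    eq₂ = trans (cong (λ z → + suc N - z + 1ℤ) (ℤₚ.pos-* 2 (suc j))) (trans (ring₂ (+ N) (+ j)) (cong (λ z → + N - z) (sym (ℤₚ.pos-* 2 j))))

  coef-central : ∀ n k → k ℕ.≤ n → coef 0 (2 ℕ.* n) (+ (2 ℕ.* k)) ≡ + ((2 ℕ.* n) C (n ℕ.∸ k))
  coef-central n k k≤n = trans (cong (coef 0 (2 ℕ.* n)) eq) (coef-C (2 ℕ.* n) (n ℕ.∸ k))
    where
    ring : ∀ a b → a ≡ (b + a) - b
    ring = solve-∀
    eq : + (2 ℕ.* k) ≡ + (2 ℕ.* n) - + (2 ℕ.* (n ℕ.∸ k))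
    eq = trans (ring (+ (2 ℕ.* k)) (+ (2 ℕ.* (n ℕ.∸ k)))) (cong (λ z → + z - + (2 ℕ.* (n ℕ.∸ k)))
         (trans (sym (ℕₚ.*-distribˡ-+ 2 (n ℕ.∸ k) k)) (cong (2 ℕ.*_) (ℕₚ.m∸n+n≡m k≤n))))

  -- Three-term relations turn the quintic weight into two Krawtchouk terms: the polynomial of F has no first-order component.
  module _ (t N f₀ f₁ f₂ f₃ f₄ f₅ : ℤ)
           (h₀ : t * f₀ ≡ N * f₁)
           (h₁ : t * f₁ ≡ f₀ + (N - 1ℤ) * f₂)
           (h₂ : t * f₂ ≡ + 2 * f₁ + (N - + 2) * f₃)
           (h₃ : t * f₃ ≡ + 3 * f₂ + (N - + 3) * f₄)
           (h₄ : t * f₄ ≡ + 4 * f₃ + (N - + 4) * f₅) where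

    private
      tt₁ : t * (t * f₁) ≡ (+ 3 * N - + 2) * f₁ + (N - 1ℤ) * (N - + 2) * f₃
      tt₁ = trans (cong (t *_) h₁) (trans (ring₁ t f₀ (N - 1ℤ) f₂) (trans (cong₂ (λ x y → x + (N - 1ℤ) * y) h₀ h₂) (ring₂ N f₁ f₃)))
        where
        ring₁ : ∀ t a c b → t * (a + c * b) ≡ t * a + c * (t * b)
        ring₁ = solve-∀
        ring₂ : ∀ N a b → N * a + (N - 1ℤ) * (+ 2 * a + (N - + 2) * b) ≡ (+ 3 * N - + 2) * a + (N - 1ℤ) * (N - + 2) * b
        ring₂ = solve-∀
      tt₃ : t * (t * f₃) ≡ + 6 * f₁ + (+ 7 * N - + 18) * f₃ + (N - + 3) * (N - + 4) * f₅
      tt₃ = trans (cong (t *_) h₃) (trans (ring₁ t f₂ (N - + 3) f₄) (trans (cong₂ (λ x y → + 3 * x + (N - + 3) * y) h₂ h₄) (ring₂ N f₁ f₃ f₅)))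
        where
        ring₁ : ∀ t a c b → t * (+ 3 * a + c * b) ≡ + 3 * (t * a) + c * (t * b)
        ring₁ = solve-∀
        ring₂ : ∀ N a b c → + 3 * (+ 2 * a + (N - + 2) * b) + (N - + 3) * (+ 4 * b + (N - + 4) * c) ≡ + 6 * a + (+ 7 * N - + 18) * b + (N - + 3) * (N - + 4) * c
        ring₂ = solve-∀

    quintic : t * (t * t - + 6 * N + + 8) * (t * t - N) * f₀ ≡ N * (N - 1ℤ) * (N - + 2) * (N - + 4) * (+ 3 * f₃ + (N - + 3) * f₅)
    quintic = begin
      t * (t * t - + 6 * N + + 8) * (t * t - N) * f₀              ≡⟨ ring₁ t N f₀ ⟩
      (t * t - + 6 * N + + 8) * (t * t - N) * (t * f₀)            ≡⟨ cong ((t * t - + 6 * N + + 8) * (t * t - N) *_) h₀ ⟩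
      (t * t - + 6 * N + + 8) * (t * t - N) * (N * f₁)            ≡⟨ ring₂ t N f₁ ⟩
      N * (t * t - + 6 * N + + 8) * (t * (t * f₁) - N * f₁)       ≡⟨ cong (λ z → N * (t * t - + 6 * N + + 8) * (z - N * f₁)) tt₁ ⟩
      N * (t * t - + 6 * N + + 8) * ((+ 3 * N - + 2) * f₁ + (N - 1ℤ) * (N - + 2) * f₃ - N * f₁) ≡⟨ ring₃ t N f₁ f₃ ⟩
      N * (N - 1ℤ) * (+ 2 * (t * (t * f₁)) + (N - + 2) * (t * (t * f₃)) - (+ 6 * N - + 8) * (+ 2 * f₁ + (N - + 2) * f₃))
        ≡⟨ cong₂ (λ x y → N * (N - 1ℤ) * (+ 2 * x + (N - + 2) * y - (+ 6 * N - + 8) * (+ 2 * f₁ + (N - + 2) * f₃))) tt₁ tt₃ ⟩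
      N * (N - 1ℤ) * (+ 2 * ((+ 3 * N - + 2) * f₁ + (N - 1ℤ) * (N - + 2) * f₃) + (N - + 2) * (+ 6 * f₁ + (+ 7 * N - + 18) * f₃ + (N - + 3) * (N - + 4) * f₅) - (+ 6 * N - + 8) * (+ 2 * f₁ + (N - + 2) * f₃))
        ≡⟨ ring₄ N f₁ f₃ f₅ ⟩
      N * (N - 1ℤ) * (N - + 2) * (N - + 4) * (+ 3 * f₃ + (N - + 3) * f₅) ∎
      where
      open ≡-Reasoning
      ring₁ : ∀ t N f → t * (t * t - + 6 * N + + 8) * (t * t - N) * f ≡ (t * t - + 6 * N + + 8) * (t * t - N) * (t * f)
      ring₁ = solve-∀
      ring₂ : ∀ t N f → (t * t - + 6 * N + + 8) * (t * t - N) * (N * f) ≡ N * (t * t - + 6 * N + + 8) * (t * (t * f) - N * f)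
      ring₂ = solve-∀
      ring₃ : ∀ t N a b → N * (t * t - + 6 * N + + 8) * ((+ 3 * N - + 2) * a + (N - 1ℤ) * (N - + 2) * b - N * a)
                          ≡ N * (N - 1ℤ) * (+ 2 * (t * (t * a)) + (N - + 2) * (t * (t * b)) - (+ 6 * N - + 8) * (+ 2 * a + (N - + 2) * b))
      ring₃ = solve-∀
      ring₄ : ∀ N a b c → N * (N - 1ℤ) * (+ 2 * ((+ 3 * N - + 2) * a + (N - 1ℤ) * (N - + 2) * b) + (N - + 2) * (+ 6 * a + (+ 7 * N - + 18) * b + (N - + 3) * (N - + 4) * c) - (+ 6 * N - + 8) * (+ 2 * a + (N - + 2) * b))
                          ≡ N * (N - 1ℤ) * (N - + 2) * (N - + 4) * (+ 3 * b + (N - + 3) * c)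
      ring₄ = solve-∀

  -- The tail sums of the weight, in closed form.
  quartic : ∀ t N g₀ g₁ g₂ g₃ g₄ →
    t * g₀ ≡ (N - 1ℤ) * g₁ → t * g₁ ≡ g₀ + (N - + 2) * g₂ → t * g₂ ≡ + 2 * g₁ + (N - + 3) * g₃ → t * g₃ ≡ + 3 * g₂ + (N - + 4) * g₄ →
    N * (N - 1ℤ) * (N - + 2) * (N - + 4) * (+ 3 * g₂ + (N - + 3) * g₄) ≡ N * ((t * t - 1ℤ) * (t * t - + 3 * N + + 3)) * g₀
  quartic t N g₀ g₁ g₂ g₃ g₄ h₀ h₁ h₂ h₃ = sym (begin
    N * ((t * t - 1ℤ) * (t * t - + 3 * N + + 3)) * g₀                        ≡⟨ ring₁ t N g₀ ⟩
    N * (t * (t * (t * (t * g₀))) - (+ 3 * N - + 2) * (t * (t * g₀)) + (+ 3 * N - + 3) * g₀)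
      ≡⟨ cong (λ z → N * (t * (t * z) - (+ 3 * N - + 2) * z + (+ 3 * N - + 3) * g₀)) tt₀ ⟩
    N * (t * (t * ((N - 1ℤ) * (g₀ + (N - + 2) * g₂))) - (+ 3 * N - + 2) * ((N - 1ℤ) * (g₀ + (N - + 2) * g₂)) + (+ 3 * N - + 3) * g₀)
      ≡⟨ ring₂ t N g₀ g₂ ⟩
    N * ((N - 1ℤ) * (t * (t * g₀) + (N - + 2) * (t * (t * g₂))) - (+ 3 * N - + 2) * ((N - 1ℤ) * (g₀ + (N - + 2) * g₂)) + (+ 3 * N - + 3) * g₀)
      ≡⟨ cong₂ (λ x y → N * ((N - 1ℤ) * (x + (N - + 2) * y) - (+ 3 * N - + 2) * ((N - 1ℤ) * (g₀ + (N - + 2) * g₂)) + (+ 3 * N - + 3) * g₀)) tt₀ tt₂ ⟩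
    N * ((N - 1ℤ) * ((N - 1ℤ) * (g₀ + (N - + 2) * g₂) + (N - + 2) * (+ 2 * g₀ + (+ 5 * N - + 13) * g₂ + (N - + 3) * (N - + 4) * g₄)) - (+ 3 * N - + 2) * ((N - 1ℤ) * (g₀ + (N - + 2) * g₂)) + (+ 3 * N - + 3) * g₀)
      ≡⟨ ring₃ N g₀ g₂ g₄ ⟩
    N * (N - 1ℤ) * (N - + 2) * (N - + 4) * (+ 3 * g₂ + (N - + 3) * g₄) ∎)
    where
    open ≡-Reasoning
    tt₀ : t * (t * g₀) ≡ (N - 1ℤ) * (g₀ + (N - + 2) * g₂)
    tt₀ = trans (cong (t *_) h₀) (trans (r t (N - 1ℤ) g₁) (cong ((N - 1ℤ) *_) h₁))
      where
      r : ∀ t c g → t * (c * g) ≡ c * (t * g)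
      r = solve-∀
    tt₂ : t * (t * g₂) ≡ + 2 * g₀ + (+ 5 * N - + 13) * g₂ + (N - + 3) * (N - + 4) * g₄
    tt₂ = trans (cong (t *_) h₂) (trans (r₁ t g₁ (N - + 3) g₃) (trans (cong₂ (λ x y → + 2 * x + (N - + 3) * y) h₁ h₃) (r₂ N g₀ g₂ g₄)))
      where
      r₁ : ∀ t a c b → t * (+ 2 * a + c * b) ≡ + 2 * (t * a) + c * (t * b)
      r₁ = solve-∀
      r₂ : ∀ N a b c → + 2 * (a + (N - + 2) * b) + (N - + 3) * (+ 3 * b + (N - + 4) * c) ≡ + 2 * a + (+ 5 * N - + 13) * b + (N - + 3) * (N - + 4) * c
      r₂ = solve-∀
    ring₁ : ∀ t N g → N * ((t * t - 1ℤ) * (t * t - + 3 * N + + 3)) * g ≡ N * (t * (t * (t * (t * g))) - (+ 3 * N - + 2) * (t * (t * g)) + (+ 3 * N - + 3) * g)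
    ring₁ = solve-∀
    ring₂ : ∀ t N a b → N * (t * (t * ((N - 1ℤ) * (a + (N - + 2) * b))) - (+ 3 * N - + 2) * ((N - 1ℤ) * (a + (N - + 2) * b)) + (+ 3 * N - + 3) * a)
                        ≡ N * ((N - 1ℤ) * (t * (t * a) + (N - + 2) * (t * (t * b))) - (+ 3 * N - + 2) * ((N - 1ℤ) * (a + (N - + 2) * b)) + (+ 3 * N - + 3) * a)
    ring₂ = solve-∀
    ring₃ : ∀ N a b c → N * ((N - 1ℤ) * ((N - 1ℤ) * (a + (N - + 2) * b) + (N - + 2) * (+ 2 * a + (+ 5 * N - + 13) * b + (N - + 3) * (N - + 4) * c)) - (+ 3 * N - + 2) * ((N - 1ℤ) * (a + (N - + 2) * b)) + (+ 3 * N - + 3) * a)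
                        ≡ N * (N - 1ℤ) * (N - + 2) * (N - + 4) * (+ 3 * b + (N - + 3) * c)
    ring₃ = solve-∀

-- From F to a sum of the weight over pairs

module Reduction where

  open Sums
  open Coefficients
  open Folding
  open Quadrature
  open BlockSums using (G; u)
  open PanelSum
  open DivisorSums
  open import Defs using (σ; F)
  open import Data.Nat as ℕ using (ℕ; zero; suc; s≤s; z≤n)
  import Data.Nat.Properties as ℕₚ
  open import Data.Nat.Combinatorics using (_C_)
  open import Data.Integer as ℤ using (ℤ; +_; -[1+_]; _+_; _*_; _-_; -_; ∣_∣; 0ℤ; 1ℤ)
  import Data.Integer.Properties as ℤₚ
  open import Data.Integer.Tactic.RingSolver using (solve-∀)
  import Data.Nat.Tactic.RingSolver as ℕS
  open import Data.List using ([]; _∷_)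
  open import Data.List.Relation.Unary.All using (All; []; _∷_)
  open import Data.Product using (_,_; proj₁)
  open import Relation.Binary.PropositionalEquality

  lin-cong-ok : ∀ {X Y : ℤ → ℤ} → (∀ s → Ok s → X s ≡ Y s) → lin ωs X ≡ lin ωs Y
  lin-cong-ok {X} {Y} e = go ωs ωs-ok
    where
    go : ∀ l → All (λ sw → Ok (proj₁ sw)) l → lin l X ≡ lin l Y
    go []            []       = refl
    go ((s , w) ∷ l) (o ∷ os) = cong₂ _+_ (cong (w *_) (e s o)) (go l os)

  lin-∑± : ∀ l n (X : ℤ → ℤ → ℤ) → ∑± n (λ x → lin l (X x)) ≡ lin l (λ s → ∑± n (λ x → X x s))
  lin-∑± l n X = trans (cong (λ z → lin l (X 0ℤ) + z) (trans (∑-cong n (λ i → sym (lin-+ l (X (+ suc i)) (X -[1+ i ])))) (sym (lin-∑ l n (λ i s → X (+ suc i) s + X -[1+ i ] s)))))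
    (sym (lin-+ l (X 0ℤ) (λ s → ∑ n (λ i → X (+ suc i) s + X -[1+ i ] s))))

  lin-const : ∀ l c → lin l (λ _ → c) ≡ c * lin l (λ _ → 1ℤ)
  lin-const l c = trans (lin-cong l (λ _ → sym (ℤₚ.*-identityʳ c))) (lin-* l c (λ _ → 1ℤ))

  5+s≡∣5+s∣ : ∀ s → Ok s → + ∣ + 5 + s ∣ ≡ + 5 + s
  5+s≡∣5+s∣ (+ a)    ok = refl
  5+s≡∣5+s∣ -[1+ a ] ok = ℤₚ.0≤i⇒+∣i∣≡i (subst (0ℤ ℤ.≤_) (sym (ℤₚ.⊖-≥ (s≤s ok))) (ℤ.+≤+ z≤n))

  ∣5+s∣≤11 : ∀ s → Ok s → ∣ + 5 + s ∣ ℕ.≤ 11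
  ∣5+s∣≤11 (+ a)    ok = ℕₚ.+-monoʳ-≤ 5 ok
  ∣5+s∣≤11 -[1+ a ] ok = ℕₚ.≤-trans (ℕₚ.≤-reflexive (cong ∣_∣ (ℤₚ.⊖-≥ (s≤s ok)))) (ℕₚ.≤-trans (ℕₚ.m∸n≤m 5 (suc a)) (ℕₚ.m≤m+n 5 6))

  ∣2s-1∣≤11 : ∀ s → Ok s → suc ∣ + 2 * s - 1ℤ ∣ ℕ.≤ 12
  ∣2s-1∣≤11 (+ zero)  ok = s≤s (s≤s z≤n)
  ∣2s-1∣≤11 (+ suc a) ok = subst (λ z → suc ∣ z ∣ ℕ.≤ 12) (ring (+ a)) (subst (λ z → suc ∣ 1ℤ + z ∣ ℕ.≤ 12) (ℤₚ.pos-* 2 a) (ℕₚ.+-monoʳ-≤ 2 (ℕₚ.*-monoʳ-≤ 2 (ℕₚ.≤-pred ok))))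
    where
    ring : ∀ a → 1ℤ + + 2 * a ≡ + 2 * (1ℤ + a) - 1ℤ
    ring = solve-∀
  ∣2s-1∣≤11 -[1+ a ] ok = ℕₚ.≤-trans (ℕₚ.≤-reflexive (cong suc (trans (cong ∣_∣ eq) (ℤₚ.∣-i∣≡∣i∣ (+ (3 ℕ.+ 2 ℕ.* a)))))) (ℕₚ.≤-trans (ℕₚ.+-monoʳ-≤ 4 (ℕₚ.*-monoʳ-≤ 2 ok)) ℕₚ.≤-refl)
    where
    ring : ∀ a → + 2 * (- (1ℤ + a)) - 1ℤ ≡ - (+ 3 + + 2 * a)
    ring = solve-∀
    eq : + 2 * -[1+ a ] - 1ℤ ≡ - + (3 ℕ.+ 2 ℕ.* a)
    eq = trans (ring (+ a)) (cong (λ z → - (+ 3 + z)) (sym (ℤₚ.pos-* 2 a)))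

  ∑-flatten : ∀ I d (h : ℕ → ℤ) → ∑ I (λ k → ∑ d (λ v → h (k ℕ.* d ℕ.+ v))) ≡ ∑ (I ℕ.* d) h
  ∑-flatten zero    d h = refl
  ∑-flatten (suc I) d h = trans (cong (_+ ∑ d (λ v → h (I ℕ.* d ℕ.+ v))) (∑-flatten I d h))
    (trans (sym (∑-split (I ℕ.* d) d h)) (cong (λ z → ∑ z h) (ℕₚ.+-comm (I ℕ.* d) d)))

  module _ (p : ℕ) where

    -- With N = 6 + p this is N(N - 1)(N - 2)(N - 4); the factor N - 3 appears inside `G`, at the
    -- term of order five.
    κ₀ : ℤ
    κ₀ = + (6 ℕ.+ p) * (+ (6 ℕ.+ p) - 1ℤ) * (+ (6 ℕ.+ p) - + 2) * (+ (6 ℕ.+ p) - + 4)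

    private
      r₁ : ∀ x a → 0ℤ * 0ℤ + x * a ≡ x * a
      r₁ = solve-∀
      r₂ : ∀ p a b → 1ℤ * a + (+ 5 + p) * b ≡ a + (+ 6 + p - 1ℤ) * b
      r₂ = solve-∀
      r₃ : ∀ p a b → + 2 * a + (+ 4 + p) * b ≡ + 2 * a + (+ 6 + p - + 2) * b
      r₃ = solve-∀
      r₄ : ∀ p a b → + 3 * a + (+ 3 + p) * b ≡ + 3 * a + (+ 6 + p - + 3) * b
      r₄ = solve-∀
      r₅ : ∀ p a b → + 4 * a + (+ 2 + p) * b ≡ + 4 * a + (+ 6 + p - + 4) * b
      r₅ = solve-∀
      s₁ : ∀ p a → 0ℤ * 0ℤ + (+ 5 + p) * a ≡ (+ 6 + p - 1ℤ) * a
      s₁ = solve-∀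
      s₂ : ∀ p a b → 1ℤ * a + (+ 4 + p) * b ≡ a + (+ 6 + p - + 2) * b
      s₂ = solve-∀
      s₃ : ∀ p a b → + 2 * a + (+ 3 + p) * b ≡ + 2 * a + (+ 6 + p - + 3) * b
      s₃ = solve-∀
      s₄ : ∀ p a b → + 3 * a + (+ 2 + p) * b ≡ + 3 * a + (+ 6 + p - + 4) * b
      s₄ = solve-∀
      s₅ : ∀ p → + 6 + p - + 3 ≡ + 3 + p
      s₅ = solve-∀
      comm : ∀ r k t → coef r (p ℕ.+ k) t ≡ coef r (k ℕ.+ p) t
      comm r k t = cong (λ z → coef r z t) (ℕₚ.+-comm p k)
      +comm : + (p ℕ.+ 3) ≡ + 6 + + p - + 3
      +comm = trans (cong +_ (ℕₚ.+-comm p 3)) (sym (s₅ (+ p)))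

    weight : ∀ t → t * (t * t - + 6 * + (6 ℕ.+ p) + + 8) * (t * t - + (6 ℕ.+ p)) * coef 0 (6 ℕ.+ p) t ≡ κ₀ * G p 0 t
    weight t = trans (quintic t (+ (6 ℕ.+ p)) _ (coef 1 (5 ℕ.+ p) t) (coef 2 (4 ℕ.+ p) t) (coef 3 (3 ℕ.+ p) t) (coef 4 (2 ℕ.+ p) t) (coef 5 (1 ℕ.+ p) t)
        (trans (coef-*t 0 (6 ℕ.+ p) t) (r₁ (+ (6 ℕ.+ p)) (coef 1 (5 ℕ.+ p) t)))
        (trans (coef-*t 1 (5 ℕ.+ p) t) (r₂ (+ p) (coef 0 (6 ℕ.+ p) t) (coef 2 (4 ℕ.+ p) t)))
        (trans (coef-*t 2 (4 ℕ.+ p) t) (r₃ (+ p) (coef 1 (5 ℕ.+ p) t) (coef 3 (3 ℕ.+ p) t)))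
        (trans (coef-*t 3 (3 ℕ.+ p) t) (r₄ (+ p) (coef 2 (4 ℕ.+ p) t) (coef 4 (2 ℕ.+ p) t)))
        (trans (coef-*t 4 (2 ℕ.+ p) t) (r₅ (+ p) (coef 3 (3 ℕ.+ p) t) (coef 5 (1 ℕ.+ p) t))))
      (cong (κ₀ *_) (sym (cong₂ _+_ (cong (+ 3 *_) (comm 3 3 t)) (cong₂ _*_ +comm (comm 5 1 t)))))

    -- `G p 0` with one factor y - y⁻¹ removed, so that the weight is a difference of two values
    -- (`G-tail`) and its unit-step sums telescope.
    q̂ : ℤ → ℤ
    q̂ t = + 3 * coef 2 (p ℕ.+ 3) t + + (p ℕ.+ 3) * coef 4 (p ℕ.+ 1) t

    q̂-closed : ∀ t → κ₀ * q̂ t ≡ + (6 ℕ.+ p) * ((t * t - 1ℤ) * (t * t - + 3 * + (6 ℕ.+ p) + + 3)) * coef 0 (5 ℕ.+ p) t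
    q̂-closed t = trans (cong (κ₀ *_) (cong₂ _+_ (cong (+ 3 *_) (comm 2 3 t)) (cong₂ _*_ +comm (comm 4 1 t))))
      (quartic t (+ (6 ℕ.+ p)) (coef 0 (5 ℕ.+ p) t) (coef 1 (4 ℕ.+ p) t) (coef 2 (3 ℕ.+ p) t) (coef 3 (2 ℕ.+ p) t) (coef 4 (1 ℕ.+ p) t)
        (trans (coef-*t 0 (5 ℕ.+ p) t) (s₁ (+ p) (coef 1 (4 ℕ.+ p) t)))
        (trans (coef-*t 1 (4 ℕ.+ p) t) (s₂ (+ p) (coef 0 (5 ℕ.+ p) t) (coef 2 (3 ℕ.+ p) t)))
        (trans (coef-*t 2 (3 ℕ.+ p) t) (s₃ (+ p) (coef 1 (4 ℕ.+ p) t) (coef 3 (2 ℕ.+ p) t)))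
        (trans (coef-*t 3 (2 ℕ.+ p) t) (s₄ (+ p) (coef 2 (3 ℕ.+ p) t) (coef 4 (1 ℕ.+ p) t))))

    q̂-even : ∀ t → q̂ (- t) ≡ q̂ t
    q̂-even t = cong₂ (λ x y → + 3 * x + + (p ℕ.+ 3) * y) (trans (coef-parity 2 (p ℕ.+ 3) t) (ℤₚ.*-identityˡ _)) (trans (coef-parity 4 (p ℕ.+ 1) t) (ℤₚ.*-identityˡ _))

    q̂-support : ∀ t → 5 ℕ.+ p ℕ.< ∣ t ∣ → q̂ t ≡ 0ℤ
    q̂-support t lt = trans (cong₂ (λ x y → + 3 * x + + (p ℕ.+ 3) * y)
        (coef-support 2 (p ℕ.+ 3) t (subst (ℕ._< ∣ t ∣) (ring₁ p) lt)) (coef-support 4 (p ℕ.+ 1) t (subst (ℕ._< ∣ t ∣) (ring₂ p) lt)))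
      (trans (ℤₚ.+-identityˡ _) (ℤₚ.*-zeroʳ (+ (p ℕ.+ 3))))
      where
      ring₁ : ∀ p → 5 ℕ.+ p ≡ 2 ℕ.+ (p ℕ.+ 3)
      ring₁ = ℕS.solve-∀
      ring₂ : ∀ p → 5 ℕ.+ p ≡ 4 ℕ.+ (p ℕ.+ 1)
      ring₂ = ℕS.solve-∀

    G-tail : ∀ t → G p 0 t ≡ q̂ (t - 1ℤ) - q̂ (t + 1ℤ)
    G-tail t = trans (cong₂ (λ x y → + 3 * x + + (p ℕ.+ 3) * y) (coef-B 2 (p ℕ.+ 3) t) (coef-B 4 (p ℕ.+ 1) t))
      (ring (+ (p ℕ.+ 3)) (coef 2 (p ℕ.+ 3) (t - 1ℤ)) (coef 2 (p ℕ.+ 3) (t + 1ℤ)) (coef 4 (p ℕ.+ 1) (t - 1ℤ)) (coef 4 (p ℕ.+ 1) (t + 1ℤ)))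
      where
      ring : ∀ c a a′ b b′ → + 3 * (a - a′) + c * (b - b′) ≡ + 3 * a + c * b - (+ 3 * a′ + c * b′)
      ring = solve-∀

    u-support : ∀ x → 6 ℕ.+ p ℕ.< ∣ + 2 * x ∣ → u p x ≡ 0ℤ
    u-support x lt = trans (cong₂ (λ a b → + 3 * a + + (p ℕ.+ 3) * b)
        (coef-support 3 (p ℕ.+ 3) (+ 2 * x) (subst (ℕ._< ∣ + 2 * x ∣) (ring₁ p) lt)) (coef-support 5 (p ℕ.+ 1) (+ 2 * x) (subst (ℕ._< ∣ + 2 * x ∣) (ring₂ p) lt)))
      (trans (ℤₚ.+-identityˡ _) (ℤₚ.*-zeroʳ (+ (p ℕ.+ 3))))
      where
      ring₁ : ∀ p → 6 ℕ.+ p ≡ 3 ℕ.+ (p ℕ.+ 3)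
      ring₁ = ℕS.solve-∀
      ring₂ : ∀ p → 6 ℕ.+ p ≡ 5 ℕ.+ (p ℕ.+ 1)
      ring₂ = ℕS.solve-∀

    -- Orders 3 and 5 become 2, 4 and 6. No order 0 arises, the one order whose folds do not decay.
    tG : ∀ t → t * G p 0 t ≡ + 9 * coef 2 (4 ℕ.+ p) t + + 8 * + (3 ℕ.+ p) * coef 4 (2 ℕ.+ p) t + + (3 ℕ.+ p) * + (1 ℕ.+ p) * coef 6 p t
    tG t = begin
      t * (+ 3 * coef 3 (p ℕ.+ 3) t + + (p ℕ.+ 3) * coef 5 (p ℕ.+ 1) t)  ≡⟨ cong₂ (λ x y → t * (+ 3 * x + y)) (comm 3 3 t) (cong₂ _*_ (cong +_ (ℕₚ.+-comm p 3)) (comm 5 1 t)) ⟩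
      t * (+ 3 * coef 3 (3 ℕ.+ p) t + + (3 ℕ.+ p) * coef 5 (1 ℕ.+ p) t)  ≡⟨ ring₁ t (coef 3 (3 ℕ.+ p) t) (+ (3 ℕ.+ p)) (coef 5 (1 ℕ.+ p) t) ⟩
      + 3 * (t * coef 3 (3 ℕ.+ p) t) + + (3 ℕ.+ p) * (t * coef 5 (1 ℕ.+ p) t) ≡⟨ cong₂ (λ x y → + 3 * x + + (3 ℕ.+ p) * y) (coef-*t 3 (3 ℕ.+ p) t) (coef-*t 5 (1 ℕ.+ p) t) ⟩
      + 3 * (+ 3 * coef 2 (4 ℕ.+ p) t + + (3 ℕ.+ p) * coef 4 (2 ℕ.+ p) t) + + (3 ℕ.+ p) * (+ 5 * coef 4 (2 ℕ.+ p) t + + (1 ℕ.+ p) * coef 6 p t)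
        ≡⟨ ring₂ (coef 2 (4 ℕ.+ p) t) (+ (3 ℕ.+ p)) (coef 4 (2 ℕ.+ p) t) (+ (1 ℕ.+ p)) (coef 6 p t) ⟩
      + 9 * coef 2 (4 ℕ.+ p) t + + 8 * + (3 ℕ.+ p) * coef 4 (2 ℕ.+ p) t + + (3 ℕ.+ p) * + (1 ℕ.+ p) * coef 6 p t ∎
      where
      open ≡-Reasoning
      ring₁ : ∀ t a c b → t * (+ 3 * a + c * b) ≡ + 3 * (t * a) + c * (t * b)
      ring₁ = solve-∀
      ring₂ : ∀ a c b d e → + 3 * (+ 3 * a + c * b) + c * (+ 5 * b + d * e) ≡ + 9 * a + + 8 * c * b + c * d * e
      ring₂ = solve-∀

    module _ (n : ℕ) (2n≡ : 2 ℕ.* n ≡ 6 ℕ.+ p) where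

      S : ℤ
      S = ∑ n (λ k → + σ (suc k) * u p (+ suc k))

      -- In terms of t = 2k and N = 2n the three polynomial factors have denominators 2, 4 and 2.
      F-S : + 16 * F n ≡ κ₀ * S
      F-S = begin
        + 16 * F n                                                ≡⟨ cong (+ 16 *_) (sumℤ-range1 n term) ⟩
        + 16 * ∑ n (λ i → term (suc i))                           ≡⟨ ∑-* n (+ 16) (λ i → term (suc i)) ⟨
        ∑ n (λ i → + 16 * term (suc i))                           ≡⟨ ∑-cong< n (λ i i<n → eq i i<n) ⟩
        ∑ n (λ i → κ₀ * (+ σ (suc i) * u p (+ suc i)))            ≡⟨ ∑-* n κ₀ (λ i → + σ (suc i) * u p (+ suc i)) ⟩
        κ₀ * S                                                    ∎
        where
        open ≡-Reasoning
        term : ℕ → ℤ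
        term k = (+ k) * (+ σ k) * ((+ (k ℕ.^ 2)) - (+ (3 ℕ.* n)) + (+ 2)) * ((+ (2 ℕ.* k ℕ.^ 2)) - (+ n)) * (+ ((2 ℕ.* n) C (n ℕ.∸ k)))
        k²≡ : ∀ k → + (k ℕ.^ 2) ≡ + k * + k
        k²≡ k = trans (cong (λ z → + (k ℕ.* z)) (ℕₚ.*-identityʳ k)) (ℤₚ.pos-* k k)
        ring : ∀ k s n c → + 16 * (k * s * (k * k - + 3 * n + + 2) * (+ 2 * (k * k) - n) * c)
                           ≡ s * ((+ 2 * k) * ((+ 2 * k) * (+ 2 * k) - + 6 * (+ 2 * n) + + 8) * ((+ 2 * k) * (+ 2 * k) - + 2 * n) * c)
        ring = solve-∀
        ring′ : ∀ s κ g → s * (κ * g) ≡ κ * (s * g)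
        ring′ = solve-∀
        +2n : + 2 * + n ≡ + (6 ℕ.+ p)
        +2n = trans (sym (ℤₚ.pos-* 2 n)) (cong +_ 2n≡)
        eq : ∀ i → i ℕ.< n → + 16 * term (suc i) ≡ κ₀ * (+ σ (suc i) * u p (+ suc i))
        eq i i<n = begin
          + 16 * term k
            ≡⟨ cong₂ (λ x y → + 16 * (+ k * + σ k * x * y * + ((2 ℕ.* n) C (n ℕ.∸ k))))
                     (cong₂ (λ x y → x - y + + 2) (k²≡ k) (ℤₚ.pos-* 3 n)) (cong (_- + n) (trans (ℤₚ.pos-* 2 (k ℕ.^ 2)) (cong (+ 2 *_) (k²≡ k)))) ⟩
          + 16 * (+ k * + σ k * (+ k * + k - + 3 * + n + + 2) * (+ 2 * (+ k * + k) - + n) * + ((2 ℕ.* n) C (n ℕ.∸ k)))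
            ≡⟨ ring (+ k) (+ σ k) (+ n) (+ ((2 ℕ.* n) C (n ℕ.∸ k))) ⟩
          + σ k * (t * (t * t - + 6 * (+ 2 * + n) + + 8) * (t * t - + 2 * + n) * + ((2 ℕ.* n) C (n ℕ.∸ k)))
            ≡⟨ cong₂ (λ x y → + σ k * (t * (t * t - + 6 * x + + 8) * (t * t - x) * y)) +2n
                     (trans (sym (coef-central n k i<n)) (cong₂ (coef 0) 2n≡ (ℤₚ.pos-* 2 k))) ⟩
          + σ k * (t * (t * t - + 6 * + (6 ℕ.+ p) + + 8) * (t * t - + (6 ℕ.+ p)) * coef 0 (6 ℕ.+ p) t)
            ≡⟨ cong (+ σ k *_) (weight t) ⟩
          + σ k * (κ₀ * G p 0 t) ≡⟨ ring′ (+ σ k) κ₀ (G p 0 t) ⟩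
          κ₀ * (+ σ k * u p (+ k)) ∎
          where
          k = suc i
          t = + 2 * + k

-- Splitting the sum into heads, panels and telescoped unit rules

module Decomposition where

  open Sums
  open Coefficients
  open Folding
  open Quadrature
  open BlockSums using (u)
  open PanelSum
  open DivisorSums
  open Reduction
  open import Data.Nat as ℕ using (ℕ; suc; s≤s)
  import Data.Nat.Properties as ℕₚ
  open import Data.Integer using (ℤ; +_; -[1+_]; _+_; _*_; _-_; -_; ∣_∣; 0ℤ; 1ℤ)
  import Data.Integer.Properties as ℤₚ
  open import Data.Integer.Tactic.RingSolver using (solve-∀)
  open import Relation.Binary.PropositionalEquality

  module _ (p n : ℕ) (2n≡ : 2 ℕ.* n ≡ 6 ℕ.+ p) (M₀ : ℕ) where

    L : ℤ
    L = lin ωs (λ _ → 1ℤ)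

    M : ℕ
    M = suc M₀

    offset : ℤ → ℕ
    offset s = ∣ + 5 + s ∣

    -- For x = d ≥ 1 this is the lower end left over when the unit rules telescope. Since it makes
    -- sense for every integer x, it can be summed over a full window.
    Y : ℤ → ℤ
    Y x = lin ωs (λ s → q̂ p (+ 2 * s - 1ℤ + + (2 ℕ.* (5 ℕ.+ M)) * x))

    -- The reflection s ↦ 1 - s of the nodes changes the sign of 2s - 1, and `q̂` is even.
    Y-even : ∀ x → Y (- x) ≡ Y x
    Y-even x = trans (lin-cong ωs (λ s → trans (sym (q̂-even p _)) (cong (q̂ p) (ring c x s)))) (ωs-sym (λ s → q̂ p (+ 2 * s - 1ℤ + c * x)))
      where
      c = + (2 ℕ.* (5 ℕ.+ M))
      ring : ∀ c x s → - (+ 2 * s - 1ℤ + c * (- x)) ≡ + 2 * (1ℤ - s) - 1ℤ + c * x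
      ring = solve-∀

    u-zero : ∀ k → n ℕ.< k → u p (+ k) ≡ 0ℤ
    u-zero k n<k = u-support p (+ k) (subst (6 ℕ.+ p ℕ.<_) (sym (cong ∣_∣ (sym (ℤₚ.pos-* 2 k)))) (subst (ℕ._< 2 ℕ.* k) 2n≡ (ℕₚ.*-monoʳ-< 2 n<k)))

    module _ (i : ℕ) where

      private
        d = suc i
        y : ℕ → ℤ
        y m = + d * u p (+ (m ℕ.* d))

        y-zero : ∀ m → n ℕ.≤ m → y (suc m) ≡ 0ℤ
        y-zero m n≤m = trans (cong (+ d *_) (u-zero (suc m ℕ.* d) (ℕₚ.≤-trans (s≤s n≤m) (ℕₚ.m≤m*n (suc m) d)))) (ℤₚ.*-zeroʳ (+ d))

        head : ℤ
        head = lin ωs (λ s → ∑ (M₀ ℕ.+ offset s) (λ m → y (suc m)))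

        -- For fixed j the twelve copies sit at (5 + M + j) d + s d and form the wide rule on one
        -- panel. The unit rules of that panel are added and subtracted.
        panel-split : ∀ j → lin ωs (λ s → y (suc (M₀ ℕ.+ offset s ℕ.+ j))) ≡ panelAt p d (5 ℕ.+ (M ℕ.+ j)) + ∑ d (λ v → lin ωs (λ s → u p (+ ((5 ℕ.+ M) ℕ.* d) + s + + (j ℕ.* d ℕ.+ v))))
        panel-split j = begin
          lin ωs (λ s → y (suc (M₀ ℕ.+ offset s ℕ.+ j)))                          ≡⟨ lin-* ωs (+ d) (λ s → u p (+ (suc (M₀ ℕ.+ offset s ℕ.+ j) ℕ.* d))) ⟩
          + d * lin ωs (λ s → u p (+ (suc (M₀ ℕ.+ offset s ℕ.+ j) ℕ.* d)))        ≡⟨ cong (+ d *_) (lin-cong-ok (λ s ok → cong (u p) (index s ok))) ⟩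
          + d * A                                                            ≡⟨ ring₁ (+ d * A) B ⟩
          (+ d * A - B) + B                                                  ≡⟨ cong (λ z → (+ d * A - B) + z) (∑-cong d (λ v → lin-cong ωs (λ s → cong (u p) (index′ s v)))) ⟩
          panelAt p d (5 ℕ.+ (M ℕ.+ j)) + ∑ d (λ v → lin ωs (λ s → u p (+ ((5 ℕ.+ M) ℕ.* d) + s + + (j ℕ.* d ℕ.+ v)))) ∎
          where
          open ≡-Reasoning
          b = + ((5 ℕ.+ (M ℕ.+ j)) ℕ.* d) - + 5
          A = lin ωs (λ s → u p (b + (+ 5 + s * + d)))
          B = ∑ d (λ v → lin ωs (λ s → u p (b + (+ 5 + s + + v))))
          ring₁ : ∀ x y → x ≡ x - y + y
          ring₁ = solve-∀
          ring₂ : ∀ M₀ s j d → (1ℤ + (M₀ + (+ 5 + s) + j)) * d ≡ (+ 5 + (1ℤ + M₀ + j)) * d - + 5 + (+ 5 + s * d)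
          ring₂ = solve-∀
          ring₃ : ∀ M₀ j d s v → (+ 5 + (1ℤ + M₀ + j)) * d - + 5 + (+ 5 + s + v) ≡ (+ 5 + (1ℤ + M₀)) * d + s + (j * d + v)
          ring₃ = solve-∀
          index : ∀ s → Ok s → + (suc (M₀ ℕ.+ offset s ℕ.+ j) ℕ.* d) ≡ b + (+ 5 + s * + d)
          index s ok = trans (ℤₚ.pos-* (suc (M₀ ℕ.+ offset s ℕ.+ j)) d) (trans (cong (λ z → (1ℤ + (+ M₀ + z + + j)) * + d) (5+s≡∣5+s∣ s ok))
            (trans (ring₂ (+ M₀) s (+ j) (+ d)) (cong (λ z → z - + 5 + (+ 5 + s * + d)) (sym (ℤₚ.pos-* (5 ℕ.+ (M ℕ.+ j)) d)))))
          index′ : ∀ s v → b + (+ 5 + s + + v) ≡ + ((5 ℕ.+ M) ℕ.* d) + s + + (j ℕ.* d ℕ.+ v)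
          index′ s v = trans (cong (λ z → z - + 5 + (+ 5 + s + + v)) (ℤₚ.pos-* (5 ℕ.+ (M ℕ.+ j)) d)) (trans (ring₃ (+ M₀) (+ j) (+ d) s (+ v))
            (cong₂ (λ x z → x + s + (z + + v)) (sym (ℤₚ.pos-* (5 ℕ.+ M) d)) (sym (ℤₚ.pos-* j d))))

        -- The d unit rules of consecutive panels join to one sum over unit steps, which telescopes
        -- by `G-tail`; its far end exceeds the support because it lies beyond 2n.
        tails : ∑ n (λ j → ∑ d (λ v → lin ωs (λ s → u p (+ ((5 ℕ.+ M) ℕ.* d) + s + + (j ℕ.* d ℕ.+ v))))) ≡ Y (+ d)
        tails = begin
          ∑ n (λ j → ∑ d (λ v → lin ωs (λ s → h s (j ℕ.* d ℕ.+ v))))   ≡⟨ ∑-flatten n d (λ w → lin ωs (λ s → h s w)) ⟩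
          ∑ (n ℕ.* d) (λ w → lin ωs (λ s → h s w))                     ≡⟨ lin-∑ ωs (n ℕ.* d) (λ w s → h s w) ⟨
          lin ωs (λ s → ∑ (n ℕ.* d) (h s))                             ≡⟨ lin-cong-ok (λ s ok → trans (∑-cong (n ℕ.* d) (step s)) (trans (∑-telescope (n ℕ.* d) (e s)) (last s ok))) ⟩
          lin ωs (λ s → q̂ p (+ 2 * s - 1ℤ + + (2 ℕ.* (5 ℕ.+ M)) * + d)) ∎
          where
          open ≡-Reasoning
          B = + ((5 ℕ.+ M) ℕ.* d)
          h e : ℤ → ℕ → ℤ
          h s w = u p (B + s + + w)
          e s w = q̂ p (+ 2 * (B + s + + w) - 1ℤ)
          ring₁ : ∀ B s w → + 2 * (B + s + w) + 1ℤ ≡ + 2 * (B + s + (1ℤ + w)) - 1ℤ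
          ring₁ = solve-∀
          step : ∀ s w → h s w ≡ e s w - e s (suc w)
          step s w = trans (G-tail p (+ 2 * (B + s + + w))) (cong (λ z → e s w - q̂ p z) (ring₁ B s (+ w)))
          ring₂ : ∀ M d s → + 2 * ((+ 5 + M) * d + s + 0ℤ) - 1ℤ ≡ + 2 * s - 1ℤ + + 2 * (+ 5 + M) * d
          ring₂ = solve-∀
          ring₄ : ∀ a M i n → + 2 * ((+ 5 + (1ℤ + M)) * (1ℤ + i) + (a - + 5) + n * (1ℤ + i)) - 1ℤ ≡ 1ℤ + (+ 2 * n + + 2 * (a + M + (+ 6 + M + n) * i))
          ring₄ = solve-∀
          ring₅ : ∀ s → s ≡ + 5 + s - + 5
          ring₅ = solve-∀
          last : ∀ s → Ok s → e s 0 - e s (n ℕ.* d) ≡ q̂ p (+ 2 * s - 1ℤ + + (2 ℕ.* (5 ℕ.+ M)) * + d)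
          last s ok = trans (cong₂ _-_ (cong (q̂ p) (trans (cong (λ z → + 2 * (z + s + 0ℤ) - 1ℤ) (ℤₚ.pos-* (5 ℕ.+ M) d)) (trans (ring₂ (+ M) (+ d) s) (cong (λ z → + 2 * s - 1ℤ + z * + d) (sym (ℤₚ.pos-* 2 (5 ℕ.+ M)))))))
                                       (q̂-support p (+ 2 * (B + s + + (n ℕ.* d)) - 1ℤ) (subst (λ z → 5 ℕ.+ p ℕ.< ∣ z ∣) (sym far) big)))
                            (ℤₚ.+-identityʳ _)
            where
            k = 2 ℕ.* (offset s ℕ.+ M₀ ℕ.+ (6 ℕ.+ M₀ ℕ.+ n) ℕ.* i)
            far : + 2 * (B + s + + (n ℕ.* d)) - 1ℤ ≡ + (1 ℕ.+ (2 ℕ.* n ℕ.+ k))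
            far = trans (cong₂ (λ x z → + 2 * (x + s + z) - 1ℤ) (ℤₚ.pos-* (5 ℕ.+ M) d) (ℤₚ.pos-* n d))
                  (trans (cong (λ z → + 2 * (+ (5 ℕ.+ M) * + d + z + + n * + d) - 1ℤ) (trans (ring₅ s) (cong (_- + 5) (sym (5+s≡∣5+s∣ s ok)))))
                  (trans (ring₄ (+ offset s) (+ M₀) (+ i) (+ n))
                         (cong₂ (λ x z → 1ℤ + (x + z)) (sym (ℤₚ.pos-* 2 n)) (trans (cong (λ z → + 2 * (+ (offset s ℕ.+ M₀) + z)) (sym (ℤₚ.pos-* (6 ℕ.+ M₀ ℕ.+ n) i))) (sym (ℤₚ.pos-* 2 (offset s ℕ.+ M₀ ℕ.+ (6 ℕ.+ M₀ ℕ.+ n) ℕ.* i)))))))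
            big : 5 ℕ.+ p ℕ.< 1 ℕ.+ (2 ℕ.* n ℕ.+ k)
            big = ℕₚ.≤-trans (ℕₚ.≤-reflexive (sym 2n≡)) (ℕₚ.≤-trans (ℕₚ.m≤m+n (2 ℕ.* n) k) (ℕₚ.n≤1+n _))

      -- The sum over m is written once for each node s and cut after M₀ + 5 + s. Because the cuts
      -- are consecutive, the weighted pieces behind them line up as quadrature rules of step d,
      -- while the pieces in front form `head`.
      row : L * ∑ n (λ m → y (suc m)) ≡ head + (∑ n (λ j → panelAt p d (5 ℕ.+ (M ℕ.+ j))) + Y (+ d))
      row = begin
        L * C                                                          ≡⟨ trans (ℤₚ.*-comm L C) (sym (lin-const ωs C)) ⟩
        lin ωs (λ _ → C)                                               ≡⟨ lin-cong ωs (λ s → sym (trans (sym (∑-split (M₀ ℕ.+ offset s) n (λ m → y (suc m)))) (∑-extend (λ m → y (suc m)) (ℕₚ.m≤n+m n (M₀ ℕ.+ offset s)) y-zero))) ⟩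
        lin ωs (λ s → ∑ (M₀ ℕ.+ offset s) (λ m → y (suc m)) + ∑ n (λ j → y (suc (M₀ ℕ.+ offset s ℕ.+ j)))) ≡⟨ lin-+ ωs (λ s → ∑ (M₀ ℕ.+ offset s) (λ m → y (suc m))) (λ s → ∑ n (λ j → y (suc (M₀ ℕ.+ offset s ℕ.+ j)))) ⟩
        head + lin ωs (λ s → ∑ n (λ j → y (suc (M₀ ℕ.+ offset s ℕ.+ j))))   ≡⟨ cong (λ z → head + z) (trans (lin-∑ ωs n (λ j s → y (suc (M₀ ℕ.+ offset s ℕ.+ j)))) (∑-cong n panel-split)) ⟩
        head + ∑ n (λ j → panelAt p d (5 ℕ.+ (M ℕ.+ j)) + ∑ d (λ v → lin ωs (λ s → u p (+ ((5 ℕ.+ M) ℕ.* d) + s + + (j ℕ.* d ℕ.+ v)))))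
          ≡⟨ cong (λ z → head + z) (trans (∑-+ n (λ j → panelAt p d (5 ℕ.+ (M ℕ.+ j))) (λ j → ∑ d (λ v → lin ωs (λ s → u p (+ ((5 ℕ.+ M) ℕ.* d) + s + + (j ℕ.* d ℕ.+ v)))))) (cong (λ z → ∑ n (λ j → panelAt p d (5 ℕ.+ (M ℕ.+ j))) + z) tails)) ⟩
        head + (∑ n (λ j → panelAt p d (5 ℕ.+ (M ℕ.+ j))) + Y (+ d)) ∎
        where
        open ≡-Reasoning
        C = ∑ n (λ m → y (suc m))

    h : ℕ → ℤ
    h m = ∑ n (λ i → + suc i * u p (+ (m ℕ.* suc i)))

    E₁ : ℤ
    E₁ = lin ωs (λ s → ∑ (M₀ ℕ.+ offset s) (λ m → h (suc m)))

    pans : ℕ → ℤ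
    pans i = ∑ n (λ j → panelAt p (suc i) (5 ℕ.+ (M ℕ.+ j)))

    -- For d = 1 the wide rule and the unit rule coincide; hence the panel bounds may assume d ≥ 2.
    panelAt-1 : ∀ k → panelAt p 1 k ≡ 0ℤ
    panelAt-1 k = trans (cong₂ (λ x z → 1ℤ * x - (0ℤ + z)) (lin-cong ωs (λ s → cong g (cong (λ z → + 5 + z) (ℤₚ.*-identityʳ s)))) (lin-cong ωs (λ s → cong g (ℤₚ.+-identityʳ (+ 5 + s)))))
      (ring (lin ωs (λ s → g (+ 5 + s))))
      where
      g : ℤ → ℤ
      g x = u p (+ (k ℕ.* 1) - + 5 + x)
      ring : ∀ x → 1ℤ * x - (0ℤ + x) ≡ 0ℤ
      ring = solve-∀

    -- Doubling lets the evenness of `Y` complete the sum over d ≥ 1 to a symmetric window, which is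
    -- a fold.
    decomposition : + 2 * (L * S p n 2n≡) ≡ + 2 * E₁ + + 2 * ∑ n pans + (∑± n Y - Y 0ℤ)
    decomposition = begin
      + 2 * (L * S p n 2n≡)                                            ≡⟨ cong (λ z → + 2 * (L * z)) (∑-σ n n (λ k → u p (+ k)) ℕₚ.≤-refl u-zero) ⟩
      + 2 * (L * ∑ n (λ i → ∑ n (λ m → + suc i * u p (+ (suc m ℕ.* suc i)))))  ≡⟨ cong (+ 2 *_) (sym (∑-* n L (λ i → ∑ n (λ m → + suc i * u p (+ (suc m ℕ.* suc i)))))) ⟩
      + 2 * ∑ n (λ i → L * ∑ n (λ m → + suc i * u p (+ (suc m ℕ.* suc i))))    ≡⟨ cong (+ 2 *_) (∑-cong n row) ⟩
      + 2 * ∑ n (λ i → heads i + (pans i + Y (+ suc i)))               ≡⟨ cong (+ 2 *_) (trans (∑-+ n heads (λ i → pans i + Y (+ suc i))) (cong₂ _+_ heads≡ (∑-+ n pans (λ i → Y (+ suc i))))) ⟩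
      + 2 * (E₁ + (∑ n pans + ∑ n (λ i → Y (+ suc i))))                ≡⟨ ring E₁ (∑ n pans) (∑ n (λ i → Y (+ suc i))) (Y 0ℤ) ⟩
      + 2 * E₁ + + 2 * ∑ n pans + (Y 0ℤ + + 2 * ∑ n (λ i → Y (+ suc i)) - Y 0ℤ) ≡⟨ cong (λ z → + 2 * E₁ + + 2 * ∑ n pans + (Y 0ℤ + z - Y 0ℤ)) doubled ⟩
      + 2 * E₁ + + 2 * ∑ n pans + (∑± n Y - Y 0ℤ) ∎
      where
      open ≡-Reasoning
      heads : ℕ → ℤ
      heads i = lin ωs (λ s → ∑ (M₀ ℕ.+ offset s) (λ m → + suc i * u p (+ (suc m ℕ.* suc i))))
      heads≡ : ∑ n heads ≡ E₁
      heads≡ = trans (sym (lin-∑ ωs n (λ i s → ∑ (M₀ ℕ.+ offset s) (λ m → + suc i * u p (+ (suc m ℕ.* suc i))))))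
                     (lin-cong ωs (λ s → ∑-swap n (M₀ ℕ.+ offset s) (λ i m → + suc i * u p (+ (suc m ℕ.* suc i)))))
      ring : ∀ e q y z → + 2 * (e + (q + y)) ≡ + 2 * e + + 2 * q + (z + + 2 * y - z)
      ring = solve-∀
      ring′ : ∀ x → + 2 * x ≡ x + x
      ring′ = solve-∀
      doubled : + 2 * ∑ n (λ i → Y (+ suc i)) ≡ ∑ n (λ i → Y (+ suc i) + Y -[1+ i ])
      doubled = trans (sym (∑-* n (+ 2) (λ i → Y (+ suc i)))) (∑-cong n (λ i → trans (ring′ (Y (+ suc i))) (cong (λ z → Y (+ suc i) + z) (sym (Y-even (+ suc i))))))

-- Exponentially small terms

module SmallTerms where

  open Sums
  open Coefficients
  open Folding
  open Quadrature
  open PanelBound using (linᴺ-*)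
  open BlockSums using (G; u; G-parity)
  open PanelSum
  open DivisorSums
  open Reduction
  open Decomposition
  open import Data.Nat as ℕ using (ℕ; suc; s≤s; z≤n)
  import Data.Nat.Properties as ℕₚ
  open import Data.Integer using (ℤ; +_; -[1+_]; _+_; _*_; _-_; -_; ∣_∣; 0ℤ; 1ℤ)
  import Data.Integer.Properties as ℤₚ
  open import Data.Integer.Tactic.RingSolver using (solve-∀)
  import Data.Nat.Tactic.RingSolver as ℕS
  open import Relation.Binary.PropositionalEquality

  -- Folds of different orders come with exponents k + p. They are brought to the common exponent p,
  -- each surplus step costing a factor 2 at most, since 2q ≤ 2(4 + q).
  rate-cancel : ∀ X C q k p → X ℕ.* (4 ℕ.+ q) ℕ.^ (k ℕ.+ p) ℕ.≤ C ℕ.* (2 ℕ.* q) ℕ.^ (k ℕ.+ p) →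
                X ℕ.* (4 ℕ.+ q) ℕ.^ p ℕ.≤ C ℕ.* 2 ℕ.^ k ℕ.* (2 ℕ.* q) ℕ.^ p
  rate-cancel X C q k p le = ℕₚ.*-cancelˡ-≤ (R ℕ.^ k) {{ℕₚ.m^n≢0 R k}} (begin
    R ℕ.^ k ℕ.* (X ℕ.* R ℕ.^ p)                          ≡⟨ ring₁ (R ℕ.^ k) X (R ℕ.^ p) ⟩
    X ℕ.* (R ℕ.^ k ℕ.* R ℕ.^ p)                          ≡⟨ cong (X ℕ.*_) (ℕₚ.^-distribˡ-+-* R k p) ⟨
    X ℕ.* R ℕ.^ (k ℕ.+ p)                                ≤⟨ le ⟩
    C ℕ.* (2 ℕ.* q) ℕ.^ (k ℕ.+ p)                        ≡⟨ cong (C ℕ.*_) (ℕₚ.^-distribˡ-+-* (2 ℕ.* q) k p) ⟩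
    C ℕ.* ((2 ℕ.* q) ℕ.^ k ℕ.* (2 ℕ.* q) ℕ.^ p)          ≤⟨ ℕₚ.*-monoʳ-≤ C (ℕₚ.*-monoˡ-≤ ((2 ℕ.* q) ℕ.^ p) (ℕₚ.≤-trans (ℕₚ.≤-reflexive (^-distrib-* k 2 q)) (ℕₚ.*-monoʳ-≤ (2 ℕ.^ k) (ℕₚ.^-monoˡ-≤ k (ℕₚ.m≤n+m q 4))))) ⟩
    C ℕ.* (2 ℕ.^ k ℕ.* R ℕ.^ k ℕ.* (2 ℕ.* q) ℕ.^ p)      ≡⟨ ring₂ C (2 ℕ.^ k) (R ℕ.^ k) ((2 ℕ.* q) ℕ.^ p) ⟩
    R ℕ.^ k ℕ.* (C ℕ.* 2 ℕ.^ k ℕ.* (2 ℕ.* q) ℕ.^ p)      ∎)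
    where
    open ℕₚ.≤-Reasoning
    R = 4 ℕ.+ q
    ring₁ : ∀ a b c → a ℕ.* (b ℕ.* c) ≡ b ℕ.* (a ℕ.* c)
    ring₁ = ℕS.solve-∀
    ring₂ : ∀ C t r z → C ℕ.* (t ℕ.* r ℕ.* z) ≡ r ℕ.* (C ℕ.* t ℕ.* z)
    ring₂ = ℕS.solve-∀

  module _ (p n : ℕ) (2n≡ : 2 ℕ.* n ≡ 6 ℕ.+ p) (q : ℕ) where

    R^ θ^ y : ℕ
    R^ = (4 ℕ.+ q) ℕ.^ p
    θ^ = (2 ℕ.* q) ℕ.^ p
    y  = 3 ℕ.+ p

    -- Lower bounds on the number of folds: the support of coef fits into one period of the antisymmetric extension.
    fits : ∀ m → 1 ℕ.≤ m → 5 ℕ.+ p ℕ.< m ℕ.* (2 ℕ.* n ℕ.+ 1)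
    fits m m≥1 = ℕₚ.≤-trans (ℕₚ.≤-trans (ℕₚ.≤-reflexive (sym 2n≡)) (ℕₚ.m≤m+n (2 ℕ.* n) 1)) (ℕₚ.m≤n*m (2 ℕ.* n ℕ.+ 1) m {{ℕ.>-nonZero m≥1}})

    module _ (m : ℕ) (m≥1 : 1 ℕ.≤ m) (m²≤ : m ℕ.* m ℕ.≤ 4 ℕ.+ q) where

      fold₂ : ∀ k t → k ℕ.≤ 4 → suc ∣ t ∣ ℕ.≤ m → ∣ fold m n 2 (k ℕ.+ p) t ∣ ℕ.* R^ ℕ.≤ 12 ℕ.* suc ∣ t ∣ ℕ.* 2 ℕ.^ k ℕ.* θ^
      fold₂ k t k≤4 t<m = rate-cancel (∣ fold m n 2 (k ℕ.+ p) t ∣) (12 ℕ.* suc ∣ t ∣) q k p (ℕₚ.≤-trans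
        (fold-even-bound m n m≥1 1 refl q m²≤ (k ℕ.+ p) t t<m (ℕₚ.≤-trans (s≤s (s≤s (ℕₚ.+-monoˡ-≤ p k≤4))) (fits m m≥1)))
        (ℕₚ.≤-reflexive (ring ((2 ℕ.* q) ℕ.^ (k ℕ.+ p)) (suc ∣ t ∣))))
        where
        ring : ∀ x t → 12 ℕ.* x ℕ.* t ≡ 12 ℕ.* t ℕ.* x
        ring = ℕS.solve-∀

      fold₄ : ∀ k t → k ℕ.≤ 2 → suc ∣ t ∣ ℕ.≤ m → ∣ fold m n 4 (k ℕ.+ p) t ∣ ℕ.* R^ ℕ.≤ 48 ℕ.* suc ∣ t ∣ ℕ.* 2 ℕ.^ k ℕ.* θ^
      fold₄ k t k≤2 t<m = rate-cancel (∣ fold m n 4 (k ℕ.+ p) t ∣) (48 ℕ.* suc ∣ t ∣) q k p (ℕₚ.≤-trans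
        (fold-even-bound m n m≥1 3 refl q m²≤ (k ℕ.+ p) t t<m (ℕₚ.≤-trans (s≤s (ℕₚ.+-monoʳ-≤ 3 (ℕₚ.+-monoˡ-≤ p k≤2))) (fits m m≥1)))
        (ℕₚ.≤-reflexive (ring ((2 ℕ.* q) ℕ.^ (k ℕ.+ p)) (suc ∣ t ∣))))
        where
        ring : ∀ x t → 48 ℕ.* x ℕ.* t ≡ 48 ℕ.* t ℕ.* x
        ring = ℕS.solve-∀

      fold₆ : ∣ fold m n 6 p 0ℤ ∣ ℕ.* R^ ℕ.≤ 192 ℕ.* θ^
      fold₆ = ℕₚ.≤-trans (fold-even-bound m n m≥1 5 refl q m²≤ p 0ℤ m≥1 (fits m m≥1)) (ℕₚ.≤-reflexive (ℕₚ.*-identityʳ (192 ℕ.* θ^)))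

      private
        c = + (2 ℕ.* m)

        T : ℤ → ℤ
        T t = t * G p 0 t

        T-even : ∀ t → T (- t) ≡ T t
        T-even t = trans (cong (- t *_) (G-parity p 0 t)) (ring t (G p 0 t))
          where
          ring : ∀ t g → - t * (- 1ℤ * g) ≡ t * g
          ring = solve-∀

      -- With t = 2md, the term 2m d u(md) equals t G(t), which is even and vanishes at 0. Twice its
      -- sum over d ≥ 1 is therefore a complete fold at 0, and `tG` splits it into orders.
      4mh : ∀ M₀ → + 4 * + m * h p n 2n≡ M₀ m ≡ + 9 * fold m n 2 (4 ℕ.+ p) 0ℤ + + 8 * + y * fold m n 4 (2 ℕ.+ p) 0ℤ + + y * + (1 ℕ.+ p) * fold m n 6 p 0ℤ
      4mh M₀ = begin
        + 4 * + m * ∑ n (λ i → + suc i * u p (+ (m ℕ.* suc i)))                ≡⟨ ∑-* n (+ 4 * + m) (λ i → + suc i * u p (+ (m ℕ.* suc i))) ⟨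
        ∑ n (λ i → + 4 * + m * (+ suc i * u p (+ (m ℕ.* suc i))))              ≡⟨ ∑-cong n eq ⟩
        ∑ n (λ i → T (0ℤ + c * + suc i) + T (0ℤ + c * -[1+ i ]))               ≡⟨ ℤₚ.+-identityˡ _ ⟨
        0ℤ + ∑ n (λ i → T (0ℤ + c * + suc i) + T (0ℤ + c * -[1+ i ]))          ≡⟨ cong (_+ ∑ n (λ i → T (0ℤ + c * + suc i) + T (0ℤ + c * -[1+ i ]))) T0 ⟨
        ∑± n (λ x → T (0ℤ + c * x))                                            ≡⟨ ∑±-cong n (λ x → tG p (0ℤ + c * x)) ⟩
        ∑± n (λ x → + 9 * f₂ x + + 8 * + y * f₄ x + + y * + (1 ℕ.+ p) * f₆ x)  ≡⟨ trans (∑±-+ n (λ x → + 9 * f₂ x + + 8 * + y * f₄ x) (λ x → + y * + (1 ℕ.+ p) * f₆ x))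
                                                                                    (cong₂ _+_ (trans (∑±-+ n (λ x → + 9 * f₂ x) (λ x → + 8 * + y * f₄ x)) (cong₂ _+_ (∑±-* n (+ 9) f₂) (∑±-* n (+ 8 * + y) f₄))) (∑±-* n (+ y * + (1 ℕ.+ p)) f₆)) ⟩
        + 9 * fold m n 2 (4 ℕ.+ p) 0ℤ + + 8 * + y * fold m n 4 (2 ℕ.+ p) 0ℤ + + y * + (1 ℕ.+ p) * fold m n 6 p 0ℤ ∎
        where
        open ≡-Reasoning
        f₂ f₄ f₆ : ℤ → ℤ
        f₂ x = coef 2 (4 ℕ.+ p) (0ℤ + c * x)
        f₄ x = coef 4 (2 ℕ.+ p) (0ℤ + c * x)
        f₆ x = coef 6 p (0ℤ + c * x)
        T0 : T (0ℤ + c * 0ℤ) ≡ 0ℤ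
        T0 = trans (cong T (trans (ℤₚ.+-identityˡ (c * 0ℤ)) (ℤₚ.*-zeroʳ c))) (ℤₚ.*-zeroˡ (G p 0 0ℤ))
        ring₁ : ∀ m i → 0ℤ + + 2 * m * i ≡ + 2 * (m * i)
        ring₁ = solve-∀
        ring₂ : ∀ m i g → + 4 * m * (i * g) ≡ + 2 * (m * i) * g + + 2 * (m * i) * g
        ring₂ = solve-∀
        ring₃ : ∀ c i → 0ℤ + c * - i ≡ - (0ℤ + c * i)
        ring₃ = solve-∀
        index : ∀ i → 0ℤ + c * + suc i ≡ + 2 * + (m ℕ.* suc i)
        index i = trans (cong (λ z → 0ℤ + z * + suc i) (ℤₚ.pos-* 2 m)) (trans (ring₁ (+ m) (+ suc i)) (cong (+ 2 *_) (sym (ℤₚ.pos-* m (suc i)))))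
        eq : ∀ i → + 4 * + m * (+ suc i * u p (+ (m ℕ.* suc i))) ≡ T (0ℤ + c * + suc i) + T (0ℤ + c * -[1+ i ])
        eq i = trans (ring₂ (+ m) (+ suc i) (u p (+ (m ℕ.* suc i)))) (trans (cong (λ z → + 2 * z * g + + 2 * z * g) (sym (ℤₚ.pos-* m (suc i))))
          (cong₂ _+_ (cong T (sym (index i))) (trans (cong T (sym (index i))) (trans (sym (T-even (0ℤ + c * + suc i))) (cong T (sym (ring₃ c (+ suc i))))))))
          where g = u p (+ (m ℕ.* suc i))

      h-bound : ∀ M₀ → 146 ℕ.≤ y → ∣ h p n 2n≡ M₀ m ∣ ℕ.* R^ ℕ.≤ 50 ℕ.* (y ℕ.* y) ℕ.* θ^
      h-bound M₀ y≥ = ℕₚ.*-cancelˡ-≤ 4 (begin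
        4 ℕ.* (H ℕ.* R^)                                         ≤⟨ ℕₚ.*-monoʳ-≤ 4 (ℕₚ.*-monoˡ-≤ R^ (ℕₚ.m≤n*m H m {{ℕ.>-nonZero m≥1}})) ⟩
        4 ℕ.* (m ℕ.* H ℕ.* R^)                                   ≡⟨ ring₁ m H R^ ⟩
        4 ℕ.* m ℕ.* H ℕ.* R^                                     ≡⟨ cong (ℕ._* R^) (trans (cong (ℕ._* H) (sym (ℤₚ.∣i*j∣≡∣i∣*∣j∣ (+ 4) (+ m)))) (trans (sym (ℤₚ.∣i*j∣≡∣i∣*∣j∣ (+ 4 * + m) (h p n 2n≡ M₀ m))) (cong ∣_∣ (4mh M₀)))) ⟩
        ∣ + 9 * A₂ + + 8 * + y * A₄ + + y * + (1 ℕ.+ p) * A₆ ∣ ℕ.* R^ ≤⟨ ℕₚ.*-monoˡ-≤ R^ (ℕₚ.≤-trans (ℤₚ.∣i+j∣≤∣i∣+∣j∣ (+ 9 * A₂ + + 8 * + y * A₄) (+ y * + (1 ℕ.+ p) * A₆)) (ℕₚ.+-monoˡ-≤ _ (ℤₚ.∣i+j∣≤∣i∣+∣j∣ (+ 9 * A₂) (+ 8 * + y * A₄)))) ⟩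
        (∣ + 9 * A₂ ∣ ℕ.+ ∣ + 8 * + y * A₄ ∣ ℕ.+ ∣ + y * + (1 ℕ.+ p) * A₆ ∣) ℕ.* R^
          ≡⟨ cong (ℕ._* R^) (cong₂ ℕ._+_ (cong₂ ℕ._+_ (ℤₚ.∣i*j∣≡∣i∣*∣j∣ (+ 9) A₂) (trans (ℤₚ.∣i*j∣≡∣i∣*∣j∣ (+ 8 * + y) A₄) (cong (ℕ._* ∣ A₄ ∣) (ℤₚ.∣i*j∣≡∣i∣*∣j∣ (+ 8) (+ y)))))
               (trans (ℤₚ.∣i*j∣≡∣i∣*∣j∣ (+ y * + (1 ℕ.+ p)) A₆) (cong (ℕ._* ∣ A₆ ∣) (ℤₚ.∣i*j∣≡∣i∣*∣j∣ (+ y) (+ (1 ℕ.+ p)))))) ⟩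
        (9 ℕ.* ∣ A₂ ∣ ℕ.+ 8 ℕ.* y ℕ.* ∣ A₄ ∣ ℕ.+ y ℕ.* (1 ℕ.+ p) ℕ.* ∣ A₆ ∣) ℕ.* R^   ≡⟨ ring₂ (∣ A₂ ∣) y (∣ A₄ ∣) (1 ℕ.+ p) (∣ A₆ ∣) R^ ⟩
        9 ℕ.* (∣ A₂ ∣ ℕ.* R^) ℕ.+ 8 ℕ.* y ℕ.* (∣ A₄ ∣ ℕ.* R^) ℕ.+ y ℕ.* (1 ℕ.+ p) ℕ.* (∣ A₆ ∣ ℕ.* R^)
          ≤⟨ ℕₚ.+-mono-≤ (ℕₚ.+-mono-≤ (ℕₚ.*-monoʳ-≤ 9 (fold₂ 4 0ℤ ℕₚ.≤-refl m≥1)) (ℕₚ.*-monoʳ-≤ (8 ℕ.* y) (fold₄ 2 0ℤ ℕₚ.≤-refl m≥1))) (ℕₚ.*-monoʳ-≤ (y ℕ.* (1 ℕ.+ p)) fold₆) ⟩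
        9 ℕ.* (192 ℕ.* θ^) ℕ.+ 8 ℕ.* y ℕ.* (192 ℕ.* θ^) ℕ.+ y ℕ.* (1 ℕ.+ p) ℕ.* (192 ℕ.* θ^) ≡⟨ ring₃ y (1 ℕ.+ p) θ^ ⟩
        (1728 ℕ.+ 1536 ℕ.* y ℕ.+ 192 ℕ.* (y ℕ.* (1 ℕ.+ p))) ℕ.* θ^  ≤⟨ ℕₚ.*-monoˡ-≤ θ^ poly ⟩
        200 ℕ.* (y ℕ.* y) ℕ.* θ^                                 ≡⟨ ring₅ (y ℕ.* y) θ^ ⟩
        4 ℕ.* (50 ℕ.* (y ℕ.* y) ℕ.* θ^)                          ∎)
        where
        open ℕₚ.≤-Reasoning
        H = ∣ h p n 2n≡ M₀ m ∣
        A₂ = fold m n 2 (4 ℕ.+ p) 0ℤ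
        A₄ = fold m n 4 (2 ℕ.+ p) 0ℤ
        A₆ = fold m n 6 p 0ℤ
        ring₁ : ∀ m H R → 4 ℕ.* (m ℕ.* H ℕ.* R) ≡ 4 ℕ.* m ℕ.* H ℕ.* R
        ring₁ = ℕS.solve-∀
        ring₂ : ∀ a y b z c R → (9 ℕ.* a ℕ.+ 8 ℕ.* y ℕ.* b ℕ.+ y ℕ.* z ℕ.* c) ℕ.* R ≡ 9 ℕ.* (a ℕ.* R) ℕ.+ 8 ℕ.* y ℕ.* (b ℕ.* R) ℕ.+ y ℕ.* z ℕ.* (c ℕ.* R)
        ring₂ = ℕS.solve-∀
        ring₃ : ∀ y z t → 9 ℕ.* (192 ℕ.* t) ℕ.+ 8 ℕ.* y ℕ.* (192 ℕ.* t) ℕ.+ y ℕ.* z ℕ.* (192 ℕ.* t) ≡ (1728 ℕ.+ 1536 ℕ.* y ℕ.+ 192 ℕ.* (y ℕ.* z)) ℕ.* t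
        ring₃ = ℕS.solve-∀
        ring₄ : ∀ p → 1728 ℕ.+ 1536 ℕ.* (3 ℕ.+ p) ℕ.+ 192 ℕ.* ((3 ℕ.+ p) ℕ.* (1 ℕ.+ p)) ≡ 192 ℕ.* ((3 ℕ.+ p) ℕ.* (3 ℕ.+ p)) ℕ.+ (1152 ℕ.* (3 ℕ.+ p) ℕ.+ 1728)
        ring₄ = ℕS.solve-∀
        ring₅ : ∀ x t → 200 ℕ.* x ℕ.* t ≡ 4 ℕ.* (50 ℕ.* x ℕ.* t)
        ring₅ = ℕS.solve-∀
        ring₆ : ∀ x → 1152 ℕ.* x ℕ.+ 16 ℕ.* x ≡ 8 ℕ.* (146 ℕ.* x)
        ring₆ = ℕS.solve-∀
        ring₇ : ∀ x → 192 ℕ.* x ℕ.+ 8 ℕ.* x ≡ 200 ℕ.* x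
        ring₇ = ℕS.solve-∀
        -- Here 1728 ≤ 16 · 146 ≤ 16 y, and then 1152 y + 16 y = 8 · 146 y ≤ 8 y² fills the gap
        -- between 192 and 200.
        poly : 1728 ℕ.+ 1536 ℕ.* y ℕ.+ 192 ℕ.* (y ℕ.* (1 ℕ.+ p)) ℕ.≤ 200 ℕ.* (y ℕ.* y)
        poly = begin
          1728 ℕ.+ 1536 ℕ.* y ℕ.+ 192 ℕ.* (y ℕ.* (1 ℕ.+ p))   ≡⟨ ring₄ p ⟩
          192 ℕ.* (y ℕ.* y) ℕ.+ (1152 ℕ.* y ℕ.+ 1728)         ≤⟨ ℕₚ.+-monoʳ-≤ (192 ℕ.* (y ℕ.* y)) (ℕₚ.+-monoʳ-≤ (1152 ℕ.* y) (ℕₚ.≤-trans (ℕₚ.m≤m+n 1728 608) (ℕₚ.*-monoʳ-≤ 16 y≥))) ⟩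
          192 ℕ.* (y ℕ.* y) ℕ.+ (1152 ℕ.* y ℕ.+ 16 ℕ.* y)     ≡⟨ cong (192 ℕ.* (y ℕ.* y) ℕ.+_) (ring₆ y) ⟩
          192 ℕ.* (y ℕ.* y) ℕ.+ 8 ℕ.* (146 ℕ.* y)             ≤⟨ ℕₚ.+-monoʳ-≤ (192 ℕ.* (y ℕ.* y)) (ℕₚ.*-monoʳ-≤ 8 (ℕₚ.*-monoˡ-≤ y y≥)) ⟩
          192 ℕ.* (y ℕ.* y) ℕ.+ 8 ℕ.* (y ℕ.* y)               ≡⟨ ring₇ (y ℕ.* y) ⟩
          200 ℕ.* (y ℕ.* y)                                   ∎

    module _ (M₀ : ℕ) (Q²≤ : (M₀ ℕ.+ 11) ℕ.* (M₀ ℕ.+ 11) ℕ.≤ 4 ℕ.+ q) (y≥ : 146 ℕ.≤ y) where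

      private
        Q = M₀ ℕ.+ 11

        lin-bound : ∀ (X : ℤ → ℤ) B → (∀ s → Ok s → R^ ℕ.* ∣ X s ∣ ℕ.≤ B) → R^ ℕ.* ∣ lin ωs X ∣ ℕ.≤ B ℕ.* linᴺ ωs (λ _ → 1)
        lin-bound X B hyp = ℕₚ.≤-trans (lin-abs ωs Ok ωs-ok R^ X (λ _ → B ℕ.* 1) (λ s ok → ℕₚ.≤-trans (hyp s ok) (ℕₚ.≤-reflexive (sym (ℕₚ.*-identityʳ B)))))
                                       (ℕₚ.≤-reflexive (linᴺ-* ωs B (λ _ → 1)))

      E₁-bound : R^ ℕ.* ∣ E₁ p n 2n≡ M₀ ∣ ℕ.≤ (M₀ ℕ.+ 11) ℕ.* (50 ℕ.* (y ℕ.* y) ℕ.* θ^) ℕ.* linᴺ ωs (λ _ → 1)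
      E₁-bound = lin-bound _ (Q ℕ.* (50 ℕ.* (y ℕ.* y) ℕ.* θ^)) (λ s ok → begin
        R^ ℕ.* ∣ ∑ (M₀ ℕ.+ ∣ + 5 + s ∣) (λ m → h p n 2n≡ M₀ (suc m)) ∣            ≤⟨ ℕₚ.*-monoʳ-≤ R^ (∑-abs (M₀ ℕ.+ ∣ + 5 + s ∣) (λ m → h p n 2n≡ M₀ (suc m))) ⟩
        -- The cuts differ with s, but none exceeds M₀ + 11; all heads are enlarged to that common
        -- length.
        R^ ℕ.* ∑ᴺ (M₀ ℕ.+ ∣ + 5 + s ∣) (λ m → ∣ h p n 2n≡ M₀ (suc m) ∣)           ≤⟨ ℕₚ.*-monoʳ-≤ R^ (∑ᴺ-extend (λ m → ∣ h p n 2n≡ M₀ (suc m) ∣) (ℕₚ.+-monoʳ-≤ M₀ (∣5+s∣≤11 s ok))) ⟩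
        R^ ℕ.* ∑ᴺ Q (λ m → ∣ h p n 2n≡ M₀ (suc m) ∣)                              ≡⟨ ∑ᴺ-* Q R^ (λ m → ∣ h p n 2n≡ M₀ (suc m) ∣) ⟨
        ∑ᴺ Q (λ m → R^ ℕ.* ∣ h p n 2n≡ M₀ (suc m) ∣)                              ≤⟨ ∑ᴺ-mono< Q (λ m m<Q → ℕₚ.≤-trans (ℕₚ.≤-reflexive (ℕₚ.*-comm R^ (∣ h p n 2n≡ M₀ (suc m) ∣))) (h-bound (suc m) (s≤s z≤n) (ℕₚ.≤-trans (ℕₚ.*-mono-≤ m<Q m<Q) Q²≤) M₀ y≥)) ⟩
        ∑ᴺ Q (λ _ → 50 ℕ.* (y ℕ.* y) ℕ.* θ^)                                      ≡⟨ ∑ᴺ-const Q (50 ℕ.* (y ℕ.* y) ℕ.* θ^) ⟩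
        Q ℕ.* (50 ℕ.* (y ℕ.* y) ℕ.* θ^)                                           ∎)
        where open ℕₚ.≤-Reasoning

      -- Summed over the window first, the rule acts on folds with m = M₀ + 6 at the points 2s - 1.
      -- As |2s - 1| ≤ 11, the hypothesis M₀ ≥ 6 places them and their neighbours within [-m, m].
      Y-bound : 6 ℕ.≤ M₀ → R^ ℕ.* ∣ ∑± n (Y p n 2n≡ M₀) ∣ ℕ.≤ 1200 ℕ.* y ℕ.* θ^ ℕ.* linᴺ ωs (λ _ → 1)
      Y-bound M₀≥6 = ℕₚ.≤-trans (ℕₚ.≤-reflexive (cong (λ z → R^ ℕ.* ∣ z ∣) (lin-∑± ωs n (λ x s → q̂ p (+ 2 * s - 1ℤ + + (2 ℕ.* m) * x)))))
        (lin-bound (λ s → ∑± n (λ x → q̂ p (+ 2 * s - 1ℤ + + (2 ℕ.* m) * x))) (1200 ℕ.* y ℕ.* θ^) (λ s ok → begin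
        R^ ℕ.* ∣ ∑± n (λ x → q̂ p (+ 2 * s - 1ℤ + + (2 ℕ.* m) * x)) ∣
          ≡⟨ cong (λ z → R^ ℕ.* ∣ z ∣) (trans (∑±-+ n (λ x → + 3 * coef 2 (p ℕ.+ 3) (τ s + + (2 ℕ.* m) * x)) (λ x → + (p ℕ.+ 3) * coef 4 (p ℕ.+ 1) (τ s + + (2 ℕ.* m) * x)))
               (cong₂ _+_ (∑±-* n (+ 3) (λ x → coef 2 (p ℕ.+ 3) (τ s + + (2 ℕ.* m) * x))) (∑±-* n (+ (p ℕ.+ 3)) (λ x → coef 4 (p ℕ.+ 1) (τ s + + (2 ℕ.* m) * x))))) ⟩
        R^ ℕ.* ∣ + 3 * fold m n 2 (p ℕ.+ 3) (τ s) + + (p ℕ.+ 3) * fold m n 4 (p ℕ.+ 1) (τ s) ∣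
          ≡⟨ cong (λ z → R^ ℕ.* ∣ z ∣) (cong₂ _+_ (cong (λ k → + 3 * fold m n 2 k (τ s)) (ℕₚ.+-comm p 3)) (cong₂ _*_ (cong +_ (ℕₚ.+-comm p 3)) (cong (λ k → fold m n 4 k (τ s)) (ℕₚ.+-comm p 1)))) ⟩
        R^ ℕ.* ∣ + 3 * A₂ s + + y * A₄ s ∣                       ≤⟨ ℕₚ.*-monoʳ-≤ R^ (ℕₚ.≤-trans (ℤₚ.∣i+j∣≤∣i∣+∣j∣ (+ 3 * A₂ s) (+ y * A₄ s)) (ℕₚ.≤-reflexive (cong₂ ℕ._+_ (ℤₚ.∣i*j∣≡∣i∣*∣j∣ (+ 3) (A₂ s)) (ℤₚ.∣i*j∣≡∣i∣*∣j∣ (+ y) (A₄ s))))) ⟩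
        R^ ℕ.* (3 ℕ.* ∣ A₂ s ∣ ℕ.+ y ℕ.* ∣ A₄ s ∣)               ≡⟨ ring₁ R^ (∣ A₂ s ∣) y (∣ A₄ s ∣) ⟩
        3 ℕ.* (∣ A₂ s ∣ ℕ.* R^) ℕ.+ y ℕ.* (∣ A₄ s ∣ ℕ.* R^)      ≤⟨ ℕₚ.+-mono-≤ (ℕₚ.*-monoʳ-≤ 3 (ℕₚ.≤-trans (fold₂ m m≥1 m²≤ 3 (τ s) (ℕₚ.n≤1+n 3) (t<m s ok)) (ℕₚ.*-monoˡ-≤ θ^ (ℕₚ.*-monoˡ-≤ 8 (ℕₚ.*-monoʳ-≤ 12 (∣2s-1∣≤11 s ok))))))
                                                                                       (ℕₚ.*-monoʳ-≤ y (ℕₚ.≤-trans (fold₄ m m≥1 m²≤ 1 (τ s) (ℕₚ.n≤1+n 1) (t<m s ok)) (ℕₚ.*-monoˡ-≤ θ^ (ℕₚ.*-monoˡ-≤ 2 (ℕₚ.*-monoʳ-≤ 48 (∣2s-1∣≤11 s ok)))))) ⟩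
        3 ℕ.* (1152 ℕ.* θ^) ℕ.+ y ℕ.* (1152 ℕ.* θ^)              ≡⟨ ring₂ y θ^ ⟩
        (3456 ℕ.+ 1152 ℕ.* y) ℕ.* θ^                             ≤⟨ ℕₚ.*-monoˡ-≤ θ^ (ℕₚ.≤-trans (ℕₚ.+-monoˡ-≤ (1152 ℕ.* y) (ℕₚ.≤-trans (ℕₚ.m≤m+n 3456 3552) (ℕₚ.*-monoʳ-≤ 48 y≥))) (ℕₚ.≤-reflexive (ring₃ y))) ⟩
        1200 ℕ.* y ℕ.* θ^                                        ∎))
        where
        open ℕₚ.≤-Reasoning
        m = 5 ℕ.+ suc M₀
        τ : ℤ → ℤ
        τ s = + 2 * s - 1ℤ
        A₂ A₄ : ℤ → ℤ
        A₂ s = fold m n 2 (3 ℕ.+ p) (τ s)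
        A₄ s = fold m n 4 (1 ℕ.+ p) (τ s)
        m≥1 : 1 ℕ.≤ m
        m≥1 = s≤s z≤n
        m≤Q : m ℕ.≤ Q
        m≤Q = ℕₚ.≤-trans (ℕₚ.≤-reflexive (ring M₀)) (ℕₚ.+-monoʳ-≤ M₀ (ℕₚ.m≤m+n 6 5))
          where
          ring : ∀ M₀ → 5 ℕ.+ suc M₀ ≡ M₀ ℕ.+ 6
          ring = ℕS.solve-∀
        m²≤ : m ℕ.* m ℕ.≤ 4 ℕ.+ q
        m²≤ = ℕₚ.≤-trans (ℕₚ.*-mono-≤ m≤Q m≤Q) Q²≤
        t<m : ∀ s → Ok s → suc ∣ τ s ∣ ℕ.≤ m
        t<m s ok = ℕₚ.≤-trans (∣2s-1∣≤11 s ok) (ℕₚ.+-monoʳ-≤ 6 M₀≥6)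
        ring₁ : ∀ R a y b → R ℕ.* (3 ℕ.* a ℕ.+ y ℕ.* b) ≡ 3 ℕ.* (a ℕ.* R) ℕ.+ y ℕ.* (b ℕ.* R)
        ring₁ = ℕS.solve-∀
        ring₂ : ∀ y t → 3 ℕ.* (1152 ℕ.* t) ℕ.+ y ℕ.* (1152 ℕ.* t) ≡ (3456 ℕ.+ 1152 ℕ.* y) ℕ.* t
        ring₂ = ℕS.solve-∀
        ring₃ : ∀ y → 48 ℕ.* y ℕ.+ 1152 ℕ.* y ≡ 1200 ℕ.* y
        ring₃ = ℕS.solve-∀

-- The value at d = 0 and the main term

module MainTerm where

  open Sums
  open Coefficients
  open Quadrature
  open PanelBound using (linᴺ-*)
  open Reduction using (κ₀; q̂; q̂-closed)
  open Decomposition using (Y)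
  open import Data.Nat as ℕ using (ℕ; zero; suc; s≤s; z≤n)
  import Data.Nat.Properties as ℕₚ
  open import Data.Integer as ℤ using (ℤ; +_; -[1+_]; _+_; _*_; _-_; -_; ∣_∣; 0ℤ; 1ℤ)
  import Data.Integer.Properties as ℤₚ
  open import Data.Integer.Tactic.RingSolver using (solve-∀)
  import Data.Nat.Tactic.RingSolver as ℕS
  open import Relation.Binary.PropositionalEquality

  -- The ratio of adjacent binomial coefficients without division, read off from t times the
  -- coefficient in (y + y⁻¹)^(s+1), which `coef-A` and `coef-*t` evaluate in two ways.
  coef-ratio : ∀ s t → (+ suc s + t) * coef 0 s (t + 1ℤ) ≡ (+ suc s - t) * coef 0 s (t - 1ℤ)
  coef-ratio s t = begin
    (+ suc s + t) * b                             ≡⟨ ring₁ (+ suc s) t a b ⟩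
    (t * (a + b) - + suc s * (a - b)) + (+ suc s - t) * a ≡⟨ cong (_+ (+ suc s - t) * a) (trans (cong₂ _-_ rel refl) (ℤₚ.+-inverseʳ (+ suc s * (a - b)))) ⟩
    0ℤ + (+ suc s - t) * a                        ≡⟨ ℤₚ.+-identityˡ _ ⟩
    (+ suc s - t) * a                             ∎
    where
    open ≡-Reasoning
    a = coef 0 s (t - 1ℤ)
    b = coef 0 s (t + 1ℤ)
    ring₁ : ∀ S t a b → (S + t) * b ≡ (t * (a + b) - S * (a - b)) + (S - t) * a
    ring₁ = solve-∀
    ring₂ : ∀ x → 0ℤ * 0ℤ + x ≡ x
    ring₂ = solve-∀
    rel : t * (a + b) ≡ + suc s * (a - b)
    rel = trans (cong (t *_) (sym (coef-A 0 s t))) (trans (coef-*t 0 (suc s) t) (trans (ring₂ (+ suc s * coef 1 s t)) (cong (+ suc s *_) (coef-B 0 s t))))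

  -- This is 2(1³ + ⋯ + a³), the accumulated source term of `ε-rec`.
  cubes : ℕ → ℕ
  cubes zero    = 0
  cubes (suc a) = cubes a ℕ.+ 2 ℕ.* (suc a ℕ.* suc a ℕ.* suc a)

  module _ (p n : ℕ) (2n≡ : 2 ℕ.* n ≡ 6 ℕ.+ p) where

    private
      w : ℤ → ℤ
      w = coef 0 (5 ℕ.+ p)

    ω₁ : ℤ
    ω₁ = w 1ℤ

    W₁ : ℕ
    W₁ = ∣ ω₁ ∣

    -- The error, times n², of approximating a binomial coefficient near the centre by (1 - s(s -
    -- 1)/n) times the central one.
    ε : ℤ → ℤ
    ε s = + n * + n * w (+ 2 * s - 1ℤ) - (+ n * + n - s * (s - 1ℤ) * + n) * ω₁

    private
      +2n : + 6 + + p ≡ + 2 * + n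
      +2n = trans (cong +_ (sym 2n≡)) (ℤₚ.pos-* 2 n)

      step : ∀ s → (+ n + s) * w (+ 2 * s + 1ℤ) ≡ (+ n - s) * w (+ 2 * s - 1ℤ)
      step s = ℤₚ.*-cancelˡ-≡ (+ 2) _ _ (trans (ring₁ (+ n) s (w (+ 2 * s + 1ℤ))) (trans (cong (λ z → (z + + 2 * s) * w (+ 2 * s + 1ℤ)) (sym +2n))
        (trans (coef-ratio (5 ℕ.+ p) (+ 2 * s)) (trans (cong (λ z → (z - + 2 * s) * w (+ 2 * s - 1ℤ)) +2n) (ring₂ (+ n) s (w (+ 2 * s - 1ℤ)))))))
        where
        ring₁ : ∀ n s x → + 2 * ((n + s) * x) ≡ (+ 2 * n + + 2 * s) * x
        ring₁ = solve-∀
        ring₂ : ∀ n s x → (+ 2 * n - + 2 * s) * x ≡ + 2 * ((n - s) * x)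
        ring₂ = solve-∀

      -- The exact values satisfy the ratio (n - s)/(n + s). The approximation misses that relation
      -- by 2s³ n alone, since the terms with higher powers of n cancel.
      ε-rec : ∀ s → (+ n + s) * ε (s + 1ℤ) ≡ (+ n - s) * ε s + + n * (+ 2 * (s * s * s) * ω₁)
      ε-rec s = begin
        (+ n + s) * ε (s + 1ℤ)   ≡⟨ cong (λ z → (+ n + s) * (+ n * + n * w z - (+ n * + n - (s + 1ℤ) * (s + 1ℤ - 1ℤ) * + n) * ω₁)) (ring₀ s) ⟩
        (+ n + s) * (+ n * + n * b - (+ n * + n - (s + 1ℤ) * (s + 1ℤ - 1ℤ) * + n) * ω₁) ≡⟨ ring₁ (+ n) s b ω₁ ⟩
        + n * + n * ((+ n + s) * b) - (+ n + s) * ((+ n * + n - (s + 1ℤ) * (s + 1ℤ - 1ℤ) * + n) * ω₁) ≡⟨ cong (λ z → + n * + n * z - (+ n + s) * ((+ n * + n - (s + 1ℤ) * (s + 1ℤ - 1ℤ) * + n) * ω₁)) (step s) ⟩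
        + n * + n * ((+ n - s) * a′) - (+ n + s) * ((+ n * + n - (s + 1ℤ) * (s + 1ℤ - 1ℤ) * + n) * ω₁) ≡⟨ ring₂ (+ n) s a′ ω₁ ⟩
        (+ n - s) * ε s + + n * (+ 2 * (s * s * s) * ω₁) ∎
        where
        open ≡-Reasoning
        a′ = w (+ 2 * s - 1ℤ)
        b = w (+ 2 * s + 1ℤ)
        ring₀ : ∀ s → + 2 * (s + 1ℤ) - 1ℤ ≡ + 2 * s + 1ℤ
        ring₀ = solve-∀
        ring₁ : ∀ n s b o → (n + s) * (n * n * b - (n * n - (s + 1ℤ) * (s + 1ℤ - 1ℤ) * n) * o) ≡ n * n * ((n + s) * b) - (n + s) * ((n * n - (s + 1ℤ) * (s + 1ℤ - 1ℤ) * n) * o)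
        ring₁ = solve-∀
        ring₂ : ∀ n s a o → n * n * ((n - s) * a) - (n + s) * ((n * n - (s + 1ℤ) * (s + 1ℤ - 1ℤ) * n) * o)
                            ≡ (n - s) * (n * n * a - (n * n - s * (s - 1ℤ) * n) * o) + n * (+ 2 * (s * s * s) * o)
        ring₂ = solve-∀

    ε-pos : ∀ a → a ℕ.≤ n → ∣ ε (+ suc a) ∣ ℕ.≤ cubes a ℕ.* W₁
    ε-pos zero    a≤n = ℕₚ.≤-reflexive (cong ∣_∣ (ring (+ n) ω₁))
      where
      ring : ∀ n o → n * n * o - (n * n - 1ℤ * 0ℤ * n) * o ≡ 0ℤ
      ring = solve-∀
    ε-pos (suc a) a<n = ℕₚ.*-cancelˡ-≤ (n ℕ.+ s) {{ℕ.>-nonZero (ℕₚ.≤-trans (s≤s z≤n) (ℕₚ.m≤n+m s n))}} (begin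
      (n ℕ.+ s) ℕ.* ∣ ε (+ suc s) ∣                               ≡⟨ ℤₚ.∣i*j∣≡∣i∣*∣j∣ (+ (n ℕ.+ s)) (ε (+ suc s)) ⟨
      ∣ (+ n + + s) * ε (+ suc s) ∣                               ≡⟨ cong ∣_∣ (trans (cong (λ z → (+ n + + s) * ε z) (ring₀ (+ s))) (ε-rec (+ s))) ⟩
      ∣ (+ n - + s) * ε (+ s) + + n * (+ 2 * (+ s * + s * + s) * ω₁) ∣ ≤⟨ ℤₚ.∣i+j∣≤∣i∣+∣j∣ ((+ n - + s) * ε (+ s)) (+ n * (+ 2 * (+ s * + s * + s) * ω₁)) ⟩
      ∣ (+ n - + s) * ε (+ s) ∣ ℕ.+ ∣ + n * (+ 2 * (+ s * + s * + s) * ω₁) ∣ ≡⟨ cong₂ ℕ._+_ (ℤₚ.∣i*j∣≡∣i∣*∣j∣ (+ n - + s) (ε (+ s))) (trans (ℤₚ.∣i*j∣≡∣i∣*∣j∣ (+ n) (+ 2 * (+ s * + s * + s) * ω₁)) (cong (n ℕ.*_) (trans (ℤₚ.∣i*j∣≡∣i∣*∣j∣ (+ 2 * (+ s * + s * + s)) ω₁) (cong (ℕ._* W₁) cube)))) ⟩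
      ∣ + n - + s ∣ ℕ.* ∣ ε (+ s) ∣ ℕ.+ n ℕ.* (2 ℕ.* (s ℕ.* s ℕ.* s) ℕ.* W₁) ≤⟨ ℕₚ.+-monoˡ-≤ _ (ℕₚ.*-mono-≤ n-s≤n (ε-pos a (ℕₚ.<⇒≤ a<n))) ⟩
      n ℕ.* (cubes a ℕ.* W₁) ℕ.+ n ℕ.* (2 ℕ.* (s ℕ.* s ℕ.* s) ℕ.* W₁) ≡⟨ ring₁ n (cubes a) W₁ (2 ℕ.* (s ℕ.* s ℕ.* s)) ⟩
      n ℕ.* (cubes (suc a) ℕ.* W₁)                                ≤⟨ ℕₚ.*-monoˡ-≤ (cubes (suc a) ℕ.* W₁) (ℕₚ.m≤m+n n s) ⟩
      (n ℕ.+ s) ℕ.* (cubes (suc a) ℕ.* W₁)                        ∎)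
      where
      open ℕₚ.≤-Reasoning
      s = suc a
      ring₀ : ∀ s → 1ℤ + s ≡ s + 1ℤ
      ring₀ = solve-∀
      ring₁ : ∀ n c W e → n ℕ.* (c ℕ.* W) ℕ.+ n ℕ.* (e ℕ.* W) ≡ n ℕ.* ((c ℕ.+ e) ℕ.* W)
      ring₁ = ℕS.solve-∀
      cube : ∣ + 2 * (+ s * + s * + s) ∣ ≡ 2 ℕ.* (s ℕ.* s ℕ.* s)
      cube = trans (ℤₚ.∣i*j∣≡∣i∣*∣j∣ (+ 2) (+ s * + s * + s)) (cong (2 ℕ.*_) (trans (ℤₚ.∣i*j∣≡∣i∣*∣j∣ (+ s * + s) (+ s)) (cong (ℕ._* s) (ℤₚ.∣i*j∣≡∣i∣*∣j∣ (+ s) (+ s)))))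
      n-s≤n : ∣ + n - + s ∣ ℕ.≤ n
      n-s≤n = ℕₚ.≤-trans (ℕₚ.≤-reflexive (cong ∣_∣ (trans (ℤₚ.m-n≡m⊖n n s) (ℤₚ.⊖-≥ a<n)))) (ℕₚ.m∸n≤m n s)

    ε-sym : ∀ s → ε (1ℤ - s) ≡ ε s
    ε-sym s = cong₂ (λ x y → + n * + n * x - (+ n * + n - y * + n) * ω₁)
      (trans (cong w (ring₁ s)) (trans (coef-parity 0 (5 ℕ.+ p) (+ 2 * s - 1ℤ)) (ℤₚ.*-identityˡ _))) (ring₂ s)
      where
      ring₁ : ∀ s → + 2 * (1ℤ - s) - 1ℤ ≡ - (+ 2 * s - 1ℤ)
      ring₁ = solve-∀
      ring₂ : ∀ s → (1ℤ - s) * (1ℤ - s - 1ℤ) ≡ s * (s - 1ℤ)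
      ring₂ = solve-∀

    cubes-mono : ∀ {a b} → a ℕ.≤ b → cubes a ℕ.≤ cubes b
    cubes-mono {a} {b} a≤b = subst (λ z → cubes a ℕ.≤ cubes z) (ℕₚ.m∸n+n≡m a≤b) (go (b ℕ.∸ a))
      where
      go : ∀ k → cubes a ℕ.≤ cubes (k ℕ.+ a)
      go zero    = ℕₚ.≤-refl
      go (suc k) = ℕₚ.≤-trans (go k) (ℕₚ.m≤m+n _ _)

    -- The constant 450 is `cubes 5`; nodes s ≤ 0 are reflected to 1 - s, so the largest argument is
    -- 6 = 5 + 1.
    ε-bound : 5 ℕ.≤ n → ∀ s → Ok s → ∣ ε s ∣ ℕ.≤ 450 ℕ.* W₁
    ε-bound n≥5 (+ zero)  ok = ℕₚ.≤-trans (ℕₚ.≤-reflexive (cong ∣_∣ (sym (ε-sym (+ 0))))) (ℕₚ.≤-trans (ε-pos 0 z≤n) z≤n)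
    ε-bound n≥5 (+ suc a) ok = ℕₚ.≤-trans (ε-pos a (ℕₚ.≤-trans (ℕₚ.≤-pred ok) n≥5)) (ℕₚ.*-monoˡ-≤ W₁ (cubes-mono (ℕₚ.≤-pred ok)))
    ε-bound n≥5 -[1+ a ]  ok = ℕₚ.≤-trans (ℕₚ.≤-reflexive (cong ∣_∣ (sym (ε-sym -[1+ a ])))) (ℕₚ.≤-trans (ε-pos (suc a) (ℕₚ.≤-trans (s≤s ok) n≥5)) (ℕₚ.*-monoˡ-≤ W₁ (cubes-mono (s≤s ok))))

    -- For t = 2s - 1 this is (t² - 1)/4, the variable in which the closed form of `q̂` and the
    -- moments of the rule are expressed.
    σ₂ : ℤ → ℤ
    σ₂ s = s * (s - 1ℤ)

    private
      σ₂-bound : ∀ s → Ok s → ∣ σ₂ s ∣ ℕ.≤ 30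
      σ₂-bound (+ zero) ok = z≤n
      σ₂-bound (+ suc a) ok = ℕₚ.≤-trans (ℕₚ.≤-reflexive (trans (ℤₚ.∣i*j∣≡∣i∣*∣j∣ (+ suc a) (+ suc a - 1ℤ)) (cong (suc a ℕ.*_) (cong ∣_∣ (ring (+ a)))))) (ℕₚ.*-mono-≤ ok (ℕₚ.≤-pred ok))
        where
        ring : ∀ a → 1ℤ + a - 1ℤ ≡ a
        ring = solve-∀
      σ₂-bound -[1+ a ] ok = ℕₚ.≤-trans (ℕₚ.≤-reflexive (trans (ℤₚ.∣i*j∣≡∣i∣*∣j∣ -[1+ a ] (-[1+ a ] - 1ℤ)) (cong (λ z → suc a ℕ.* z) (cong (λ k → suc (suc k)) (ℕₚ.+-identityʳ a))))) (ℕₚ.*-mono-≤ (s≤s ok) (s≤s (s≤s ok)))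

      σ₂-nonneg : ∀ s → + ∣ σ₂ s ∣ ≡ σ₂ s
      σ₂-nonneg (+ zero)  = refl
      σ₂-nonneg (+ suc a) = ℤₚ.0≤i⇒+∣i∣≡i (subst (0ℤ ℤ.≤_) (trans (ℤₚ.pos-* (suc a) a) (cong (+ suc a *_) (ring (+ a)))) (ℤ.+≤+ z≤n))
        where
        ring : ∀ a → a ≡ 1ℤ + a - 1ℤ
        ring = solve-∀
      σ₂-nonneg -[1+ a ]  = refl

      factor-bound : 21 ℕ.≤ n → ∀ s → Ok s → ∣ + 2 * σ₂ s + + 2 - + 3 * + n ∣ ℕ.≤ 3 ℕ.* n
      factor-bound n≥21 s ok = subst (λ z → ∣ z ∣ ℕ.≤ 3 ℕ.* n) (sym eq) (ℕₚ.≤-trans (ℕₚ.≤-reflexive (ℤₚ.∣-i∣≡∣i∣ (+ (3 ℕ.* n ℕ.∸ k₁)))) (ℕₚ.m∸n≤m (3 ℕ.* n) k₁))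
       where
       k₁ = 2 ℕ.* ∣ σ₂ s ∣ ℕ.+ 2
       k≤ : k₁ ℕ.≤ 3 ℕ.* n
       k≤ = ℕₚ.≤-trans (ℕₚ.+-monoˡ-≤ 2 (ℕₚ.*-monoʳ-≤ 2 (σ₂-bound s ok))) (ℕₚ.≤-trans (ℕₚ.n≤1+n 62) (ℕₚ.*-monoʳ-≤ 3 n≥21))
       eq : + 2 * σ₂ s + + 2 - + 3 * + n ≡ - + (3 ℕ.* n ℕ.∸ k₁)
       eq = trans (cong₂ (λ x y → + 2 * x + + 2 - y) (sym (σ₂-nonneg s)) (sym (ℤₚ.pos-* 3 n)))
            (trans (cong (λ z → z + + 2 - + (3 ℕ.* n)) (sym (ℤₚ.pos-* 2 (∣ σ₂ s ∣)))) (trans (ℤₚ.m-n≡m⊖n k₁ (3 ℕ.* n)) (ℤₚ.⊖-≤ k≤)))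

    module _ (M₀ : ℕ) (n≥21 : 21 ℕ.≤ n) where

      Bᵐ : ℕ
      Bᵐ = c₁ ℕ.+ c₂ ℕ.* c₃ ℕ.* linᴺ ωs (λ _ → 1)

      private
        L₀ = lin ωs (λ _ → 1ℤ)

        P : ℤ → ℤ
        P s = σ₂ s * (+ 2 * σ₂ s + + 2 - + 3 * + n)

        E : ℤ
        E = lin ωs (λ s → P s * ε s)

        κ₀Y : + n * (κ₀ p * Y p n 2n≡ M₀ 0ℤ) ≡ + 16 * lin ωs (λ s → P s * (+ n * + n * w (+ 2 * s - 1ℤ)))
        κ₀Y = begin
          + n * (κ₀ p * Y p n 2n≡ M₀ 0ℤ)                         ≡⟨ cong (+ n *_) (sym (lin-* ωs (κ₀ p) (λ s → q̂ p (τ s)))) ⟩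
          + n * lin ωs (λ s → κ₀ p * q̂ p (τ s))                  ≡⟨ sym (lin-* ωs (+ n) (λ s → κ₀ p * q̂ p (τ s))) ⟩
          lin ωs (λ s → + n * (κ₀ p * q̂ p (τ s)))                ≡⟨ lin-cong ωs eq ⟩
          lin ωs (λ s → + 16 * (P s * (+ n * + n * w (+ 2 * s - 1ℤ)))) ≡⟨ lin-* ωs (+ 16) (λ s → P s * (+ n * + n * w (+ 2 * s - 1ℤ))) ⟩
          + 16 * lin ωs (λ s → P s * (+ n * + n * w (+ 2 * s - 1ℤ))) ∎
          where
          open ≡-Reasoning
          c = + (2 ℕ.* (5 ℕ.+ suc M₀))
          τ : ℤ → ℤ
          τ s = + 2 * s - 1ℤ + c * 0ℤ
          ring₁ : ∀ s c → + 2 * s - 1ℤ + c * 0ℤ ≡ + 2 * s - 1ℤ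
          ring₁ = solve-∀
          ring₂ : ∀ n s x → n * (+ 2 * n * (((+ 2 * s - 1ℤ) * (+ 2 * s - 1ℤ) - 1ℤ) * ((+ 2 * s - 1ℤ) * (+ 2 * s - 1ℤ) - + 3 * (+ 2 * n) + + 3)) * x)
                            ≡ + 16 * (s * (s - 1ℤ) * (+ 2 * (s * (s - 1ℤ)) + + 2 - + 3 * n) * (n * n * x))
          ring₂ = solve-∀
          eq : ∀ s → + n * (κ₀ p * q̂ p (τ s)) ≡ + 16 * (P s * (+ n * + n * w (+ 2 * s - 1ℤ)))
          eq s = trans (cong (λ z → + n * (κ₀ p * q̂ p z)) (ring₁ s c)) (trans (cong (+ n *_) (q̂-closed p (+ 2 * s - 1ℤ)))
            (trans (cong (λ z → + n * (z * (((+ 2 * s - 1ℤ) * (+ 2 * s - 1ℤ) - 1ℤ) * ((+ 2 * s - 1ℤ) * (+ 2 * s - 1ℤ) - + 3 * z + + 3)) * w (+ 2 * s - 1ℤ))) +2n) (ring₂ (+ n) s (w (+ 2 * s - 1ℤ)))))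

        moments : lin ωs (λ s → P s * (+ n - σ₂ s)) ≡ - + 3 * + n * + n * lin ωs σ₂ + + n * (+ 5 * lin ωs (λ s → σ₂ s * σ₂ s) + + 2 * lin ωs σ₂) + (- + 2 * lin ωs (λ s → σ₂ s * σ₂ s * σ₂ s) + - + 2 * lin ωs (λ s → σ₂ s * σ₂ s))
        moments = begin
          lin ωs (λ s → P s * (+ n - σ₂ s))                                   ≡⟨ lin-cong ωs (λ s → ring (+ n) (σ₂ s)) ⟩
          lin ωs (λ s → A₁ s + + n * A₂ s + A₃ s)                             ≡⟨ lin-+ ωs (λ s → A₁ s + + n * A₂ s) A₃ ⟩
          lin ωs (λ s → A₁ s + + n * A₂ s) + lin ωs A₃                        ≡⟨ cong₂ _+_ (lin-+ ωs A₁ (λ s → + n * A₂ s)) (lin-+ ωs (λ s → - + 2 * (σ₂ s * σ₂ s * σ₂ s)) (λ s → - + 2 * (σ₂ s * σ₂ s))) ⟩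
          lin ωs A₁ + lin ωs (λ s → + n * A₂ s) + (lin ωs (λ s → - + 2 * (σ₂ s * σ₂ s * σ₂ s)) + lin ωs (λ s → - + 2 * (σ₂ s * σ₂ s)))
            ≡⟨ cong₂ _+_ (cong₂ _+_ (lin-* ωs (- + 3 * + n * + n) σ₂) (trans (lin-* ωs (+ n) A₂) (cong (+ n *_) (trans (lin-+ ωs (λ s → + 5 * (σ₂ s * σ₂ s)) (λ s → + 2 * σ₂ s)) (cong₂ _+_ (lin-* ωs (+ 5) (λ s → σ₂ s * σ₂ s)) (lin-* ωs (+ 2) σ₂))))))
                         (cong₂ _+_ (lin-* ωs (- + 2) (λ s → σ₂ s * σ₂ s * σ₂ s)) (lin-* ωs (- + 2) (λ s → σ₂ s * σ₂ s))) ⟩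
          - + 3 * + n * + n * lin ωs σ₂ + + n * (+ 5 * lin ωs (λ s → σ₂ s * σ₂ s) + + 2 * lin ωs σ₂) + (- + 2 * lin ωs (λ s → σ₂ s * σ₂ s * σ₂ s) + - + 2 * lin ωs (λ s → σ₂ s * σ₂ s)) ∎
          where
          open ≡-Reasoning
          A₁ A₂ A₃ : ℤ → ℤ
          A₁ s = - + 3 * + n * + n * σ₂ s
          A₂ s = + 5 * (σ₂ s * σ₂ s) + + 2 * σ₂ s
          A₃ s = - + 2 * (σ₂ s * σ₂ s * σ₂ s) + - + 2 * (σ₂ s * σ₂ s)
          ring : ∀ n x → x * (+ 2 * x + + 2 - + 3 * n) * (n - x) ≡ - + 3 * n * n * x + n * (+ 5 * (x * x) + + 2 * x) + (- + 2 * (x * x * x) + - + 2 * (x * x))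
          ring = solve-∀

        -- The factor n clears the 1/n of the approximation. By the moments the rule yields 384 μ
        -- (210 n² - 70 n - 22) ω₁ n; the first two terms are 420 μ (192 n² - 64 n) ω₁ n, and 8448 =
        -- 384 · 22 is left over beside the error E.
        exact : + n * (+ 24 * (κ₀ p * Y p n 2n≡ M₀ 0ℤ) - ω₁ * L₀ * (+ 192 * (+ n * + n) - + 64 * + n)) ≡ - (+ n * (+ c₁ * ω₁)) + + c₂ * E
        exact = begin
          + n * (+ 24 * (κ₀ p * Y p n 2n≡ M₀ 0ℤ) - ω₁ * L₀ * (+ 192 * (+ n * + n) - + 64 * + n))
            ≡⟨ ring₁ (+ n) (κ₀ p * Y p n 2n≡ M₀ 0ℤ) ω₁ L₀ ⟩
          + 24 * (+ n * (κ₀ p * Y p n 2n≡ M₀ 0ℤ)) - + n * (ω₁ * L₀ * (+ 192 * (+ n * + n) - + 64 * + n))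
            ≡⟨ cong₂ (λ x y → + 24 * x - + n * (ω₁ * y * (+ 192 * (+ n * + n) - + 64 * + n))) (trans κ₀Y (cong (+ 16 *_) split)) ωs-moment₀ ⟩
          + 24 * (+ 16 * (+ n * ω₁ * lin ωs (λ s → P s * (+ n - σ₂ s)) + E)) - + n * (ω₁ * (+ 420 * + μ) * (+ 192 * (+ n * + n) - + 64 * + n))
            ≡⟨ cong (λ z → + 24 * (+ 16 * (+ n * ω₁ * z + E)) - + n * (ω₁ * (+ 420 * + μ) * (+ 192 * (+ n * + n) - + 64 * + n))) (trans moments
                 (cong₂ _+_ (cong₂ (λ x y → - + 3 * + n * + n * x + + n * (+ 5 * y + + 2 * x)) ωs-moment₁ ωs-moment₂) (cong₂ (λ x y → - + 2 * x + - + 2 * y) ωs-moment₃ ωs-moment₂))) ⟩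
          + 24 * (+ 16 * (+ n * ω₁ * (- + 3 * + n * + n * (- + 70 * + μ) + + n * (+ 5 * (+ 14 * + μ) + + 2 * (- + 70 * + μ)) + (- + 2 * (- + 3 * + μ) + - + 2 * (+ 14 * + μ))) + E)) - + n * (ω₁ * (+ 420 * + μ) * (+ 192 * (+ n * + n) - + 64 * + n))
            ≡⟨ ring₂ (+ n) ω₁ E (+ μ) ⟩
          - (+ n * (+ 8448 * + μ * ω₁)) + + 24 * + 16 * E ≡⟨ cong₂ (λ x y → - (+ n * (x * ω₁)) + y * E) c₁≡ c₂≡ ⟨
          - (+ n * (+ c₁ * ω₁)) + + c₂ * E ∎
          where
          open ≡-Reasoning
          ring₁ : ∀ n k o L → n * (+ 24 * k - o * L * (+ 192 * (n * n) - + 64 * n)) ≡ + 24 * (n * k) - n * (o * L * (+ 192 * (n * n) - + 64 * n))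
          ring₁ = solve-∀
          ring₂ : ∀ n o E G → + 24 * (+ 16 * (n * o * (- + 3 * n * n * (- + 70 * G) + n * (+ 5 * (+ 14 * G) + + 2 * (- + 70 * G)) + (- + 2 * (- + 3 * G) + - + 2 * (+ 14 * G))) + E)) - n * (o * (+ 420 * G) * (+ 192 * (n * n) - + 64 * n))
                            ≡ - (n * (+ 8448 * G * o)) + + 24 * + 16 * E
          ring₂ = solve-∀
          ring₃ : ∀ P n x s o → P * (n * n * x) ≡ n * o * (P * (n - s)) + P * (n * n * x - (n * n - s * n) * o)
          ring₃ = solve-∀
          split : lin ωs (λ s → P s * (+ n * + n * w (+ 2 * s - 1ℤ))) ≡ + n * ω₁ * lin ωs (λ s → P s * (+ n - σ₂ s)) + E
          split = trans (lin-cong ωs (λ s → ring₃ (P s) (+ n) (w (+ 2 * s - 1ℤ)) (σ₂ s) ω₁)) (trans (lin-+ ωs (λ s → + n * ω₁ * (P s * (+ n - σ₂ s))) (λ s → P s * ε s))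
                    (cong (_+ E) (lin-* ωs (+ n * ω₁) (λ s → P s * (+ n - σ₂ s)))))

        E-bound : ∣ E ∣ ℕ.≤ c₃ ℕ.* (n ℕ.* W₁) ℕ.* linᴺ ωs (λ _ → 1)
        E-bound = ℕₚ.≤-trans (ℕₚ.≤-reflexive (sym (ℕₚ.*-identityˡ (∣ E ∣)))) (ℕₚ.≤-trans (lin-abs ωs Ok ωs-ok 1 (λ s → P s * ε s) (λ _ → c₃ ℕ.* (n ℕ.* W₁) ℕ.* 1) bound)
                  (ℕₚ.≤-reflexive (linᴺ-* ωs (c₃ ℕ.* (n ℕ.* W₁)) (λ _ → 1))))
          where
          ring : ∀ a b c n W → a ℕ.* (b ℕ.* n) ℕ.* (c ℕ.* W) ≡ a ℕ.* b ℕ.* c ℕ.* (n ℕ.* W) ℕ.* 1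
          ring = ℕS.solve-∀
          bound : ∀ s → Ok s → 1 ℕ.* ∣ P s * ε s ∣ ℕ.≤ c₃ ℕ.* (n ℕ.* W₁) ℕ.* 1
          bound s ok = ℕₚ.≤-trans (ℕₚ.≤-reflexive (trans (ℕₚ.*-identityˡ _) (trans (ℤₚ.∣i*j∣≡∣i∣*∣j∣ (P s) (ε s)) (cong (ℕ._* ∣ ε s ∣) (ℤₚ.∣i*j∣≡∣i∣*∣j∣ (σ₂ s) (+ 2 * σ₂ s + + 2 - + 3 * + n))))))
            (ℕₚ.≤-trans (ℕₚ.*-mono-≤ (ℕₚ.*-mono-≤ (σ₂-bound s ok) (factor-bound n≥21 s ok)) (ε-bound (ℕₚ.≤-trans (ℕₚ.m≤m+n 5 16) n≥21) s ok)) (ℕₚ.≤-reflexive (trans (ring 30 3 450 n W₁) (cong (λ z → z ℕ.* (n ℕ.* W₁) ℕ.* 1) c₃≡))))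

      main-term : ∣ + 24 * (κ₀ p * Y p n 2n≡ M₀ 0ℤ) - ω₁ * lin ωs (λ _ → 1ℤ) * (+ 192 * (+ n * + n) - + 64 * + n) ∣ ℕ.≤ Bᵐ ℕ.* W₁
      main-term = ℕₚ.*-cancelˡ-≤ n {{ℕ.>-nonZero (ℕₚ.≤-trans (s≤s z≤n) n≥21)}} (begin
        n ℕ.* ∣ X ∣                                                     ≡⟨ ℤₚ.∣i*j∣≡∣i∣*∣j∣ (+ n) X ⟨
        ∣ + n * X ∣                                                     ≡⟨ cong ∣_∣ exact ⟩
        ∣ - (+ n * (+ c₁ * ω₁)) + + c₂ * E ∣                  ≤⟨ ℤₚ.∣i+j∣≤∣i∣+∣j∣ (- (+ n * (+ c₁ * ω₁))) (+ c₂ * E) ⟩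
        ∣ - (+ n * (+ c₁ * ω₁)) ∣ ℕ.+ ∣ + c₂ * E ∣            ≡⟨ cong₂ ℕ._+_ (trans (ℤₚ.∣-i∣≡∣i∣ (+ n * (+ c₁ * ω₁))) (trans (ℤₚ.∣i*j∣≡∣i∣*∣j∣ (+ n) (+ c₁ * ω₁)) (cong (n ℕ.*_) (ℤₚ.∣i*j∣≡∣i∣*∣j∣ (+ c₁) ω₁)))) (ℤₚ.∣i*j∣≡∣i∣*∣j∣ (+ c₂) E) ⟩
        n ℕ.* (c₁ ℕ.* W₁) ℕ.+ c₂ ℕ.* ∣ E ∣                    ≤⟨ ℕₚ.+-monoʳ-≤ (n ℕ.* (c₁ ℕ.* W₁)) (ℕₚ.*-monoʳ-≤ c₂ E-bound) ⟩
        n ℕ.* (c₁ ℕ.* W₁) ℕ.+ c₂ ℕ.* (c₃ ℕ.* (n ℕ.* W₁) ℕ.* linᴺ ωs (λ _ → 1)) ≡⟨ ring n W₁ (linᴺ ωs (λ _ → 1)) c₁ c₂ c₃ ⟩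
        n ℕ.* (Bᵐ ℕ.* W₁)                                               ∎)
        where
        open ℕₚ.≤-Reasoning
        X = + 24 * (κ₀ p * Y p n 2n≡ M₀ 0ℤ) - ω₁ * L₀ * (+ 192 * (+ n * + n) - + 64 * + n)
        ring : ∀ n W z c a b → n ℕ.* (c ℕ.* W) ℕ.+ a ℕ.* (b ℕ.* (n ℕ.* W) ℕ.* z) ≡ n ℕ.* ((c ℕ.+ a ℕ.* b ℕ.* z) ℕ.* W)
        ring = ℕS.solve-∀

-- Elementary estimates: powers, exponentials and central binomial coefficients

module Estimates where

  open Sums
  open Coefficients
  open Krawtchouk using (rise)
  open WeightedNorms
  open Quadrature using (^-distrib-*)
  open DivisorSums using (coef-central)
  open MainTerm using (coef-ratio)
  open import Defs using (centralBinom)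
  open import Data.Nat using (ℕ; zero; suc; s≤s; z≤n; _!; _+_; _*_; _^_; _≤_; _<_; _≤?_; NonZero; >-nonZero)
  open import Data.Nat.Properties
  open import Data.Integer as ℤ using (ℤ; +_; ∣_∣; 0ℤ; 1ℤ)
  import Data.Integer.Properties as ℤₚ
  open import Data.Integer.Tactic.RingSolver using () renaming (solve-∀ to solve-∀ℤ)
  open import Data.Nat.Tactic.RingSolver using (solve-∀)
  open import Data.Product using (_×_; _,_; ∃)
  open import Data.Sum using (inj₁; inj₂)
  open import Relation.Nullary using (yes; no)
  open import Relation.Binary.PropositionalEquality

  integerRoot : ∀ (f : ℕ → ℕ) X B → f 0 ≤ X → X < f (suc B) → ∃ λ Q → f Q ≤ X × X < f (suc Q)
  integerRoot f X zero    f0≤X X<f = 0 , f0≤X , X<f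
  integerRoot f X (suc B) f0≤X X<f with f (suc B) ≤? X
  ... | yes le = suc B , le , X<f
  ... | no ¬le = integerRoot f X B f0≤X (≰⇒> ¬le)

  rise-lower : ∀ r s x → x ≤ suc s → x ^ r ≤ rise r s
  rise-lower zero    s x le = ≤-refl
  rise-lower (suc r) s x le = *-mono-≤ le (rise-lower r (suc s) x (m≤n⇒m≤1+n le))

  -- `weighted-ℓ¹` in powers of a single x close to N: `rise r s` is at least x^r, and N^j is at
  -- most (b/a)^j x^j. As r - j = 2e, the square root leaves x^e.
  weighted-ℓ¹-power : ∀ T r s j e x K a b .{{_ : NonZero a}} .{{_ : NonZero x}} → r ≡ j + (e + e) → r + s ≤ T → x ≤ suc s → a * (r + s) ≤ b * x →
    dfact j * r ! * b ^ j ≤ a ^ j * (K * K) →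
    x ^ e * ∑±ᴺ T (λ t → ∣ t ∣ ^ j * ∣ coef r s t ∣) ≤ K * 2 ^ (r + s)
  weighted-ℓ¹-power T r s j e x K a b r≡ le x≤ aN≤bx numeric = square-cancel-≤ (*-cancelˡ-≤ (a ^ j) {{m^n≢0 a j}} (*-cancelˡ-≤ (x ^ j) {{m^n≢0 x j}} (begin
    x ^ j * (a ^ j * ((x ^ e * Z) * (x ^ e * Z)))        ≡⟨ ring₁ (x ^ j) (a ^ j) (x ^ e) Z ⟩
    a ^ j * (x ^ j * (x ^ e * x ^ e) * (Z * Z))          ≡⟨ cong (λ z → a ^ j * (z * (Z * Z))) (trans (cong (x ^ j *_) (sym (^-distribˡ-+-* x e e))) (trans (sym (^-distribˡ-+-* x j (e + e))) (cong (x ^_) (sym r≡)))) ⟩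
    a ^ j * (x ^ r * (Z * Z))                            ≤⟨ *-monoʳ-≤ (a ^ j) (≤-trans (*-monoˡ-≤ (Z * Z) (rise-lower r s x x≤)) (weighted-ℓ¹ T r s j le)) ⟩
    a ^ j * (dfact j * N ^ j * t * (t * r !))            ≡⟨ ring₂ (a ^ j) (dfact j) (N ^ j) t (r !) ⟩
    a ^ j * N ^ j * (dfact j * r !) * (t * t)            ≤⟨ *-monoˡ-≤ (t * t) (*-monoˡ-≤ (dfact j * r !) (≤-trans (≤-reflexive (sym (^-distrib-* j a N))) (≤-trans (^-monoˡ-≤ j aN≤bx) (≤-reflexive (^-distrib-* j b x))))) ⟩
    b ^ j * x ^ j * (dfact j * r !) * (t * t)            ≡⟨ ring₃ (b ^ j) (x ^ j) (dfact j * r !) (t * t) ⟩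
    x ^ j * (dfact j * r ! * b ^ j * (t * t))            ≤⟨ *-monoʳ-≤ (x ^ j) (*-monoˡ-≤ (t * t) numeric) ⟩
    x ^ j * (a ^ j * (K * K) * (t * t))                  ≡⟨ ring₄ (x ^ j) (a ^ j) K t ⟩
    x ^ j * (a ^ j * ((K * t) * (K * t)))                ∎)))
    where
    open ≤-Reasoning
    N = r + s
    t = 2 ^ (r + s)
    Z = ∑±ᴺ T (λ t → ∣ t ∣ ^ j * ∣ coef r s t ∣)
    ring₁ : ∀ p q y z → p * (q * ((y * z) * (y * z))) ≡ q * (p * (y * y) * (z * z))
    ring₁ = solve-∀
    ring₂ : ∀ a d n t f → a * (d * n * t * (t * f)) ≡ a * n * (d * f) * (t * t)
    ring₂ = solve-∀
    ring₃ : ∀ b x d t → b * x * d * t ≡ x * (d * b * t)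
    ring₃ = solve-∀
    ring₄ : ∀ x a K t → x * (a * (K * K) * (t * t)) ≡ x * (a * ((K * t) * (K * t)))
    ring₄ = solve-∀

  choose₂ choose₃ : ℕ → ℕ
  choose₂ zero    = 0
  choose₂ (suc k) = choose₂ k + k
  choose₃ zero    = 0
  choose₃ (suc k) = choose₃ k + choose₂ k

  choose₂≡ : ∀ k → 2 * choose₂ k + k ≡ k * k
  choose₂≡ zero    = refl
  choose₂≡ (suc k) = trans (ring₁ (choose₂ k) k) (trans (cong (_+ (k + k + 1)) (choose₂≡ k)) (ring₂ k))
    where
    ring₁ : ∀ c k → 2 * (c + k) + suc k ≡ 2 * c + k + (k + k + 1)
    ring₁ = solve-∀
    ring₂ : ∀ k → k * k + (k + k + 1) ≡ suc k * suc k
    ring₂ = solve-∀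

  choose₃≡ : ∀ k → 6 * choose₃ k + 3 * (k * k) ≡ k * k * k + 2 * k
  choose₃≡ zero    = refl
  choose₃≡ (suc k) = trans (ring₁ (choose₃ k) (choose₂ k) k) (trans (cong₂ (λ x y → x + 3 * y + (3 * k + 3)) (choose₃≡ k) (choose₂≡ k)) (ring₂ k))
    where
    ring₁ : ∀ c b k → 6 * (c + b) + 3 * (suc k * suc k) ≡ 6 * c + 3 * (k * k) + 3 * (2 * b + k) + (3 * k + 3)
    ring₁ = solve-∀
    ring₂ : ∀ k → k * k * k + 2 * k + 3 * (k * k) + (3 * k + 3) ≡ suc k * suc k * suc k + 2 * suc k
    ring₂ = solve-∀

  -- The first four terms of the expansion of (1 + 1/m)^k, times m^k m³. Pascal's rule drives the
  -- induction, and only the fourth-order term is dropped.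
  bernoulli₃ : ∀ m k → m ^ k * (m * m * m + k * (m * m) + choose₂ k * m + choose₃ k) ≤ suc m ^ k * (m * m * m)
  bernoulli₃ m zero    = ≤-reflexive (ring (m * m * m))
    where
    ring : ∀ x → 1 * (x + 0 + 0 + 0) ≡ 1 * x
    ring = solve-∀
  bernoulli₃ m (suc k) = begin
    m * m ^ k * (m * m * m + suc k * (m * m) + (choose₂ k + k) * m + (choose₃ k + choose₂ k))  ≤⟨ m≤m+n _ (m ^ k * choose₃ k) ⟩
    m * m ^ k * (m * m * m + suc k * (m * m) + (choose₂ k + k) * m + (choose₃ k + choose₂ k)) + m ^ k * choose₃ k ≡⟨ ring₁ m (m ^ k) k (choose₂ k) (choose₃ k) ⟩
    suc m * (m ^ k * (m * m * m + k * (m * m) + choose₂ k * m + choose₃ k))                    ≤⟨ *-monoʳ-≤ (suc m) (bernoulli₃ m k) ⟩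
    suc m * (suc m ^ k * (m * m * m))                                                          ≡⟨ *-assoc (suc m) (suc m ^ k) (m * m * m) ⟨
    suc m * suc m ^ k * (m * m * m)                                                            ∎
    where
    open ≤-Reasoning
    ring₁ : ∀ m p k b c → m * p * (m * m * m + suc k * (m * m) + (b + k) * m + (c + b)) + p * c ≡ suc m * (p * (m * m * m + k * (m * m) + b * m + c))
    ring₁ = solve-∀

  -- The four terms add up to 8/3 - 1/m + 1/(3m²), and 8/3 - 2.66 = 1/150, whence the bound on m.
  euler : ∀ m → 150 ≤ m → 266 * m ^ m ≤ 100 * suc m ^ m
  euler m m≥ = *-cancelˡ-≤ (6 * (m * m * m)) {{m*n≢0 6 (m * m * m) {{_}} {{m*n≢0 (m * m) m {{m*n≢0 m m}}}}}} (begin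
    6 * (m * m * m) * (266 * m ^ m)                    ≡⟨ ring₁ (m * m * m) (m ^ m) ⟩
    1596 * (m * m * m) * m ^ m                         ≤⟨ *-monoˡ-≤ (m ^ m) poly ⟩
    100 * (6 * P) * m ^ m                              ≡⟨ ring₂ P (m ^ m) ⟩
    600 * (m ^ m * P)                                  ≤⟨ *-monoʳ-≤ 600 (bernoulli₃ m m) ⟩
    600 * (suc m ^ m * (m * m * m))                    ≡⟨ ring₃ (suc m ^ m) (m * m * m) ⟩
    6 * (m * m * m) * (100 * suc m ^ m)                ∎)
    where
    open ≤-Reasoning
    instance
      m≢0 : NonZero m
      m≢0 = >-nonZero (≤-trans (s≤s z≤n) m≥)
    b = choose₂ m
    c = choose₃ m
    P = m * m * m + m * (m * m) + b * m + c
    ring₁ : ∀ x y → 6 * x * (266 * y) ≡ 1596 * x * y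
    ring₁ = solve-∀
    ring₂ : ∀ P y → 100 * (6 * P) * y ≡ 600 * (y * P)
    ring₂ = solve-∀
    ring₃ : ∀ x y → 600 * (x * y) ≡ 6 * y * (100 * x)
    ring₃ = solve-∀
    ring₄ : ∀ m b c → 6 * (m * m * m + m * (m * m) + b * m + c) + 6 * (m * m) ≡ 12 * (m * m * m) + 3 * m * (2 * b + m) + (6 * c + 3 * (m * m))
    ring₄ = solve-∀
    ring₅ : ∀ m → 12 * (m * m * m) + 3 * m * (m * m) + (m * m * m + 2 * m) ≡ 16 * (m * m * m) + 2 * m
    ring₅ = solve-∀
    6P : 6 * P + 6 * (m * m) ≡ 16 * (m * m * m) + 2 * m
    6P = trans (ring₄ m b c) (trans (cong₂ (λ x y → 12 * (m * m * m) + 3 * m * x + y) (choose₂≡ m) (choose₃≡ m)) (ring₅ m))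
    ring₆ : ∀ x y → 1596 * x + 100 * (6 * y) ≡ 1596 * x + 4 * (150 * y)
    ring₆ = solve-∀
    ring₇ : ∀ x → 1596 * x + 4 * x ≡ 100 * (16 * x)
    ring₇ = solve-∀
    poly : 1596 * (m * m * m) ≤ 100 * (6 * P)
    poly = +-cancelʳ-≤ (100 * (6 * (m * m))) _ _ (begin
      1596 * (m * m * m) + 100 * (6 * (m * m))         ≡⟨ ring₆ (m * m * m) (m * m) ⟩
      1596 * (m * m * m) + 4 * (150 * (m * m))         ≤⟨ +-monoʳ-≤ (1596 * (m * m * m)) (*-monoʳ-≤ 4 (≤-trans (*-monoˡ-≤ (m * m) m≥) (≤-reflexive (sym (*-assoc m m m))))) ⟩
      1596 * (m * m * m) + 4 * (m * m * m)             ≡⟨ ring₇ (m * m * m) ⟩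
      100 * (16 * (m * m * m))                         ≤⟨ *-monoʳ-≤ 100 (m≤m+n (16 * (m * m * m)) (2 * m)) ⟩
      100 * (16 * (m * m * m) + 2 * m)                 ≡⟨ cong (100 *_) (sym 6P) ⟩
      100 * (6 * P + 6 * (m * m))                      ≡⟨ *-distribˡ-+ 100 (6 * P) (6 * (m * m)) ⟩
      100 * (6 * P) + 100 * (6 * (m * m))              ∎)

  -- Each block of m ≥ q/4 factors (q + 4)/q contributes at least (1 + 1/m)^m ≥ 2.66.
  decay : ∀ q m k r → 150 ≤ m → q ≤ 4 * m → 266 ^ k * q ^ (r + k * m) ≤ 100 ^ k * (4 + q) ^ (r + k * m)
  decay q m zero    r m≥ q≤ = *-monoʳ-≤ 1 (^-monoˡ-≤ (r + 0) (m≤n+m q 4))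
  decay q m (suc k) r m≥ q≤ = begin
    266 * 266 ^ k * q ^ (r + (m + k * m))                      ≡⟨ cong (λ z → 266 * 266 ^ k * q ^ z) (ringᵉ r m (k * m)) ⟩
    266 * 266 ^ k * q ^ (m + (r + k * m))                      ≡⟨ cong (266 * 266 ^ k *_) (^-distribˡ-+-* q m (r + k * m)) ⟩
    266 * 266 ^ k * (q ^ m * q ^ (r + k * m))                  ≡⟨ ring 266 (266 ^ k) (q ^ m) (q ^ (r + k * m)) ⟩
    266 * q ^ m * (266 ^ k * q ^ (r + k * m))                  ≤⟨ *-mono-≤ block (decay q m k r m≥ q≤) ⟩
    100 * (4 + q) ^ m * (100 ^ k * (4 + q) ^ (r + k * m))      ≡⟨ ring 100 (100 ^ k) ((4 + q) ^ m) ((4 + q) ^ (r + k * m)) ⟨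
    100 * 100 ^ k * ((4 + q) ^ m * (4 + q) ^ (r + k * m))      ≡⟨ cong (100 * 100 ^ k *_) (^-distribˡ-+-* (4 + q) m (r + k * m)) ⟨
    100 * 100 ^ k * (4 + q) ^ (m + (r + k * m))                ≡⟨ cong (λ z → 100 * 100 ^ k * (4 + q) ^ z) (ringᵉ r m (k * m)) ⟨
    100 * 100 ^ k * (4 + q) ^ (r + (m + k * m))                ∎
    where
    open ≤-Reasoning
    ring : ∀ a b c d → a * b * (c * d) ≡ a * c * (b * d)
    ring = solve-∀
    ringᵉ : ∀ r m x → r + (m + x) ≡ m + (r + x)
    ringᵉ = solve-∀
    ring₁ : ∀ q m → q * suc m ≡ q * m + q
    ring₁ = solve-∀
    ring₂ : ∀ q m → q * m + 4 * m ≡ (4 + q) * m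
    ring₂ = solve-∀
    instance
      m≢0 : NonZero m
      m≢0 = >-nonZero (≤-trans (s≤s z≤n) m≥)
    step : q * suc m ≤ (4 + q) * m
    step = ≤-trans (≤-reflexive (ring₁ q m)) (≤-trans (+-monoʳ-≤ (q * m) q≤) (≤-reflexive (ring₂ q m)))
    block : 266 * q ^ m ≤ 100 * (4 + q) ^ m
    block = *-cancelˡ-≤ (m ^ m) {{m^n≢0 m m}} (begin
      m ^ m * (266 * q ^ m)                            ≡⟨ ring₅ (m ^ m) 266 (q ^ m) ⟩
      q ^ m * (266 * m ^ m)                            ≤⟨ *-monoʳ-≤ (q ^ m) (euler m m≥) ⟩
      q ^ m * (100 * suc m ^ m)                        ≡⟨ ring₆ (q ^ m) 100 (suc m ^ m) ⟩
      100 * (q ^ m * suc m ^ m)                        ≡⟨ cong (100 *_) (^-distrib-* m q (suc m)) ⟨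
      100 * (q * suc m) ^ m                            ≤⟨ *-monoʳ-≤ 100 (^-monoˡ-≤ m step) ⟩
      100 * ((4 + q) * m) ^ m                          ≡⟨ cong (100 *_) (^-distrib-* m (4 + q) m) ⟩
      100 * ((4 + q) ^ m * m ^ m)                      ≡⟨ ring₇ 100 ((4 + q) ^ m) (m ^ m) ⟩
      m ^ m * (100 * (4 + q) ^ m)                      ∎)
      where
      ring₅ : ∀ x a y → x * (a * y) ≡ y * (a * x)
      ring₅ = solve-∀
      ring₆ : ∀ x a y → x * (a * y) ≡ a * (x * y)
      ring₆ = solve-∀
      ring₇ : ∀ a x y → a * (x * y) ≡ y * (a * x)
      ring₇ = solve-∀

  -- The growth factor ((k + 2)/(k + 1))^e decreases in k, so once it is at most 2.66, at k₀, the
  -- exponential keeps its lead.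
  exp-beats-power : ∀ A B e k₀ j → 100 * suc (suc k₀) ^ e ≤ 266 * suc k₀ ^ e → A * suc k₀ ^ e * 100 ^ k₀ ≤ B * 266 ^ k₀ →
                    A * suc (j + k₀) ^ e * 100 ^ (j + k₀) ≤ B * 266 ^ (j + k₀)
  exp-beats-power A B e k₀ zero    ratio base = base
  exp-beats-power A B e k₀ (suc j) ratio base = *-cancelˡ-≤ (suc k₀ ^ e) {{m^n≢0 (suc k₀) e}} (begin
    suc k₀ ^ e * (A * suc (suc k) ^ e * (100 * 100 ^ k))    ≡⟨ ring₁ (suc k₀ ^ e) A (suc (suc k) ^ e) 100 (100 ^ k) ⟩
    A * 100 ^ k * (100 * (suc k₀ ^ e * suc (suc k) ^ e))    ≤⟨ *-monoʳ-≤ (A * 100 ^ k) (*-monoʳ-≤ 100 cross) ⟩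
    A * 100 ^ k * (100 * (suc (suc k₀) ^ e * suc k ^ e))    ≡⟨ ring₂ (A * 100 ^ k) 100 (suc (suc k₀) ^ e) (suc k ^ e) ⟩
    A * 100 ^ k * suc k ^ e * (100 * suc (suc k₀) ^ e)      ≤⟨ *-mono-≤ (≤-trans (≤-reflexive (ring₃ A (100 ^ k) (suc k ^ e))) (exp-beats-power A B e k₀ j ratio base)) ratio ⟩
    B * 266 ^ k * (266 * suc k₀ ^ e)                        ≡⟨ ring₄ B (266 ^ k) 266 (suc k₀ ^ e) ⟩
    suc k₀ ^ e * (B * (266 * 266 ^ k))                      ∎)
    where
    open ≤-Reasoning
    k = j + k₀
    ring₁ : ∀ s A x c p → s * (A * x * (c * p)) ≡ A * p * (c * (s * x))
    ring₁ = solve-∀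
    ring₂ : ∀ a c x y → a * (c * (x * y)) ≡ a * y * (c * x)
    ring₂ = solve-∀
    ring₃ : ∀ A p x → A * p * x ≡ A * x * p
    ring₃ = solve-∀
    ring₄ : ∀ B p c s → B * p * (c * s) ≡ s * (B * (c * p))
    ring₄ = solve-∀
    ring₅ : ∀ j k₀ → suc k₀ * suc (suc (j + k₀)) + j ≡ suc (suc k₀) * suc (j + k₀)
    ring₅ = solve-∀
    cross : suc k₀ ^ e * suc (suc k) ^ e ≤ suc (suc k₀) ^ e * suc k ^ e
    cross = ≤-trans (≤-reflexive (sym (^-distrib-* e (suc k₀) (suc (suc k))))) (≤-trans (^-monoˡ-≤ e (≤-trans (m≤m+n _ j) (≤-reflexive (ring₅ j k₀)))) (≤-reflexive (^-distrib-* e (suc (suc k₀)) (suc k))))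

  -- (a + b)/(α + β) is at most the larger of a/α and b/β.
  fourth-power-+ : ∀ a b α β Y .{{_ : NonZero α}} .{{_ : NonZero β}} → a ^ 4 ≤ α ^ 4 * Y → b ^ 4 ≤ β ^ 4 * Y → (a + b) ^ 4 ≤ (α + β) ^ 4 * Y
  fourth-power-+ a b α β Y ha hb with ≤-total (a * β) (b * α)
  ... | inj₁ aβ≤bα = *-cancelˡ-≤ (β ^ 4) {{m^n≢0 β 4}} (begin
    β ^ 4 * (a + b) ^ 4          ≡⟨ ^-distrib-* 4 β (a + b) ⟨
    (β * (a + b)) ^ 4            ≤⟨ ^-monoˡ-≤ 4 (≤-trans (≤-reflexive (ring₁ a b β)) (≤-trans (+-monoˡ-≤ (b * β) aβ≤bα) (≤-reflexive (ring₂ b α β)))) ⟩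
    (b * (α + β)) ^ 4            ≡⟨ ^-distrib-* 4 b (α + β) ⟩
    b ^ 4 * (α + β) ^ 4          ≤⟨ *-monoˡ-≤ ((α + β) ^ 4) hb ⟩
    β ^ 4 * Y * (α + β) ^ 4      ≡⟨ ring₃ (β ^ 4) Y ((α + β) ^ 4) ⟩
    β ^ 4 * ((α + β) ^ 4 * Y)    ∎)
    where
    open ≤-Reasoning
    ring₁ : ∀ a b c → c * (a + b) ≡ a * c + b * c
    ring₁ = solve-∀
    ring₂ : ∀ b x y → b * x + b * y ≡ b * (x + y)
    ring₂ = solve-∀
    ring₃ : ∀ x y z → x * y * z ≡ x * (z * y)
    ring₃ = solve-∀
  ... | inj₂ bα≤aβ = *-cancelˡ-≤ (α ^ 4) {{m^n≢0 α 4}} (begin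
    α ^ 4 * (a + b) ^ 4          ≡⟨ ^-distrib-* 4 α (a + b) ⟨
    (α * (a + b)) ^ 4            ≤⟨ ^-monoˡ-≤ 4 (≤-trans (≤-reflexive (ring₁ a b α)) (≤-trans (+-monoʳ-≤ (a * α) bα≤aβ) (≤-reflexive (ring₂ a α β)))) ⟩
    (a * (α + β)) ^ 4            ≡⟨ ^-distrib-* 4 a (α + β) ⟩
    a ^ 4 * (α + β) ^ 4          ≤⟨ *-monoˡ-≤ ((α + β) ^ 4) ha ⟩
    α ^ 4 * Y * (α + β) ^ 4      ≡⟨ ring₃ (α ^ 4) Y ((α + β) ^ 4) ⟩
    α ^ 4 * ((α + β) ^ 4 * Y)    ∎)
    where
    open ≤-Reasoning
    ring₁ : ∀ a b c → c * (a + b) ≡ a * c + b * c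
    ring₁ = solve-∀
    ring₂ : ∀ a x y → a * x + a * y ≡ a * (x + y)
    ring₂ = solve-∀
    ring₃ : ∀ x y z → x * y * z ≡ x * (z * y)
    ring₃ = solve-∀

  central : ℕ → ℕ
  central n = ∣ coef 0 (2 * n) 0ℤ ∣

  central≡ : ∀ n → central n ≡ centralBinom n
  central≡ n = cong ∣_∣ (coef-central n 0 z≤n)

  halves : ∀ s → coef 0 (suc s) 0ℤ ≡ + 2 ℤ.* coef 0 s 1ℤ
  halves s = trans (coef-A 0 s 0ℤ) (trans (cong (λ z → z ℤ.+ coef 0 s 1ℤ) (trans (coef-parity 0 s 1ℤ) (ℤₚ.*-identityˡ _))) (ring (coef 0 s 1ℤ)))
    where
    ring : ∀ x → x ℤ.+ x ≡ + 2 ℤ.* x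
    ring = solve-∀ℤ

  central-suc : ∀ n → suc n * central (suc n) ≡ 2 * (2 * n + 1) * central n
  central-suc n = begin
    suc n * ∣ coef 0 (2 * suc n) 0ℤ ∣                 ≡⟨ ℤₚ.∣i*j∣≡∣i∣*∣j∣ (+ suc n) (coef 0 (2 * suc n) 0ℤ) ⟨
    ∣ + suc n ℤ.* coef 0 (2 * suc n) 0ℤ ∣             ≡⟨ cong ∣_∣ eq ⟩
    ∣ + (2 * (2 * n + 1)) ℤ.* coef 0 (2 * n) 0ℤ ∣     ≡⟨ ℤₚ.∣i*j∣≡∣i∣*∣j∣ (+ (2 * (2 * n + 1))) (coef 0 (2 * n) 0ℤ) ⟩
    2 * (2 * n + 1) * central n                       ∎
    where
    open ≡-Reasoning
    x = coef 0 (2 * n) 0ℤ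
    y = coef 0 (2 * n) (+ 2)
    idx : ∀ n → 2 * suc n ≡ suc (suc (2 * n))
    idx = solve-∀
    ring₁ : ∀ n x y → (+ 1 ℤ.+ n) ℤ.* (+ 2 ℤ.* (x ℤ.+ y)) ≡ + 2 ℤ.* (+ 1 ℤ.+ n) ℤ.* x ℤ.+ (+ 1 ℤ.+ + 2 ℤ.* n ℤ.+ + 1) ℤ.* y
    ring₁ = solve-∀ℤ
    ring₂ : ∀ n x → + 2 ℤ.* (+ 1 ℤ.+ n) ℤ.* x ℤ.+ (+ 1 ℤ.+ + 2 ℤ.* n ℤ.- + 1) ℤ.* x ≡ + 2 ℤ.* (+ 2 ℤ.* n ℤ.+ + 1) ℤ.* x
    ring₂ = solve-∀ℤ
    +2n : + (2 * n) ≡ + 2 ℤ.* + n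
    +2n = ℤₚ.pos-* 2 n
    eq : + suc n ℤ.* coef 0 (2 * suc n) 0ℤ ≡ + (2 * (2 * n + 1)) ℤ.* x
    eq = begin
      + suc n ℤ.* coef 0 (2 * suc n) 0ℤ                     ≡⟨ cong (λ k → + suc n ℤ.* coef 0 k 0ℤ) (idx n) ⟩
      + suc n ℤ.* coef 0 (suc (suc (2 * n))) 0ℤ             ≡⟨ cong (+ suc n ℤ.*_) (trans (halves (suc (2 * n))) (cong (+ 2 ℤ.*_) (coef-A 0 (2 * n) 1ℤ))) ⟩
      + suc n ℤ.* (+ 2 ℤ.* (x ℤ.+ y))                       ≡⟨ ring₁ (+ n) x y ⟩
      + 2 ℤ.* (+ 1 ℤ.+ + n) ℤ.* x ℤ.+ (+ 1 ℤ.+ + 2 ℤ.* + n ℤ.+ + 1) ℤ.* y ≡⟨ cong (λ z → + 2 ℤ.* (+ 1 ℤ.+ + n) ℤ.* x ℤ.+ z) ratio ⟩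
      + 2 ℤ.* (+ 1 ℤ.+ + n) ℤ.* x ℤ.+ (+ 1 ℤ.+ + 2 ℤ.* + n ℤ.- + 1) ℤ.* x ≡⟨ ring₂ (+ n) x ⟩
      + 2 ℤ.* (+ 2 ℤ.* + n ℤ.+ + 1) ℤ.* x                   ≡⟨ cong (ℤ._* x) (trans (ℤₚ.pos-* 2 (2 * n + 1)) (cong (λ z → + 2 ℤ.* (z ℤ.+ + 1)) +2n)) ⟨
      + (2 * (2 * n + 1)) ℤ.* x                             ∎
      where
      ratio : (+ 1 ℤ.+ + 2 ℤ.* + n ℤ.+ + 1) ℤ.* y ≡ (+ 1 ℤ.+ + 2 ℤ.* + n ℤ.- + 1) ℤ.* x
      ratio = trans (cong (λ z → (+ 1 ℤ.+ z ℤ.+ + 1) ℤ.* y) (sym +2n)) (trans (coef-ratio (2 * n) 1ℤ) (cong (λ z → (+ 1 ℤ.+ z ℤ.- + 1) ℤ.* x) +2n))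

  -- The square of 4^n ≤ 2 √n C(2n, n), with equality at n = 1. The induction works because (2n +
  -- 1)² exceeds 4n(n + 1) by one.
  central-lower : ∀ n → 16 ^ suc n ≤ 4 * suc n * (central (suc n) * central (suc n))
  central-lower zero = ≤-reflexive (cong (λ z → 4 * 1 * (z * z)) (sym (cong ∣_∣ (coef-central 1 0 z≤n))))
  central-lower (suc n) = *-cancelˡ-≤ s (begin
    s * (16 * 16 ^ suc n)                                   ≤⟨ *-monoʳ-≤ s (*-monoʳ-≤ 16 (central-lower n)) ⟩
    s * (16 * (4 * suc n * (c * c)))                        ≤⟨ m≤m+n _ (16 * (c * c)) ⟩
    s * (16 * (4 * suc n * (c * c))) + 16 * (c * c)         ≡⟨ ring₁ n c ⟩
    4 * ((2 * (2 * suc n + 1) * c) * (2 * (2 * suc n + 1) * c)) ≡⟨ cong (λ z → 4 * (z * z)) (central-suc (suc n)) ⟨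
    4 * ((s * c′) * (s * c′))                               ≡⟨ ring₂ s c′ ⟩
    s * (4 * s * (c′ * c′))                                 ∎)
    where
    open ≤-Reasoning
    s = suc (suc n)
    c = central (suc n)
    c′ = central (suc (suc n))
    ring₁ : ∀ n c → suc (suc n) * (16 * (4 * suc n * (c * c))) + 16 * (c * c) ≡ 4 * ((2 * (2 * suc n + 1) * c) * (2 * (2 * suc n + 1) * c))
    ring₁ = solve-∀
    ring₂ : ∀ s c → 4 * ((s * c) * (s * c)) ≡ s * (4 * s * (c * c))
    ring₂ = solve-∀

-- The exact error identity

module ErrorBound where

  open Sums
  open Coefficients
  open Krawtchouk using (coef-nonneg)
  open Quadrature
  open PanelSum
  open Reduction using (κ₀; S; F-S)
  open Decomposition using (L; Y; E₁; pans; panelAt-1; decomposition)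
  open SmallTerms
  open MainTerm
  open Estimates
  open import Defs using (F; A; centralBinom)
  open import Data.Nat using (ℕ; zero; suc; z≤n; _+_; _*_; _^_; _≤_)
  open import Data.Nat.Properties
  open import Data.Integer as ℤ using (ℤ; +_; ∣_∣; 0ℤ; 1ℤ)
  import Data.Integer.Properties as ℤₚ
  open import Data.Integer.Tactic.RingSolver using () renaming (solve-∀ to solve-∀ℤ)
  open import Data.Nat.Tactic.RingSolver using (solve-∀)
  open import Relation.Binary.PropositionalEquality

  module _ (p n : ℕ) (2n≡ : 2 * n ≡ 6 + p) (M₀ : ℕ) (n≥21 : 21 ≤ n) where

    l : ℕ
    l = ∣ + 32 ℤ.* L p n 2n≡ M₀ ∣

    κ : ℕ
    κ = (6 + p) * (5 + p) * (4 + p) * (2 + p)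

    private
      E = E₁ p n 2n≡ M₀
      P = ∑ n (pans p n 2n≡ M₀)
      V = ∑± n (Y p n 2n≡ M₀)
      Y₀ = Y p n 2n≡ M₀ 0ℤ
      L′ = L p n 2n≡ M₀
      ω = ω₁ p n 2n≡

    κ-abs : ∣ κ₀ p ∣ ≡ κ
    κ-abs = trans (ℤₚ.∣i*j∣≡∣i∣*∣j∣ (N ℤ.* (N ℤ.- 1ℤ) ℤ.* (N ℤ.- + 2)) (N ℤ.- + 4)) (cong₂ _*_ (trans (ℤₚ.∣i*j∣≡∣i∣*∣j∣ (N ℤ.* (N ℤ.- 1ℤ)) (N ℤ.- + 2))
              (cong₂ _*_ (trans (ℤₚ.∣i*j∣≡∣i∣*∣j∣ N (N ℤ.- 1ℤ)) (cong ((6 + p) *_) (cong ∣_∣ (r₁ (+ p))))) (cong ∣_∣ (r₂ (+ p))))) (cong ∣_∣ (r₄ (+ p))))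
      where
      N = + (6 + p)
      r₁ : ∀ p → + 6 ℤ.+ p ℤ.- 1ℤ ≡ + 5 ℤ.+ p
      r₁ = solve-∀ℤ
      r₂ : ∀ p → + 6 ℤ.+ p ℤ.- + 2 ≡ + 4 ℤ.+ p
      r₂ = solve-∀ℤ
      r₄ : ∀ p → + 6 ℤ.+ p ℤ.- + 4 ≡ + 2 ℤ.+ p
      r₄ = solve-∀ℤ

    centralBinom≡ : centralBinom n ≡ 2 * W₁ p n 2n≡
    centralBinom≡ = trans (sym (central≡ n)) (trans (cong ∣_∣ (trans (cong (λ k → coef 0 k 0ℤ) 2n≡) (halves (5 + p)))) (ℤₚ.∣i*j∣≡∣i∣*∣j∣ (+ 2) (coef 0 (5 + p) 1ℤ)))

    private
      +centralBinom : + centralBinom n ≡ + 2 ℤ.* ω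
      +centralBinom = trans (sym (cong +_ (central≡ n))) (trans (cong (λ k → + ∣ coef 0 k 0ℤ ∣) 2n≡)
        (trans (ℤₚ.0≤i⇒+∣i∣≡i (coef-nonneg (6 + p) 0ℤ)) (halves (5 + p))))

      X : ℤ
      X = + 24 ℤ.* (κ₀ p ℤ.* Y₀) ℤ.- ω ℤ.* L′ ℤ.* (+ 192 ℤ.* (+ n ℤ.* + n) ℤ.- + 64 ℤ.* + n)

      -- The factor 32 L accounts for the doubling in `decomposition`, the 16 of `F-S` and the total
      -- weight L of the rule. The main term is paired with the value at d = 0 inside X, which
      -- `main-term` bounds.
      identity : + 32 ℤ.* L′ ℤ.* (+ 24 ℤ.* F n ℤ.+ + centralBinom n ℤ.* (+ (3 * n ^ 2) ℤ.- + n)) ≡ + 24 ℤ.* (κ₀ p ℤ.* (+ 2 ℤ.* E ℤ.+ + 2 ℤ.* P ℤ.+ V)) ℤ.- X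
      identity = begin
        + 32 ℤ.* L′ ℤ.* (+ 24 ℤ.* F n ℤ.+ + centralBinom n ℤ.* (+ (3 * n ^ 2) ℤ.- + n))
          ≡⟨ cong₂ (λ x y → + 32 ℤ.* L′ ℤ.* (+ 24 ℤ.* F n ℤ.+ x ℤ.* (y ℤ.- + n))) +centralBinom
               (trans (ℤₚ.pos-* 3 (n ^ 2)) (cong (+ 3 ℤ.*_) (trans (cong (λ z → + (n * z)) (*-identityʳ n)) (ℤₚ.pos-* n n)))) ⟩
        + 32 ℤ.* L′ ℤ.* (+ 24 ℤ.* F n ℤ.+ + 2 ℤ.* ω ℤ.* (+ 3 ℤ.* (+ n ℤ.* + n) ℤ.- + n))
          ≡⟨ ring₁ L′ (F n) ω (+ n) ⟩
        + 24 ℤ.* (+ 2 ℤ.* (L′ ℤ.* (+ 16 ℤ.* F n))) ℤ.+ ω ℤ.* L′ ℤ.* (+ 192 ℤ.* (+ n ℤ.* + n) ℤ.- + 64 ℤ.* + n)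
          ≡⟨ cong (λ z → + 24 ℤ.* (+ 2 ℤ.* (L′ ℤ.* z)) ℤ.+ ω ℤ.* L′ ℤ.* (+ 192 ℤ.* (+ n ℤ.* + n) ℤ.- + 64 ℤ.* + n)) (F-S p n 2n≡) ⟩
        + 24 ℤ.* (+ 2 ℤ.* (L′ ℤ.* (κ₀ p ℤ.* S p n 2n≡))) ℤ.+ ω ℤ.* L′ ℤ.* (+ 192 ℤ.* (+ n ℤ.* + n) ℤ.- + 64 ℤ.* + n)
          ≡⟨ ring₂ L′ (κ₀ p) (S p n 2n≡) (ω ℤ.* L′ ℤ.* (+ 192 ℤ.* (+ n ℤ.* + n) ℤ.- + 64 ℤ.* + n)) ⟩
        + 24 ℤ.* (κ₀ p ℤ.* (+ 2 ℤ.* (L′ ℤ.* S p n 2n≡))) ℤ.+ ω ℤ.* L′ ℤ.* (+ 192 ℤ.* (+ n ℤ.* + n) ℤ.- + 64 ℤ.* + n)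
          ≡⟨ cong (λ z → + 24 ℤ.* (κ₀ p ℤ.* z) ℤ.+ ω ℤ.* L′ ℤ.* (+ 192 ℤ.* (+ n ℤ.* + n) ℤ.- + 64 ℤ.* + n)) (decomposition p n 2n≡ M₀) ⟩
        + 24 ℤ.* (κ₀ p ℤ.* (+ 2 ℤ.* E ℤ.+ + 2 ℤ.* P ℤ.+ (V ℤ.- Y₀))) ℤ.+ ω ℤ.* L′ ℤ.* (+ 192 ℤ.* (+ n ℤ.* + n) ℤ.- + 64 ℤ.* + n)
          ≡⟨ ring₃ (κ₀ p) E P V Y₀ (ω ℤ.* L′ ℤ.* (+ 192 ℤ.* (+ n ℤ.* + n) ℤ.- + 64 ℤ.* + n)) ⟩
        + 24 ℤ.* (κ₀ p ℤ.* (+ 2 ℤ.* E ℤ.+ + 2 ℤ.* P ℤ.+ V)) ℤ.- X ∎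
        where
        open ≡-Reasoning
        ring₁ : ∀ L F o n → + 32 ℤ.* L ℤ.* (+ 24 ℤ.* F ℤ.+ + 2 ℤ.* o ℤ.* (+ 3 ℤ.* (n ℤ.* n) ℤ.- n)) ≡ + 24 ℤ.* (+ 2 ℤ.* (L ℤ.* (+ 16 ℤ.* F))) ℤ.+ o ℤ.* L ℤ.* (+ 192 ℤ.* (n ℤ.* n) ℤ.- + 64 ℤ.* n)
        ring₁ = solve-∀ℤ
        ring₂ : ∀ L k S z → + 24 ℤ.* (+ 2 ℤ.* (L ℤ.* (k ℤ.* S))) ℤ.+ z ≡ + 24 ℤ.* (k ℤ.* (+ 2 ℤ.* (L ℤ.* S))) ℤ.+ z
        ring₂ = solve-∀ℤ
        ring₃ : ∀ k E P V Y z → + 24 ℤ.* (k ℤ.* (+ 2 ℤ.* E ℤ.+ + 2 ℤ.* P ℤ.+ (V ℤ.- Y))) ℤ.+ z ≡ + 24 ℤ.* (k ℤ.* (+ 2 ℤ.* E ℤ.+ + 2 ℤ.* P ℤ.+ V)) ℤ.- (+ 24 ℤ.* (k ℤ.* Y) ℤ.- z)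
        ring₃ = solve-∀ℤ

    error-bound : l * A n ≤ 24 * (κ * (2 * ∣ E ∣ + ∣ V ∣)) + 24 * (κ * (2 * ∣ P ∣)) + Bᵐ p n 2n≡ M₀ n≥21 * W₁ p n 2n≡
    error-bound = begin
      l * A n                                                                  ≡⟨ ℤₚ.∣i*j∣≡∣i∣*∣j∣ (+ 32 ℤ.* L′) (+ 24 ℤ.* F n ℤ.+ + centralBinom n ℤ.* (+ (3 * n ^ 2) ℤ.- + n)) ⟨
      ∣ + 32 ℤ.* L′ ℤ.* (+ 24 ℤ.* F n ℤ.+ + centralBinom n ℤ.* (+ (3 * n ^ 2) ℤ.- + n)) ∣ ≡⟨ cong ∣_∣ identity ⟩
      ∣ + 24 ℤ.* (κ₀ p ℤ.* T) ℤ.- X ∣                                          ≤⟨ ℤₚ.∣i-j∣≤∣i∣+∣j∣ (+ 24 ℤ.* (κ₀ p ℤ.* T)) X ⟩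
      ∣ + 24 ℤ.* (κ₀ p ℤ.* T) ∣ + ∣ X ∣                                        ≤⟨ +-mono-≤ T≤ (main-term p n 2n≡ M₀ n≥21) ⟩
      24 * (κ * (2 * ∣ E ∣ + ∣ V ∣)) + 24 * (κ * (2 * ∣ P ∣)) + Bᵐ p n 2n≡ M₀ n≥21 * W₁ p n 2n≡ ∎
      where
      open ≤-Reasoning
      T = + 2 ℤ.* E ℤ.+ + 2 ℤ.* P ℤ.+ V
      ring : ∀ k e v q → 24 * (k * (2 * e + 2 * q + v)) ≡ 24 * (k * (2 * e + v)) + 24 * (k * (2 * q))
      ring = solve-∀
      ∣T∣≤ : ∣ T ∣ ≤ 2 * ∣ E ∣ + 2 * ∣ P ∣ + ∣ V ∣
      ∣T∣≤ = ≤-trans (ℤₚ.∣i+j∣≤∣i∣+∣j∣ (+ 2 ℤ.* E ℤ.+ + 2 ℤ.* P) V) (+-monoˡ-≤ (∣ V ∣) (≤-trans (ℤₚ.∣i+j∣≤∣i∣+∣j∣ (+ 2 ℤ.* E) (+ 2 ℤ.* P))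
              (≤-reflexive (cong₂ _+_ (ℤₚ.∣i*j∣≡∣i∣*∣j∣ (+ 2) E) (ℤₚ.∣i*j∣≡∣i∣*∣j∣ (+ 2) P)))))
      T≤ : ∣ + 24 ℤ.* (κ₀ p ℤ.* T) ∣ ≤ 24 * (κ * (2 * ∣ E ∣ + ∣ V ∣)) + 24 * (κ * (2 * ∣ P ∣))
      T≤ = ≤-trans (≤-reflexive (trans (ℤₚ.∣i*j∣≡∣i∣*∣j∣ (+ 24) (κ₀ p ℤ.* T)) (cong (24 *_) (trans (ℤₚ.∣i*j∣≡∣i∣*∣j∣ (κ₀ p) T) (cong (_* ∣ T ∣) κ-abs)))))
           (≤-trans (*-monoʳ-≤ 24 (*-monoʳ-≤ κ ∣T∣≤)) (≤-reflexive (ring κ (∣ E ∣) (∣ V ∣) (∣ P ∣))))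

    -- The row d = 1 vanishes, so the remaining rows start at d = 2; appending one further row
    -- restores the length n.
    pans-bound : ∣ P ∣ ≤ panelSum p (suc M₀) n n
    pans-bound = ≤-trans (∑-abs n (pans p n 2n≡ M₀)) (go n)
      where
      row : ∀ i → ∣ pans p n 2n≡ M₀ (suc i) ∣ ≤ ∑ᴺ n (λ j → ∣ panelAt p (2 + i) (5 + (suc M₀ + j)) ∣)
      row i = ∑-abs n (λ j → panelAt p (2 + i) (5 + (suc M₀ + j)))
      zeroth : ∣ pans p n 2n≡ M₀ 0 ∣ ≡ 0
      zeroth = cong ∣_∣ (∑-0 n (λ j → panelAt-1 p n 2n≡ M₀ (5 + (suc M₀ + j))))
      go : ∀ k → ∑ᴺ k (λ i → ∣ pans p n 2n≡ M₀ i ∣) ≤ ∑ᴺ k (λ i → ∑ᴺ n (λ j → ∣ panelAt p (2 + i) (5 + (suc M₀ + j)) ∣))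
      go zero    = z≤n
      go (suc k) = ≤-trans (≤-reflexive (trans (∑ᴺ-head k (λ i → ∣ pans p n 2n≡ M₀ i ∣)) (cong (_+ ∑ᴺ k (λ i → ∣ pans p n 2n≡ M₀ (suc i) ∣)) zeroth)))
        (≤-trans (∑ᴺ-mono k row) (∑ᴺ-extend (λ i → ∑ᴺ n (λ j → ∣ panelAt p (2 + i) (5 + (suc M₀ + j)) ∣)) (n≤1+n k)))

-- Comparing powers of n, of the cutoff and of the number of blocks

module PowerBounds where

  open Sums using (square-cancel-≤)
  open Quadrature using (^-distrib-*)
  open Estimates
  open import Data.Nat using (ℕ; suc; _+_; _*_; _^_; _∸_; _≤_; NonZero)
  open import Data.Nat.Properties
  open import Data.Nat.Tactic.RingSolver using (solve-∀)
  open import Relation.Binary.PropositionalEquality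

  -- The exponents are variables so that powers of open terms do not unfold.
  module _ (X M M′ c f n W t b a₁ a₂ a₃ a₄ s α β i j u v h w : ℕ)
           .{{_ : NonZero M}} .{{_ : NonZero c}} .{{_ : NonZero a₁}} .{{_ : NonZero a₃}}
           (hα : α * (h + h) ≡ v + j * u) (hβ : β * (h + h) + h ≡ i * u + (w + w))
           (X≤ : X * (M ^ α * c) ≤ f * (n ^ β * t))
           (t≤ : t * t ≤ s * s * n * (W * W))
           (n≤ : a₁ * n ^ i ≤ a₂ * M′ ^ j)
           (M′≤ : a₃ * M′ ≤ a₄ * M)
           (a₃≤M : a₃ ≤ M)
           (numeric : (s * f) ^ (h + h) * (a₂ ^ u * a₄ ^ (j * u)) ≤ (b * c) ^ (h + h) * (a₁ ^ u * a₃ ^ (j * u) * a₃ ^ v)) where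

    private
      H = h + h
      U = j * u
      a = s * f

      nᵘ : a₁ ^ u * a₃ ^ U * n ^ (i * u) ≤ a₂ ^ u * a₄ ^ U * M ^ U
      nᵘ = begin
        a₁ ^ u * a₃ ^ U * n ^ (i * u)                ≡⟨ ring₁ (a₁ ^ u) (a₃ ^ U) (n ^ (i * u)) ⟩
        a₁ ^ u * n ^ (i * u) * a₃ ^ U                ≡⟨ cong (λ z → a₁ ^ u * z * a₃ ^ U) (^-*-assoc n i u) ⟨
        a₁ ^ u * (n ^ i) ^ u * a₃ ^ U                ≡⟨ cong (_* a₃ ^ U) (^-distrib-* u a₁ (n ^ i)) ⟨
        (a₁ * n ^ i) ^ u * a₃ ^ U                    ≤⟨ *-monoˡ-≤ (a₃ ^ U) (^-monoˡ-≤ u n≤) ⟩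
        (a₂ * M′ ^ j) ^ u * a₃ ^ U                   ≡⟨ cong (_* a₃ ^ U) (trans (^-distrib-* u a₂ (M′ ^ j)) (cong (a₂ ^ u *_) (^-*-assoc M′ j u))) ⟩
        a₂ ^ u * M′ ^ U * a₃ ^ U                     ≡⟨ ring₂ (a₂ ^ u) (M′ ^ U) (a₃ ^ U) ⟩
        a₂ ^ u * (a₃ ^ U * M′ ^ U)                   ≡⟨ cong (a₂ ^ u *_) (^-distrib-* U a₃ M′) ⟨
        a₂ ^ u * (a₃ * M′) ^ U                       ≤⟨ *-monoʳ-≤ (a₂ ^ u) (^-monoˡ-≤ U M′≤) ⟩
        a₂ ^ u * (a₄ * M) ^ U                        ≡⟨ trans (cong (a₂ ^ u *_) (^-distrib-* U a₄ M)) (sym (*-assoc (a₂ ^ u) (a₄ ^ U) (M ^ U))) ⟩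
        a₂ ^ u * a₄ ^ U * M ^ U                      ∎
        where
        open ≤-Reasoning
        ring₁ : ∀ x y z → x * y * z ≡ x * z * y
        ring₁ = solve-∀
        ring₂ : ∀ x y z → x * y * z ≡ x * (z * y)
        ring₂ = solve-∀

      -- Of the α H powers of M, j u are traded for powers of n through the size of the cutoff. The
      -- other v powers only have to supply a constant, for which a₃ ≤ M suffices.
      key : a ^ H * n ^ (i * u) ≤ (b * c) ^ H * M ^ (α * H)
      key = *-cancelˡ-≤ (a₁ ^ u * a₃ ^ U) {{m*n≢0 (a₁ ^ u) (a₃ ^ U) {{m^n≢0 a₁ u}} {{m^n≢0 a₃ U}}}} (begin
        a₁ ^ u * a₃ ^ U * (a ^ H * n ^ (i * u))                       ≡⟨ ring₁ (a₁ ^ u * a₃ ^ U) (a ^ H) (n ^ (i * u)) ⟩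
        a ^ H * (a₁ ^ u * a₃ ^ U * n ^ (i * u))                       ≤⟨ *-monoʳ-≤ (a ^ H) nᵘ ⟩
        a ^ H * (a₂ ^ u * a₄ ^ U * M ^ U)                             ≡⟨ *-assoc (a ^ H) (a₂ ^ u * a₄ ^ U) (M ^ U) ⟨
        a ^ H * (a₂ ^ u * a₄ ^ U) * M ^ U                             ≤⟨ *-monoˡ-≤ (M ^ U) numeric ⟩
        (b * c) ^ H * (a₁ ^ u * a₃ ^ U * a₃ ^ v) * M ^ U              ≤⟨ *-monoˡ-≤ (M ^ U) (*-monoʳ-≤ ((b * c) ^ H) (*-monoʳ-≤ (a₁ ^ u * a₃ ^ U) (^-monoˡ-≤ v a₃≤M))) ⟩
        (b * c) ^ H * (a₁ ^ u * a₃ ^ U * M ^ v) * M ^ U               ≡⟨ ring₂ ((b * c) ^ H) (a₁ ^ u * a₃ ^ U) (M ^ v) (M ^ U) ⟩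
        a₁ ^ u * a₃ ^ U * ((b * c) ^ H * (M ^ v * M ^ U))             ≡⟨ cong (λ z → a₁ ^ u * a₃ ^ U * ((b * c) ^ H * z)) (trans (cong (M ^_) hα) (^-distribˡ-+-* M v U)) ⟨
        a₁ ^ u * a₃ ^ U * ((b * c) ^ H * M ^ (α * H))                 ∎)
        where
        open ≤-Reasoning
        ring₁ : ∀ x y z → x * (y * z) ≡ y * (x * z)
        ring₁ = solve-∀
        ring₂ : ∀ x y z w → x * (y * z) * w ≡ y * (x * (z * w))
        ring₂ = solve-∀

      tᴴ : t ^ H ≤ s ^ H * (n ^ h * W ^ H)
      tᴴ = begin
        t ^ H                                    ≡⟨ trans (^-distribˡ-+-* t h h) (sym (^-distrib-* h t t)) ⟩
        (t * t) ^ h                              ≤⟨ ^-monoˡ-≤ h t≤ ⟩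
        (s * s * n * (W * W)) ^ h                ≡⟨ trans (^-distrib-* h (s * s * n) (W * W)) (cong₂ _*_ (trans (^-distrib-* h (s * s) n) (cong (_* n ^ h) (square s))) (square W)) ⟩
        s ^ H * n ^ h * W ^ H                    ≡⟨ *-assoc (s ^ H) (n ^ h) (W ^ H) ⟩
        s ^ H * (n ^ h * W ^ H)                  ∎
        where
        open ≤-Reasoning
        square : ∀ x → (x * x) ^ h ≡ x ^ H
        square x = trans (^-distrib-* h x x) (sym (^-distribˡ-+-* x h h))

      powerᴴ : X ^ H ≤ (b * W) ^ H * n ^ (w + w)
      powerᴴ = *-cancelˡ-≤ ((M ^ α * c) ^ H) {{m^n≢0 (M ^ α * c) H {{m*n≢0 (M ^ α) c {{m^n≢0 M α}}}}}} (begin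
        (M ^ α * c) ^ H * X ^ H                        ≡⟨ trans (*-comm ((M ^ α * c) ^ H) (X ^ H)) (sym (^-distrib-* H X (M ^ α * c))) ⟩
        (X * (M ^ α * c)) ^ H                          ≤⟨ ^-monoˡ-≤ H X≤ ⟩
        (f * (n ^ β * t)) ^ H                          ≡⟨ trans (^-distrib-* H f (n ^ β * t)) (cong (f ^ H *_) (trans (^-distrib-* H (n ^ β) t) (cong (_* t ^ H) (^-*-assoc n β H)))) ⟩
        f ^ H * (n ^ (β * H) * t ^ H)                  ≤⟨ *-monoʳ-≤ (f ^ H) (*-monoʳ-≤ (n ^ (β * H)) tᴴ) ⟩
        f ^ H * (n ^ (β * H) * (s ^ H * (n ^ h * W ^ H))) ≡⟨ ring₁ (f ^ H) (n ^ (β * H)) (s ^ H) (n ^ h) (W ^ H) ⟩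
        s ^ H * f ^ H * (n ^ (β * H) * n ^ h) * W ^ H  ≡⟨ cong₂ (λ x y → x * y * W ^ H) (sym (^-distrib-* H s f)) (trans (sym (^-distribˡ-+-* n (β * H) h)) (trans (cong (n ^_) hβ) (^-distribˡ-+-* n (i * u) (w + w)))) ⟩
        a ^ H * (n ^ (i * u) * n ^ (w + w)) * W ^ H    ≡⟨ ring₂ (a ^ H) (n ^ (i * u)) (n ^ (w + w)) (W ^ H) ⟩
        a ^ H * n ^ (i * u) * (n ^ (w + w) * W ^ H)    ≤⟨ *-monoˡ-≤ (n ^ (w + w) * W ^ H) key ⟩
        (b * c) ^ H * M ^ (α * H) * (n ^ (w + w) * W ^ H) ≡⟨ cong₂ (λ x y → x * y * (n ^ (w + w) * W ^ H)) (^-distrib-* H b c) (sym (^-*-assoc M α H)) ⟩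
        b ^ H * c ^ H * (M ^ α) ^ H * (n ^ (w + w) * W ^ H) ≡⟨ ring₃ (b ^ H) (c ^ H) ((M ^ α) ^ H) (n ^ (w + w)) (W ^ H) ⟩
        (M ^ α) ^ H * c ^ H * (b ^ H * W ^ H * n ^ (w + w)) ≡⟨ cong₂ (λ x y → x * (y * n ^ (w + w))) (sym (^-distrib-* H (M ^ α) c)) (sym (^-distrib-* H b W)) ⟩
        (M ^ α * c) ^ H * ((b * W) ^ H * n ^ (w + w))  ∎)
        where
        open ≤-Reasoning
        ring₁ : ∀ f x q y w → f * (x * (q * (y * w))) ≡ q * f * (x * y) * w
        ring₁ = solve-∀
        ring₂ : ∀ a x y w → a * (x * y) * w ≡ a * x * (y * w)
        ring₂ = solve-∀
        ring₃ : ∀ b c m x w → b * c * m * (x * w) ≡ m * c * (b * w * x)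
        ring₃ = solve-∀

    -- The proof runs at the exponent 2h: the factor 2 removes the square root of n in the lower
    -- bound for W, and h removes the fractional exponent w/h.
    power-bound : X ^ h ≤ b ^ h * (W ^ h * n ^ w)
    power-bound = square-cancel-≤ (begin
      X ^ h * X ^ h                                            ≡⟨ ^-distribˡ-+-* X h h ⟨
      X ^ H                                                    ≤⟨ powerᴴ ⟩
      (b * W) ^ H * n ^ (w + w)                                ≡⟨ cong₂ _*_ (trans (^-distribˡ-+-* (b * W) h h) (cong (λ z → z * z) (^-distrib-* h b W))) (^-distribˡ-+-* n w w) ⟩
      b ^ h * W ^ h * (b ^ h * W ^ h) * (n ^ w * n ^ w)        ≡⟨ ring (b ^ h) (W ^ h) (n ^ w) ⟩
      b ^ h * (W ^ h * n ^ w) * (b ^ h * (W ^ h * n ^ w))      ∎)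
      where
      open ≤-Reasoning
      ring : ∀ b w n → b * w * (b * w) * (n * n) ≡ b * (w * n) * (b * (w * n))
      ring = solve-∀

  module _ (X c n q p k r m W s e g h j k₀ : ℕ) .{{n≢0 : NonZero n}} .{{_ : NonZero e}}
           (p≡ : p ≡ r + k * m) (m≥ : 150 ≤ m) (q≤ : q ≤ 4 * m) (k≥ : k₀ ≤ k)
           (X≤ : (4 + q) ^ p * X ≤ c * n ^ h * (2 * q) ^ p)
           (t≤ : s * 2 ^ p ≤ n * W)
           (n≤ : e * n ≤ suc k ^ j)
           (ratio : 100 * suc (suc k₀) ^ (j * suc h) ≤ 266 * suc k₀ ^ (j * suc h))
           (numeric : c * suc k₀ ^ (j * suc h) * 100 ^ k₀ ≤ g * (s * e ^ suc h) * 266 ^ k₀) where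

    -- The lower bound for W costs one more power of n, so n^(h+1) has to be beaten. It is at most a
    -- power of k + 1, for k the number of blocks, whereas the decay is 2.66^(-k); from k₀ on the
    -- latter wins.
    small-part : X ≤ g * W
    small-part = *-cancelˡ-≤ R^ {{m^n≢0 (4 + q) p}} (*-cancelˡ-≤ (n * e ^ H * 266 ^ k) {{m*n≢0 (n * e ^ H) (266 ^ k) {{m*n≢0 n (e ^ H) {{n≢0}} {{m^n≢0 e H}}}} {{m^n≢0 266 k}}}} (begin
      n * e ^ H * 266 ^ k * (R^ * X)                                  ≤⟨ *-monoʳ-≤ (n * e ^ H * 266 ^ k) X≤ ⟩
      n * e ^ H * 266 ^ k * (c * n ^ h * (2 * q) ^ p)                 ≡⟨ cong (λ z → n * e ^ H * 266 ^ k * (c * n ^ h * z)) (^-distrib-* p 2 q) ⟩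
      n * e ^ H * 266 ^ k * (c * n ^ h * (2 ^ p * q ^ p))             ≡⟨ ring₁ n (e ^ H) (266 ^ k) c (n ^ h) (2 ^ p) (q ^ p) ⟩
      c * (e ^ H * n ^ H) * (2 ^ p * (266 ^ k * q ^ p))               ≤⟨ *-mono-≤ (*-monoʳ-≤ c nᴴ) (*-monoʳ-≤ (2 ^ p) dec) ⟩
      c * suc k ^ (j * H) * (2 ^ p * (100 ^ k * R^))                  ≡⟨ ring₂ c (suc k ^ (j * H)) (2 ^ p) (100 ^ k) R^ ⟩
      c * suc k ^ (j * H) * 100 ^ k * (2 ^ p * R^)                    ≤⟨ *-monoˡ-≤ (2 ^ p * R^) growth ⟩
      g * (s * e ^ H) * 266 ^ k * (2 ^ p * R^)                        ≡⟨ ring₃ g s (e ^ H) (266 ^ k) (2 ^ p) R^ ⟩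
      g * (e ^ H * 266 ^ k * R^) * (s * 2 ^ p)                        ≤⟨ *-monoʳ-≤ (g * (e ^ H * 266 ^ k * R^)) t≤ ⟩
      g * (e ^ H * 266 ^ k * R^) * (n * W)                            ≡⟨ ring₄ g (e ^ H) (266 ^ k) R^ n W ⟩
      n * e ^ H * 266 ^ k * (R^ * (g * W))                            ∎))
      where
      open ≤-Reasoning
      H = suc h
      R^ = (4 + q) ^ p
      ring₁ : ∀ n e s c x t z → n * e * s * (c * x * (t * z)) ≡ c * (e * (n * x)) * (t * (s * z))
      ring₁ = solve-∀
      ring₂ : ∀ c s t h R → c * s * (t * (h * R)) ≡ c * s * h * (t * R)
      ring₂ = solve-∀
      ring₃ : ∀ g u e s t R → g * (u * e) * s * (t * R) ≡ g * (e * s * R) * (u * t)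
      ring₃ = solve-∀
      ring₄ : ∀ g e s R n W → g * (e * s * R) * (n * W) ≡ n * e * s * (R * (g * W))
      ring₄ = solve-∀
      nᴴ : e ^ H * n ^ H ≤ suc k ^ (j * H)
      nᴴ = ≤-trans (≤-reflexive (sym (^-distrib-* H e n))) (≤-trans (^-monoˡ-≤ H n≤) (≤-reflexive (^-*-assoc (suc k) j H)))
      dec : 266 ^ k * q ^ p ≤ 100 ^ k * R^
      dec = subst (λ z → 266 ^ k * q ^ z ≤ 100 ^ k * (4 + q) ^ z) (sym p≡) (decay q m k r m≥ q≤)
      growth : c * suc k ^ (j * H) * 100 ^ k ≤ g * (s * e ^ H) * 266 ^ k
      growth = subst (λ z → c * suc z ^ (j * H) * 100 ^ z ≤ g * (s * e ^ H) * 266 ^ z) (m∸n+n≡m k≥)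
        (exp-beats-power c (g * (s * e ^ H)) (j * H) k₀ (k ∸ k₀) ratio numeric)

  -- The allowance g · 2 · l is shared 1 : 9 between X₁ and X₂. As s⁴ ≤ n^w, a bound by a constant
  -- multiple of W counts as a bound with n^(w/4).
  fourth-power-split : ∀ f A l C W n g γ X₁ X₂ s w .{{_ : NonZero l}} .{{γ≢0 : NonZero γ}} → C ≡ 2 * W → s ^ 4 ≤ n ^ w → 10 * γ ≡ g * 2 * l →
    l * (f * A) ≤ X₁ + X₂ → X₁ ≤ γ * (s * W) → X₂ ^ 4 ≤ (9 * γ) ^ 4 * (W ^ 4 * n ^ w) → (f * A) ^ 4 ≤ (g * C) ^ 4 * n ^ w
  fourth-power-split f A l C W n g γ X₁ X₂ s w {{l≢0}} {{γ≢0}} C≡ s≤ γ≡ total h₁ h₂ = *-cancelˡ-≤ (l ^ 4) {{m^n≢0 l 4 {{l≢0}}}} (begin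
    l ^ 4 * (f * A) ^ 4                        ≡⟨ ^-distrib-* 4 l (f * A) ⟨
    (l * (f * A)) ^ 4                          ≤⟨ ^-monoˡ-≤ 4 total ⟩
    (X₁ + X₂) ^ 4                              ≤⟨ fourth-power-+ X₁ X₂ γ (9 * γ) (W ^ 4 * n ^ w) {{γ≢0}} {{m*n≢0 9 γ {{_}} {{γ≢0}}}} X₁⁴ h₂ ⟩
    (γ + 9 * γ) ^ 4 * (W ^ 4 * n ^ w)          ≡⟨ cong (λ z → z ^ 4 * (W ^ 4 * n ^ w)) (trans (ring₁ γ) γ≡) ⟩
    (g * 2 * l) ^ 4 * (W ^ 4 * n ^ w)          ≡⟨ sym (*-assoc ((g * 2 * l) ^ 4) (W ^ 4) (n ^ w)) ⟩
    (g * 2 * l) ^ 4 * W ^ 4 * n ^ w            ≡⟨ cong (_* n ^ w) (trans (sym (^-distrib-* 4 (g * 2 * l) W)) (trans (cong (_^ 4) (ring₂ g l W)) (^-distrib-* 4 l (g * (2 * W))))) ⟩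
    l ^ 4 * (g * (2 * W)) ^ 4 * n ^ w          ≡⟨ trans (*-assoc (l ^ 4) ((g * (2 * W)) ^ 4) (n ^ w)) (cong (λ z → l ^ 4 * ((g * z) ^ 4 * n ^ w)) (sym C≡)) ⟩
    l ^ 4 * ((g * C) ^ 4 * n ^ w)              ∎)
    where
    open ≤-Reasoning
    ring₁ : ∀ γ → γ + 9 * γ ≡ 10 * γ
    ring₁ = solve-∀
    ring₂ : ∀ g l w → g * 2 * l * w ≡ l * (g * (2 * w))
    ring₂ = solve-∀
    X₁⁴ : X₁ ^ 4 ≤ γ ^ 4 * (W ^ 4 * n ^ w)
    X₁⁴ = begin
      X₁ ^ 4                                   ≤⟨ ^-monoˡ-≤ 4 h₁ ⟩
      (γ * (s * W)) ^ 4                        ≡⟨ trans (^-distrib-* 4 γ (s * W)) (cong (γ ^ 4 *_) (trans (^-distrib-* 4 s W) (*-comm (s ^ 4) (W ^ 4)))) ⟩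
      γ ^ 4 * (W ^ 4 * s ^ 4)                  ≤⟨ *-monoʳ-≤ (γ ^ 4) (*-monoʳ-≤ (W ^ 4) s≤) ⟩
      γ ^ 4 * (W ^ 4 * n ^ w)                  ∎

-- Assembling the estimates with symbolic constants

module Inequalities where

  open Quadrature using (^-distrib-*)
  open import Data.Nat using (suc; _+_; _*_; _^_; _≤_; _<_; _≤?_; _<?_; NonZero)
  open import Data.Nat.Properties
  open import Data.Nat.Tactic.RingSolver using (solve-∀)
  open import Relation.Nullary using (yes; no; contradiction)
  open import Relation.Binary.PropositionalEquality

  ^-cancelˡ-≤ : ∀ k {a b} .{{_ : NonZero k}} → a ^ k ≤ b ^ k → a ≤ b
  ^-cancelˡ-≤ (suc k) {a} {b} le with a ≤? b
  ... | yes a≤b = a≤b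
  ... | no  a≰b = contradiction le (<⇒≱ (^-monoˡ-< (suc k) (≰⇒> a≰b)))

  ^-cancelˡ-< : ∀ k a b → a ^ k < b ^ k → a < b
  ^-cancelˡ-< k a b lt with a <? b
  ... | yes a<b = a<b
  ... | no  a≮b = contradiction lt (≤⇒≯ (^-monoˡ-≤ k (≮⇒≥ a≮b)))

  -- Here v = 2^12: the factor 2v comes from the even positions, and T = v t holds because the norms
  -- live at N = 2n + 12. Cancelling v leaves the power t = 2^(2n); e/d bounds (x + 1)/x.
  panel-linear : ∀ x Mp c S K₀ Z₁ Z₂ K₁ K₂ K T t v d e .{{_ : NonZero v}} .{{_ : NonZero d}} → T ≡ v * t →
    2 * (2 * v) * (2 * Mp * (c * S)) ≤ K₀ * (3 * Z₁ + suc x * Z₂) → x * Z₁ ≤ K₁ * T → x * x * Z₂ ≤ K₂ * T →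
    d * suc x ≤ e * x → 3 * d * K₁ + e * K₂ ≤ d * K →
    8 * (x * S) * (Mp * c) ≤ K₀ * K * t
  panel-linear x Mp c S K₀ Z₁ Z₂ K₁ K₂ K T t v d e T≡ bound h₁ h₂ x≥ numeric = *-cancelˡ-≤ (d * v) {{m*n≢0 d v}} (begin
    d * v * (8 * (x * S) * (Mp * c))                          ≡⟨ ring₁ d v x S Mp c ⟩
    d * x * (2 * (2 * v) * (2 * Mp * (c * S)))                ≤⟨ *-monoʳ-≤ (d * x) bound ⟩
    d * x * (K₀ * (3 * Z₁ + suc x * Z₂))                      ≡⟨ ring₂ d x K₀ Z₁ (suc x) Z₂ ⟩
    K₀ * (3 * d * (x * Z₁) + d * suc x * (x * Z₂))            ≤⟨ *-monoʳ-≤ K₀ (+-mono-≤ (*-monoʳ-≤ (3 * d) h₁) (*-monoˡ-≤ (x * Z₂) x≥)) ⟩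
    K₀ * (3 * d * (K₁ * T) + e * x * (x * Z₂))                ≡⟨ ring₃ K₀ (3 * d * (K₁ * T)) e x Z₂ ⟩
    K₀ * (3 * d * (K₁ * T) + e * (x * x * Z₂))                ≤⟨ *-monoʳ-≤ K₀ (+-monoʳ-≤ (3 * d * (K₁ * T)) (*-monoʳ-≤ e h₂)) ⟩
    K₀ * (3 * d * (K₁ * T) + e * (K₂ * T))                    ≡⟨ ring₄ K₀ (3 * d) K₁ e K₂ T ⟩
    K₀ * ((3 * d * K₁ + e * K₂) * T)                          ≤⟨ *-monoʳ-≤ K₀ (*-monoˡ-≤ T numeric) ⟩
    K₀ * (d * K * T)                                          ≡⟨ cong (λ z → K₀ * (d * K * z)) T≡ ⟩
    K₀ * (d * K * (v * t))                                    ≡⟨ ring₅ K₀ d K v t ⟩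
    d * v * (K₀ * K * t)                                      ∎)
    where
    open ≤-Reasoning
    ring₁ : ∀ d v x S M c → d * v * (8 * (x * S) * (M * c)) ≡ d * x * (2 * (2 * v) * (2 * M * (c * S)))
    ring₁ = solve-∀
    ring₂ : ∀ d x K a y b → d * x * (K * (3 * a + y * b)) ≡ K * (3 * d * (x * a) + d * y * (x * b))
    ring₂ = solve-∀
    ring₃ : ∀ K a e x z → K * (a + e * x * (x * z)) ≡ K * (a + e * (x * x * z))
    ring₃ = solve-∀
    ring₄ : ∀ K d a e b T → K * (d * (a * T) + e * (b * T)) ≡ K * ((d * a + e * b) * T)
    ring₄ = solve-∀
    ring₅ : ∀ K₀ d K v t → K₀ * (d * K * (v * t)) ≡ d * v * (K₀ * K * t)
    ring₅ = solve-∀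

  panel-total : ∀ x y₄ y₅ y₆ n P S Mc B t f D → f * 48 * B ≡ D → y₄ ≤ 2 * n → y₅ ≤ 2 * n → y₆ ≤ 2 * n → P ≤ S → 8 * (x * S) * Mc ≤ B * t →
    f * (24 * (y₆ * y₅ * y₄ * x * (2 * P))) * Mc ≤ D * (n ^ 3 * t)
  panel-total x y₄ y₅ y₆ n P S Mc B t f D D≡ h₄ h₅ h₆ P≤S le = begin
    f * (24 * (y₆ * y₅ * y₄ * x * (2 * P))) * Mc               ≤⟨ *-monoˡ-≤ Mc (*-monoʳ-≤ f (*-monoʳ-≤ 24 (*-mono-≤ (*-monoˡ-≤ x (*-mono-≤ (*-mono-≤ h₆ h₅) h₄)) (*-monoʳ-≤ 2 P≤S)))) ⟩
    f * (24 * (2 * n * (2 * n) * (2 * n) * x * (2 * S))) * Mc  ≡⟨ ring₁ f n x S Mc ⟩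
    f * 48 * (n * n * n) * (8 * (x * S) * Mc)                  ≤⟨ *-monoʳ-≤ (f * 48 * (n * n * n)) le ⟩
    f * 48 * (n * n * n) * (B * t)                             ≡⟨ ring₂ (f * 48) n B t ⟩
    f * 48 * B * (n * (n * (n * 1)) * t)                       ≡⟨ cong (_* (n ^ 3 * t)) D≡ ⟩
    D * (n ^ 3 * t)                                            ∎
    where
    open ≤-Reasoning
    ring₁ : ∀ f n x S M → f * (24 * (2 * n * (2 * n) * (2 * n) * x * (2 * S))) * M ≡ f * 48 * (n * n * n) * (8 * (x * S) * M)
    ring₁ = solve-∀
    ring₂ : ∀ f n B t → f * (n * n * n) * (B * t) ≡ f * B * (n * (n * (n * 1)) * t)
    ring₂ = solve-∀

  -- 101 is 2 · 50 + 1: the bound for V is absorbed through 1200 ≤ Q y as one more unit. 64 collects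
  -- the twos of κ and y², and the factor 100 on the left is spent on replacing Q by n.
  small-total : ∀ R E V Q y θ w κ n f D → f * 24 * 101 * 64 * w ≡ D → R * E ≤ Q * (50 * (y * y) * θ) * w → R * V ≤ 1200 * y * θ * w →
    1200 ≤ Q * y → κ ≤ 2 * n * (2 * n) * (2 * n) * (2 * n) → y ≤ 2 * n → 100 * Q ≤ n →
    R * (100 * (f * (24 * (κ * (2 * E + V))))) ≤ D * n ^ 7 * θ
  small-total R E V Q y θ w κ n f D D≡ hE hV big κ≤ y≤ Q≤ = begin
    R * (100 * (f * (24 * (κ * (2 * E + V)))))                                     ≡⟨ ring₁ 100 24 R f κ E V ⟩
    100 * (f * (24 * (κ * (2 * (R * E) + R * V))))                                 ≤⟨ *-monoʳ-≤ 100 (*-monoʳ-≤ f (*-monoʳ-≤ 24 (*-mono-≤ κ≤ (+-mono-≤ (*-monoʳ-≤ 2 hE) hV′)))) ⟩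
    100 * (f * (24 * (k * (2 * (Q * (50 * (y * y) * θ) * w) + Q * y * y * θ * w)))) ≡⟨ ring₂ 100 f 24 50 k Q y θ w ⟩
    f * 24 * 101 * w * k * (100 * Q) * (y * y) * θ                                 ≤⟨ *-monoˡ-≤ θ (*-mono-≤ (*-monoʳ-≤ (f * 24 * 101 * w * k) Q≤) (*-mono-≤ y≤ y≤)) ⟩
    f * 24 * 101 * w * k * n * (2 * n * (2 * n)) * θ                               ≡⟨ ring₃ (f * 24 * 101) w n θ ⟩
    f * 24 * 101 * 64 * w * n ^ 7 * θ                                              ≡⟨ cong (λ z → z * n ^ 7 * θ) D≡ ⟩
    D * n ^ 7 * θ                                                                  ∎
    where
    open ≤-Reasoning
    k = 2 * n * (2 * n) * (2 * n) * (2 * n)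
    ring₁ : ∀ h u R f κ E V → R * (h * (f * (u * (κ * (2 * E + V))))) ≡ h * (f * (u * (κ * (2 * (R * E) + R * V))))
    ring₁ = solve-∀
    ring₂ : ∀ h f u v k Q y θ w → h * (f * (u * (k * (2 * (Q * (v * (y * y) * θ) * w) + Q * y * y * θ * w)))) ≡ f * u * (2 * v + 1) * w * k * (h * Q) * (y * y) * θ
    ring₂ = solve-∀
    ring₃ : ∀ f w n θ → f * w * (2 * n * (2 * n) * (2 * n) * (2 * n)) * n * (2 * n * (2 * n)) * θ ≡ f * 64 * w * (n * (n * (n * (n * (n * (n * (n * 1))))))) * θ
    ring₃ = solve-∀
    hV′ : R * V ≤ Q * y * y * θ * w
    hV′ = ≤-trans hV (*-monoˡ-≤ w (*-monoˡ-≤ θ (*-monoˡ-≤ y big)))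

  -- k counts the blocks of length m ≈ Q²/4 among the p steps.
  block-count : ∀ n p Q k r m a b d e g .{{_ : NonZero n}} .{{_ : NonZero g}} .{{_ : NonZero d}} → p ≡ r + k * m → r ≤ m → 4 * m ≤ Q * Q →
    b * Q ^ 5 ≤ a * n ^ 2 → e * n ≤ d * (4 * p) → g * (a * a * d ^ 5) ≤ b * b * e ^ 5 → .{{_ : NonZero a}} →
    g * n ≤ suc k ^ 5
  block-count n p Q k r m a b d e g p≡ r≤m m≤ Q≤ p≥ numeric = *-cancelˡ-≤ (n ^ 4 * (a * a * d ^ 5)) {{m*n≢0 (n ^ 4) (a * a * d ^ 5) {{m^n≢0 n 4}} {{m*n≢0 (a * a) (d ^ 5) {{m*n≢0 a a}} {{m^n≢0 d 5}}}}}} (begin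
    n ^ 4 * (a * a * d ^ 5) * (g * n)                ≡⟨ ring₁ (n ^ 4) (a * a * d ^ 5) g n ⟩
    g * (a * a * d ^ 5) * n ^ 5                      ≤⟨ *-monoˡ-≤ (n ^ 5) numeric ⟩
    b * b * e ^ 5 * n ^ 5                            ≡⟨ trans (*-assoc (b * b) (e ^ 5) (n ^ 5)) (cong (b * b *_) (sym (^-distrib-* 5 e n))) ⟩
    b * b * (e * n) ^ 5                              ≤⟨ *-monoʳ-≤ (b * b) (^-monoˡ-≤ 5 (≤-trans p≥ (*-monoʳ-≤ d 4p≤))) ⟩
    b * b * (d * (suc k * (Q * Q))) ^ 5              ≡⟨ cong (b * b *_) (trans (^-distrib-* 5 d (suc k * (Q * Q))) (cong (d ^ 5 *_) (trans (^-distrib-* 5 (suc k) (Q * Q)) (cong (suc k ^ 5 *_) (^-distrib-* 5 Q Q))))) ⟩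
    b * b * (d ^ 5 * (suc k ^ 5 * (Q ^ 5 * Q ^ 5)))  ≡⟨ ring₂ b (d ^ 5) (suc k ^ 5) (Q ^ 5) ⟩
    (b * Q ^ 5) * (b * Q ^ 5) * (d ^ 5 * suc k ^ 5)  ≤⟨ *-monoˡ-≤ (d ^ 5 * suc k ^ 5) (*-mono-≤ Q≤ Q≤) ⟩
    (a * n ^ 2) * (a * n ^ 2) * (d ^ 5 * suc k ^ 5)  ≡⟨ ring₃ a (n ^ 2) (d ^ 5) (suc k ^ 5) ⟩
    n ^ 2 * n ^ 2 * (a * a * d ^ 5) * suc k ^ 5      ≡⟨ cong (λ z → z * (a * a * d ^ 5) * suc k ^ 5) (sym (^-distribˡ-+-* n 2 2)) ⟩
    n ^ 4 * (a * a * d ^ 5) * suc k ^ 5              ∎)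
    where
    open ≤-Reasoning
    ring₁ : ∀ N c g n → N * c * (g * n) ≡ g * c * (n * N)
    ring₁ = solve-∀
    ring₂ : ∀ b d k Q → b * b * (d * (k * (Q * Q))) ≡ (b * Q) * (b * Q) * (d * k)
    ring₂ = solve-∀
    ring₃ : ∀ a N d k → (a * N) * (a * N) * (d * k) ≡ N * N * (a * a * d) * k
    ring₃ = solve-∀
    ring₄ : ∀ k m → 4 * (suc k * m) ≡ suc k * (4 * m)
    ring₄ = solve-∀
    4p≤ : 4 * p ≤ suc k * (Q * Q)
    4p≤ = ≤-trans (*-monoʳ-≤ 4 (≤-trans (≤-reflexive p≡) (+-monoˡ-≤ (k * m) r≤m))) (≤-trans (≤-reflexive (ring₄ k m)) (*-monoʳ-≤ (suc k) m≤))

  scaled-root : ∀ Q n a b c .{{_ : NonZero b}} → b * Q ^ 5 ≤ a * n ^ 2 → a * c ^ 5 ≤ b * n ^ 3 → c * Q ≤ n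
  scaled-root Q n a b c Q≤ n≥ = ^-cancelˡ-≤ 5 (*-cancelˡ-≤ b (begin
    b * (c * Q) ^ 5          ≡⟨ cong (b *_) (^-distrib-* 5 c Q) ⟩
    b * (c ^ 5 * Q ^ 5)      ≡⟨ ring₁ b (c ^ 5) (Q ^ 5) ⟩
    c ^ 5 * (b * Q ^ 5)      ≤⟨ *-monoʳ-≤ (c ^ 5) Q≤ ⟩
    c ^ 5 * (a * n ^ 2)      ≡⟨ ring₂ (c ^ 5) a (n ^ 2) ⟩
    a * c ^ 5 * n ^ 2        ≤⟨ *-monoˡ-≤ (n ^ 2) n≥ ⟩
    b * n ^ 3 * n ^ 2        ≡⟨ trans (*-assoc b (n ^ 3) (n ^ 2)) (cong (b *_) (sym (^-distribˡ-+-* n 3 2))) ⟩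
    b * n ^ 5                ∎))
    where
    open ≤-Reasoning
    ring₁ : ∀ b c q → b * (c * q) ≡ c * (b * q)
    ring₁ = solve-∀
    ring₂ : ∀ c a m → c * (a * m) ≡ a * c * m
    ring₂ = solve-∀

  error-split : ∀ l A f a b B W X₁ → l * A ≤ a + b + B * W → f * a + f * B * W ≤ X₁ → l * (f * A) ≤ X₁ + f * b
  error-split l A f a b B W X₁ le h = begin
    l * (f * A)                    ≡⟨ ring₁ l f A ⟩
    f * (l * A)                    ≤⟨ *-monoʳ-≤ f le ⟩
    f * (a + b + B * W)            ≡⟨ ring₂ f a b B W ⟩
    f * a + f * B * W + f * b      ≤⟨ +-monoˡ-≤ (f * b) h ⟩
    X₁ + f * b                     ∎
    where
    open ≤-Reasoning
    ring₁ : ∀ l f A → l * (f * A) ≡ f * (l * A)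
    ring₁ = solve-∀
    ring₂ : ∀ f a b B W → f * (a + b + B * W) ≡ f * a + f * B * W + f * b
    ring₂ = solve-∀

  small-combine : ∀ h X g b W γ s .{{_ : NonZero h}} → h * X ≤ g * W → g + h * b ≤ h * (s * γ) → X + b * W ≤ γ * (s * W)
  small-combine h X g b W γ s X≤ numeric = *-cancelˡ-≤ h (begin
    h * (X + b * W)             ≡⟨ ring₁ h X b W ⟩
    h * X + h * b * W           ≤⟨ +-monoˡ-≤ (h * b * W) X≤ ⟩
    g * W + h * b * W           ≡⟨ *-distribʳ-+ W g (h * b) ⟨
    (g + h * b) * W             ≤⟨ *-monoˡ-≤ W numeric ⟩
    h * (s * γ) * W             ≡⟨ ring₂ h s γ W ⟩
    h * (γ * (s * W))           ∎)
    where
    open ≤-Reasoning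
    ring₁ : ∀ h X b W → h * (X + b * W) ≡ h * X + h * b * W
    ring₁ = solve-∀
    ring₂ : ∀ h s γ W → h * (s * γ) * W ≡ h * (γ * (s * W))
    ring₂ = solve-∀

-- Numerical constants and the total panel error

module PanelTotal where

  open Sums using (∑±ᴺ; ∑±ᴺ-cong)
  open Coefficients using (coef)
  open WeightedNorms using (dfact)
  open Quadrature
  open PanelBound using (Kʳ; Kˡ)
  open PanelSum
  open SmallTerms
  open MainTerm
  open Estimates
  open ErrorBound
  open PowerBounds
  open Inequalities
  open import Defs
  open import Data.Nat using (ℕ; suc; s≤s; z≤n; _!; _+_; _*_; _^_; _≤_; NonZero; >-nonZero)
  open import Data.Nat.Properties
  open import Data.Integer using (∣_∣)
  open import Data.Nat.Tactic.RingSolver using (solve-∀)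
  open import Relation.Binary.PropositionalEquality

  weighted-pow : ∀ T N r s j e x K a b .{{_ : NonZero a}} .{{_ : NonZero x}} → r ≡ j + (e + e) → r + s ≡ N → N ≤ T → x ≤ suc s → a * N ≤ b * x →
    dfact j * r ! * b ^ j ≤ a ^ j * (K * K) →
    x ^ e * ∑±ᴺ T (λ t → pow j ∣ t ∣ * ∣ coef r s t ∣) ≤ K * 2 ^ N
  weighted-pow T N r s j e x K a b r≡ refl le x≤ aN≤ numeric =
    ≤-trans (≤-reflexive (cong (x ^ e *_) (∑±ᴺ-cong T (λ t → cong (_* ∣ coef r s t ∣) (pow≡^ j ∣ t ∣)))))
            (weighted-ℓ¹-power T r s j e x K a b r≡ le x≤ aN≤ numeric)

  -- Explicit arguments, because unifying a large literal with an unsolved product unfolds it.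
  value₂ : ∀ (f : ℕ → ℕ → ℕ) x x′ y y′ → x ≡ x′ → y ≡ y′ → f x y ≡ f x′ y′
  value₂ f x _ y _ refl refl = refl

  -- 10 γ₀ is the constant 24 · 38755553 of the theorem times 2 · 32 · 958003200; the panels may use 9 γ₀ of it,
  -- everything else shares γ₀.  K₁₅ and K₁₇ lie just above the square roots of 25‼ 15! and 25‼ 17!.
  abstract
    γ₀ K₁₅ K₁₇ K₁ Kᵖ cᵖ cˢ gˢ Bᶜ : ℕ
    γ₀  = 24 * 38755553 * 64 * 95800320
    K₁₅ = 3233000000000
    K₁₇ = 53305000000000
    K₁  = 63010000000000
    Kᵖ  = 5000 * 48 * ((6 * 219872813022816738 + 5 * 18388361671565312) * K₁)
    cᵖ  = 2 ^ 11 * 11 !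
    cˢ  = 5000 * 24 * 101 * 64 * 1349429160
    gˢ  = 90000 * γ₀
    Bᶜ  = 19269550080 + 384 * 40500 * 1349429160

    γ₀≢0 : NonZero γ₀
    γ₀≢0 = _

    cᵖ≢0 : NonZero cᵖ
    cᵖ≢0 = _

    γ₀-scale : 10 * γ₀ ≡ 24 * 38755553 * 2 * 30656102400
    γ₀-scale = refl

    Kᵖ≡ : ∀ p → 5000 * 48 * (K₀ p * K₁) ≡ Kᵖ
    Kᵖ≡ p = value₂ (λ y z → 5000 * 48 * (z * y)) K₁ K₁ (K₀ p) (6 * 219872813022816738 + 5 * 18388361671565312) refl K₀-value
      where
      K₀-value : K₀ p ≡ 6 * 219872813022816738 + 5 * 18388361671565312
      K₀-value = value₂ (λ x y → 6 * x + 5 * y) Kʳ 219872813022816738 Kˡ 18388361671565312 ωs-right ωs-left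

    cᵖ≡ : ∀ p → c₀ p ≡ cᵖ
    cᵖ≡ p = cong₂ _*_ (pow≡^ 11 2) (fact≡! 11)

    cˢ≡ : 5000 * 24 * 101 * 64 * linᴺ ωs (λ _ → 1) ≡ cˢ
    cˢ≡ = value₂ _*_ (5000 * 24 * 101 * 64) (5000 * 24 * 101 * 64) (linᴺ ωs (λ _ → 1)) 1349429160 refl ωs-norm

    Bᶜ≡ : c₁ + c₂ * c₃ * linᴺ ωs (λ _ → 1) ≡ Bᶜ
    Bᶜ≡ = value₂ _+_ c₁ 19269550080 (c₂ * c₃ * linᴺ ωs (λ _ → 1)) (384 * 40500 * 1349429160) c₁-value
           (value₂ _*_ (c₂ * c₃) (384 * 40500) (linᴺ ωs (λ _ → 1)) 1349429160 (value₂ _*_ c₂ 384 c₃ 40500 c₂-value c₃-value) ωs-norm)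

    numeric₁₅ : dfact 13 * 15 ! * 1250 ^ 13 ≤ 1249 ^ 13 * (K₁₅ * K₁₅)
    numeric₁₅ = ≤ᵇ⇒≤ _ _ _

    numeric₁₇ : dfact 13 * 17 ! * 1250 ^ 13 ≤ 1249 ^ 13 * (K₁₇ * K₁₇)
    numeric₁₇ = ≤ᵇ⇒≤ _ _ _

    numeric-sum : 3 * 10000 * K₁₅ + 10001 * K₁₇ ≤ 10000 * K₁
    numeric-sum = ≤ᵇ⇒≤ _ _ _

    numeric-panels : (4 * Kᵖ) ^ (4 + 4) * (10 ^ 11 * 38 ^ (5 * 11)) ≤ (9 * γ₀ * cᵖ) ^ (4 + 4) * (7 ^ 11 * 27 ^ (5 * 11) * 27 ^ 49)
    numeric-panels = ≤ᵇ⇒≤ _ _ _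

    numeric-ratio : 100 * suc (suc 58) ^ (5 * suc 7) ≤ 266 * suc 58 ^ (5 * suc 7)
    numeric-ratio = ≤ᵇ⇒≤ _ _ _

    numeric-small : cˢ * suc 58 ^ (5 * suc 7) * 100 ^ 58 ≤ gˢ * (1600 * 66700 ^ suc 7) * 266 ^ 58
    numeric-small = ≤ᵇ⇒≤ _ _ _

    -- 66700 lies just below 7.997⁵/0.7², where 7.997 n bounds 4p from below and 0.7 n² bounds Q⁵
    -- from above.
    numeric-blocks : 66700 * (7 * 7 * 1000 ^ 5) ≤ 10 * 10 * 7997 ^ 5
    numeric-blocks = ≤ᵇ⇒≤ _ _ _

    numeric-total : gˢ + 100 * (5000 * Bᶜ) ≤ 100 * (1000 * γ₀)
    numeric-total = ≤ᵇ⇒≤ _ _ _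

  scale-≤ : ∀ a b k x → b ≡ suc a → a * k ≤ x → a * (k + x) ≤ b * x
  scale-≤ a b k x refl h = ≤-trans (≤-reflexive (*-distribˡ-+ a k x)) (+-monoˡ-≤ (a * x) h)

  panels-power : ∀ p n M P W x N t → 2 * n ≡ 6 + p → x ≡ 2 + p → N ≡ 18 + p → 10000 ≤ n → P ≤ panelSum p M n n → 27 ≤ M →
    7 * n ^ 2 ≤ 10 * (M + 11) ^ 5 → t ≡ 2 ^ (2 * n) → t * t ≤ 4 * 4 * n * (W * W) →
    (5000 * (24 * ((6 + p) * (5 + p) * (4 + p) * x * (2 * P)))) ^ 4 ≤ (9 * γ₀) ^ 4 * (W ^ 4 * n ^ 3)
  panels-power p n M P W x N t 2n≡ x≡ N≡ n≥ P≤ M≥ n≤ t≡ t≤ =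
    -- The exponents satisfy 13 · 8 = 5 · 11 + 49 for M and 3 · 8 + 4 = 2 · 11 + 2 · 3 for n, the
    -- summand 4 coming from the square root of n in `t≤`. 38/27 bounds (M + 11)/M for M ≥ 27.
    power-bound X M (M + 11) cᵖ Kᵖ n W t (9 * γ₀) 7 10 27 38 4 13 3 2 5 11 49 4 3 {{>-nonZero (≤-trans (s≤s z≤n) M≥)}} {{cᵖ≢0}}
      refl refl X≤ t≤ n≤ M′≤ M≥ numeric-panels
    where
    X = 5000 * (24 * ((6 + p) * (5 + p) * (4 + p) * x * (2 * P)))
    S = panelSum p M n n
    T = 2 * Z p M n n
    Z₁ = weightedNorm p M n n 15 (p + 3)
    Z₂ = weightedNorm p M n n 17 (p + 1)
    instance
      x≢0 : NonZero x
      x≢0 = subst NonZero (sym x≡) _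
    20000≤6+p : 20000 ≤ 6 + p
    20000≤6+p = ≤-trans (*-monoʳ-≤ 2 n≥) (≤-reflexive 2n≡)
    p≤x : 19994 ≤ x
    p≤x = ≤-trans (+-cancelˡ-≤ 6 19994 p 20000≤6+p) (≤-trans (m≤n+m p 2) (≤-reflexive (sym x≡)))
    N≤T : N ≤ T
    N≤T = begin
      N                  ≡⟨ trans N≡ (cong (12 +_) (sym 2n≡)) ⟩
      12 + 2 * n         ≤⟨ +-monoˡ-≤ (2 * n) (m≤m+n 12 10) ⟩
      22 + 2 * n         ≡⟨ ring n ⟩
      2 * (11 + n)       ≤⟨ *-monoʳ-≤ 2 (≤-trans (m≤n+m (11 + n) M) (m≤m+n (M + (11 + n)) ((1 + n) * (M + (11 + n))))) ⟩
      T                  ∎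
      where
      open ≤-Reasoning
      ring : ∀ n → 22 + 2 * n ≡ 2 * (11 + n)
      ring = solve-∀
    x≤ : ∀ k → x ≤ suc (p + suc k)
    x≤ k = ≤-trans (≤-reflexive x≡) (s≤s (≤-trans (≤-reflexive (+-comm 1 p)) (+-monoʳ-≤ p (s≤s z≤n))))
    -- N = x + 16, and 1249 · 16 = 19984 is still below x.
    N≤x : 1249 * N ≤ 1250 * x
    N≤x = ≤-trans (≤-reflexive (cong (1249 *_) (trans N≡ (cong (16 +_) (sym x≡))))) (scale-≤ 1249 1250 16 x refl (≤-trans (m≤m+n 19984 10) p≤x))
    x≥ : 10000 * suc x ≤ 10001 * x
    x≥ = scale-≤ 10000 10001 1 x refl (≤-trans (m≤m+n 10000 9994) p≤x)
    h₁ : x * Z₁ ≤ K₁₅ * 2 ^ N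
    h₁ = ≤-trans (≤-reflexive (cong (_* Z₁) (sym (*-identityʳ x))))
      (weighted-pow T N 15 (p + 3) 13 1 x K₁₅ 1249 1250 refl (trans (ring p) (sym N≡)) N≤T (x≤ 2) N≤x numeric₁₅)
      where
      ring : ∀ p → 15 + (p + 3) ≡ 18 + p
      ring = solve-∀
    h₂ : x * x * Z₂ ≤ K₁₇ * 2 ^ N
    h₂ = ≤-trans (≤-reflexive (cong (λ z → x * z * Z₂) (sym (*-identityʳ x))))
      (weighted-pow T N 17 (p + 1) 13 2 x K₁₇ 1249 1250 refl (trans (ring p) (sym N≡)) N≤T (x≤ 0) N≤x numeric₁₇)
      where
      ring : ∀ p → 17 + (p + 1) ≡ 18 + p
      ring = solve-∀
    bound : 2 * (2 * 4096) * (2 * pow 13 M * (c₀ p * S)) ≤ K₀ p * (3 * Z₁ + suc x * Z₂)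
    bound = ≤-trans (≤-reflexive (cong (λ z → 2 * z * (2 * pow 13 M * (c₀ p * S))) (sym 2^13)))
      (≤-trans (panelSum-bound p M n n) (≤-reflexive (cong (λ z → K₀ p * (3 * Z₁ + z * Z₂)) (trans (+-comm p 3) (cong suc (sym x≡))))))
      where
      2^13 : pow 13 2 ≡ 2 * 4096
      2^13 = pow≡^ 13 2
    2^N : 2 ^ N ≡ 4096 * t
    2^N = trans (cong (2 ^_) (trans N≡ (cong (12 +_) (sym 2n≡)))) (trans (^-distribˡ-+-* 2 12 (2 * n)) (cong₂ _*_ 2^12 (sym t≡)))
      where
      2^12 : 2 ^ 12 ≡ 4096
      2^12 = refl
    linear : 8 * (x * S) * (pow 13 M * c₀ p) ≤ K₀ p * K₁ * t
    linear = panel-linear x (pow 13 M) (c₀ p) S (K₀ p) Z₁ Z₂ K₁₅ K₁₇ K₁ (2 ^ N) t 4096 10000 10001 2^N bound h₁ h₂ x≥ numeric-sum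
    y≤ : ∀ k → k ≤ 6 → k + p ≤ 2 * n
    y≤ k k≤ = ≤-trans (+-monoˡ-≤ p k≤) (≤-reflexive (sym 2n≡))
    X≤ : X * (M ^ 13 * cᵖ) ≤ Kᵖ * (n ^ 3 * t)
    X≤ = ≤-trans (≤-reflexive (cong₂ (λ y z → X * (y * z)) (sym (pow≡^ 13 M)) (sym (cᵖ≡ p))))
      (panel-total x (4 + p) (5 + p) (6 + p) n P S (pow 13 M * c₀ p) (K₀ p * K₁) t 5000 Kᵖ (Kᵖ≡ p)
        (y≤ 4 (m≤m+n 4 2)) (y≤ 5 (m≤m+n 5 1)) (y≤ 6 ≤-refl) P≤ linear)
    M′≤ : 27 * (M + 11) ≤ 38 * M
    M′≤ = begin
      27 * (M + 11)             ≡⟨ *-distribˡ-+ 27 M 11 ⟩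
      27 * M + 11 * 27          ≤⟨ +-monoʳ-≤ (27 * M) (*-monoʳ-≤ 11 M≥) ⟩
      27 * M + 11 * M           ≡⟨ *-distribʳ-+ M 27 11 ⟨
      38 * M                    ∎
      where open ≤-Reasoning

-- The choice of the cutoff and the final bound

module Conclusion where

  open Sums using (∑; ∑±; square-cancel-≤)
  open Quadrature
  open Decomposition using (Y; E₁; pans)
  open SmallTerms
  open MainTerm
  open Estimates
  open ErrorBound
  open PowerBounds
  open Inequalities
  open PanelTotal
  open import Defs
  open import Data.Nat using (ℕ; suc; s≤s; z≤n; _+_; _*_; _^_; _∸_; _≤_; _<_; _/_; _%_; NonZero; >-nonZero)
  open import Data.Nat.DivMod using (m≡m%n+[m/n]*n; m%n<n; m/n*n≤m; /-monoˡ-≤)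
  open import Data.Nat.Properties
  open import Data.Integer as ℤ using (ℤ; ∣_∣)
  open import Data.Nat.Tactic.RingSolver using (solve-∀)
  open import Data.Product using (_×_; _,_; ∃)
  open import Relation.Binary.PropositionalEquality

  power-of-4-bound : ∀ n W → 1 ≤ n → centralBinom n ≡ 2 * W → 2 ^ (2 * n) * 2 ^ (2 * n) ≤ 4 * 4 * n * (W * W)
  power-of-4-bound n@(suc k) W (s≤s z≤n) C≡ = begin
    2 ^ (2 * n) * 2 ^ (2 * n)         ≡⟨ ^-distribˡ-+-* 2 (2 * n) (2 * n) ⟨
    2 ^ (2 * n + 2 * n)               ≡⟨ cong (2 ^_) (ring₁ n) ⟩
    2 ^ (4 * n)                       ≡⟨ ^-*-assoc 2 4 n ⟨
    16 ^ n                            ≤⟨ central-lower k ⟩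
    4 * n * (central n * central n)   ≡⟨ cong (λ z → 4 * n * (z * z)) (trans (central≡ n) C≡) ⟩
    4 * n * (2 * W * (2 * W))         ≡⟨ ring₂ n W ⟩
    4 * 4 * n * (W * W)               ∎
    where
    open ≤-Reasoning
    ring₁ : ∀ n → 2 * n + 2 * n ≡ 4 * n
    ring₁ = solve-∀
    ring₂ : ∀ n W → 4 * n * (2 * W * (2 * W)) ≡ 4 * 4 * n * (W * W)
    ring₂ = solve-∀

  -- 25² · 4² = 10⁴ ≤ n.
  power-of-4-linear : ∀ n W t → 10000 ≤ n → t * t ≤ 4 * 4 * n * (W * W) → 25 * t ≤ n * W
  power-of-4-linear n W t n≥ t≤ = square-cancel-≤ (begin
    25 * t * (25 * t)                 ≡⟨ ring₁ 25 t ⟩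
    25 * 25 * (t * t)                 ≤⟨ *-monoʳ-≤ (25 * 25) t≤ ⟩
    25 * 25 * (4 * 4 * n * (W * W))   ≡⟨ ring₂ 25 4 n W ⟩
    25 * 25 * (4 * 4) * (n * (W * W)) ≤⟨ *-monoˡ-≤ (n * (W * W)) n≥ ⟩
    n * (n * (W * W))                 ≡⟨ ring₃ n W ⟩
    n * W * (n * W)                   ∎)
    where
    open ≤-Reasoning
    ring₁ : ∀ a t → a * t * (a * t) ≡ a * a * (t * t)
    ring₁ = solve-∀
    ring₂ : ∀ a b n W → a * a * (b * b * n * (W * W)) ≡ a * a * (b * b) * (n * (W * W))
    ring₂ = solve-∀
    ring₃ : ∀ n W → n * (n * (W * W)) ≡ n * W * (n * W)
    ring₃ = solve-∀

  linear-lower : ∀ n p a e h → 2 * n ≡ 6 + p → e + h ≡ a * 8 → a * 24 ≤ h * n → e * n ≤ a * (4 * p)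
  linear-lower n p a e h 2n≡ e+h≡ n≥ = +-cancelʳ-≤ (a * 24) _ _ (begin
    e * n + a * 24            ≤⟨ +-monoʳ-≤ (e * n) n≥ ⟩
    e * n + h * n             ≡⟨ *-distribʳ-+ n e h ⟨
    (e + h) * n               ≡⟨ cong (_* n) e+h≡ ⟩
    a * 8 * n                 ≡⟨ ring₁ a n ⟩
    a * (4 * (2 * n))         ≡⟨ cong (λ z → a * (4 * z)) 2n≡ ⟩
    a * (4 * (6 + p))         ≡⟨ ring₂ a p ⟩
    a * (4 * p) + a * 24      ∎)
    where
    open ≤-Reasoning
    ring₁ : ∀ a n → a * 8 * n ≡ a * (4 * (2 * n))
    ring₁ = solve-∀
    ring₂ : ∀ a p → a * (4 * (6 + p)) ≡ a * (4 * p) + a * 24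
    ring₂ = solve-∀

  abstract
    -- Together with 66700 n ≤ (k + 1)⁵ this gives at least 58 blocks, the starting point of the
    -- comparison with 2.66^k.
    numeric-58 : 58 ^ 5 < 66700 * 10000
    numeric-58 = ≤ᵇ⇒≤ _ _ _

    numeric-100 : 7 * 100 ^ 5 ≤ 10 * 10000 ^ 3
    numeric-100 = ≤ᵇ⇒≤ _ _ _

  quarter≥150 : ∀ Q → 37 ≤ Q → 150 ≤ Q * Q / 4
  quarter≥150 Q Q≥ = /-monoˡ-≤ {600} {Q * Q} 4 600≤
    where
    600≤ : 600 ≤ Q * Q
    600≤ = ≤-trans {600} {1369} {Q * Q} (m≤m+n 600 769) (*-mono-≤ {37} {Q} {37} {Q} Q≥ Q≥)

  small-bound : ∀ p n Q q E V W w κ y m k r R θ → R ≡ (4 + q) ^ p → θ ≡ (2 * q) ^ p → 2 * n ≡ 6 + p → y ≡ 3 + p → 10000 ≤ n → 37 ≤ Q → 10 * Q ^ 5 ≤ 7 * n ^ 2 →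
    p ≡ r + k * m → r ≤ m → 150 ≤ m → 4 * m ≤ Q * Q → q ≤ 4 * m →
    5000 * 24 * 101 * 64 * w ≡ cˢ → κ ≤ 2 * n * (2 * n) * (2 * n) * (2 * n) →
    R * E ≤ Q * (50 * (y * y) * θ) * w → R * V ≤ 1200 * y * θ * w →
    2 ^ (2 * n) * 2 ^ (2 * n) ≤ 4 * 4 * n * (W * W) →
    100 * (5000 * (24 * (κ * (2 * E + V)))) ≤ gˢ * W
  small-bound p n Q q E V W w κ y m k r R θ refl refl 2n≡ y≡ n≥ Q≥ Q≤ p≡ r≤m m≥ 4m≤ q≤ w≡ κ≤ hE hV t≤ =
    small-part (100 * (5000 * (24 * (κ * (2 * E + V))))) cˢ n q p k r m W 1600 66700 gˢ 7 5 58 p≡ m≥ q≤ k≥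
      (small-total ((4 + q) ^ p) E V Q y ((2 * q) ^ p) w κ n 5000 cˢ w≡ hE hV big κ≤ y≤ 100Q≤)
      2^p≤ count numeric-ratio numeric-small
    where
    instance
      n≢0 : NonZero n
      n≢0 = >-nonZero (≤-trans (s≤s z≤n) n≥)
    4p≥ : 7997 * n ≤ 1000 * (4 * p)
    4p≥ = linear-lower n p 1000 7997 3 2n≡ refl (≤-trans (m≤m+n 24000 6000) (*-monoʳ-≤ 3 n≥))
    count : 66700 * n ≤ suc k ^ 5
    count = block-count n p Q k r m 7 10 1000 7997 66700 p≡ r≤m 4m≤ Q≤ 4p≥ numeric-blocks
    k≥ : 58 ≤ k
    k≥ = ≤-pred (^-cancelˡ-< 5 58 (suc k) (≤-trans numeric-58 (≤-trans (*-monoʳ-≤ 66700 n≥) count)))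
    y≤ : y ≤ 2 * n
    y≤ = ≤-trans (≤-reflexive y≡) (≤-trans (+-monoˡ-≤ p (m≤m+n 3 3)) (≤-reflexive (sym 2n≡)))
    100Q≤ : 100 * Q ≤ n
    100Q≤ = scaled-root Q n 7 10 100 Q≤ (≤-trans numeric-100 (*-monoʳ-≤ 10 (^-monoˡ-≤ 3 n≥)))
    y≥ : 1200 ≤ y
    y≥ = ≤-trans (+-cancelˡ-≤ 6 1200 p (≤-trans (m≤m+n 1206 18794) (≤-trans (*-monoʳ-≤ 2 n≥) (≤-reflexive 2n≡)))) (≤-trans (m≤n+m p 3) (≤-reflexive (sym y≡)))
    big : 1200 ≤ Q * y
    big = ≤-trans y≥ (m≤n*m y Q {{>-nonZero (≤-trans (s≤s z≤n) Q≥)}})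
    2^p≤ : 1600 * 2 ^ p ≤ n * W
    2^p≤ = ≤-trans (≤-reflexive (trans (*-assoc 25 64 (2 ^ p)) (cong (25 *_) (trans (sym (^-distribˡ-+-* 2 6 p)) (cong (2 ^_) (sym 2n≡))))))
      (power-of-4-linear n W (2 ^ (2 * n)) n≥ t≤)

  -- The block length is the integer part of Q²/4. The remainder modulo 4 is covered by the 4 in 4 +
  -- q = Q².
  quarter : ∀ Q q → 4 + q ≡ Q * Q → 37 ≤ Q → ∃ λ m → 150 ≤ m × 4 * m ≤ Q * Q × q ≤ 4 * m
  quarter Q q q≡ Q≥ = Q * Q / 4 , quarter≥150 Q Q≥ , ≤-trans (≤-reflexive (*-comm 4 (Q * Q / 4))) (m/n*n≤m (Q * Q) 4) ,
    +-cancelˡ-≤ 4 q (4 * (Q * Q / 4)) (begin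
      4 + q                          ≡⟨ q≡ ⟩
      Q * Q                          ≡⟨ m≡m%n+[m/n]*n (Q * Q) 4 ⟩
      Q * Q % 4 + Q * Q / 4 * 4      ≤⟨ +-mono-≤ (<⇒≤ (m%n<n (Q * Q) 4)) (≤-reflexive (*-comm (Q * Q / 4) 4)) ⟩
      4 + 4 * (Q * Q / 4)            ∎)
    where open ≤-Reasoning

  scale-value : ∀ p n 2n≡ M₀ n≥21 → l p n 2n≡ M₀ n≥21 ≡ 30656102400
  scale-value p n 2n≡ M₀ n≥21 = cong (λ z → ∣ ℤ.+ 32 ℤ.* z ∣) (trans ωs-moment₀ (cong (λ z → ℤ.+ 420 ℤ.* ℤ.+ z) μ-value))

  module _ (p n : ℕ) (2n≡ : 2 * n ≡ 6 + p) (n≥ : 10000 ≤ n) (M₀ : ℕ) (M₀≥ : 26 ≤ M₀)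
           (lower : 10 * (M₀ + 11) ^ 5 ≤ 7 * n ^ 2) (upper : 7 * n ^ 2 ≤ 10 * (suc M₀ + 11) ^ 5) where

    private
      n≥21 : 21 ≤ n
      n≥21 = ≤-trans (m≤m+n 21 9979) n≥
      Q = M₀ + 11
      q = Q * Q ∸ 4
      W = W₁ p n 2n≡
      E = ∣ E₁ p n 2n≡ M₀ ∣
      P = ∣ ∑ n (pans p n 2n≡ M₀) ∣
      V = ∣ ∑± n (Y p n 2n≡ M₀) ∣
      w = linᴺ ωs (λ _ → 1)
      κ′ = κ p n 2n≡ M₀ n≥21
      Q≥ : 37 ≤ Q
      Q≥ = +-monoˡ-≤ 11 M₀≥
      q≡ : 4 + q ≡ Q * Q
      q≡ = m+[n∸m]≡n (≤-trans {4} {1369} {Q * Q} (m≤m+n 4 1365) (*-mono-≤ {37} {Q} {37} {Q} Q≥ Q≥))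
      y≥ : 146 ≤ 3 + p
      y≥ = ≤-trans (+-cancelˡ-≤ 6 146 p (≤-trans (m≤m+n 152 19848) (≤-trans (*-monoʳ-≤ 2 n≥) (≤-reflexive 2n≡)))) (m≤n+m p 3)
      y≤ : ∀ k → k ≤ 6 → k + p ≤ 2 * n
      y≤ k k≤ = ≤-trans (+-monoˡ-≤ p k≤) (≤-reflexive (sym 2n≡))
      κ≤ : κ′ ≤ 2 * n * (2 * n) * (2 * n) * (2 * n)
      κ≤ = *-mono-≤ (*-mono-≤ (*-mono-≤ (y≤ 6 ≤-refl) (y≤ 5 (m≤m+n 5 1))) (y≤ 4 (m≤m+n 4 2))) (y≤ 2 (m≤m+n 2 4))
      t≤ : 2 ^ (2 * n) * 2 ^ (2 * n) ≤ 4 * 4 * n * (W * W)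
      t≤ = power-of-4-bound n W (≤-trans (s≤s z≤n) n≥) (centralBinom≡ p n 2n≡ M₀ n≥21)
      small : 100 * (5000 * (24 * (κ′ * (2 * E + V)))) ≤ gˢ * W
      small = go (quarter Q q q≡ Q≥)
        where
        go : (∃ λ m → 150 ≤ m × 4 * m ≤ Q * Q × q ≤ 4 * m) → 100 * (5000 * (24 * (κ′ * (2 * E + V)))) ≤ gˢ * W
        go (m@(suc _) , m≥ , 4m≤ , q≤) = small-bound p n Q q E V W w κ′ (y p n 2n≡ q) m (p / m) (p % m) (R^ p n 2n≡ q) (θ^ p n 2n≡ q) refl refl 2n≡ refl n≥ Q≥ lower
          (m≡m%n+[m/n]*n p m) (<⇒≤ (m%n<n p m)) m≥ 4m≤ q≤ cˢ≡ κ≤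
          (E₁-bound p n 2n≡ q M₀ (≤-reflexive (sym q≡)) y≥) (Y-bound p n 2n≡ q M₀ (≤-reflexive (sym q≡)) y≥ (≤-trans (m≤m+n 6 20) M₀≥)) t≤
      panels : (5000 * (24 * (κ′ * (2 * P)))) ^ 4 ≤ (9 * γ₀) ^ 4 * (W ^ 4 * n ^ 3)
      panels = panels-power p n (suc M₀) P W (2 + p) (18 + p) (2 ^ (2 * n)) 2n≡ refl refl n≥ (pans-bound p n 2n≡ M₀ n≥21) (s≤s M₀≥) upper refl t≤
      combined : 5000 * (24 * (κ′ * (2 * E + V))) + 5000 * Bᵐ p n 2n≡ M₀ n≥21 * W ≤ γ₀ * (1000 * W)
      combined = small-combine 100 (5000 * (24 * (κ′ * (2 * E + V)))) gˢ (5000 * Bᵐ p n 2n≡ M₀ n≥21) W γ₀ 1000 small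
        (subst (λ z → gˢ + 100 * (5000 * z) ≤ 100 * (1000 * γ₀)) (sym Bᶜ≡) numeric-total)
      total : 30656102400 * (5000 * A n) ≤ γ₀ * (1000 * W) + 5000 * (24 * (κ′ * (2 * P)))
      total = subst (λ z → z * (5000 * A n) ≤ γ₀ * (1000 * W) + 5000 * (24 * (κ′ * (2 * P)))) (scale-value p n 2n≡ M₀ n≥21)
        (error-split (l p n 2n≡ M₀ n≥21) (A n) 5000 (24 * (κ′ * (2 * E + V))) (24 * (κ′ * (2 * P))) (Bᵐ p n 2n≡ M₀ n≥21) W (γ₀ * (1000 * W))
          (error-bound p n 2n≡ M₀ n≥21) combined)

    bound-at : (5000 * A n) ^ 4 ≤ (24 * 38755553 * centralBinom n) ^ 4 * n ^ 3
    -- 1000 is 10000^(3/4), so terms of size W can be charged as 1000 W ≤ n^(3/4) W.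
    bound-at = fourth-power-split 5000 (A n) 30656102400 (centralBinom n) W n (24 * 38755553) γ₀ (γ₀ * (1000 * W)) (5000 * (24 * (κ′ * (2 * P)))) 1000 3
      {{_}} {{γ₀≢0}} (centralBinom≡ p n 2n≡ M₀ n≥21) (^-monoˡ-≤ 3 n≥) γ₀-scale total ≤-refl panels

  abstract
    -- 37⁵ = 69343957 lies just below 7 · 10⁷: the cutoff is at least 37 from n = 10000 on, and the
    -- panels start at M = Q - 10 ≥ 27.
    numeric-37 : 10 * 37 ^ 5 ≤ 7 * 10000 ^ 2
    numeric-37 = ≤ᵇ⇒≤ _ _ _

  root-exists : ∀ n → 10000 ≤ n → ∃ λ Q → 10 * Q ^ 5 ≤ 7 * n ^ 2 × 7 * n ^ 2 < 10 * suc Q ^ 5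
  root-exists n n≥ = integerRoot (λ Q → 10 * Q ^ 5) (7 * n ^ 2) n z≤n (begin-strict
      7 * n ^ 2              ≤⟨ *-monoˡ-≤ (n ^ 2) (m≤m+n 7 3) ⟩
      10 * n ^ 2             ≤⟨ *-monoʳ-≤ 10 (^-monoˡ-≤ 2 (n≤1+n n)) ⟩
      10 * suc n ^ 2         <⟨ *-monoʳ-< 10 (^-monoʳ-< (suc n) (s≤s (≤-trans (s≤s z≤n) n≥)) {2} {5} (s≤s (s≤s (s≤s z≤n)))) ⟩
      10 * suc n ^ 5         ∎)
    where open ≤-Reasoning

  bound-from-root : ∀ n Q → 10000 ≤ n → 10 * Q ^ 5 ≤ 7 * n ^ 2 → 7 * n ^ 2 < 10 * suc Q ^ 5 →
    (5000 * A n) ^ 4 ≤ (24 * 38755553 * centralBinom n) ^ 4 * n ^ 3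
  bound-from-root n Q n≥ lower upper = bound-at p n 2n≡ n≥ M₀ M₀≥ lower′ upper′
    where
    p = 2 * n ∸ 6
    2n≡ : 2 * n ≡ 6 + p
    2n≡ = sym (m+[n∸m]≡n (≤-trans {6} {20000} {2 * n} (m≤m+n 6 19994) (*-monoʳ-≤ 2 {10000} {n} n≥)))
    Q≥ : 37 ≤ Q
    Q≥ = ≤-pred (^-cancelˡ-< 5 37 (suc Q) (*-cancelˡ-< 10 (37 ^ 5) (suc Q ^ 5) (≤-<-trans (≤-trans numeric-37 (*-monoʳ-≤ 7 {10000 ^ 2} {n ^ 2} (^-monoˡ-≤ 2 n≥))) upper)))
    -- The longest head has length M₀ + 11 and thus ends exactly at Q, the largest length for which
    -- the folds are known to decay fast enough.
    M₀ = Q ∸ 11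
    M₀≥ : 26 ≤ M₀
    M₀≥ = ∸-monoˡ-≤ {37} {Q} 11 Q≥
    Q≡ : M₀ + 11 ≡ Q
    Q≡ = m∸n+n≡m (≤-trans (m≤m+n 11 26) Q≥)
    lower′ : 10 * (M₀ + 11) ^ 5 ≤ 7 * n ^ 2
    lower′ = subst (λ z → 10 * z ^ 5 ≤ 7 * n ^ 2) (sym Q≡) lower
    upper′ : 7 * n ^ 2 ≤ 10 * (suc M₀ + 11) ^ 5
    upper′ = subst (λ z → 7 * n ^ 2 ≤ 10 * suc z ^ 5) (sym Q≡) (<⇒≤ upper)

open Conclusion using (root-exists; bound-from-root)
open import Defs
open import Data.Nat using (ℕ; _≤_; _*_; _^_)
open import Data.Product using (_,_)

mainTheorem1 : (n : ℕ) → 10000 ≤ n →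
    (5000 * A n) ^ 4 ≤ (24 * 38755553 * centralBinom n) ^ 4 * n ^ 3
mainTheorem1 n n≥ = let Q , lower , upper = root-exists n n≥ in bound-from-root n Q n≥ lower upper
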